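{- Let $\alpha \geq 1$ be an integer and set \[\psi = \psi(\alpha) = \left\lfloor \frac{5^{\alpha+2}}{24}\right\rfloor +1-\gcd(\alpha,2).\] Then the function $\frac{(1+5x)^{\psi}}{5^{\lfloor \alpha/2 \rfloor}} L_{\alpha}$ is a polynomial in $x$ with integer coefficients, i.e. it lies in $\mathbb{Z}[x]$.
   Context: All functions are treated as formal Laurent series in $q$. For $r\ge1$, $f_r = \prod_{n\ge1}(1-q^{rn})$. Let $x = q\frac{f_2 f_{10}^3}{f_1^3 f_5}$ (the eta-quotient $\eta(2\tau)\eta(10\tau)^3/(\eta(\tau)^3\eta(5\tau))$); since $x = q+O(q^2)$, rational functions in $x$ with denominators powers of $1+5x$ are well-defined Laurent series in $q$. The operator $U_5$ acts by $U_5\left(\sum_{n} a(n)q^n\right) = \sum_{n} a(5n)q^n$. Let $\Phi = q^5 \frac{f_{25}f_{50}^2}{f_1f_2^2}$. Define $L_0 = 1$ and for $\alpha\ge 0$, $L_{\alpha+1} = U_5(\Phi\cdot L_\alpha)$ if $\alpha$ is even and $L_{\alpha+1} = U_5(L_\alpha)$ if $\alpha$ is odd. -}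

module Defs where

open import Data.Nat as ℕ using (ℕ; zero; suc; _∸_; _≤ᵇ_; _≡ᵇ_; _%_; _/_)
open import Data.Nat.GCD using (gcd)
open import Data.Integer using (ℤ; +_; -_; _+_; _*_)
open import Data.List using (List; []; _∷_; map; foldr; upTo)
open import Data.Bool using (if_then_else_)

-- Formal power series in q with integer coefficients: n ↦ coefficient of q^n.
-- (All series in the statement have no negative powers of q.)
Series : Set
Series = ℕ → ℤ

sumℤ : List ℤ → ℤ
sumℤ = foldr _+_ (+ 0)

const : ℤ → Series
const c zero    = c
const c (suc n) = + 0

zeroS oneS : Series
zeroS = const (+ 0)
oneS  = const (+ 1)

_⊕_ : Series → Series → Series
(a ⊕ b) n = a n + b n

_·_ : ℤ → Series → Series
(c · a) n = c * a n

_⊗_ : Series → Series → Series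
(a ⊗ b) n = sumℤ (map (λ i → a i * b (n ∸ i)) (upTo (suc n)))

infixl 6 _⊕_
infixl 7 _⊗_ _·_

shift : ℕ → Series → Series
shift k a n = if k ≤ᵇ n then a (n ∸ k) else + 0

qS : Series
qS = shift 1 oneS

pow : Series → ℕ → Series
pow a zero    = oneS
pow a (suc k) = a ⊗ pow a k

-- Multiplicative inverse of a series a with constant term 1:
-- b 0 = 1,  b m = - Σ_{i=1}^{m} a i * b (m - i).
-- invTab a m agrees with the inverse on all indices ≤ m.
invTab : Series → ℕ → Series
invTab a zero    = λ _ → + 1
invTab a (suc m) = λ k → if k ≤ᵇ m then t k
                           else - sumℤ (map (λ i → a (suc i) * t (m ∸ i)) (upTo (suc m)))
  where t = invTab a m

inv : Series → Series
inv a n = invTab a n n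

oneMinusQ : ℕ → Series
oneMinusQ k = oneS ⊕ ((- + 1) · shift k oneS)

partialProd : ℕ → ℕ → Series
partialProd r zero    = oneS
partialProd r (suc N) = partialProd r N ⊗ oneMinusQ (r ℕ.* suc N)

-- f_r = ∏_{n≥1} (1 - q^{r n}); for r ≥ 1 the coefficient of q^n is that of
-- the partial product with n factors (later factors are ≡ 1 mod q^{n+1}).
f : ℕ → Series
f r n = partialProd r n n

xS : Series
xS = qS ⊗ f 2 ⊗ pow (f 10) 3 ⊗ inv (pow (f 1) 3 ⊗ f 5)

Φ : Series
Φ = shift 5 (f 25 ⊗ pow (f 50) 2) ⊗ inv (f 1 ⊗ pow (f 2) 2)

U5 : Series → Series
U5 a n = a (5 ℕ.* n)

L : ℕ → Series
L zero    = oneS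
L (suc α) = if α % 2 ≡ᵇ 0 then U5 (Φ ⊗ L α) else U5 (L α)

evalPoly : List ℤ → Series → Series
evalPoly []       s = zeroS
evalPoly (c ∷ cs) s = const c ⊕ s ⊗ evalPoly cs s

-- ψ(α) = ⌊5^{α+2}/24⌋ + 1 - gcd(α,2)   (always ≥ 4, so ∸ is exact)
ψ : ℕ → ℕ
ψ α = (5 ℕ.^ (α ℕ.+ 2)) / 24 ℕ.+ 1 ∸ gcd α 2

F : ℕ → Series
F α = pow (oneS ⊕ (+ 5) · xS) (ψ α) ⊗ L α

-- The pentagonal number theorem and Gauss's theorem f₁ Σ q^(n(n+1)/2) = f₂², dissected modulo 5, yield the
-- Rogers–Ramanujan parametrisation: f₁ R = q f₂₅ (1 - R - R²) and f₂ S = q² f₅₀ (1 - S - S²), where S - R² = R S² (S + R²).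
-- Comparing logarithmic derivatives gives the norm of the first dissection, and with it the eta quotients of level 10 as
-- rational functions of k, where k(q⁵) = R S².  In particular x = k/(1 - 4k - k²), because both sides have the same
-- quotient by their images under q ↦ q⁵.
--
-- Eliminating R and S shows that x satisfies a monic quintic over ℤ[X], X = x(q⁵), so U₅ is determined on ℤ[x] by
-- U₅(xⁱ) and U₅(Z⁵ Φ xⁱ) for i < 5, where Z = 1 + 5X.  These are polynomials in x, computed from the fact that Rⁱ Sʲ
-- has only exponents ≡ i + 2j modulo 5.  Since Z⁵ = z g with z = 1 + 5x and g ∈ ℤ[5x, 5X, 5X²], one has
-- z⁵ⁿ U₅(L) = U₅(gⁿ zⁿ L), which clears all denominators.
--
-- The power of 5 is controlled by two lattices: Λ₀, spanned by 5^⌊r/5⌋ xʳ, and Λ₁ = ⟨x - x³, x² - x³⟩ + 5x Λ₀.  Both are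
-- stable under 5x and 5x², and U₅(Z⁵ Φ gⁿ Λ₀) ⊆ Λ₁ while U₅(gⁿ Λ₁) ⊆ 5 Λ₀.

module Submission where

open import Defs
open import Algebra.Bundles using (CommutativeRing)
open import Data.Bool as Bool using (Bool; true; false; _∧_; if_then_else_)
open import Data.Fin using (Fin; zero; suc; #_)
open import Data.Integer as ℤ using (ℤ; +_; -[1+_])
import Data.Integer.Properties as ℤₚ
open import Data.List as List using (List; []; _∷_)
import Data.List.Properties as Listₚ
open import Data.Nat as ℕ using (ℕ; zero; suc; _≤_; _<_; z≤n; s≤s)
import Data.Nat.Properties as ℕₚ
import Data.Nat.DivMod as DivMod
open import Data.Product using (∃; _×_; _,_; proj₁; proj₂)
open import Data.Sum using (_⊎_; inj₁; inj₂)
open import Data.Vec as Vec using (Vec; []; _∷_)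
open import Data.Vec.N-ary using (N-ary; _$ⁿ_)
open import Data.Unit using (⊤; tt)
open import Data.Empty using (⊥-elim)
open import Function using (_∘_; id)
open import Level using (0ℓ)
open import Relation.Binary.PropositionalEquality as ≡ using (_≡_; refl; cong; cong₂; sym; trans; subst)
open import Relation.Nullary using (yes; no; ¬_)
import Relation.Binary.Reasoning.Setoid as SetoidReasoning
open import Algebra.Properties.Ring using (-0#≈0#; -‿+-comm; -‿distribˡ-*; -‿distribʳ-*)
import Algebra.Properties.CommutativeSemigroup as CommutativeSemigroupProperties
open import Algebra.Structures using (IsCommutativeRing)
open import Data.Nat.Induction using (<-rec)
open import Data.Nat.Tactic.RingSolver using (solve-∀)
open import Data.Nat.Coprimality using (Coprime; coprime-divisor)
open import Data.Nat.Divisibility as Divisibility using (_∣_; _∣?_; ∣-trans; n∣m*n; m∣m*n; ∣m+n∣m⇒∣n; m%n≡0⇒n∣m; n∣m⇒m%n≡0)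
open import Relation.Nullary.Decidable using (isYes; toWitness; toWitnessFalse)
open import Data.Integer.Divisibility.Signed using () renaming (_∣_ to _∣ᶻ_; _∣?_ to _∣ᶻ?_; divides to dividesᶻ)
open import Data.Nat.GCD using (gcd; gcd[m,n]∣m; gcd[m,n]∣n; gcd-greatest)

-- No theory of modular forms enters: every identity of series becomes, after multiplication by
-- suitable factors, a combination of earlier relations with explicit polynomial cofactors, which
-- the solver verifies on integer coefficients; the factors are then cancelled, each being regular.
--
-- Write a = A₅/R₅ = f₁/(q f₂₅) and b = B₅/S₅ = f₂/(q² f₅₀). The quotient b/a and the square a² are
-- rational in x and X, whereas Φ = 1/(a b²) comes out as a rational function times a. So U₅ has to
-- be found on two modules: the powers of x, and a times these.
--
-- The exponent ⌊r/5⌋ reflects x⁵ ≡ X modulo 5: X itself is outside ℤ[5X, 5X²], and one factor 5 for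
-- every five powers of x repairs this. Λ₀ alone cannot carry the induction, since U₅(x), U₅(x²),
-- U₅(x³) have linear coefficients 41, 86, 51, all prime to 5. But these three images agree modulo 5
-- Λ₀; so x - x³ and x² - x³ gain the factor 5, and the step with Φ lands in their span modulo 5x
-- Λ₀.

-- A reflective solver for commutative rings, with identities modulo hypotheses

record IntegerHom (R : CommutativeRing 0ℓ 0ℓ) : Set where
  open CommutativeRing R
  field
    ι   : ℤ → Carrier
    ι-0 : ι (+ 0) ≈ 0#
    ι-1 : ι (+ 1) ≈ 1#
    ι-+ : ∀ a b → ι (a ℤ.+ b) ≈ ι a + ι b
    ι-* : ∀ a b → ι (a ℤ.* b) ≈ ι a * ι b
    ι-neg : ∀ a → ι (ℤ.- a) ≈ - ι a

-- Dense multivariate polynomials in Horner form; trailing zeros are allowed.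
Poly : ℕ → Set
Poly zero    = ℤ
Poly (suc n) = List (Poly n)

isZero : ∀ n → Poly n → Bool
isZero zero    (+ zero)  = true
isZero zero    (+ suc _) = false
isZero zero    -[1+ _ ]  = false
isZero (suc n) []        = true
isZero (suc n) (p ∷ ps)  = isZero n p ∧ isZero (suc n) ps

0ₚ : ∀ n → Poly n
0ₚ zero    = + 0
0ₚ (suc n) = []

conₚ : ∀ n → ℤ → Poly n
conₚ zero    c = c
conₚ (suc n) c = conₚ n c ∷ []

varₚ : ∀ {n} → Fin n → Poly n
varₚ {suc n} zero    = 0ₚ n ∷ conₚ n (+ 1) ∷ []
varₚ {suc n} (suc i) = varₚ i ∷ []

-- A leading coefficient that has become zero is dropped, so that cancellation does not leave
-- inflated degrees behind. `isZero` accepts untrimmed representations of zero as well.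
cons : ∀ n → Poly n → List (Poly n) → List (Poly n)
cons n p (q ∷ qs) = p ∷ q ∷ qs
cons n p []       = if isZero n p then [] else p ∷ []

addₚ : ∀ n → Poly n → Poly n → Poly n
addₚ zero    a        b        = a ℤ.+ b
addₚ (suc n) []       qs       = qs
addₚ (suc n) (p ∷ ps) []       = p ∷ ps
addₚ (suc n) (p ∷ ps) (q ∷ qs) = cons n (addₚ n p q) (addₚ (suc n) ps qs)

negₚ : ∀ n → Poly n → Poly n
negₚ zero    a        = ℤ.- a
negₚ (suc n) []       = []
negₚ (suc n) (p ∷ ps) = negₚ n p ∷ negₚ (suc n) ps

mapₚ : ∀ n → (Poly n → Poly n) → List (Poly n) → List (Poly n)
mapₚ n φ []       = []
mapₚ n φ (p ∷ ps) = cons n (φ p) (mapₚ n φ ps)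

mulₚ : ∀ n → Poly n → Poly n → Poly n
mulₚ zero    a        b  = a ℤ.* b
mulₚ (suc n) []       qs = []
mulₚ (suc n) (p ∷ ps) qs =
  -- Rows with a zero coefficient are skipped: in dense form a monomial is mostly zeros, and the
  -- polynomials checked later have degrees above twenty.
  addₚ (suc n) (if isZero n p then [] else mapₚ n (mulₚ n p) qs)
               (cons n (0ₚ n) (mulₚ (suc n) ps qs))

powₚ : ∀ n → Poly n → ℕ → Poly n
powₚ n p zero    = conₚ n (+ 1)
powₚ n p (suc k) = mulₚ n p (powₚ n p k)

infixl 6 _:+_ _:-_
infixl 7 _:*_
infixr 8 _:^_
infix  8 :-_
infix  5 _:≈_

-- `poly` admits a coefficient list as an atom, so that explicit quotients such as `quinticₚ` can
-- occur in identities as they are.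
data Expr (n : ℕ) : Set where
  con  : ℤ → Expr n
  var  : Fin n → Expr n
  poly : Poly n → Expr n
  _:+_ _:*_ _:-_ : Expr n → Expr n → Expr n
  :-_  : Expr n → Expr n
  _:^_ : Expr n → ℕ → Expr n

record Equation (n : ℕ) : Set where
  constructor _:≈_
  field lhs rhs : Expr n
open Equation

normalise : ∀ n → Expr n → Poly n
normalise n (con c)  = conₚ n c
normalise n (var i)  = varₚ i
normalise n (poly p) = p
normalise n (e :+ f) = addₚ n (normalise n e) (normalise n f)
normalise n (e :* f) = mulₚ n (normalise n e) (normalise n f)
normalise n (e :- f) = addₚ n (normalise n e) (negₚ n (normalise n f))
normalise n (:- e)   = negₚ n (normalise n e)
normalise n (e :^ k) = powₚ n (normalise n e) k

∧-true : ∀ {a b} → a ∧ b ≡ true → a ≡ true × b ≡ true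
∧-true {true} {true} _ = refl , refl

module Solver (R : CommutativeRing 0ℓ 0ℓ) (hom : IntegerHom R) where
  open CommutativeRing R renaming (refl to ≈-refl; sym to ≈-sym; trans to ≈-trans)
  open IntegerHom hom
  open SetoidReasoning setoid

  infixr 8 _^_
  _^_ : Carrier → ℕ → Carrier
  x ^ zero  = 1#
  x ^ suc k = x * x ^ k

  ^-cong : ∀ {x y} → x ≈ y → ∀ k → x ^ k ≈ y ^ k
  ^-cong x≈y zero    = ≈-refl
  ^-cong x≈y (suc k) = *-cong x≈y (^-cong x≈y k)

  eval : ∀ n → Poly n → Vec Carrier n → Carrier
  eval zero    c        []      = ι c
  eval (suc n) []       (x ∷ ρ) = 0#
  eval (suc n) (p ∷ ps) (x ∷ ρ) = eval n p ρ + x * eval (suc n) ps (x ∷ ρ)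

  ⟦_⟧ : ∀ {n} → Expr n → Vec Carrier n → Carrier
  ⟦ con c ⟧  ρ = ι c
  ⟦ var i ⟧  ρ = Vec.lookup ρ i
  ⟦ poly p ⟧ ρ = eval _ p ρ
  ⟦ e :+ f ⟧ ρ = ⟦ e ⟧ ρ + ⟦ f ⟧ ρ
  ⟦ e :* f ⟧ ρ = ⟦ e ⟧ ρ * ⟦ f ⟧ ρ
  ⟦ e :- f ⟧ ρ = ⟦ e ⟧ ρ + - ⟦ f ⟧ ρ
  ⟦ :- e ⟧   ρ = - ⟦ e ⟧ ρ
  ⟦ e :^ k ⟧ ρ = ⟦ e ⟧ ρ ^ k

  0+x*0 : ∀ x → 0# + x * 0# ≈ 0#
  0+x*0 x = ≈-trans (+-identityˡ _) (zeroʳ x)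

  open CommutativeSemigroupProperties +-commutativeSemigroup public using (interchange)
  open CommutativeSemigroupProperties *-commutativeSemigroup public using () renaming (x∙yz≈y∙xz to *-swap)

  isZero-sound : ∀ n p ρ → isZero n p ≡ true → eval n p ρ ≈ 0#
  isZero-sound zero    (+ zero) []      _ = ι-0
  isZero-sound (suc n) []       (x ∷ ρ) _ = ≈-refl
  isZero-sound (suc n) (p ∷ ps) (x ∷ ρ) h with ∧-true {isZero n p} h
  ... | hp , hps = ≈-trans (+-cong (isZero-sound n p ρ hp) (*-congˡ (isZero-sound (suc n) ps (x ∷ ρ) hps)))
                           (0+x*0 x)

  0ₚ-sound : ∀ n ρ → eval n (0ₚ n) ρ ≈ 0#
  0ₚ-sound zero    []      = ι-0
  0ₚ-sound (suc n) (x ∷ ρ) = ≈-refl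

  conₚ-sound : ∀ n c ρ → eval n (conₚ n c) ρ ≈ ι c
  conₚ-sound zero    c []      = ≈-refl
  conₚ-sound (suc n) c (x ∷ ρ) =
    ≈-trans (+-cong (conₚ-sound n c ρ) (zeroʳ x)) (+-identityʳ _)

  varₚ-sound : ∀ {n} (i : Fin n) ρ → eval n (varₚ i) ρ ≈ Vec.lookup ρ i
  varₚ-sound {suc n} zero (x ∷ ρ) = begin
    eval n (0ₚ n) ρ + x * (eval n (conₚ n (+ 1)) ρ + x * 0#)
      ≈⟨ +-cong (0ₚ-sound n ρ) (*-congˡ (+-cong (≈-trans (conₚ-sound n (+ 1) ρ) ι-1) (zeroʳ x))) ⟩
    0# + x * (1# + 0#) ≈⟨ +-identityˡ _ ⟩
    x * (1# + 0#)      ≈⟨ *-congˡ (+-identityʳ _) ⟩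
    x * 1#             ≈⟨ *-identityʳ x ⟩
    x                  ∎
  varₚ-sound {suc n} (suc i) (x ∷ ρ) =
    ≈-trans (+-cong (varₚ-sound i ρ) (zeroʳ x)) (+-identityʳ _)

  cons-sound : ∀ n p ps x ρ → eval (suc n) (cons n p ps) (x ∷ ρ) ≈ eval n p ρ + x * eval (suc n) ps (x ∷ ρ)
  cons-sound n p (q ∷ qs) x ρ = ≈-refl
  cons-sound n p [] x ρ with isZero n p in eq
  ... | true  = ≈-sym (≈-trans (+-congʳ (isZero-sound n p ρ eq)) (0+x*0 x))
  ... | false = ≈-refl

  addₚ-sound : ∀ n p q ρ → eval n (addₚ n p q) ρ ≈ eval n p ρ + eval n q ρ
  addₚ-sound zero    a        b        []      = ι-+ a b
  addₚ-sound (suc n) []       qs       (x ∷ ρ) = ≈-sym (+-identityˡ _)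
  addₚ-sound (suc n) (p ∷ ps) []       (x ∷ ρ) = ≈-sym (+-identityʳ _)
  addₚ-sound (suc n) (p ∷ ps) (q ∷ qs) (x ∷ ρ) = begin
    eval (suc n) (cons n (addₚ n p q) (addₚ (suc n) ps qs)) (x ∷ ρ)
      ≈⟨ cons-sound n (addₚ n p q) (addₚ (suc n) ps qs) x ρ ⟩
    eval n (addₚ n p q) ρ + x * eval (suc n) (addₚ (suc n) ps qs) (x ∷ ρ)
      ≈⟨ +-cong (addₚ-sound n p q ρ) (*-congˡ (addₚ-sound (suc n) ps qs (x ∷ ρ))) ⟩
    (eval n p ρ + eval n q ρ) + x * (eval (suc n) ps (x ∷ ρ) + eval (suc n) qs (x ∷ ρ))
      ≈⟨ +-congˡ (distribˡ x _ _) ⟩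
    (eval n p ρ + eval n q ρ) + (x * eval (suc n) ps (x ∷ ρ) + x * eval (suc n) qs (x ∷ ρ))
      ≈⟨ interchange _ _ _ _ ⟩
    eval (suc n) (p ∷ ps) (x ∷ ρ) + eval (suc n) (q ∷ qs) (x ∷ ρ) ∎

  negₚ-sound : ∀ n p ρ → eval n (negₚ n p) ρ ≈ - eval n p ρ
  negₚ-sound zero    a        []      = ι-neg a
  negₚ-sound (suc n) []       (x ∷ ρ) = ≈-sym (-0#≈0# ring)
  negₚ-sound (suc n) (p ∷ ps) (x ∷ ρ) = begin
    eval n (negₚ n p) ρ + x * eval (suc n) (negₚ (suc n) ps) (x ∷ ρ)
      ≈⟨ +-cong (negₚ-sound n p ρ) (*-congˡ (negₚ-sound (suc n) ps (x ∷ ρ))) ⟩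
    - eval n p ρ + x * - eval (suc n) ps (x ∷ ρ)
      ≈⟨ +-congˡ (≈-sym (-‿distribʳ-* ring _ _)) ⟩
    - eval n p ρ + - (x * eval (suc n) ps (x ∷ ρ))
      ≈⟨ -‿+-comm ring _ _ ⟩
    - (eval n p ρ + x * eval (suc n) ps (x ∷ ρ)) ∎

  mapₚ-sound : ∀ n φ c ρ → (∀ q → eval n (φ q) ρ ≈ c * eval n q ρ) →
               ∀ qs x → eval (suc n) (mapₚ n φ qs) (x ∷ ρ) ≈ c * eval (suc n) qs (x ∷ ρ)
  mapₚ-sound n φ c ρ h []       x = ≈-sym (zeroʳ c)
  mapₚ-sound n φ c ρ h (q ∷ qs) x = begin
    eval (suc n) (cons n (φ q) (mapₚ n φ qs)) (x ∷ ρ)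
      ≈⟨ cons-sound n (φ q) (mapₚ n φ qs) x ρ ⟩
    eval n (φ q) ρ + x * eval (suc n) (mapₚ n φ qs) (x ∷ ρ)
      ≈⟨ +-cong (h q) (*-congˡ (mapₚ-sound n φ c ρ h qs x)) ⟩
    c * eval n q ρ + x * (c * eval (suc n) qs (x ∷ ρ))
      ≈⟨ +-congˡ (*-swap x c _) ⟩
    c * eval n q ρ + c * (x * eval (suc n) qs (x ∷ ρ))
      ≈⟨ ≈-sym (distribˡ c _ _) ⟩
    c * (eval n q ρ + x * eval (suc n) qs (x ∷ ρ)) ∎

  mulₚ-sound : ∀ n p q ρ → eval n (mulₚ n p q) ρ ≈ eval n p ρ * eval n q ρ
  mulₚ-sound zero    a        b  []      = ι-* a b
  mulₚ-sound (suc n) []       qs (x ∷ ρ) = ≈-sym (zeroˡ _)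
  mulₚ-sound (suc n) (p ∷ ps) qs (x ∷ ρ) = begin
    eval (suc n) (addₚ (suc n) head (cons n (0ₚ n) (mulₚ (suc n) ps qs))) (x ∷ ρ)
      ≈⟨ addₚ-sound (suc n) head _ (x ∷ ρ) ⟩
    eval (suc n) head (x ∷ ρ) + eval (suc n) (cons n (0ₚ n) (mulₚ (suc n) ps qs)) (x ∷ ρ)
      ≈⟨ +-cong head-sound (cons-sound n (0ₚ n) (mulₚ (suc n) ps qs) x ρ) ⟩
    eval n p ρ * q′ + (eval n (0ₚ n) ρ + x * eval (suc n) (mulₚ (suc n) ps qs) (x ∷ ρ))
      ≈⟨ +-congˡ (+-cong (0ₚ-sound n ρ) (*-congˡ (mulₚ-sound (suc n) ps qs (x ∷ ρ)))) ⟩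
    eval n p ρ * q′ + (0# + x * (eval (suc n) ps (x ∷ ρ) * q′))
      ≈⟨ +-congˡ (≈-trans (+-identityˡ _) (≈-sym (*-assoc x _ q′))) ⟩
    eval n p ρ * q′ + (x * eval (suc n) ps (x ∷ ρ)) * q′
      ≈⟨ ≈-sym (distribʳ q′ _ _) ⟩
    (eval n p ρ + x * eval (suc n) ps (x ∷ ρ)) * q′ ∎
    where
    q′   = eval (suc n) qs (x ∷ ρ)
    head = if isZero n p then [] else mapₚ n (mulₚ n p) qs
    head-sound : eval (suc n) head (x ∷ ρ) ≈ eval n p ρ * q′
    head-sound with isZero n p in eq
    ... | true  = ≈-sym (≈-trans (*-congʳ (isZero-sound n p ρ eq)) (zeroˡ q′))
    ... | false = mapₚ-sound n (mulₚ n p) (eval n p ρ) ρ (λ q → mulₚ-sound n p q ρ) qs x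

  powₚ-sound : ∀ n p k ρ → eval n (powₚ n p k) ρ ≈ eval n p ρ ^ k
  powₚ-sound n p zero    ρ = ≈-trans (conₚ-sound n (+ 1) ρ) ι-1
  powₚ-sound n p (suc k) ρ = ≈-trans (mulₚ-sound n p (powₚ n p k) ρ) (*-congˡ (powₚ-sound n p k ρ))

  normalise-sound : ∀ {n} (e : Expr n) ρ → eval n (normalise n e) ρ ≈ ⟦ e ⟧ ρ
  normalise-sound (con c)  ρ = conₚ-sound _ c ρ
  normalise-sound (var i)  ρ = varₚ-sound i ρ
  normalise-sound (poly p) ρ = ≈-refl
  normalise-sound (e :+ f) ρ = ≈-trans (addₚ-sound _ (normalise _ e) (normalise _ f) ρ)
    (+-cong (normalise-sound e ρ) (normalise-sound f ρ))
  normalise-sound (e :* f) ρ = ≈-trans (mulₚ-sound _ (normalise _ e) (normalise _ f) ρ)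
    (*-cong (normalise-sound e ρ) (normalise-sound f ρ))
  normalise-sound (e :- f) ρ = ≈-trans (addₚ-sound _ (normalise _ e) (negₚ _ (normalise _ f)) ρ)
    (+-cong (normalise-sound e ρ) (≈-trans (negₚ-sound _ (normalise _ f) ρ) (-‿cong (normalise-sound f ρ))))
  normalise-sound (:- e)   ρ = ≈-trans (negₚ-sound _ (normalise _ e) ρ) (-‿cong (normalise-sound e ρ))
  normalise-sound (e :^ k) ρ = ≈-trans (powₚ-sound _ (normalise _ e) k ρ) (^-cong (normalise-sound e ρ) k)

  difference-zero : ∀ {a b} → a + - b ≈ 0# → a ≈ b
  difference-zero {a} {b} h = begin
    a             ≈⟨ ≈-sym (+-identityʳ a) ⟩
    a + 0#        ≈⟨ +-congˡ (≈-sym (-‿inverseˡ b)) ⟩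
    a + (- b + b) ≈⟨ ≈-sym (+-assoc a (- b) b) ⟩
    (a + - b) + b ≈⟨ +-congʳ h ⟩
    0# + b        ≈⟨ +-identityˡ b ⟩
    b             ∎

  zero-difference : ∀ {a b} → a ≈ b → a + - b ≈ 0#
  zero-difference {a} {b} h = ≈-trans (+-congʳ h) (-‿inverseʳ b)

  ⟪_⟫ : ∀ {n} → Equation n → Vec Carrier n → Set
  ⟪ l :≈ r ⟫ ρ = ⟦ l ⟧ ρ ≈ ⟦ r ⟧ ρ

  vars : ∀ n → Vec (Expr n) n
  vars n = Vec.map var (Vec.allFin n)

  -- The test is a Boolean computed on integer coefficients, so each use closes with `refl`; the
  -- elements of `ρ` are never evaluated.
  solve : ∀ n (e : N-ary n (Expr n) (Equation n)) (ρ : Vec Carrier n) →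
          isZero n (normalise n (lhs (e $ⁿ vars n) :- rhs (e $ⁿ vars n))) ≡ true →
          ⟪ e $ⁿ vars n ⟫ ρ
  solve n e ρ h = difference-zero (≈-trans (≈-sym (normalise-sound (l :- r) ρ)) (isZero-sound n _ ρ h))
    where
    l = lhs (e $ⁿ vars n)
    r = rhs (e $ⁿ vars n)

  record Goal (n : ℕ) : Set where
    constructor _by_
    field
      goal : Equation n
      hyps : List (Expr n × Equation n)

  infix 3 _by_

  combination : ∀ {n} → List (Expr n × Equation n) → Expr n
  combination []                  = con (+ 0)
  combination ((c , l :≈ r) ∷ hs) = c :* (l :- r) :+ combination hs

  Holds : ∀ {n} → List (Expr n × Equation n) → Vec Carrier n → Set
  Holds []             ρ = ⊤
  Holds ((_ , h) ∷ hs) ρ = ⟪ h ⟫ ρ × Holds hs ρ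

  combination-zero : ∀ {n} (hs : List (Expr n × Equation n)) ρ → Holds hs ρ → ⟦ combination hs ⟧ ρ ≈ 0#
  combination-zero []                  ρ _        = ι-0
  combination-zero ((c , l :≈ r) ∷ hs) ρ (p , ps) =
    ≈-trans (+-cong (≈-trans (*-congˡ (zero-difference p)) (zeroʳ _)) (combination-zero hs ρ ps)) (+-identityʳ _)

  -- The difference of the two sides is a given combination of the hypotheses.
  solve-by : ∀ n (e : N-ary n (Expr n) (Goal n)) (ρ : Vec Carrier n) →
             let open Goal (e $ⁿ vars n) in
             isZero n (normalise n ((lhs goal :- rhs goal) :- combination hyps)) ≡ true →
             Holds hyps ρ → ⟪ goal ⟫ ρ
  solve-by n e ρ h hs =
    difference-zero (≈-trans
      (difference-zero {b = ⟦ combination hyps ⟧ ρ}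
        (≈-trans (≈-sym (normalise-sound ((lhs goal :- rhs goal) :- combination hyps) ρ)) (isZero-sound n _ ρ h)))
      (combination-zero hyps ρ hs))
    where open Goal (e $ⁿ vars n)

-- The ring of formal power series in q

infix 4 _≋_

-- A record and not a bare function type, so that unification can recover the two series from the
-- type.
record _≋_ (a b : Series) : Set where
  constructor pointwise
  field at : ∀ n → a n ≡ b n
open _≋_ public

≋-refl : ∀ {a} → a ≋ a
≋-refl = pointwise λ _ → refl

≋-reflexive : ∀ {a b} → a ≡ b → a ≋ b
≋-reflexive refl = ≋-refl

≋-sym : ∀ {a b} → a ≋ b → b ≋ a
≋-sym p = pointwise λ n → sym (at p n)

≋-trans : ∀ {a b c} → a ≋ b → b ≋ c → a ≋ c
≋-trans p q = pointwise λ n → trans (at p n) (at q n)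

tail : Series → Series
tail a n = a (suc n)

-- The Cauchy product by recursion on the index, peeling off the first coefficient of the left
-- factor. Inductions on the index then generalise over that factor, and sums over lists are left
-- behind.
conv : Series → Series → Series
conv a b zero    = a 0 ℤ.* b 0
conv a b (suc n) = a 0 ℤ.* b (suc n) ℤ.+ conv (tail a) b n

sum≡conv : ∀ a b n → sumℤ (List.map (λ i → a i ℤ.* b (n ℕ.∸ i)) (List.upTo (suc n))) ≡ conv a b n
sum≡conv a b zero    = ℤₚ.+-identityʳ _
sum≡conv a b (suc n) = cong (λ s → a 0 ℤ.* b (suc n) ℤ.+ s) (begin
  sumℤ (List.map φ (List.applyUpTo suc (suc n)))    ≡⟨ cong sumℤ (Listₚ.map-applyUpTo suc φ (suc n)) ⟩
  sumℤ (List.applyUpTo (φ ∘ suc) (suc n))           ≡⟨ cong sumℤ (sym (Listₚ.map-applyUpTo id (φ ∘ suc) (suc n))) ⟩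
  sumℤ (List.map (φ ∘ suc) (List.upTo (suc n)))     ≡⟨ sum≡conv (tail a) b n ⟩
  conv (tail a) b n                                 ∎)
  where
  open ≡.≡-Reasoning
  φ = λ i → a i ℤ.* b (suc n ℕ.∸ i)

⊗≡conv : ∀ a b n → (a ⊗ b) n ≡ conv a b n
⊗≡conv = sum≡conv

conv-local : ∀ {a a′ b b′} n → (∀ i → i ≤ n → a i ≡ a′ i) → (∀ i → i ≤ n → b i ≡ b′ i) → conv a b n ≡ conv a′ b′ n
conv-local zero    p q = cong₂ ℤ._*_ (p 0 z≤n) (q 0 z≤n)
conv-local (suc n) p q = cong₂ ℤ._+_ (cong₂ ℤ._*_ (p 0 z≤n) (q (suc n) ℕₚ.≤-refl))
  (conv-local n (λ i i≤n → p (suc i) (s≤s i≤n)) (λ i i≤n → q i (ℕₚ.m≤n⇒m≤1+n i≤n)))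

conv-cong : ∀ {a a′ b b′} → (∀ n → a n ≡ a′ n) → (∀ n → b n ≡ b′ n) → ∀ n → conv a b n ≡ conv a′ b′ n
conv-cong p q n = conv-local n (λ i _ → p i) (λ i _ → q i)

open CommutativeSemigroupProperties ℤₚ.+-commutativeSemigroup using () renaming (interchange to ℤ-interchange)

conv-zeroˡ : ∀ {a} → (∀ n → a n ≡ + 0) → ∀ b n → conv a b n ≡ + 0
conv-zeroˡ p b zero    = cong (ℤ._* b 0) (p 0)
conv-zeroˡ p b (suc n) = cong₂ ℤ._+_ (cong (ℤ._* b (suc n)) (p 0)) (conv-zeroˡ (p ∘ suc) b n)

conv-const : ∀ c b n → conv (const c) b n ≡ c ℤ.* b n
conv-const c b zero    = refl
conv-const c b (suc n) = trans (cong (λ s → c ℤ.* b (suc n) ℤ.+ s) (conv-zeroˡ (λ _ → refl) b n)) (ℤₚ.+-identityʳ _)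

conv-distribʳ : ∀ a b c n → conv (a ⊕ b) c n ≡ conv a c n ℤ.+ conv b c n
conv-distribʳ a b c zero    = ℤₚ.*-distribʳ-+ (c 0) (a 0) (b 0)
conv-distribʳ a b c (suc n) = trans
  (cong₂ ℤ._+_ (ℤₚ.*-distribʳ-+ (c (suc n)) (a 0) (b 0)) (conv-distribʳ (tail a) (tail b) c n))
  (ℤ-interchange (a 0 ℤ.* c (suc n)) (b 0 ℤ.* c (suc n)) (conv (tail a) c n) (conv (tail b) c n))

conv-scaleˡ : ∀ k b c n → conv (k · b) c n ≡ k ℤ.* conv b c n
conv-scaleˡ k b c zero    = ℤₚ.*-assoc k (b 0) (c 0)
conv-scaleˡ k b c (suc n) = trans
  (cong₂ ℤ._+_ (ℤₚ.*-assoc k (b 0) (c (suc n))) (conv-scaleˡ k (tail b) c n))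
  (sym (ℤₚ.*-distribˡ-+ k (b 0 ℤ.* c (suc n)) (conv (tail b) c n)))

conv-sucʳ : ∀ a b n → conv a b (suc n) ≡ conv a (tail b) n ℤ.+ a (suc n) ℤ.* b 0
conv-sucʳ a b zero    = refl
conv-sucʳ a b (suc n) = trans
  (cong (λ s → a 0 ℤ.* b (suc (suc n)) ℤ.+ s) (conv-sucʳ (tail a) b n))
  (sym (ℤₚ.+-assoc (a 0 ℤ.* b (suc (suc n))) (conv (tail a) (tail b) n) (a (suc (suc n)) ℤ.* b 0)))

conv-comm : ∀ a b n → conv a b n ≡ conv b a n
conv-comm a b zero    = ℤₚ.*-comm (a 0) (b 0)
conv-comm a b (suc n) = begin
  a 0 ℤ.* b (suc n) ℤ.+ conv (tail a) b n ≡⟨ cong₂ ℤ._+_ (ℤₚ.*-comm (a 0) (b (suc n))) (conv-comm (tail a) b n) ⟩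
  b (suc n) ℤ.* a 0 ℤ.+ conv b (tail a) n ≡⟨ ℤₚ.+-comm (b (suc n) ℤ.* a 0) (conv b (tail a) n) ⟩
  conv b (tail a) n ℤ.+ b (suc n) ℤ.* a 0 ≡⟨ sym (conv-sucʳ b a n) ⟩
  conv b a (suc n)                        ∎
  where open ≡.≡-Reasoning

conv-assoc : ∀ a b c n → conv (conv a b) c n ≡ conv a (conv b c) n
conv-assoc a b c zero    = ℤₚ.*-assoc (a 0) (b 0) (c 0)
conv-assoc a b c (suc n) = begin
  (a₀ ℤ.* b 0) ℤ.* c (suc n) ℤ.+ conv (tail (conv a b)) c n
    -- By definition of `conv`, the series `tail (conv a b)` already is the sum of `a₀ · tail b` and
    -- `conv (tail a) b`.
    ≡⟨ cong₂ ℤ._+_ (ℤₚ.*-assoc a₀ (b 0) (c (suc n))) (conv-distribʳ (a₀ · tail b) (conv (tail a) b) c n) ⟩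
  a₀ ℤ.* (b 0 ℤ.* c (suc n)) ℤ.+ (conv (a₀ · tail b) c n ℤ.+ conv (conv (tail a) b) c n)
    ≡⟨ cong (λ s → a₀ ℤ.* (b 0 ℤ.* c (suc n)) ℤ.+ s)
            (cong₂ ℤ._+_ (conv-scaleˡ a₀ (tail b) c n) (conv-assoc (tail a) b c n)) ⟩
  a₀ ℤ.* (b 0 ℤ.* c (suc n)) ℤ.+ (a₀ ℤ.* conv (tail b) c n ℤ.+ conv (tail a) (conv b c) n)
    ≡⟨ sym (ℤₚ.+-assoc (a₀ ℤ.* (b 0 ℤ.* c (suc n))) _ _) ⟩
  (a₀ ℤ.* (b 0 ℤ.* c (suc n)) ℤ.+ a₀ ℤ.* conv (tail b) c n) ℤ.+ conv (tail a) (conv b c) n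
    ≡⟨ cong (ℤ._+ conv (tail a) (conv b c) n) (sym (ℤₚ.*-distribˡ-+ a₀ (b 0 ℤ.* c (suc n)) (conv (tail b) c n))) ⟩
  a₀ ℤ.* conv b c (suc n) ℤ.+ conv (tail a) (conv b c) n ∎
  where
  open ≡.≡-Reasoning
  a₀ = a 0

⊕-cong : ∀ {a a′ b b′} → a ≋ a′ → b ≋ b′ → a ⊕ b ≋ a′ ⊕ b′
⊕-cong p q = pointwise λ n → cong₂ ℤ._+_ (at p n) (at q n)

⊗-cong : ∀ {a a′ b b′} → a ≋ a′ → b ≋ b′ → a ⊗ b ≋ a′ ⊗ b′
⊗-cong {a} {a′} {b} {b′} p q = pointwise λ n →
  trans (⊗≡conv a b n) (trans (conv-cong (at p) (at q) n) (sym (⊗≡conv a′ b′ n)))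

⊗-comm : ∀ a b → a ⊗ b ≋ b ⊗ a
⊗-comm a b = pointwise λ n → trans (⊗≡conv a b n) (trans (conv-comm a b n) (sym (⊗≡conv b a n)))

⊗-assoc : ∀ a b c → (a ⊗ b) ⊗ c ≋ a ⊗ (b ⊗ c)
⊗-assoc a b c = pointwise λ n → begin
  ((a ⊗ b) ⊗ c) n    ≡⟨ ⊗≡conv (a ⊗ b) c n ⟩
  conv (a ⊗ b) c n   ≡⟨ conv-cong (⊗≡conv a b) (λ _ → refl) n ⟩
  conv (conv a b) c n ≡⟨ conv-assoc a b c n ⟩
  conv a (conv b c) n ≡⟨ conv-cong {a} (λ _ → refl) (λ m → sym (⊗≡conv b c m)) n ⟩
  conv a (b ⊗ c) n   ≡⟨ sym (⊗≡conv a (b ⊗ c) n) ⟩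
  (a ⊗ (b ⊗ c)) n    ∎
  where open ≡.≡-Reasoning

const-⊗ : ∀ c b n → (const c ⊗ b) n ≡ c ℤ.* b n
const-⊗ c b n = trans (⊗≡conv (const c) b n) (conv-const c b n)

⊗-identityˡ : ∀ a → oneS ⊗ a ≋ a
⊗-identityˡ a = pointwise λ n → trans (const-⊗ (+ 1) a n) (ℤₚ.*-identityˡ (a n))

⊗-distribʳ : ∀ c a b → (a ⊕ b) ⊗ c ≋ (a ⊗ c) ⊕ (b ⊗ c)
⊗-distribʳ c a b = pointwise λ n → trans (⊗≡conv (a ⊕ b) c n)
  (trans (conv-distribʳ a b c n) (cong₂ ℤ._+_ (sym (⊗≡conv a c n)) (sym (⊗≡conv b c n))))

⊗-distribˡ : ∀ c a b → c ⊗ (a ⊕ b) ≋ (c ⊗ a) ⊕ (c ⊗ b)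
⊗-distribˡ c a b = ≋-trans (⊗-comm c (a ⊕ b))
  (≋-trans (⊗-distribʳ c a b) (⊕-cong (⊗-comm a c) (⊗-comm b c)))

zeroS-0 : ∀ n → zeroS n ≡ + 0
zeroS-0 zero    = refl
zeroS-0 (suc n) = refl

infixl 6 _+_
infixl 7 _*_
infix  8 -_

-- The ring operations are opaque: otherwise unification would unfold the convolution sums.
opaque
  _+_ _*_ : Series → Series → Series
  _+_ = _⊕_
  _*_ = _⊗_

  -_ : Series → Series
  (- a) n = ℤ.- a n

  ⊕≡+ : ∀ a b → a ⊕ b ≡ a + b
  ⊕≡+ a b = refl

  ⊗≡* : ∀ a b → a ⊗ b ≡ a * b
  ⊗≡* a b = refl

  +-at : ∀ a b n → (a + b) n ≡ a n ℤ.+ b n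
  +-at a b n = refl

  *-at : ∀ a b n → (a * b) n ≡ conv a b n
  *-at = ⊗≡conv

  neg-at : ∀ a n → (- a) n ≡ ℤ.- a n
  neg-at a n = refl

  seriesLaws : IsCommutativeRing _≋_ _+_ _*_ -_ zeroS oneS
  seriesLaws = record
    { isRing = record
      { +-isAbelianGroup = record
        { isGroup = record
          { isMonoid = record
            { isSemigroup = record
              { isMagma = record
                { isEquivalence = record { refl = ≋-refl ; sym = ≋-sym ; trans = ≋-trans }
                ; ∙-cong = ⊕-cong }
              ; assoc = λ a b c → pointwise λ n → ℤₚ.+-assoc (a n) (b n) (c n) }
            ; identity = (λ a → pointwise λ n → trans (cong (ℤ._+ a n) (zeroS-0 n)) (ℤₚ.+-identityˡ (a n)))
                       , (λ a → pointwise λ n → trans (cong (λ s → a n ℤ.+ s) (zeroS-0 n)) (ℤₚ.+-identityʳ (a n))) }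
          ; inverse = (λ a → pointwise λ n → trans (ℤₚ.+-inverseˡ (a n)) (sym (zeroS-0 n)))
                    , (λ a → pointwise λ n → trans (ℤₚ.+-inverseʳ (a n)) (sym (zeroS-0 n)))
          ; ⁻¹-cong = λ p → pointwise λ n → cong ℤ.-_ (at p n) }
        ; comm = λ a b → pointwise λ n → ℤₚ.+-comm (a n) (b n) }
      ; *-cong = ⊗-cong
      ; *-assoc = ⊗-assoc
      ; *-identity = ⊗-identityˡ , λ a → ≋-trans (⊗-comm a oneS) (⊗-identityˡ a)
      ; distrib = ⊗-distribˡ , ⊗-distribʳ }
    ; *-comm = ⊗-comm }

seriesRing : CommutativeRing 0ℓ 0ℓ
seriesRing = record { isCommutativeRing = seriesLaws }

const-* : ∀ c b n → (const c * b) n ≡ c ℤ.* b n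
const-* c b n = trans (*-at (const c) b n) (conv-const c b n)

seriesHom : IntegerHom seriesRing
seriesHom = record
  { ι = const
  ; ι-0 = ≋-refl
  ; ι-1 = ≋-refl
  ; ι-+ = λ a b → pointwise λ { zero → sym (+-at (const a) (const b) 0) ; (suc n) → sym (+-at (const a) (const b) (suc n)) }
  ; ι-* = λ a b → pointwise λ { zero → sym (const-* a (const b) 0)
                              ; (suc n) → trans (sym (ℤₚ.*-zeroʳ a)) (sym (const-* a (const b) (suc n))) }
  ; ι-neg = λ a → pointwise λ { zero → sym (neg-at (const a) 0) ; (suc n) → sym (neg-at (const a) (suc n)) } }

open Solver seriesRing seriesHom public
open CommutativeRing seriesRing public using
  (zeroˡ; zeroʳ; *-identityˡ; *-identityʳ; *-cong; *-congˡ; *-congʳ; *-comm; *-assoc; +-cong; +-congˡ; +-congʳ; -‿cong; +-identityˡ; +-identityʳ)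

module ≋-Reasoning = SetoidReasoning (CommutativeRing.setoid seriesRing)

*-head : ∀ a b → (a * b) 0 ≡ a 0 ℤ.* b 0
*-head a b = *-at a b 0

pow≡^ : ∀ a k → pow a k ≡ a ^ k
pow≡^ a zero    = refl
pow≡^ a (suc k) = trans (cong (a ⊗_) (pow≡^ a k)) (⊗≡* a (a ^ k))

^-+ : ∀ a m n → a ^ (m ℕ.+ n) ≋ a ^ m * a ^ n
^-+ a zero    n = ≋-sym (*-identityˡ (a ^ n))
^-+ a (suc m) n = ≋-trans (*-congˡ (^-+ a m n)) (≋-sym (*-assoc a (a ^ m) (a ^ n)))

^-* : ∀ a k m → (a ^ k) ^ m ≋ a ^ (k ℕ.* m)
^-* a k zero    = ≋-reflexive (cong (a ^_) (sym (ℕₚ.*-zeroʳ k)))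
^-* a k (suc m) = ≋-trans (*-congˡ (^-* a k m)) (≋-trans (≋-sym (^-+ a k (k ℕ.* m))) (≋-reflexive (cong (a ^_) (sym (ℕₚ.*-suc k m)))))

^-head : ∀ {a} → a 0 ≡ + 1 → ∀ k → (a ^ k) 0 ≡ + 1
^-head p zero    = refl
^-head {a} p (suc k) = trans (*-head a (a ^ k)) (cong₂ ℤ._*_ p (^-head p k))

*-head-1 : ∀ {a b} → a 0 ≡ + 1 → b 0 ≡ + 1 → (a * b) 0 ≡ + 1
*-head-1 {a} {b} p q = trans (*-head a b) (cong₂ ℤ._*_ p q)

q*-zero : ∀ a → (qS * a) 0 ≡ + 0
q*-zero a = *-head qS a

q*-suc : ∀ a n → (qS * a) (suc n) ≡ a n
q*-suc a n = trans (*-at qS a (suc n))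
  (trans (ℤₚ.+-identityˡ _) (trans (conv-cong {b = a} tail-q (λ _ → refl) n) (trans (conv-const (+ 1) a n) (ℤₚ.*-identityˡ (a n)))))
  where
  tail-q : ∀ m → tail qS m ≡ oneS m
  tail-q zero    = refl
  tail-q (suc m) = refl

q^*-low : ∀ k a n → n < k → (qS ^ k * a) n ≡ + 0
q^*-low (suc k) a zero    _         = trans (at (*-assoc qS (qS ^ k) a) 0) (q*-zero (qS ^ k * a))
q^*-low (suc k) a (suc n) (s≤s n<k) =
  trans (at (*-assoc qS (qS ^ k) a) (suc n)) (trans (q*-suc (qS ^ k * a) n) (q^*-low k a n n<k))

q^*-+ : ∀ k a n → (qS ^ k * a) (n ℕ.+ k) ≡ a n
q^*-+ zero    a n = trans (cong (oneS * a) (ℕₚ.+-identityʳ n)) (at (*-identityˡ a) n)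
q^*-+ (suc k) a n = trans (cong (qS ^ suc k * a) (ℕₚ.+-suc n k))
  (trans (at (*-assoc qS (qS ^ k) a) (suc (n ℕ.+ k))) (trans (q*-suc (qS ^ k * a) (n ℕ.+ k)) (q^*-+ k a n)))

shift-suc : ∀ k a n → shift (suc k) a (suc n) ≡ shift k a n
shift-suc zero    a n = refl
shift-suc (suc k) a n = refl

shift≋ : ∀ k a → shift k a ≋ qS ^ k * a
shift≋ zero    a = ≋-sym (*-identityˡ a)
shift≋ (suc k) a = pointwise λ
  { zero    → sym (q^*-low (suc k) a 0 (s≤s z≤n))
  ; (suc n) → trans (shift-suc k a n) (trans (at (shift≋ k a) n)
      (sym (trans (at (*-assoc qS (qS ^ k) a) (suc n)) (q*-suc (qS ^ k * a) n)))) }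

-- Regular series

-- Cancellability takes the place of division. The factors cancelled below are products of powers of
-- q and of series with nonzero constant term.
Regular : Series → Set
Regular a = ∀ b c → a * b ≋ a * c → b ≋ c

regular-q : Regular qS
regular-q b c h = pointwise λ n → trans (sym (q*-suc b n)) (trans (at h (suc n)) (q*-suc c n))

regular-* : ∀ {a b} → Regular a → Regular b → Regular (a * b)
regular-* {a} {b} ra rb c d h =
  rb c d (ra (b * c) (b * d) (≋-trans (≋-sym (*-assoc a b c)) (≋-trans h (*-assoc a b d))))

regular-one : Regular oneS
regular-one b c h = ≋-trans (≋-sym (*-identityˡ b)) (≋-trans h (*-identityˡ c))

regular-^ : ∀ {a} → Regular a → ∀ k → Regular (a ^ k)
regular-^ ra zero    = regular-one
regular-^ ra (suc k) = regular-* ra (regular-^ ra k)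

-- Strong induction on the coefficients of d = b - c: once the earlier ones vanish, the next
-- coefficient of a d = 0 is a₀ times that of d, and ℤ has no zero divisors.
regular-head : ∀ {a} → ¬ (a 0 ≡ + 0) → Regular a
regular-head {a} a₀≢0 b c h = pointwise λ n → ℤₚ.i-j≡0⇒i≡j (b n) (c n) (trans (sym (d≡ n)) (vanish n))
  where
  d = b + - c
  d≡ : ∀ n → d n ≡ b n ℤ.- c n
  d≡ n = trans (+-at b (- c) n) (cong (λ t → b n ℤ.+ t) (neg-at c n))
  ad≋0 : a * d ≋ zeroS
  ad≋0 = ≋-trans (solve 3 (λ a b c → a :* (b :- c) :≈ a :* b :- a :* c) (a ∷ b ∷ c ∷ []) refl)
                 (zero-difference h)
  vanish : ∀ n → d n ≡ + 0
  vanish = <-rec (λ n → d n ≡ + 0) step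
    where
    integral : ∀ n → a 0 ℤ.* d n ≡ + 0 → d n ≡ + 0
    integral n e with ℤₚ.i*j≡0⇒i≡0∨j≡0 (a 0) e
    ... | inj₁ z = ⊥-elim (a₀≢0 z)
    ... | inj₂ z = z
    step : ∀ n → (∀ {m} → m < n → d m ≡ + 0) → d n ≡ + 0
    step zero    ih = integral 0 (trans (sym (*-head a d)) (at ad≋0 0))
    step (suc n) ih = integral (suc n) (begin
      a 0 ℤ.* d (suc n)                        ≡⟨ sym (ℤₚ.+-identityʳ _) ⟩
      a 0 ℤ.* d (suc n) ℤ.+ + 0                ≡⟨ cong (λ t → a 0 ℤ.* d (suc n) ℤ.+ t) (sym rest) ⟩
      a 0 ℤ.* d (suc n) ℤ.+ conv (tail a) d n  ≡⟨ sym (*-at a d (suc n)) ⟩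
      (a * d) (suc n)                          ≡⟨ at ad≋0 (suc n) ⟩
      + 0                                      ∎)
      where
      open ≡.≡-Reasoning
      rest : conv (tail a) d n ≡ + 0
      rest = trans (conv-local {a = tail a} n (λ _ _ → refl) (λ i i≤n → trans (ih (s≤s i≤n)) (sym (zeroS-0 i))))
        (trans (conv-comm (tail a) zeroS n) (conv-zeroˡ zeroS-0 (tail a) n))

regular-1 : ∀ {a} → a 0 ≡ + 1 → Regular a
regular-1 {a} p = regular-head (λ z → one≢zero (trans (sym p) z))
  where
  one≢zero : ¬ (+ 1 ≡ + 0)
  one≢zero ()

-- Inverses of series with constant term 1

invTab-stable : ∀ a m k → k ≤ m → invTab a m k ≡ inv a k
invTab-stable a zero    zero    _   = refl
invTab-stable a (suc m) k       k≤m with ℕₚ.m≤n⇒m<n∨m≡n k≤m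
... | inj₂ refl      = refl
... | inj₁ (s≤s k≤m′) with k ℕ.≤ᵇ m in eq
...   | true  = invTab-stable a m k k≤m′
...   | false = ⊥-elim (subst Bool.T eq (ℕₚ.≤⇒≤ᵇ k≤m′))

suc≰ᵇ : ∀ m → (suc m ℕ.≤ᵇ m) ≡ false
suc≰ᵇ zero    = refl
suc≰ᵇ (suc m) = suc≰ᵇ m

inv-suc : ∀ a m → inv a (suc m) ≡ ℤ.- conv (tail a) (inv a) m
inv-suc a m rewrite suc≰ᵇ m = cong ℤ.-_ (trans (sum≡conv (tail a) (invTab a m) m)
  (conv-local {a = tail a} m (λ _ _ → refl) (λ i i≤m → invTab-stable a m i i≤m)))

inverse : ∀ {a} → a 0 ≡ + 1 → a * inv a ≋ oneS
inverse {a} p = pointwise λ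
  { zero    → trans (*-head a (inv a)) (cong (ℤ._* + 1) p)
  ; (suc m) → trans (*-at a (inv a) (suc m)) (trans
      (cong (ℤ._+ conv (tail a) (inv a) m)
        (trans (cong₂ ℤ._*_ p (inv-suc a m)) (ℤₚ.*-identityˡ (ℤ.- conv (tail a) (inv a) m))))
      (ℤₚ.+-inverseˡ (conv (tail a) (inv a) m))) }

inv-head : ∀ a → inv a 0 ≡ + 1
inv-head a = refl

-- The substitution q ↦ q^(d+1)

step-induction : ∀ d (P : ℕ → Set) → (∀ i → i < suc d → P i) → (∀ n → P n → P (n ℕ.+ suc d)) → ∀ n → P n
step-induction d P base step = <-rec P λ n ih → go n ih
  where
  go : ∀ n → (∀ {m} → m < n → P m) → P n
  go n ih with n ℕ.<? suc d
  ... | yes n<d = base n n<d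
  ... | no  n≮d = subst P (ℕₚ.m∸n+n≡m d≤n) (step (n ℕ.∸ suc d) (ih (ℕₚ.∸-monoʳ-< (s≤s z≤n) d≤n)))
    where d≤n = ℕₚ.≮⇒≥ n≮d

opaque
  -- dilate d a is a(q^(d+1)): the index is shifted so that no NonZero argument is needed.
  dilate : ℕ → Series → Series
  dilate d a n = if n ℕ.% suc d ℕ.≡ᵇ 0 then a (n ℕ./ suc d) else + 0

  dilate-0 : ∀ d a → dilate d a 0 ≡ a 0
  dilate-0 d a = refl

  dilate-low : ∀ d a i → suc i < suc d → dilate d a (suc i) ≡ + 0
  dilate-low d a i i<d rewrite DivMod.m<n⇒m%n≡m {n = suc d} ⦃ ℕ.nonZero ⦄ i<d = refl

  dilate-+ : ∀ d a n → dilate d a (n ℕ.+ suc d) ≡ dilate d (tail a) n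
  dilate-+ d a n
    rewrite DivMod.[m+n]%n≡m%n n (suc d) ⦃ ℕ.nonZero ⦄
          | DivMod.m/n≡1+[m∸n]/n {n ℕ.+ suc d} {suc d} ⦃ ℕ.nonZero ⦄ (ℕₚ.m≤n+m (suc d) n)
          | ℕₚ.m+n∸n≡m n (suc d) = refl

  dilate-cong : ∀ d {a b} → a ≋ b → dilate d a ≋ dilate d b
  dilate-cong d p = pointwise λ n → cong (λ t → if n ℕ.% suc d ℕ.≡ᵇ 0 then t else + 0) (at p (n ℕ./ suc d))

  dilate-+S : ∀ d a b → dilate d (a + b) ≋ dilate d a + dilate d b
  dilate-+S d a b = pointwise λ n → trans (branch n) (sym (+-at (dilate d a) (dilate d b) n))
    where
    branch : ∀ n → dilate d (a + b) n ≡ dilate d a n ℤ.+ dilate d b n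
    branch n with n ℕ.% suc d ℕ.≡ᵇ 0
    ... | true  = +-at a b (n ℕ./ suc d)
    ... | false = refl

  dilate-neg : ∀ d a → dilate d (- a) ≋ - dilate d a
  dilate-neg d a = pointwise λ n → trans (branch n) (sym (neg-at (dilate d a) n))
    where
    branch : ∀ n → dilate d (- a) n ≡ ℤ.- dilate d a n
    branch n with n ℕ.% suc d ℕ.≡ᵇ 0
    ... | true  = neg-at a (n ℕ./ suc d)
    ... | false = refl

  dilate-tail-* : ∀ d a b n → dilate d (tail (a * b)) n ≡ a 0 ℤ.* dilate d (tail b) n ℤ.+ dilate d (tail a * b) n
  dilate-tail-* d a b n with n ℕ.% suc d ℕ.≡ᵇ 0
  ... | true  = trans (*-at a b (suc (n ℕ./ suc d)))
                  (cong (λ t → a 0 ℤ.* b (suc (n ℕ./ suc d)) ℤ.+ t) (sym (*-at (tail a) b (n ℕ./ suc d))))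
  ... | false = sym (trans (ℤₚ.+-identityʳ _) (ℤₚ.*-zeroʳ (a 0)))

  dilate-zero : ∀ d n → dilate d (λ _ → + 0) n ≡ + 0
  dilate-zero d n with n ℕ.% suc d ℕ.≡ᵇ 0
  ... | true  = refl
  ... | false = refl

  dilate-local : ∀ d {a b} n → (∀ i → i ≤ n → a i ≡ b i) → dilate d a n ≡ dilate d b n
  dilate-local d n p with n ℕ.% suc d ℕ.≡ᵇ 0
  ... | true  = p (n ℕ./ suc d) (DivMod.m/n≤m n (suc d))
  ... | false = refl

  dilate-at-multiple : ∀ d a n → dilate d a (n ℕ.* suc d) ≡ a n
  dilate-at-multiple d a n
    rewrite DivMod.m*n%n≡0 n (suc d) ⦃ ℕ.nonZero ⦄ | DivMod.m*n/n≡m n (suc d) ⦃ ℕ.nonZero ⦄ = refl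

-- The functional equation of the substitution. Multiplicativity and the composition laws are
-- derived from it, so the arithmetic of remainders stays confined to the opaque block.
dilate-head : ∀ d a → dilate d a ≋ const (a 0) + qS ^ suc d * dilate d (tail a)
dilate-head d a = pointwise λ n → trans (split n) (sym (+-at (const (a 0)) (qS ^ suc d * dilate d (tail a)) n))
  where
  split : ∀ n → dilate d a n ≡ const (a 0) n ℤ.+ (qS ^ suc d * dilate d (tail a)) n
  split = step-induction d _ low high
    where
    low : ∀ i → i < suc d → dilate d a i ≡ const (a 0) i ℤ.+ (qS ^ suc d * dilate d (tail a)) i
    low zero    i<d = trans (dilate-0 d a) (sym (trans (cong (λ t → a 0 ℤ.+ t) (q^*-low (suc d) _ 0 i<d)) (ℤₚ.+-identityʳ (a 0))))
    low (suc i) i<d = trans (dilate-low d a i i<d) (sym (cong (λ t → + 0 ℤ.+ t) (q^*-low (suc d) _ (suc i) i<d)))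
    const-high : ∀ n → const (a 0) (n ℕ.+ suc d) ≡ + 0
    const-high n = cong (const (a 0)) (ℕₚ.+-suc n d)
    high : ∀ n → _ → dilate d a (n ℕ.+ suc d) ≡ const (a 0) (n ℕ.+ suc d) ℤ.+ (qS ^ suc d * dilate d (tail a)) (n ℕ.+ suc d)
    high n _ = trans (dilate-+ d a n) (sym (trans (cong₂ ℤ._+_ (const-high n) (q^*-+ (suc d) _ n)) (ℤₚ.+-identityˡ _)))

module _ (d : ℕ) (a b : Series) where
  private
    expand : dilate d a * b ≋ const (a 0) * b + qS ^ suc d * (dilate d (tail a) * b)
    expand = ≋-trans (*-congʳ (dilate-head d a))
      (solve 4 (λ c q t b → (c :+ q :* t) :* b :≈ c :* b :+ q :* (t :* b))
        (const (a 0) ∷ qS ^ suc d ∷ dilate d (tail a) ∷ b ∷ []) refl)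

  dilate*-low : ∀ i → i < suc d → (dilate d a * b) i ≡ a 0 ℤ.* b i
  dilate*-low i i<d = trans (at expand i) (trans (+-at _ _ i)
    (trans (cong₂ ℤ._+_ (const-* (a 0) b i) (q^*-low (suc d) _ i i<d)) (ℤₚ.+-identityʳ _)))

  dilate*-+ : ∀ n → (dilate d a * b) (n ℕ.+ suc d) ≡ a 0 ℤ.* b (n ℕ.+ suc d) ℤ.+ (dilate d (tail a) * b) n
  dilate*-+ n = trans (at expand (n ℕ.+ suc d)) (trans (+-at _ _ (n ℕ.+ suc d))
    (cong₂ ℤ._+_ (const-* (a 0) b (n ℕ.+ suc d)) (q^*-+ (suc d) _ n)))

dilate-conv-+ : ∀ d a b n → dilate d (a * b) (n ℕ.+ suc d) ≡ a 0 ℤ.* dilate d b (n ℕ.+ suc d) ℤ.+ dilate d (tail a * b) n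
dilate-conv-+ d a b n = begin
  dilate d (a * b) (n ℕ.+ suc d)       ≡⟨ dilate-+ d (a * b) n ⟩
  dilate d (tail (a * b)) n            ≡⟨ dilate-tail-* d a b n ⟩
  a 0 ℤ.* dilate d (tail b) n ℤ.+ dilate d (tail a * b) n
    ≡⟨ cong (λ t → a 0 ℤ.* t ℤ.+ dilate d (tail a * b) n) (sym (dilate-+ d b n)) ⟩
  a 0 ℤ.* dilate d b (n ℕ.+ suc d) ℤ.+ dilate d (tail a * b) n ∎
  where open ≡.≡-Reasoning

dilate-* : ∀ d a b → dilate d (a * b) ≋ dilate d a * dilate d b
-- The induction must hold for all left factors at once, because its step passes from `a` to
-- `tail a`; the right factor stays fixed.
dilate-* d a b = pointwise λ n → step-induction d (λ n → ∀ a → dilate d (a * b) n ≡ (dilate d a * dilate d b) n) low high n a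
  where
  low : ∀ i → i < suc d → ∀ a → dilate d (a * b) i ≡ (dilate d a * dilate d b) i
  low zero    i<d a = trans (dilate-0 d (a * b)) (trans (*-head a b) (sym (trans (*-head (dilate d a) (dilate d b))
    (cong₂ ℤ._*_ (dilate-0 d a) (dilate-0 d b)))))
  low (suc i) i<d a = trans (dilate-low d (a * b) i i<d) (sym (trans (dilate*-low d a (dilate d b) (suc i) i<d)
    (trans (cong (a 0 ℤ.*_) (dilate-low d b i i<d)) (ℤₚ.*-zeroʳ (a 0)))))
  high : ∀ n → (∀ a → dilate d (a * b) n ≡ (dilate d a * dilate d b) n) →
         ∀ a → dilate d (a * b) (n ℕ.+ suc d) ≡ (dilate d a * dilate d b) (n ℕ.+ suc d)
  high n ih a = trans (dilate-conv-+ d a b n) (trans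
    (cong (λ t → a 0 ℤ.* dilate d b (n ℕ.+ suc d) ℤ.+ t) (ih (tail a)))
    (sym (dilate*-+ d a (dilate d b) n)))

dilate-const : ∀ d c → dilate d (const c) ≋ const c
dilate-const d c = pointwise λ { zero → dilate-0 d (const c) ; (suc n) → step-induction d (λ n → dilate d (const c) n ≡ const c n) low high (suc n) }
  where
  low : ∀ i → i < suc d → dilate d (const c) i ≡ const c i
  low zero    _   = dilate-0 d (const c)
  low (suc i) i<d = dilate-low d (const c) i i<d
  high : ∀ n → _ → dilate d (const c) (n ℕ.+ suc d) ≡ const c (n ℕ.+ suc d)
  high n _ = trans (dilate-+ d (const c) n) (trans (dilate-zero d n) (sym (cong (const c) (ℕₚ.+-suc n d))))

dilate-^ : ∀ d a k → dilate d (a ^ k) ≋ dilate d a ^ k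
dilate-^ d a zero    = dilate-const d (+ 1)
dilate-^ d a (suc k) = ≋-trans (dilate-* d a (a ^ k)) (*-congˡ (dilate-^ d a k))

dilate-q : ∀ d → dilate d qS ≋ qS ^ suc d
dilate-q d = ≋-trans (dilate-head d qS)
  (≋-trans (+-cong (pointwise λ { zero → refl ; (suc n) → refl })
     (*-congˡ (≋-trans (dilate-cong d (pointwise λ { zero → refl ; (suc n) → refl })) (dilate-const d (+ 1)))))
   (solve 1 (λ x → con (+ 0) :+ x :* con (+ 1) :≈ x) (qS ^ suc d ∷ []) refl))

-- Sections of a series modulo 5

opaque
  section : ℕ → Series → Series
  section i a n = a (i ℕ.+ 5 ℕ.* n)

  section-at : ∀ i a n → section i a n ≡ a (i ℕ.+ 5 ℕ.* n)
  section-at i a n = refl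

  U5≡section : ∀ a → U5 a ≡ section 0 a
  U5≡section a = refl

section-cong : ∀ i {a b} → a ≋ b → section i a ≋ section i b
section-cong i {a} {b} p = pointwise λ n → trans (section-at i a n) (trans (at p (i ℕ.+ 5 ℕ.* n)) (sym (section-at i b n)))

section-+ : ∀ i a b → section i (a + b) ≋ section i a + section i b
section-+ i a b = pointwise λ n → trans (section-at i (a + b) n) (trans (+-at a b (i ℕ.+ 5 ℕ.* n))
  (trans (sym (cong₂ ℤ._+_ (section-at i a n) (section-at i b n))) (sym (+-at (section i a) (section i b) n))))

section-zero : section 0 zeroS ≋ zeroS
section-zero = pointwise λ n → trans (section-at 0 zeroS n) (trans (zeroS-0 (5 ℕ.* n)) (sym (zeroS-0 n)))

section-neg : ∀ i a → section i (- a) ≋ - section i a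
section-neg i a = pointwise λ n → trans (section-at i (- a) n) (trans (neg-at a (i ℕ.+ 5 ℕ.* n))
  (trans (cong ℤ.-_ (sym (section-at i a n))) (sym (neg-at (section i a) n))))

5*suc : ∀ i n → i ℕ.+ 5 ℕ.* suc n ≡ (i ℕ.+ 5 ℕ.* n) ℕ.+ 5
5*suc i n = trans (cong (i ℕ.+_) (trans (ℕₚ.*-suc 5 n) (ℕₚ.+-comm 5 (5 ℕ.* n)))) (sym (ℕₚ.+-assoc i (5 ℕ.* n) 5))

-- This makes each section, and U₅ in particular, linear over the series in q⁵, with q⁵ turned into
-- q. Every computation of U₅ below consists in moving factors in q⁵ across by this rule.
section-dilate* : ∀ i → i < 5 → ∀ a b → section i (dilate 4 a * b) ≋ a * section i b
section-dilate* i i<5 a b = pointwise λ n → trans (section-at i (dilate 4 a * b) n) (trans (go n a) (sym (*-at a (section i b) n)))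
  where
  go : ∀ n a → (dilate 4 a * b) (i ℕ.+ 5 ℕ.* n) ≡ conv a (section i b) n
  go zero    a = trans (dilate*-low 4 a b (i ℕ.+ 0) (subst (_< 5) (sym (ℕₚ.+-identityʳ i)) i<5))
    (cong (a 0 ℤ.*_) (sym (section-at i b 0)))
  go (suc n) a = begin
    (dilate 4 a * b) (i ℕ.+ 5 ℕ.* suc n)        ≡⟨ cong (dilate 4 a * b) (5*suc i n) ⟩
    (dilate 4 a * b) ((i ℕ.+ 5 ℕ.* n) ℕ.+ 5)    ≡⟨ dilate*-+ 4 a b (i ℕ.+ 5 ℕ.* n) ⟩
    a 0 ℤ.* b ((i ℕ.+ 5 ℕ.* n) ℕ.+ 5) ℤ.+ (dilate 4 (tail a) * b) (i ℕ.+ 5 ℕ.* n)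
      ≡⟨ cong₂ (λ s t → a 0 ℤ.* s ℤ.+ t) (trans (cong b (sym (5*suc i n))) (sym (section-at i b (suc n)))) (go n (tail a)) ⟩
    conv a (section i b) (suc n) ∎
    where open ≡.≡-Reasoning

section-suc-q : ∀ i b → section (suc i) (qS * b) ≋ section i b
section-suc-q i b = pointwise λ n → trans (section-at (suc i) (qS * b) n) (trans (q*-suc b (i ℕ.+ 5 ℕ.* n)) (sym (section-at i b n)))

section-0-q : ∀ b → section 0 (qS * b) ≋ qS * section 4 b
section-0-q b = pointwise λ
  { zero    → trans (section-at 0 (qS * b) 0) (trans (q*-zero b) (sym (q*-zero (section 4 b))))
  ; (suc n) → trans (section-at 0 (qS * b) (suc n)) (trans (cong (qS * b) (trans (5*suc 0 n) (ℕₚ.+-suc (5 ℕ.* n) 4)))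
      (trans (q*-suc b (5 ℕ.* n ℕ.+ 4)) (trans (cong b (ℕₚ.+-comm (5 ℕ.* n) 4)) (trans (sym (section-at 4 b n)) (sym (q*-suc (section 4 b) n)))))) }

section-one : ∀ i → i < 5 → section i oneS ≋ const (oneS i)
section-one i _ = pointwise λ
  { zero    → trans (section-at i oneS 0) (cong oneS (ℕₚ.+-identityʳ i))
  ; (suc n) → trans (section-at i oneS (suc n)) (cong oneS (ℕₚ.+-suc i (n ℕ.+ 4 ℕ.* suc n))) }

-- Horner form of e₀ + e₁ q + e₂ q² + e₃ q³ + e₄ q⁴ with all eᵢ evaluated at q⁵.
dissection : (e₀ e₁ e₂ e₃ e₄ : Series) → Series
dissection e₀ e₁ e₂ e₃ e₄ =
  dilate 4 e₀ + qS * (dilate 4 e₁ + qS * (dilate 4 e₂ + qS * (dilate 4 e₃ + qS * dilate 4 e₄)))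

section-0-dilate : ∀ a → section 0 (dilate 4 a) ≋ a
section-0-dilate a = begin
  section 0 (dilate 4 a)        ≈⟨ section-cong 0 (≋-sym (*-identityʳ (dilate 4 a))) ⟩
  section 0 (dilate 4 a * oneS) ≈⟨ section-dilate* 0 (s≤s z≤n) a oneS ⟩
  a * section 0 oneS            ≈⟨ *-congˡ (section-one 0 (s≤s z≤n)) ⟩
  a * oneS                      ≈⟨ *-identityʳ a ⟩
  a                             ∎
  where open ≋-Reasoning

section-suc-dilate : ∀ i → suc i < 5 → ∀ a → section (suc i) (dilate 4 a) ≋ zeroS
section-suc-dilate i i<5 a = begin
  section (suc i) (dilate 4 a)        ≈⟨ section-cong (suc i) (≋-sym (*-identityʳ (dilate 4 a))) ⟩
  section (suc i) (dilate 4 a * oneS) ≈⟨ section-dilate* (suc i) i<5 a oneS ⟩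
  a * section (suc i) oneS            ≈⟨ *-congˡ (section-one (suc i) i<5) ⟩
  a * zeroS                           ≈⟨ zeroʳ a ⟩
  zeroS                               ∎
  where open ≋-Reasoning

section-0-Horner : ∀ e y → section 0 (dilate 4 e + qS * y) ≋ e + qS * section 4 y
section-0-Horner e y = ≋-trans (section-+ 0 (dilate 4 e) (qS * y)) (+-cong (section-0-dilate e) (section-0-q y))

section-suc-Horner : ∀ i → suc i < 5 → ∀ e y → section (suc i) (dilate 4 e + qS * y) ≋ section i y
section-suc-Horner i i<5 e y = ≋-trans (section-+ (suc i) (dilate 4 e) (qS * y))
  (≋-trans (+-cong (section-suc-dilate i i<5 e) (section-suc-q i y)) (+-identityˡ (section i y)))

module _ (e₀ e₁ e₂ e₃ e₄ : Series) where
  private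
    y₁ = dilate 4 e₁ + qS * (dilate 4 e₂ + qS * (dilate 4 e₃ + qS * dilate 4 e₄))
    y₂ = dilate 4 e₂ + qS * (dilate 4 e₃ + qS * dilate 4 e₄)
    y₃ = dilate 4 e₃ + qS * dilate 4 e₄
    2<5 : 2 < 5
    2<5 = s≤s (s≤s (s≤s z≤n))
    drop-q : ∀ {e y} → y ≋ zeroS → e + qS * y ≋ e
    drop-q p = ≋-trans (+-congˡ (≋-trans (*-congˡ p) (zeroʳ qS))) (+-identityʳ _)
    1<5 : 1 < 5
    1<5 = s≤s (s≤s z≤n)
    3<5 : 3 < 5
    3<5 = s≤s (s≤s (s≤s (s≤s z≤n)))
    4<5 : 4 < 5
    4<5 = s≤s (s≤s (s≤s (s≤s (s≤s z≤n))))

  section-4-dissection : section 4 (dissection e₀ e₁ e₂ e₃ e₄) ≋ e₄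
  section-4-dissection = ≋-trans (section-suc-Horner 3 4<5 e₀ y₁) (≋-trans (section-suc-Horner 2 3<5 e₁ y₂)
    (≋-trans (section-suc-Horner 1 2<5 e₂ y₃) (≋-trans (section-suc-Horner 0 1<5 e₃ (dilate 4 e₄)) (section-0-dilate e₄))))

  section-3-dissection : section 3 (dissection e₀ e₁ e₂ e₃ e₄) ≋ e₃
  section-3-dissection = ≋-trans (section-suc-Horner 2 3<5 e₀ y₁) (≋-trans (section-suc-Horner 1 2<5 e₁ y₂)
    (≋-trans (section-suc-Horner 0 1<5 e₂ y₃) (≋-trans (section-0-Horner e₃ (dilate 4 e₄))
      (drop-q (section-suc-dilate 3 4<5 e₄)))))

  section-2-dissection : section 2 (dissection e₀ e₁ e₂ e₃ e₄) ≋ e₂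
  section-2-dissection = ≋-trans (section-suc-Horner 1 2<5 e₀ y₁) (≋-trans (section-suc-Horner 0 1<5 e₁ y₂)
    (≋-trans (section-0-Horner e₂ y₃) (drop-q (≋-trans (section-suc-Horner 3 4<5 e₃ (dilate 4 e₄))
      (section-suc-dilate 2 3<5 e₄)))))

  section-1-dissection : section 1 (dissection e₀ e₁ e₂ e₃ e₄) ≋ e₁
  section-1-dissection = ≋-trans (section-suc-Horner 0 1<5 e₀ y₁) (≋-trans (section-0-Horner e₁ y₂)
    (drop-q (≋-trans (section-suc-Horner 3 4<5 e₂ y₃) (≋-trans (section-suc-Horner 2 3<5 e₃ (dilate 4 e₄))
      (section-suc-dilate 1 2<5 e₄)))))

  section-0-dissection : section 0 (dissection e₀ e₁ e₂ e₃ e₄) ≋ e₀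
  section-0-dissection = ≋-trans (section-0-Horner e₀ y₁)
    (drop-q (≋-trans (section-suc-Horner 3 4<5 e₁ y₂) (≋-trans (section-suc-Horner 2 3<5 e₂ y₃)
      (≋-trans (section-suc-Horner 1 2<5 e₃ (dilate 4 e₄)) (section-suc-dilate 0 1<5 e₄)))))

dilate-injective : ∀ d {a b} → dilate d a ≋ dilate d b → a ≋ b
dilate-injective d {a} {b} p = pointwise λ n →
  trans (sym (dilate-at-multiple d a n)) (trans (at p (n ℕ.* suc d)) (dilate-at-multiple d b n))

dissect : ∀ a → a ≋ dissection (section 0 a) (section 1 a) (section 2 a) (section 3 a) (section 4 a)
dissect a = pointwise λ n → subst (λ k → a k ≡ E k) (sym (trans (DivMod.m≡m%n+[m/n]*n n 5) (cong (n ℕ.% 5 ℕ.+_) (ℕₚ.*-comm (n ℕ./ 5) 5))))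
  (by-class (n ℕ.% 5) (DivMod.m%n<n n 5) (n ℕ./ 5))
  where
  E = dissection (section 0 a) (section 1 a) (section 2 a) (section 3 a) (section 4 a)
  by-class : ∀ i → i < 5 → ∀ m → a (i ℕ.+ 5 ℕ.* m) ≡ E (i ℕ.+ 5 ℕ.* m)
  by-class 0 _ m = trans (sym (section-at 0 a m)) (trans (sym (at (section-0-dissection _ _ _ _ _) m)) (section-at 0 E m))
  by-class 1 _ m = trans (sym (section-at 1 a m)) (trans (sym (at (section-1-dissection _ _ _ _ _) m)) (section-at 1 E m))
  by-class 2 _ m = trans (sym (section-at 2 a m)) (trans (sym (at (section-2-dissection _ _ _ _ _) m)) (section-at 2 E m))
  by-class 3 _ m = trans (sym (section-at 3 a m)) (trans (sym (at (section-3-dissection _ _ _ _ _) m)) (section-at 3 E m))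
  by-class 4 _ m = trans (sym (section-at 4 a m)) (trans (sym (at (section-4-dissection _ _ _ _ _) m)) (section-at 4 E m))
  by-class (suc (suc (suc (suc (suc _))))) (s≤s (s≤s (s≤s (s≤s (s≤s ()))))) m

-- Triangular numbers, and f_r as a limit of partial products

tri : ℕ → ℕ
tri zero    = 0
tri (suc n) = suc n ℕ.+ tri n

tri-+ : ∀ a b → tri (a ℕ.+ b) ≡ tri a ℕ.+ tri b ℕ.+ a ℕ.* b
tri-+ zero    b = sym (ℕₚ.+-identityʳ (tri b))
tri-+ (suc a) b = trans (cong (suc (a ℕ.+ b) ℕ.+_) (tri-+ a b)) (lemma a b (tri a) (tri b))
  where
  lemma : ∀ a b s t → suc (a ℕ.+ b) ℕ.+ (s ℕ.+ t ℕ.+ a ℕ.* b) ≡ suc a ℕ.+ s ℕ.+ t ℕ.+ suc a ℕ.* b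
  lemma = solve-∀

tri-double : ∀ n → tri n ℕ.+ tri n ≡ n ℕ.* suc n
tri-double zero    = refl
tri-double (suc n) = trans (lemma n (tri n)) (trans (cong (ℕ._+ (2 ℕ.+ 2 ℕ.* n)) (tri-double n)) (lemma₂ n))
  where
  lemma : ∀ n t → (suc n ℕ.+ t) ℕ.+ (suc n ℕ.+ t) ≡ (t ℕ.+ t) ℕ.+ (2 ℕ.+ 2 ℕ.* n)
  lemma = solve-∀
  lemma₂ : ∀ n → n ℕ.* suc n ℕ.+ (2 ℕ.+ 2 ℕ.* n) ≡ suc n ℕ.* suc (suc n)
  lemma₂ = solve-∀

tri-5*+ : ∀ c n → tri (5 ℕ.* n ℕ.+ c) ≡ 5 ℕ.* tri n ℕ.+ 10 ℕ.* (n ℕ.* n) ℕ.+ 5 ℕ.* (c ℕ.* n) ℕ.+ tri c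
tri-5*+ c n = begin
  tri (5 ℕ.* n ℕ.+ c)                              ≡⟨ tri-+ (5 ℕ.* n) c ⟩
  tri (5 ℕ.* n) ℕ.+ tri c ℕ.+ 5 ℕ.* n ℕ.* c        ≡⟨ cong (λ t → t ℕ.+ tri c ℕ.+ 5 ℕ.* n ℕ.* c) five ⟩
  (5 ℕ.* tri n ℕ.+ 10 ℕ.* (n ℕ.* n)) ℕ.+ tri c ℕ.+ 5 ℕ.* n ℕ.* c ≡⟨ lemma n c (tri n) (tri c) ⟩
  5 ℕ.* tri n ℕ.+ 10 ℕ.* (n ℕ.* n) ℕ.+ 5 ℕ.* (c ℕ.* n) ℕ.+ tri c ∎
  where
  open ≡.≡-Reasoning
  lemma : ∀ n c s t → (5 ℕ.* s ℕ.+ 10 ℕ.* (n ℕ.* n)) ℕ.+ t ℕ.+ 5 ℕ.* n ℕ.* c ≡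
                      5 ℕ.* s ℕ.+ 10 ℕ.* (n ℕ.* n) ℕ.+ 5 ℕ.* (c ℕ.* n) ℕ.+ t
  lemma = solve-∀
  collect : ∀ n s → s ℕ.+ (s ℕ.+ (s ℕ.+ (s ℕ.+ (s ℕ.+ 0 ℕ.+ n ℕ.* 0) ℕ.+ n ℕ.* (n ℕ.+ 0)) ℕ.+ n ℕ.* (n ℕ.+ (n ℕ.+ 0))) ℕ.+ n ℕ.* (n ℕ.+ (n ℕ.+ (n ℕ.+ 0)))) ℕ.+ n ℕ.* (n ℕ.+ (n ℕ.+ (n ℕ.+ (n ℕ.+ 0))))
                  ≡ 5 ℕ.* s ℕ.+ 10 ℕ.* (n ℕ.* n)
  collect = solve-∀
  step : ∀ k → tri (n ℕ.+ k) ≡ tri n ℕ.+ tri k ℕ.+ n ℕ.* k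
  step = tri-+ n
  five : tri (5 ℕ.* n) ≡ 5 ℕ.* tri n ℕ.+ 10 ℕ.* (n ℕ.* n)
  five rewrite step (n ℕ.+ (n ℕ.+ (n ℕ.+ (n ℕ.+ 0)))) | step (n ℕ.+ (n ℕ.+ (n ℕ.+ 0))) | step (n ℕ.+ (n ℕ.+ 0))
             | step (n ℕ.+ 0) | step 0 = collect n (tri n)

n≤tri : ∀ n → n ≤ tri n
n≤tri zero    = z≤n
n≤tri (suc n) = ℕₚ.m≤m+n (suc n) (tri n)

oneMinusQ≋ : ∀ k → oneMinusQ k ≋ oneS + - qS ^ k
oneMinusQ≋ k = pointwise λ n → begin
  oneS n ℤ.+ (ℤ.- + 1) ℤ.* shift k oneS n  ≡⟨ cong (λ t → oneS n ℤ.+ t) (trans (ℤₚ.-1*i≡-i _) (cong ℤ.-_ (at (shift≋ k oneS) n))) ⟩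
  oneS n ℤ.+ ℤ.- (qS ^ k * oneS) n         ≡⟨ cong (λ t → oneS n ℤ.+ ℤ.- t) (at (*-identityʳ (qS ^ k)) n) ⟩
  oneS n ℤ.+ ℤ.- (qS ^ k) n                ≡⟨ cong (λ t → oneS n ℤ.+ t) (sym (neg-at (qS ^ k) n)) ⟩
  oneS n ℤ.+ (- qS ^ k) n                  ≡⟨ sym (+-at oneS (- qS ^ k) n) ⟩
  (oneS + - qS ^ k) n                      ∎
  where open ≡.≡-Reasoning

partialProd-suc : ∀ r N → partialProd r (suc N) ≋ partialProd r N * (oneS + - qS ^ (r ℕ.* suc N))
partialProd-suc r N = subst (_≋ partialProd r N * (oneS + - qS ^ (r ℕ.* suc N)))
  (sym (⊗≡* (partialProd r N) (oneMinusQ (r ℕ.* suc N)))) (*-congˡ (oneMinusQ≋ (r ℕ.* suc N)))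

*-oneMinus-at : ∀ a b k n → n < k → (a * (oneS + - (qS ^ k * b))) n ≡ a n
*-oneMinus-at a b k n n<k = begin
  (a * (oneS + - (qS ^ k * b))) n
    ≡⟨ at (solve 3 (λ a q b → a :* (con (+ 1) :- q :* b) :≈ a :+ q :* (:- (a :* b))) (a ∷ qS ^ k ∷ b ∷ []) refl) n ⟩
  (a + qS ^ k * - (a * b)) n            ≡⟨ +-at a _ n ⟩
  a n ℤ.+ (qS ^ k * - (a * b)) n        ≡⟨ cong (λ t → a n ℤ.+ t) (q^*-low k _ n n<k) ⟩
  a n ℤ.+ + 0                           ≡⟨ ℤₚ.+-identityʳ (a n) ⟩
  a n                                   ∎
  where open ≡.≡-Reasoning

partialProd-at : ∀ r N n → n ≤ N → partialProd (suc r) N n ≡ f (suc r) n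
partialProd-at r zero    zero n≤N = refl
partialProd-at r (suc N) n    n≤N with ℕₚ.m≤n⇒m<n∨m≡n n≤N
... | inj₂ refl        = refl
... | inj₁ (s≤s n≤N′) = trans (at (partialProd-suc (suc r) N) n)
  (trans (at (*-congˡ {partialProd (suc r) N} (+-congˡ (-‿cong (≋-sym (*-identityʳ (qS ^ (suc r ℕ.* suc N))))))) n)
  (trans (*-oneMinus-at (partialProd (suc r) N) oneS (suc r ℕ.* suc N) n
           (ℕₚ.≤-trans (s≤s n≤N′) (ℕₚ.m≤n*m (suc N) (suc r))))
         (partialProd-at r N n n≤N′)))

*-local : ∀ {a a′ b b′} n → (∀ i → i ≤ n → a i ≡ a′ i) → (∀ i → i ≤ n → b i ≡ b′ i) → (a * b) n ≡ (a′ * b′) n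
*-local {a} {a′} {b} {b′} n p q = trans (*-at a b n) (trans (conv-local n p q) (sym (*-at a′ b′ n)))

f-head : ∀ r → f r 0 ≡ + 1
f-head r = refl

-- Euler's pentagonal number theorem, by Shanks's finite identity

sign : ℕ → ℤ
sign zero    = + 1
sign (suc n) = ℤ.- sign n

rising : ℕ → ℕ → Series
rising s zero    = oneS
rising s (suc j) = (oneS + - qS ^ suc s) * rising (suc s) j

rising-last : ∀ s j → rising s (suc j) ≋ rising s j * (oneS + - qS ^ (suc s ℕ.+ j))
rising-last s zero = ≋-trans (*-comm (oneS + - qS ^ suc s) oneS)
  (*-congˡ (+-congˡ (-‿cong (≋-reflexive (cong (qS ^_) (sym (ℕₚ.+-identityʳ (suc s))))))))
rising-last s (suc j) = begin
  (oneS + - qS ^ suc s) * rising (suc s) (suc j) ≈⟨ *-congˡ (rising-last (suc s) j) ⟩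
  (oneS + - qS ^ suc s) * (rising (suc s) j * (oneS + - qS ^ (suc (suc s) ℕ.+ j)))
    ≈⟨ ≋-sym (*-assoc (oneS + - qS ^ suc s) (rising (suc s) j) _) ⟩
  rising s (suc j) * (oneS + - qS ^ (suc (suc s) ℕ.+ j))
    ≡⟨ cong (λ k → rising s (suc j) * (oneS + - qS ^ suc k)) (sym (ℕₚ.+-suc s j)) ⟩
  rising s (suc j) * (oneS + - qS ^ (suc s ℕ.+ suc j)) ∎
  where open ≋-Reasoning

rising≋partialProd : ∀ N → rising 0 N ≋ partialProd 1 N
rising≋partialProd zero    = ≋-refl
rising≋partialProd (suc N) = ≋-trans (rising-last 0 N) (≋-trans
  (*-cong (rising≋partialProd N) (+-congˡ (-‿cong (≋-reflexive (cong (qS ^_) (sym (ℕₚ.*-identityˡ (suc N))))))))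
  (≋-sym (partialProd-suc 1 N)))

module Pentagonal where
  -- With N = s + j this is (-1)^s (q;q)_N / (q;q)_s q^(sN + s(s+1)/2). Shanks's identity evaluates
  -- the sum over 0 ≤ s ≤ N as the pentagonal series cut off at N. In `total k j` the sum s + j is
  -- held at N = k + j.
  term : ℕ → ℕ → Series
  term s j = const (sign s) * rising s j * qS ^ (s ℕ.* (s ℕ.+ j) ℕ.+ tri s)

  total : ℕ → ℕ → Series
  total zero    j = term 0 j
  total (suc k) j = total k (suc j) + term (suc k) j

  carry : ℕ → ℕ → Series
  carry k j = const (sign (suc k)) * rising k j * qS ^ (suc k ℕ.* (k ℕ.+ suc j) ℕ.+ tri k)

  const-neg : ∀ c → const (ℤ.- c) ≋ - const c
  const-neg = IntegerHom.ι-neg seriesHom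

  q^-≡ : ∀ {m n} → m ≡ n → qS ^ m ≋ qS ^ n
  q^-≡ refl = ≋-refl

  q^3 : ∀ {k} a b c → k ≡ a ℕ.+ b ℕ.+ c → qS ^ k ≋ qS ^ a * qS ^ b * qS ^ c
  q^3 a b c refl = ≋-trans (^-+ qS (a ℕ.+ b) c) (*-congʳ (^-+ qS a b))

  -- Compares the first k + 1 terms for N + 1 with those for N = k + j. At j = 0 the discrepancy
  -- `carry` is a monomial, one of the two new pentagonal terms; the other is the last term of the
  -- sum.
  telescope : ∀ k j → total k (suc j) ≋ total k j + carry k j
  telescope zero j = ≋-trans (*-congʳ (*-congˡ (rising-last 0 j))) (≋-trans
    (solve 3 (λ r q s → con (+ 1) :* (r :* (con (+ 1) :- q)) :* con (+ 1) :≈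
                        con (+ 1) :* r :* con (+ 1) :+ con (-[1+ 0 ]) :* r :* q)
      (rising 0 j ∷ qS ^ (1 ℕ.+ j) ∷ oneS ∷ []) refl)
    (+-congˡ (*-congˡ (q^-≡ (sym (trans (ℕₚ.+-identityʳ _) (ℕₚ.+-identityʳ (suc j))))))))
  telescope (suc k) j = begin
    total k (suc (suc j)) + term (suc k) (suc j)
      ≈⟨ +-cong (telescope k (suc j)) (*-cong (*-cong (const-neg σ) (rising-last (suc k) j)) (q^3 e (suc k) 0 exp₁)) ⟩
    (total k (suc j) + const (ℤ.- σ) * ((oneS + - qS ^ suc k) * Y) * qS ^ (suc k ℕ.* (k ℕ.+ suc (suc j)) ℕ.+ tri k)) +
      - const σ * (Y * (oneS + - qS ^ (suc (suc k) ℕ.+ j))) * (qS ^ e * qS ^ suc k * oneS)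
      ≈⟨ +-congʳ (+-congˡ (*-cong (*-congʳ (const-neg σ)) (q^3 e 0 0 exp₂))) ⟩
    (total k (suc j) + - const σ * ((oneS + - qS ^ suc k) * Y) * (qS ^ e * oneS * oneS)) +
      - const σ * (Y * (oneS + - qS ^ (suc (suc k) ℕ.+ j))) * (qS ^ e * qS ^ suc k * oneS)
      ≈⟨ solve 6 (λ T s a b y E →
            (T :+ (:- s) :* ((con (+ 1) :- a) :* y) :* (E :* con (+ 1) :* con (+ 1))) :+
              (:- s) :* (y :* (con (+ 1) :- b)) :* (E :* a :* con (+ 1)) :≈
            (T :+ (:- s) :* y :* E) :+ (:- (:- s)) :* y :* (E :* a :* b))
          (total k (suc j) ∷ const σ ∷ qS ^ suc k ∷ qS ^ (suc (suc k) ℕ.+ j) ∷ Y ∷ qS ^ e ∷ []) refl ⟩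
    (total k (suc j) + - const σ * Y * qS ^ e) + (- (- const σ)) * Y * (qS ^ e * qS ^ suc k * qS ^ (suc (suc k) ℕ.+ j))
      ≈⟨ ≋-sym (+-cong (+-congˡ (*-congʳ (*-congʳ (const-neg σ))))
                (*-cong (*-congʳ (≋-trans (const-neg (ℤ.- σ)) (-‿cong (const-neg σ))))
                        (q^3 e (suc k) (suc (suc k) ℕ.+ j) exp₃))) ⟩
    (total k (suc j) + term (suc k) j) + carry (suc k) j ∎
    where
    open ≋-Reasoning
    σ = sign k
    Y = rising (suc k) j
    e = suc k ℕ.* (suc k ℕ.+ j) ℕ.+ tri (suc k)
    exp₁ : suc k ℕ.* (suc k ℕ.+ suc j) ℕ.+ tri (suc k) ≡ e ℕ.+ suc k ℕ.+ 0
    exp₁ = lemma k j (tri k)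
      where
      lemma : ∀ k j t → suc k ℕ.* (suc k ℕ.+ suc j) ℕ.+ (suc k ℕ.+ t) ≡ (suc k ℕ.* (suc k ℕ.+ j) ℕ.+ (suc k ℕ.+ t)) ℕ.+ suc k ℕ.+ 0
      lemma = solve-∀
    exp₂ : suc k ℕ.* (k ℕ.+ suc (suc j)) ℕ.+ tri k ≡ e ℕ.+ 0 ℕ.+ 0
    exp₂ = lemma k j (tri k)
      where
      lemma : ∀ k j t → suc k ℕ.* (k ℕ.+ suc (suc j)) ℕ.+ t ≡ (suc k ℕ.* (suc k ℕ.+ j) ℕ.+ (suc k ℕ.+ t)) ℕ.+ 0 ℕ.+ 0
      lemma = solve-∀
    exp₃ : suc (suc k) ℕ.* (suc k ℕ.+ suc j) ℕ.+ tri (suc k) ≡ e ℕ.+ suc k ℕ.+ (suc (suc k) ℕ.+ j)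
    exp₃ = lemma k j (tri k)
      where
      lemma : ∀ k j t → suc (suc k) ℕ.* (suc k ℕ.+ suc j) ℕ.+ (suc k ℕ.+ t) ≡
                        (suc k ℕ.* (suc k ℕ.+ j) ℕ.+ (suc k ℕ.+ t)) ℕ.+ suc k ℕ.+ (suc (suc k) ℕ.+ j)
      lemma = solve-∀

  -- For m = `suc N` the two exponents are m(3m - 1)/2 and m(3m + 1)/2, written with triangular
  -- numbers to match the exponents in `term`.
  pentagonal : ℕ → Series
  pentagonal zero    = oneS
  pentagonal (suc N) = (pentagonal N + const (sign (suc N)) * qS ^ (suc N ℕ.* suc N ℕ.+ tri N))
                                     + const (sign (suc N)) * qS ^ (suc N ℕ.* suc N ℕ.+ tri (suc N))

  total≋pentagonal : ∀ N → total N 0 ≋ pentagonal N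
  total≋pentagonal zero    = solve 0 (con (+ 1) :* con (+ 1) :* con (+ 1) :≈ con (+ 1)) [] refl
  total≋pentagonal (suc N) = +-cong
    (≋-trans (telescope N 0) (+-cong (total≋pentagonal N)
      (*-cong (*-identityʳ _) (q^-≡ (cong (λ t → suc N ℕ.* t ℕ.+ tri N) (ℕₚ.+-comm N 1))))))
    (*-cong (*-identityʳ _) (q^-≡ (cong (λ t → suc N ℕ.* t ℕ.+ tri (suc N)) (ℕₚ.+-identityʳ (suc N)))))

  term-low : ∀ k j n → n < suc (suc k ℕ.+ j) → term (suc k) j n ≡ + 0
  term-low k j n n<e = trans (at (*-comm (const (sign (suc k)) * rising (suc k) j) (qS ^ e)) n)
    (q^*-low e _ n (ℕₚ.<-≤-trans n<e bound))
    where
    e = suc k ℕ.* (suc k ℕ.+ j) ℕ.+ tri (suc k)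
    bound : suc (suc k ℕ.+ j) ≤ e
    bound = subst (_≤ e) (ℕₚ.+-comm (suc k ℕ.+ j) 1)
      (ℕₚ.+-mono-≤ (ℕₚ.m≤m+n (suc k ℕ.+ j) (k ℕ.* (suc k ℕ.+ j))) (ℕₚ.≤-trans (s≤s z≤n) (n≤tri (suc k))))

  -- All terms with s ≥ 1 begin beyond q^(k+j), so up to that exponent only s = 0 contributes, and
  -- that term is the partial product itself.
  total-at : ∀ k j n → n ≤ k ℕ.+ j → total k j n ≡ rising 0 (k ℕ.+ j) n
  total-at zero    j n n≤ = at (solve 1 (λ r → con (+ 1) :* r :* con (+ 1) :≈ r) (rising 0 j ∷ []) refl) n
  total-at (suc k) j n n≤ = trans (+-at (total k (suc j)) (term (suc k) j) n)
    (trans (cong₂ ℤ._+_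
      (trans (total-at k (suc j) n (subst (n ≤_) (sym (ℕₚ.+-suc k j)) n≤)) (cong (λ t → rising 0 t n) (ℕₚ.+-suc k j)))
      (term-low k j n (s≤s n≤)))
    (ℤₚ.+-identityʳ _))

  pentagonal-at : ∀ N n → n ≤ N → pentagonal N n ≡ f 1 n
  pentagonal-at N n n≤N = trans (sym (at (total≋pentagonal N) n))
    (trans (total-at N 0 n (subst (n ≤_) (sym (ℕₚ.+-identityʳ N)) n≤N))
    (trans (cong (λ t → rising 0 t n) (ℕₚ.+-identityʳ N))
    (trans (at (rising≋partialProd N) n) (partialProd-at 0 N n n≤N))))

-- Dissection modulo 5 of the pentagonal series

dilate-monomial : ∀ c m → const c * qS ^ (5 ℕ.* m) ≋ dilate 4 (const c * qS ^ m)
dilate-monomial c m = ≋-sym (begin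
  dilate 4 (const c * qS ^ m)            ≈⟨ dilate-* 4 (const c) (qS ^ m) ⟩
  dilate 4 (const c) * dilate 4 (qS ^ m) ≈⟨ *-cong (dilate-const 4 c) (≋-trans (dilate-^ 4 qS m) (^-cong (dilate-q 4) m)) ⟩
  const c * (qS ^ 5) ^ m                 ≈⟨ *-congˡ (^-* qS 5 m) ⟩
  const c * qS ^ (5 ℕ.* m)               ∎)
  where open ≋-Reasoning

dissection-+ : ∀ a₀ a₁ a₂ a₃ a₄ b₀ b₁ b₂ b₃ b₄ → dissection a₀ a₁ a₂ a₃ a₄ + dissection b₀ b₁ b₂ b₃ b₄ ≋
               dissection (a₀ + b₀) (a₁ + b₁) (a₂ + b₂) (a₃ + b₃) (a₄ + b₄)
dissection-+ a₀ a₁ a₂ a₃ a₄ b₀ b₁ b₂ b₃ b₄ =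
  join a₀ b₀ (join a₁ b₁ (join a₂ b₂ (join a₃ b₃ (≋-sym (dilate-+S 4 a₄ b₄)))))
  where
  join : ∀ a b {y z w} → y + z ≋ w → (dilate 4 a + qS * y) + (dilate 4 b + qS * z) ≋ dilate 4 (a + b) + qS * w
  join a b {y} {z} h = ≋-trans
    (solve 5 (λ a q y b z → (a :+ q :* y) :+ (b :+ q :* z) :≈ (a :+ b) :+ q :* (y :+ z))
      (dilate 4 a ∷ qS ∷ y ∷ dilate 4 b ∷ z ∷ []) refl)
    (+-cong (≋-sym (dilate-+S 4 a b)) (*-congˡ h))

dissection-cong : ∀ {a₀ a₁ a₂ a₃ a₄ b₀ b₁ b₂ b₃ b₄} → a₀ ≋ b₀ → a₁ ≋ b₁ → a₂ ≋ b₂ → a₃ ≋ b₃ → a₄ ≋ b₄ →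
                  dissection a₀ a₁ a₂ a₃ a₄ ≋ dissection b₀ b₁ b₂ b₃ b₄
dissection-cong p₀ p₁ p₂ p₃ p₄ = +-cong (dilate-cong 4 p₀) (*-congˡ (+-cong (dilate-cong 4 p₁) (*-congˡ
  (+-cong (dilate-cong 4 p₂) (*-congˡ (+-cong (dilate-cong 4 p₃) (*-congˡ (dilate-cong 4 p₄))))))))

dilate-zeroS : dilate 4 zeroS ≋ zeroS
dilate-zeroS = dilate-const 4 (+ 0)

module _ (a : Series) where
  private
    z = dilate 4 zeroS
    d = dilate 4 a
    z₀ : ∀ {y} → z + qS * y ≋ qS * y
    z₀ = ≋-trans (+-congʳ dilate-zeroS) (+-identityˡ _)
    qz : ∀ {e} → e + qS * z ≋ e
    qz = ≋-trans (+-congˡ (≋-trans (*-congˡ dilate-zeroS) (zeroʳ qS))) (+-identityʳ _)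
    0z : ∀ {y} → y ≋ z → z + qS * y ≋ z
    0z p = ≋-trans (+-congˡ (*-congˡ p)) qz

  dissection-0 : dissection a zeroS zeroS zeroS zeroS ≋ d
  dissection-0 = ≋-trans (+-congˡ (*-congˡ (0z (0z qz)))) qz

  dissection-1 : dissection zeroS a zeroS zeroS zeroS ≋ qS * d
  dissection-1 = ≋-trans z₀ (*-congˡ (≋-trans (+-congˡ (*-congˡ (0z qz))) qz))

  dissection-2 : dissection zeroS zeroS a zeroS zeroS ≋ qS ^ 2 * d
  dissection-2 = ≋-trans z₀ (≋-trans (*-congˡ (≋-trans z₀ (*-congˡ (≋-trans (+-congˡ (*-congˡ qz)) qz))))
    (solve 2 (λ q d → q :* (q :* d) :≈ q :^ 2 :* d) (qS ∷ d ∷ []) refl))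

  dissection-3 : dissection zeroS zeroS zeroS a zeroS ≋ qS ^ 3 * d
  dissection-3 = ≋-trans z₀ (≋-trans (*-congˡ (≋-trans z₀ (*-congˡ (≋-trans z₀ (*-congˡ qz)))))
    (solve 2 (λ q d → q :* (q :* (q :* d)) :≈ q :^ 3 :* d) (qS ∷ d ∷ []) refl))

monomial-split : ∀ c i m {k} → k ≡ i ℕ.+ 5 ℕ.* m → const c * qS ^ k ≋ qS ^ i * dilate 4 (const c * qS ^ m)
monomial-split c i m refl = begin
  const c * qS ^ (i ℕ.+ 5 ℕ.* m)          ≈⟨ *-congˡ (^-+ qS i (5 ℕ.* m)) ⟩
  const c * (qS ^ i * qS ^ (5 ℕ.* m))     ≈⟨ solve 3 (λ c a b → c :* (a :* b) :≈ a :* (c :* b)) (const c ∷ qS ^ i ∷ qS ^ (5 ℕ.* m) ∷ []) refl ⟩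
  qS ^ i * (const c * qS ^ (5 ℕ.* m))     ≈⟨ *-congˡ (dilate-monomial c m) ⟩
  qS ^ i * dilate 4 (const c * qS ^ m)    ∎
  where open ≋-Reasoning

module PentagonalSections where
  open Pentagonal

  -- Only the classes 0, 1, 2 occur among pentagonal numbers modulo 5. The class 1 part is tracked
  -- exactly, since it has to reproduce the series at q²⁵; those of classes 0 and 2 remain
  -- unspecified.
  Form : Series → Series → Set
  Form y e = ∃ λ α → ∃ λ β → y ≋ dissection α e β zeroS zeroS

  private
    z+z : zeroS + zeroS ≋ zeroS
    z+z = +-identityˡ zeroS

  form₀ : ∀ {y e} → Form y e → ∀ c m {k} → k ≡ 5 ℕ.* m → Form (y + const c * qS ^ k) e
  form₀ (α , β , p) c m k≡ = α + const c * qS ^ m , β , ≋-trans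
    (+-cong p (≋-trans (monomial-split c 0 m k≡) (≋-trans (*-identityˡ _) (≋-sym (dissection-0 _)))))
    (≋-trans (dissection-+ _ _ _ _ _ _ _ _ _ _)
      (dissection-cong ≋-refl (+-identityʳ _) (+-identityʳ _) z+z z+z))

  form₂ : ∀ {y e} → Form y e → ∀ c m {k} → k ≡ 2 ℕ.+ 5 ℕ.* m → Form (y + const c * qS ^ k) e
  form₂ (α , β , p) c m k≡ = α , β + const c * qS ^ m , ≋-trans
    (+-cong p (≋-trans (monomial-split c 2 m k≡) (≋-sym (dissection-2 _))))
    (≋-trans (dissection-+ _ _ _ _ _ _ _ _ _ _)
      (dissection-cong (+-identityʳ _) (+-identityʳ _) ≋-refl z+z z+z))

  form₁ : ∀ {y e} → Form y e → ∀ c m {k} → k ≡ 1 ℕ.+ 5 ℕ.* m → Form (y + const c * qS ^ k) (e + const c * qS ^ m)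
  form₁ (α , β , p) c m k≡ = α , β , ≋-trans
    (+-cong p (≋-trans (monomial-split c 1 m k≡) (≋-trans (*-congʳ (*-identityʳ qS)) (≋-sym (dissection-1 _)))))
    (≋-trans (dissection-+ _ _ _ _ _ _ _ _ _ _)
      (dissection-cong (+-identityʳ _) ≋-refl (+-identityʳ _) z+z z+z))

  form-cong : ∀ {y y′ e e′} → y′ ≋ y → e ≋ e′ → Form y e → Form y′ e′
  form-cong p r (α , β , h) = α , β , ≋-trans p (≋-trans h (dissection-cong ≋-refl r ≋-refl ≋-refl ≋-refl))

  sign-5* : ∀ M → sign (5 ℕ.* M) ≡ sign M
  sign-5* zero    = refl
  sign-5* (suc M) = trans (cong sign (ℕₚ.*-suc 5 M)) (trans (neg⁵ (sign (5 ℕ.* M))) (cong ℤ.-_ (sign-5* M)))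
    where
    neg⁵ : ∀ a → ℤ.- (ℤ.- (ℤ.- (ℤ.- (ℤ.- a)))) ≡ ℤ.- a
    neg⁵ a = trans (ℤₚ.neg-involutive _) (ℤₚ.neg-involutive _)

  -- M² = 2 tri M - M turns an exponent identity into one between polynomials in M and tri M.
  module Exponents (M : ℕ) where
    T = tri M
    N : ℕ → ℕ
    N c = 5 ℕ.* M ℕ.+ c

    base : ℕ → ℕ
    base c = 5 ℕ.* (M ℕ.* M) ℕ.+ 2 ℕ.* (suc c ℕ.* M) ℕ.+ (T ℕ.+ 2 ℕ.* (M ℕ.* M) ℕ.+ c ℕ.* M)

    low : ℕ → ℕ → ℕ
    low c r = base c ℕ.+ r

    lower : ∀ c r i → suc c ℕ.* suc c ℕ.+ tri c ≡ i ℕ.+ 5 ℕ.* r → suc (N c) ℕ.* suc (N c) ℕ.+ tri (N c) ≡ i ℕ.+ 5 ℕ.* low c r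
    lower c r i h = trans (cong (suc (N c) ℕ.* suc (N c) ℕ.+_) (tri-5*+ c M)) (trans (lemma M c T (tri c))
      (trans (cong (5 ℕ.* base c ℕ.+_) h) (lemma₂ (base c) i r)))
      where
      lemma : ∀ M c T t → suc (5 ℕ.* M ℕ.+ c) ℕ.* suc (5 ℕ.* M ℕ.+ c) ℕ.+ (5 ℕ.* T ℕ.+ 10 ℕ.* (M ℕ.* M) ℕ.+ 5 ℕ.* (c ℕ.* M) ℕ.+ t) ≡
        5 ℕ.* (5 ℕ.* (M ℕ.* M) ℕ.+ 2 ℕ.* (suc c ℕ.* M) ℕ.+ (T ℕ.+ 2 ℕ.* (M ℕ.* M) ℕ.+ c ℕ.* M)) ℕ.+ (suc c ℕ.* suc c ℕ.+ t)
      lemma = solve-∀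
      lemma₂ : ∀ a i r → 5 ℕ.* a ℕ.+ (i ℕ.+ 5 ℕ.* r) ≡ i ℕ.+ 5 ℕ.* (a ℕ.+ r)
      lemma₂ = solve-∀

    upper : ∀ c r i → suc c ℕ.* suc c ℕ.+ tri (suc c) ≡ i ℕ.+ 5 ℕ.* r →
            suc (N c) ℕ.* suc (N c) ℕ.+ tri (suc (N c)) ≡ i ℕ.+ 5 ℕ.* (low c r ℕ.+ M)
    upper c r i h = trans (cong (λ t → suc (N c) ℕ.* suc (N c) ℕ.+ (suc (N c) ℕ.+ t)) (tri-5*+ c M)) (trans (lemma M c T (tri c))
      (trans (cong (5 ℕ.* (base c ℕ.+ M) ℕ.+_) h) (lemma₂ (base c) M i r)))
      where
      lemma : ∀ M c T t → suc (5 ℕ.* M ℕ.+ c) ℕ.* suc (5 ℕ.* M ℕ.+ c) ℕ.+ (suc (5 ℕ.* M ℕ.+ c) ℕ.+ (5 ℕ.* T ℕ.+ 10 ℕ.* (M ℕ.* M) ℕ.+ 5 ℕ.* (c ℕ.* M) ℕ.+ t)) ≡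
        5 ℕ.* (5 ℕ.* (M ℕ.* M) ℕ.+ 2 ℕ.* (suc c ℕ.* M) ℕ.+ (T ℕ.+ 2 ℕ.* (M ℕ.* M) ℕ.+ c ℕ.* M) ℕ.+ M) ℕ.+ (suc c ℕ.* suc c ℕ.+ (suc c ℕ.+ t))
      lemma = solve-∀
      lemma₂ : ∀ a M i r → 5 ℕ.* (a ℕ.+ M) ℕ.+ (i ℕ.+ 5 ℕ.* r) ≡ i ℕ.+ 5 ℕ.* (a ℕ.+ r ℕ.+ M)
      lemma₂ = solve-∀

    square : M ℕ.* M ℕ.+ M ≡ T ℕ.+ T
    square = trans (trans (ℕₚ.+-comm (M ℕ.* M) M) (sym (ℕₚ.*-suc M M))) (sym (tri-double M))

    upper₄ : low 3 5 ℕ.+ M ≡ 5 ℕ.* (suc M ℕ.* suc M ℕ.+ tri M)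
    upper₄ = ℕₚ.+-cancelʳ-≡ (2 ℕ.* (M ℕ.* M ℕ.+ M)) _ _
      (trans (cong (low 3 5 ℕ.+ M ℕ.+_) (cong (2 ℕ.*_) square)) (lemma M T))
      where
      lemma : ∀ M T → 5 ℕ.* (M ℕ.* M) ℕ.+ 2 ℕ.* (4 ℕ.* M) ℕ.+ (T ℕ.+ 2 ℕ.* (M ℕ.* M) ℕ.+ 3 ℕ.* M) ℕ.+ 5 ℕ.+ M ℕ.+ 2 ℕ.* (T ℕ.+ T) ≡
                      5 ℕ.* (suc M ℕ.* suc M ℕ.+ T) ℕ.+ 2 ℕ.* (M ℕ.* M ℕ.+ M)
      lemma = solve-∀

    lower₆ : low 5 10 ≡ 5 ℕ.* (suc M ℕ.* suc M ℕ.+ tri (suc M))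
    lower₆ = ℕₚ.+-cancelʳ-≡ (2 ℕ.* (M ℕ.* M ℕ.+ M)) _ _
      (trans (cong (low 5 10 ℕ.+_) (cong (2 ℕ.*_) square)) (lemma M T))
      where
      lemma : ∀ M T → 5 ℕ.* (M ℕ.* M) ℕ.+ 2 ℕ.* (6 ℕ.* M) ℕ.+ (T ℕ.+ 2 ℕ.* (M ℕ.* M) ℕ.+ 5 ℕ.* M) ℕ.+ 10 ℕ.+ 2 ℕ.* (T ℕ.+ T) ≡
                      5 ℕ.* (suc M ℕ.* suc M ℕ.+ (suc M ℕ.+ T)) ℕ.+ 2 ℕ.* (M ℕ.* M ℕ.+ M)
      lemma = solve-∀

  -- Ten monomials are added, for m from 5M + 2 to 5M + 6. With j = M + 1, class 1 receives m(3m +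
  -- 1)/2 at m = 5j - 1 and m(3m - 1)/2 at m = 5j + 1, which equal 1 + 25 j(3j - 1)/2 and 1 + 25
  -- j(3j + 1)/2. The sign is (-1)^m = -(-1)^j.
  step : ∀ M → Form (pentagonal (5 ℕ.* M ℕ.+ 1)) (- dilate 4 (pentagonal M)) →
         Form (pentagonal (suc (suc (suc (suc (suc (5 ℕ.* M ℕ.+ 1))))))) (- dilate 4 (pentagonal (suc M)))
  step M h₀ = form-cong ≋-refl value h₁₀
    where
    open Exponents M
    σ : ℕ → ℤ
    σ c = sign (suc (N c))
    next : ∀ c → suc (N c) ≡ N (suc c)
    next c = sym (ℕₚ.+-suc (5 ℕ.* M) c)
    at-N : ∀ c {k} → k ≡ N c → suc k ℕ.* suc k ℕ.+ tri k ≡ suc (N c) ℕ.* suc (N c) ℕ.+ tri (N c)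
    at-N c refl = refl
    at-N′ : ∀ c {k} → k ≡ N c → suc k ℕ.* suc k ℕ.+ tri (suc k) ≡ suc (N c) ℕ.* suc (N c) ℕ.+ tri (suc (N c))
    at-N′ c refl = refl
    n₁ = N 1
    e₂ : suc n₁ ≡ N 2
    e₂ = next 1
    e₃ : suc (suc n₁) ≡ N 3
    e₃ = trans (cong suc e₂) (next 2)
    e₄ : suc (suc (suc n₁)) ≡ N 4
    e₄ = trans (cong suc e₃) (next 3)
    e₅ : suc (suc (suc (suc n₁))) ≡ N 5
    e₅ = trans (cong suc e₄) (next 4)
    h₁ = form₀ h₀ (sign (suc n₁)) (low 1 1) (lower 1 1 0 refl)
    h₂ = form₂ h₁ (sign (suc n₁)) (low 1 1 ℕ.+ M) (upper 1 1 2 refl)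
    h₃ = form₂ h₂ (sign (suc (suc n₁))) (low 2 2) (trans (at-N 2 e₂) (lower 2 2 2 refl))
    h₄ = form₀ h₃ (sign (suc (suc n₁))) (low 2 3 ℕ.+ M) (trans (at-N′ 2 e₂) (upper 2 3 0 refl))
    h₅ = form₂ h₄ (sign (suc (suc (suc n₁)))) (low 3 4) (trans (at-N 3 e₃) (lower 3 4 2 refl))
    h₆ = form₁ h₅ (sign (suc (suc (suc n₁)))) (low 3 5 ℕ.+ M) (trans (at-N′ 3 e₃) (upper 3 5 1 refl))
    h₇ = form₀ h₆ (sign (suc (suc (suc (suc n₁))))) (low 4 7) (trans (at-N 4 e₄) (lower 4 7 0 refl))
    h₈ = form₀ h₇ (sign (suc (suc (suc (suc n₁))))) (low 4 8 ℕ.+ M) (trans (at-N′ 4 e₄) (upper 4 8 0 refl))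
    h₉ = form₁ h₈ (sign (suc (suc (suc (suc (suc n₁)))))) (low 5 10) (trans (at-N 5 e₅) (lower 5 10 1 refl))
    h₁₀ = form₂ h₉ (sign (suc (suc (suc (suc (suc n₁)))))) (low 5 11 ℕ.+ M) (trans (at-N′ 5 e₅) (upper 5 11 2 refl))
    sign-n₁ : sign n₁ ≡ ℤ.- sign M
    sign-n₁ = trans (cong sign (ℕₚ.+-comm (5 ℕ.* M) 1)) (cong ℤ.-_ (sign-5* M))
    sign₄ : sign (suc (suc (suc n₁))) ≡ ℤ.- sign (suc M)
    sign₄ = trans (ℤₚ.neg-involutive _) (cong ℤ.-_ sign-n₁)
    sign₆ : sign (suc (suc (suc (suc (suc n₁))))) ≡ ℤ.- sign (suc M)
    sign₆ = trans (ℤₚ.neg-involutive _) sign₄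
    p₁ = suc M ℕ.* suc M ℕ.+ tri M
    p₂ = suc M ℕ.* suc M ℕ.+ tri (suc M)
    monomial : ∀ c {c′} m {k} → c′ ≡ ℤ.- c → k ≡ 5 ℕ.* m → const c′ * qS ^ k ≋ - dilate 4 (const c * qS ^ m)
    monomial c m refl refl = ≋-trans (*-congʳ (const-neg c)) (≋-trans (≋-sym (-‿distribˡ-* (CommutativeRing.ring seriesRing) (const c) _))
      (-‿cong (dilate-monomial c m)))
    E = pentagonal M
    t₁ = const (sign (suc M)) * qS ^ p₁
    t₂ = const (sign (suc M)) * qS ^ p₂
    value : (- dilate 4 E + const (sign (suc (suc (suc n₁)))) * qS ^ (low 3 5 ℕ.+ M))
              + const (sign (suc (suc (suc (suc (suc n₁)))))) * qS ^ low 5 10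
            ≋ - dilate 4 (pentagonal (suc M))
    value = begin
      _ ≈⟨ +-cong (+-congˡ (monomial (sign (suc M)) p₁ sign₄ upper₄)) (monomial (sign (suc M)) p₂ sign₆ lower₆) ⟩
      (- dilate 4 E + - dilate 4 t₁) + - dilate 4 t₂
        ≈⟨ solve 3 (λ a b c → ((:- a) :+ (:- b)) :+ (:- c) :≈ :- ((a :+ b) :+ c)) (dilate 4 E ∷ dilate 4 t₁ ∷ dilate 4 t₂ ∷ []) refl ⟩
      - ((dilate 4 E + dilate 4 t₁) + dilate 4 t₂)
        ≈⟨ -‿cong (≋-sym (≋-trans (dilate-+S 4 (E + t₁) t₂) (+-congʳ (dilate-+S 4 E t₁)))) ⟩
      - dilate 4 (pentagonal (suc M)) ∎
      where open ≋-Reasoning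

  -- The cutoff 5M + 1 is chosen so that the class 1 terms, which sit at m = 1 and at m = 5j ± 1,
  -- are exactly those with j ≤ M.
  forms : ∀ M → Form (pentagonal (5 ℕ.* M ℕ.+ 1)) (- dilate 4 (pentagonal M))
  forms zero    = form-cong ≋-refl
    (≋-trans (solve 0 (con (+ 0) :+ con (-[1+ 0 ]) :* con (+ 1) :≈ :- con (+ 1)) [] refl) (-‿cong (≋-sym (dilate-const 4 (+ 1)))))
    (form₂ (form₁ (oneS , zeroS , ≋-trans (≋-sym (dilate-const 4 (+ 1))) (≋-sym (dissection-0 oneS))) (-[1+ 0 ]) 0 refl) (-[1+ 0 ]) 0 refl)
  forms (suc M) = subst (λ k → Form (pentagonal k) (- dilate 4 (pentagonal (suc M)))) (sym (index M)) (step M (forms M))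
    where
    index : ∀ M → 5 ℕ.* suc M ℕ.+ 1 ≡ suc (suc (suc (suc (suc (5 ℕ.* M ℕ.+ 1)))))
    index = solve-∀

  private
    bound : ∀ i n → i < 5 → i ℕ.+ 5 ℕ.* n ≤ 5 ℕ.* suc n ℕ.+ 1
    bound i n i<5 = ℕₚ.≤-trans (ℕₚ.+-monoˡ-≤ (5 ℕ.* n) (ℕₚ.<⇒≤ i<5))
      (ℕₚ.≤-trans (ℕₚ.≤-reflexive (sym (ℕₚ.*-suc 5 n))) (ℕₚ.m≤m+n (5 ℕ.* suc n) 1))

    section-f : ∀ i → i < 5 → ∀ n → section i (f 1) n ≡ section i (pentagonal (5 ℕ.* suc n ℕ.+ 1)) n
    section-f i i<5 n = trans (section-at i (f 1) n) (trans
      (sym (pentagonal-at (5 ℕ.* suc n ℕ.+ 1) (i ℕ.+ 5 ℕ.* n) (bound i n i<5))) (sym (section-at i _ n)))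

  f-section-1 : section 1 (f 1) ≋ - dilate 4 (f 1)
  f-section-1 = pointwise λ n → trans (section-f 1 (s≤s (s≤s z≤n)) n) (trans
    (at (≋-trans (section-cong 1 (proj₂ (proj₂ (forms (suc n))))) (section-1-dissection _ _ _ _ _)) n)
    (trans (neg-at _ n) (trans (cong ℤ.-_ (dilate-at-local n)) (sym (neg-at _ n)))))
    where
    dilate-at-local : ∀ n → dilate 4 (pentagonal (suc n)) n ≡ dilate 4 (f 1) n
    dilate-at-local n = dilate-local 4 n (λ i i≤n → pentagonal-at (suc n) i (ℕₚ.m≤n⇒m≤1+n i≤n))

  f-section-3 : section 3 (f 1) ≋ zeroS
  f-section-3 = pointwise λ n → trans (section-f 3 (s≤s (s≤s (s≤s (s≤s z≤n)))) n)
    (at (≋-trans (section-cong 3 (proj₂ (proj₂ (forms (suc n))))) (section-3-dissection _ _ _ _ _)) n)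

  f-section-4 : section 4 (f 1) ≋ zeroS
  f-section-4 = pointwise λ n → trans (section-f 4 (s≤s (s≤s (s≤s (s≤s (s≤s z≤n))))) n)
    (at (≋-trans (section-cong 4 (proj₂ (proj₂ (forms (suc n))))) (section-4-dissection _ _ _ _ _)) n)

-- Gauss's theorem on the triangular theta series, again by a finite identity of Shanks

module Triangular where
  even : ℕ → ℕ → Series
  even s zero    = oneS
  even s (suc j) = (oneS + - qS ^ (2 ℕ.* suc s)) * even (suc s) j

  odd : ℕ → Series
  odd zero    = oneS
  odd (suc s) = odd s * (oneS + - qS ^ suc (2 ℕ.* s))

  even-last : ∀ s j → even s (suc j) ≋ even s j * (oneS + - qS ^ (2 ℕ.* (suc s ℕ.+ j)))
  even-last s zero = ≋-trans (*-comm (oneS + - qS ^ (2 ℕ.* suc s)) oneS)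
    (*-congˡ (+-congˡ (-‿cong (≋-reflexive (cong (λ t → qS ^ (2 ℕ.* t)) (sym (ℕₚ.+-identityʳ (suc s))))))))
  even-last s (suc j) = begin
    (oneS + - qS ^ (2 ℕ.* suc s)) * even (suc s) (suc j) ≈⟨ *-congˡ (even-last (suc s) j) ⟩
    (oneS + - qS ^ (2 ℕ.* suc s)) * (even (suc s) j * (oneS + - qS ^ (2 ℕ.* (suc (suc s) ℕ.+ j))))
      ≈⟨ ≋-sym (*-assoc (oneS + - qS ^ (2 ℕ.* suc s)) (even (suc s) j) _) ⟩
    even s (suc j) * (oneS + - qS ^ (2 ℕ.* (suc (suc s) ℕ.+ j)))
      ≡⟨ cong (λ k → even s (suc j) * (oneS + - qS ^ (2 ℕ.* suc k))) (sym (ℕₚ.+-suc s j)) ⟩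
    even s (suc j) * (oneS + - qS ^ (2 ℕ.* (suc s ℕ.+ suc j))) ∎
    where open ≋-Reasoning

  even≋partialProd : ∀ N → even 0 N ≋ partialProd 2 N
  even≋partialProd zero    = ≋-refl
  even≋partialProd (suc N) = ≋-trans (even-last 0 N) (≋-trans (*-congʳ (even≋partialProd N)) (≋-sym (partialProd-suc 2 N)))

  double : ℕ → ℕ
  double zero    = zero
  double (suc n) = suc (suc (double n))

  double≡ : ∀ n → double n ≡ 2 ℕ.* n
  double≡ zero    = refl
  double≡ (suc n) = trans (cong (2 ℕ.+_) (double≡ n)) (sym (ℕₚ.*-suc 2 n))

  n≤double : ∀ n → n ≤ double n
  n≤double zero    = z≤n
  n≤double (suc n) = s≤s (ℕₚ.m≤n⇒m≤1+n (n≤double n))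

  odd*even : ∀ N → odd N * even 0 N ≋ partialProd 1 (double N)
  odd*even zero    = *-identityˡ oneS
  odd*even (suc N) = begin
    odd N * (oneS + - a) * even 0 (suc N) ≈⟨ *-congˡ (even-last 0 N) ⟩
    odd N * (oneS + - a) * (even 0 N * (oneS + - b))
      ≈⟨ solve 4 (λ o a e b → o :* (con (+ 1) :- a) :* (e :* (con (+ 1) :- b)) :≈ o :* e :* (con (+ 1) :- a) :* (con (+ 1) :- b))
           (odd N ∷ a ∷ even 0 N ∷ b ∷ []) refl ⟩
    odd N * even 0 N * (oneS + - a) * (oneS + - b)
      ≈⟨ *-cong (*-cong (odd*even N) (+-congˡ (-‿cong (≋-reflexive (cong (qS ^_) e₁)))))
                (+-congˡ (-‿cong (≋-reflexive (cong (qS ^_) e₂)))) ⟩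
    partialProd 1 (double N) * (oneS + - qS ^ (1 ℕ.* suc (double N))) * (oneS + - qS ^ (1 ℕ.* suc (suc (double N))))
      ≈⟨ *-congʳ (≋-sym (partialProd-suc 1 (double N))) ⟩
    partialProd 1 (suc (double N)) * (oneS + - qS ^ (1 ℕ.* suc (suc (double N))))
      ≈⟨ ≋-sym (partialProd-suc 1 (suc (double N))) ⟩
    partialProd 1 (double (suc N)) ∎
    where
    open ≋-Reasoning
    a = qS ^ suc (2 ℕ.* N)
    b = qS ^ (2 ℕ.* (1 ℕ.+ N))
    e₁ : suc (2 ℕ.* N) ≡ 1 ℕ.* suc (double N)
    e₁ = trans (cong suc (sym (double≡ N))) (sym (ℕₚ.*-identityˡ _))
    e₂ : 2 ℕ.* (1 ℕ.+ N) ≡ 1 ℕ.* suc (suc (double N))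
    e₂ = trans (sym (double≡ (suc N))) (sym (ℕₚ.*-identityˡ _))

  -- With N = s + j this is (q²;q²)_N (q;q²)_s / (q²;q²)_s q^(s(2N+1)). The sum over 0 ≤ s ≤ N
  -- equals (q;q²)_N times the theta series cut off after the triangular number of index 2N.
  term : ℕ → ℕ → Series
  term s j = even s j * odd s * qS ^ (s ℕ.* suc (2 ℕ.* (s ℕ.+ j)))

  total : ℕ → ℕ → Series
  total zero    j = term 0 j
  total (suc k) j = total k (suc j) + term (suc k) j

  carry : ℕ → ℕ → Series
  carry k j = even k j * odd (suc k) * qS ^ (suc k ℕ.* suc (2 ℕ.* (k ℕ.+ j)))

  q^-split : ∀ {k} a b → k ≡ a ℕ.+ b → qS ^ k ≋ qS ^ a * qS ^ b
  q^-split a b refl = ^-+ qS a b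

  -- Passing from N = k + j to N + 1 now multiplies the partial sum by 1 - q^(2N+1), the next factor
  -- of `odd`; the rest is `carry`. At j = 0, `carry` and the new last term are q to two successive
  -- triangular numbers, times `odd (suc N)`.
  telescope : ∀ k j → total k (suc j) ≋ (oneS + - qS ^ suc (2 ℕ.* (k ℕ.+ j))) * total k j + carry k j
  telescope zero j = begin
    even 0 (suc j) * oneS * oneS ≈⟨ *-congʳ (*-congʳ (≋-trans (even-last 0 j) (*-congˡ (+-congˡ (-‿cong (q^-split 1 (suc (2 ℕ.* j)) (e j))))))) ⟩
    even 0 j * (oneS + - (qS ^ 1 * b)) * oneS * oneS
      ≈⟨ solve 3 (λ e q b → e :* (con (+ 1) :- q :* b) :* con (+ 1) :* con (+ 1) :≈
           (con (+ 1) :- b) :* (e :* con (+ 1) :* con (+ 1)) :+ e :* (con (+ 1) :* (con (+ 1) :- q)) :* b)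
           (even 0 j ∷ qS ^ 1 ∷ b ∷ []) refl ⟩
    (oneS + - b) * (even 0 j * oneS * oneS) + even 0 j * (oneS * (oneS + - qS ^ 1)) * b
      ≈⟨ +-congˡ (*-congˡ (≋-reflexive (cong (qS ^_) (sym (ℕₚ.+-identityʳ (suc (2 ℕ.* j))))))) ⟩
    (oneS + - qS ^ suc (2 ℕ.* (0 ℕ.+ j))) * total 0 j + carry 0 j ∎
    where
    open ≋-Reasoning
    b = qS ^ suc (2 ℕ.* j)
    e : ∀ j → 2 ℕ.* (1 ℕ.+ j) ≡ 1 ℕ.+ suc (2 ℕ.* j)
    e = solve-∀
  telescope (suc k) j = begin
    total k (suc (suc j)) + term (suc k) (suc j)
      ≈⟨ +-cong (≋-trans (telescope k (suc j)) (+-cong (*-congʳ (+-congˡ (-‿cong (≋-reflexive (cong (λ t → qS ^ suc (2 ℕ.* t)) (ℕₚ.+-suc k j))))))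
           (*-congˡ (≋-reflexive (cong (λ t → qS ^ (suc k ℕ.* suc (2 ℕ.* t))) (ℕₚ.+-suc k j))))))
           (*-cong (*-congʳ (even-last (suc k) j)) (q^-split e₀ (2 ℕ.* suc k) (e₁ k j))) ⟩
    (oneS + - b) * T + (oneS + - a) * Y * O * E + Y * (oneS + - c) * O * (E * a)
      ≈⟨ solve-by 8 (λ T a b c d Y O E →
           (con (+ 1) :- b) :* T :+ (con (+ 1) :- a) :* Y :* O :* E :+ Y :* (con (+ 1) :- c) :* O :* (E :* a) :≈
           (con (+ 1) :- b) :* (T :+ Y :* O :* E) :+ Y :* (O :* (con (+ 1) :- d)) :* (E :* b)
           by (:- (Y :* O :* E) , c :* a :≈ b :* d) ∷ [])
         (T ∷ a ∷ b ∷ c ∷ d ∷ Y ∷ O ∷ E ∷ []) refl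
         (≋-trans (≋-sym (^-+ qS (2 ℕ.* (suc (suc k) ℕ.+ j)) (2 ℕ.* suc k)))
           (q^-split (suc (2 ℕ.* (suc k ℕ.+ j))) (suc (2 ℕ.* suc k)) (e₃ k j)) , tt) ⟩
    (oneS + - b) * (T + Y * O * E) + Y * (O * (oneS + - d)) * (E * b)
      ≈⟨ +-congˡ (*-congˡ (≋-sym (q^-split e₀ (suc (2 ℕ.* (suc k ℕ.+ j))) (e₂ k j)))) ⟩
    (oneS + - b) * total (suc k) j + carry (suc k) j ∎
    where
    open ≋-Reasoning
    T = total k (suc j)
    Y = even (suc k) j
    O = odd (suc k)
    e₀ = suc k ℕ.* suc (2 ℕ.* (suc k ℕ.+ j))
    E = qS ^ e₀
    a = qS ^ (2 ℕ.* suc k)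
    b = qS ^ suc (2 ℕ.* (suc k ℕ.+ j))
    c = qS ^ (2 ℕ.* (suc (suc k) ℕ.+ j))
    d = qS ^ suc (2 ℕ.* suc k)
    e₁ : ∀ k j → suc k ℕ.* suc (2 ℕ.* (suc k ℕ.+ suc j)) ≡ suc k ℕ.* suc (2 ℕ.* (suc k ℕ.+ j)) ℕ.+ 2 ℕ.* suc k
    e₁ = solve-∀
    e₂ : ∀ k j → suc (suc k) ℕ.* suc (2 ℕ.* (suc k ℕ.+ j)) ≡ suc k ℕ.* suc (2 ℕ.* (suc k ℕ.+ j)) ℕ.+ suc (2 ℕ.* (suc k ℕ.+ j))
    e₂ = solve-∀
    e₃ : ∀ k j → 2 ℕ.* (suc (suc k) ℕ.+ j) ℕ.+ 2 ℕ.* suc k ≡ suc (2 ℕ.* (suc k ℕ.+ j)) ℕ.+ suc (2 ℕ.* suc k)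
    e₃ = solve-∀

  partialPsi : ℕ → Series
  partialPsi zero    = oneS
  partialPsi (suc m) = partialPsi m + const (+ 1) * qS ^ tri (suc m)

  tri-suc-double : ∀ N → tri (suc (double N)) ≡ suc N ℕ.* suc (2 ℕ.* N)
  tri-suc-double zero    = refl
  tri-suc-double (suc N) = trans (cong (λ t → suc (suc (suc (double N))) ℕ.+ (suc (suc (double N)) ℕ.+ t)) (tri-suc-double N))
    (trans (cong (λ d → suc (suc (suc d)) ℕ.+ (suc (suc d) ℕ.+ suc N ℕ.* suc (2 ℕ.* N))) (double≡ N)) (lemma N))
    where
    lemma : ∀ N → suc (suc (suc (2 ℕ.* N))) ℕ.+ (suc (suc (2 ℕ.* N)) ℕ.+ suc N ℕ.* suc (2 ℕ.* N)) ≡ suc (suc N) ℕ.* suc (2 ℕ.* suc N)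
    lemma = solve-∀

  tri-double-suc : ∀ N → tri (double (suc N)) ≡ suc N ℕ.* suc (2 ℕ.* suc N)
  tri-double-suc N = trans (cong (suc (suc (double N)) ℕ.+_) (tri-suc-double N))
    (trans (cong (λ d → suc (suc d) ℕ.+ suc N ℕ.* suc (2 ℕ.* N)) (double≡ N)) (lemma N))
    where
    lemma : ∀ N → suc (suc (2 ℕ.* N)) ℕ.+ suc N ℕ.* suc (2 ℕ.* N) ≡ suc N ℕ.* suc (2 ℕ.* suc N)
    lemma = solve-∀

  total≋ : ∀ N → total N 0 ≋ odd N * partialPsi (double N)
  total≋ zero    = *-identityʳ _
  total≋ (suc N) = begin
    total N 1 + term (suc N) 0
      ≈⟨ +-cong (≋-trans (telescope N 0) (+-cong (*-cong (+-congˡ (-‿cong (≋-reflexive (cong (λ t → qS ^ suc (2 ℕ.* t)) (ℕₚ.+-identityʳ N))))) (total≋ N))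
           (*-congˡ (≋-reflexive (cong (qS ^_) (trans (cong (λ t → suc N ℕ.* suc (2 ℕ.* t)) (ℕₚ.+-identityʳ N)) (sym (tri-suc-double N))))))))
           (*-congˡ (≋-reflexive (cong (qS ^_) (trans (cong (λ t → suc N ℕ.* suc (2 ℕ.* t)) (ℕₚ.+-identityʳ (suc N))) (sym (tri-double-suc N)))))) ⟩
    (oneS + - b) * (odd N * P) + oneS * (odd N * (oneS + - b)) * x + oneS * (odd N * (oneS + - b)) * y
      ≈⟨ solve 5 (λ o b P x y → (con (+ 1) :- b) :* (o :* P) :+ con (+ 1) :* (o :* (con (+ 1) :- b)) :* x :+ con (+ 1) :* (o :* (con (+ 1) :- b)) :* y
           :≈ o :* (con (+ 1) :- b) :* (P :+ con (+ 1) :* x :+ con (+ 1) :* y)) (odd N ∷ b ∷ P ∷ x ∷ y ∷ []) refl ⟩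
    odd (suc N) * partialPsi (double (suc N)) ∎
    where
    open ≋-Reasoning
    b = qS ^ suc (2 ℕ.* N)
    P = partialPsi (double N)
    x = qS ^ tri (suc (double N))
    y = qS ^ tri (double (suc N))

  term-low : ∀ k j n → n ≤ suc k ℕ.+ j → term (suc k) j n ≡ + 0
  term-low k j n n≤ = trans (at (*-comm (even (suc k) j * odd (suc k)) (qS ^ e)) n)
    (q^*-low e _ n (ℕₚ.<-≤-trans (s≤s n≤) (ℕₚ.≤-trans (s≤s (ℕₚ.m≤n*m (suc k ℕ.+ j) 2)) (ℕₚ.m≤n*m (suc (2 ℕ.* (suc k ℕ.+ j))) (suc k)))))
    where e = suc k ℕ.* suc (2 ℕ.* (suc k ℕ.+ j))

  total-at : ∀ k j n → n ≤ k ℕ.+ j → total k j n ≡ even 0 (k ℕ.+ j) n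
  total-at zero    j n n≤ = at (≋-trans (*-identityʳ _) (*-identityʳ _)) n
  total-at (suc k) j n n≤ = trans (+-at (total k (suc j)) (term (suc k) j) n)
    (trans (cong₂ ℤ._+_
      (trans (total-at k (suc j) n (subst (n ≤_) (sym (ℕₚ.+-suc k j)) n≤)) (cong (λ t → even 0 t n) (ℕₚ.+-suc k j)))
      (term-low k j n n≤))
    (ℤₚ.+-identityʳ _))

  psi : Series
  psi n = partialPsi n n

  partialPsi-at : ∀ m n → n ≤ m → partialPsi m n ≡ psi n
  partialPsi-at zero    zero n≤m = refl
  partialPsi-at (suc m) n    n≤m with ℕₚ.m≤n⇒m<n∨m≡n n≤m
  ... | inj₂ refl      = refl
  ... | inj₁ (s≤s n≤m′) = trans (+-at (partialPsi m) _ n) (trans (cong₂ ℤ._+_ (partialPsi-at m n n≤m′)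
    (trans (at (*-comm (const (+ 1)) (qS ^ tri (suc m))) n) (q^*-low (tri (suc m)) _ n (ℕₚ.<-≤-trans (s≤s n≤m′) (n≤tri (suc m))))))
    (ℤₚ.+-identityʳ _))

  -- Up to q^n, f₁ splits into its odd and even factors. The odd ones times the theta series form
  -- the finite sum `total n 0`, of which only the term s = 0, again the even product, is visible up
  -- to q^n.
  gauss : f 1 * psi ≋ f 2 * f 2
  gauss = pointwise λ n → begin
    (f 1 * psi) n
      ≡⟨ *-local n (λ i i≤n → sym (partialProd-at 0 (double n) i (ℕₚ.≤-trans i≤n (n≤double n))))
                   (λ i i≤n → sym (partialPsi-at (double n) i (ℕₚ.≤-trans i≤n (n≤double n)))) ⟩
    (partialProd 1 (double n) * partialPsi (double n)) n ≡⟨ at (*-congʳ (≋-sym (odd*even n))) n ⟩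
    (odd n * even 0 n * partialPsi (double n)) n
      ≡⟨ at (solve 3 (λ o e p → o :* e :* p :≈ e :* (o :* p)) (odd n ∷ even 0 n ∷ partialPsi (double n) ∷ []) refl) n ⟩
    (even 0 n * (odd n * partialPsi (double n))) n       ≡⟨ at (*-congˡ (≋-sym (total≋ n))) n ⟩
    (even 0 n * total n 0) n
      ≡⟨ *-local n (λ i i≤n → trans (at (even≋partialProd n) i) (partialProd-at 1 n i i≤n))
                   (λ i i≤n → trans (total-at n 0 i (subst (i ≤_) (sym (ℕₚ.+-identityʳ n)) i≤n))
                       (trans (cong (λ t → even 0 t i) (ℕₚ.+-identityʳ n)) (trans (at (even≋partialProd n) i) (partialProd-at 1 n i i≤n)))) ⟩
    (f 2 * f 2) n ∎
    where open ≡.≡-Reasoning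

  Form : Series → Series → Set
  Form y e = ∃ λ α → ∃ λ β → y ≋ dissection α β zeroS e zeroS

  private
    z+z : zeroS + zeroS ≋ zeroS
    z+z = +-identityˡ zeroS

  form₀ : ∀ {y e} → Form y e → ∀ c m {k} → k ≡ 5 ℕ.* m → Form (y + const c * qS ^ k) e
  form₀ (α , β , p) c m k≡ = α + const c * qS ^ m , β , ≋-trans
    (+-cong p (≋-trans (monomial-split c 0 m k≡) (≋-trans (*-identityˡ _) (≋-sym (dissection-0 _)))))
    (≋-trans (dissection-+ _ _ _ _ _ _ _ _ _ _)
      (dissection-cong ≋-refl (+-identityʳ _) z+z (+-identityʳ _) z+z))

  form₁ : ∀ {y e} → Form y e → ∀ c m {k} → k ≡ 1 ℕ.+ 5 ℕ.* m → Form (y + const c * qS ^ k) e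
  form₁ (α , β , p) c m k≡ = α , β + const c * qS ^ m , ≋-trans
    (+-cong p (≋-trans (monomial-split c 1 m k≡) (≋-trans (*-congʳ (*-identityʳ qS)) (≋-sym (dissection-1 _)))))
    (≋-trans (dissection-+ _ _ _ _ _ _ _ _ _ _)
      (dissection-cong (+-identityʳ _) ≋-refl z+z (+-identityʳ _) z+z))

  form₃ : ∀ {y e} → Form y e → ∀ c m {k} → k ≡ 3 ℕ.+ 5 ℕ.* m → Form (y + const c * qS ^ k) (e + const c * qS ^ m)
  form₃ (α , β , p) c m k≡ = α , β , ≋-trans
    (+-cong p (≋-trans (monomial-split c 3 m k≡) (≋-sym (dissection-3 _))))
    (≋-trans (dissection-+ _ _ _ _ _ _ _ _ _ _)
      (dissection-cong (+-identityʳ _) (+-identityʳ _) z+z ≋-refl z+z))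

  form-cong : ∀ {y y′ e e′} → y′ ≋ y → e ≋ e′ → Form y e → Form y′ e′
  form-cong p r (α , β , h) = α , β , ≋-trans p (≋-trans h (dissection-cong ≋-refl ≋-refl ≋-refl r ≋-refl))

  -- Triangular numbers lie in the classes 0, 1, 3 modulo 5. Class 3 is met once in each block of
  -- five indices, through tri(5m + 2) = 3 + 25 tri(m).
  step : ∀ M → Form (partialPsi (5 ℕ.* M ℕ.+ 4)) (dilate 4 (partialPsi M)) →
         Form (partialPsi (suc (suc (suc (suc (suc (5 ℕ.* M ℕ.+ 4))))))) (dilate 4 (partialPsi (suc M)))
  step M h = form-cong ≋-refl value h₅
    where
    M′ = suc M
    N = 5 ℕ.* M ℕ.+ 4
    base : ℕ → ℕ → ℕ
    base c r = tri M′ ℕ.+ 2 ℕ.* (M′ ℕ.* M′) ℕ.+ c ℕ.* M′ ℕ.+ r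
    exponent : ∀ c i {r k} → tri c ≡ i ℕ.+ 5 ℕ.* r → k ≡ 5 ℕ.* M′ ℕ.+ c → tri k ≡ i ℕ.+ 5 ℕ.* base c r
    exponent c i {r} h refl = trans (tri-5*+ c M′) (trans (cong (5 ℕ.* tri M′ ℕ.+ 10 ℕ.* (M′ ℕ.* M′) ℕ.+ 5 ℕ.* (c ℕ.* M′) ℕ.+_) h)
      (lemma M′ (tri M′) c i r))
      where
      lemma : ∀ M T c i r → 5 ℕ.* T ℕ.+ 10 ℕ.* (M ℕ.* M) ℕ.+ 5 ℕ.* (c ℕ.* M) ℕ.+ (i ℕ.+ 5 ℕ.* r) ≡ i ℕ.+ 5 ℕ.* (T ℕ.+ 2 ℕ.* (M ℕ.* M) ℕ.+ c ℕ.* M ℕ.+ r)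
      lemma = solve-∀
    e₀ : suc N ≡ 5 ℕ.* M′ ℕ.+ 0
    e₀ = lemma M
      where
      lemma : ∀ M → suc (5 ℕ.* M ℕ.+ 4) ≡ 5 ℕ.* suc M ℕ.+ 0
      lemma = solve-∀
    next : ∀ {k} c → k ≡ 5 ℕ.* M′ ℕ.+ c → suc k ≡ 5 ℕ.* M′ ℕ.+ suc c
    next c p = trans (cong suc p) (sym (ℕₚ.+-suc (5 ℕ.* M′) c))
    e₁ = next 0 e₀
    e₂ = next 1 e₁
    e₃ = next 2 e₂
    e₄ = next 3 e₃
    h₁ = form₀ h (+ 1) (base 0 0) (exponent 0 0 refl e₀)
    h₂ = form₁ h₁ (+ 1) (base 1 0) (exponent 1 1 refl e₁)
    h₃ = form₃ h₂ (+ 1) (base 2 0) (exponent 2 3 refl e₂)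
    h₄ = form₁ h₃ (+ 1) (base 3 1) (exponent 3 1 refl e₃)
    h₅ = form₀ h₄ (+ 1) (base 4 2) (exponent 4 0 refl e₄)
    index : base 2 0 ≡ 5 ℕ.* tri M′
    index = trans (lemma M′ (tri M′)) (trans (cong (λ t → tri M′ ℕ.+ 2 ℕ.* t) (sym (tri-double M′))) (lemma₂ (tri M′)))
      where
      lemma : ∀ M T → T ℕ.+ 2 ℕ.* (M ℕ.* M) ℕ.+ 2 ℕ.* M ℕ.+ 0 ≡ T ℕ.+ 2 ℕ.* (M ℕ.* suc M)
      lemma = solve-∀
      lemma₂ : ∀ T → T ℕ.+ 2 ℕ.* (T ℕ.+ T) ≡ 5 ℕ.* T
      lemma₂ = solve-∀
    value : dilate 4 (partialPsi M) + const (+ 1) * qS ^ base 2 0 ≋ dilate 4 (partialPsi (suc M))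
    value = ≋-trans (+-congˡ (≋-trans (*-congˡ (≋-reflexive (cong (qS ^_) index))) (dilate-monomial (+ 1) (tri M′))))
      (≋-sym (dilate-+S 4 (partialPsi M) (const (+ 1) * qS ^ tri M′)))

  forms : ∀ M → Form (partialPsi (5 ℕ.* M ℕ.+ 4)) (dilate 4 (partialPsi M))
  forms zero = form-cong ≋-refl
    (≋-trans (solve 0 (con (+ 0) :+ con (+ 1) :* con (+ 1) :≈ con (+ 1)) [] refl) (≋-sym (dilate-const 4 (+ 1))))
    (form₀ (form₁ (form₃ (form₁ h (+ 1) 0 {1} refl) (+ 1) 0 {3} refl) (+ 1) 1 {6} refl) (+ 1) 2 {10} refl)
    where
    h : Form oneS zeroS
    h = oneS , zeroS , ≋-trans (≋-sym (dilate-const 4 (+ 1))) (≋-sym (dissection-0 oneS))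
  forms (suc M) = subst (λ k → Form (partialPsi k) (dilate 4 (partialPsi (suc M)))) (sym (index M)) (step M (forms M))
    where
    index : ∀ M → 5 ℕ.* suc M ℕ.+ 4 ≡ suc (suc (suc (suc (suc (5 ℕ.* M ℕ.+ 4)))))
    index = solve-∀

  private
    bound : ∀ i n → i < 5 → i ℕ.+ 5 ℕ.* n ≤ 5 ℕ.* suc n ℕ.+ 4
    bound i n i<5 = ℕₚ.≤-trans (ℕₚ.+-monoˡ-≤ (5 ℕ.* n) (ℕₚ.<⇒≤ i<5))
      (ℕₚ.≤-trans (ℕₚ.≤-reflexive (sym (ℕₚ.*-suc 5 n))) (ℕₚ.m≤m+n (5 ℕ.* suc n) 4))

    section-psi : ∀ i → i < 5 → ∀ n → section i psi n ≡ section i (partialPsi (5 ℕ.* suc n ℕ.+ 4)) n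
    section-psi i i<5 n = trans (section-at i psi n) (trans
      (sym (partialPsi-at (5 ℕ.* suc n ℕ.+ 4) (i ℕ.+ 5 ℕ.* n) (bound i n i<5))) (sym (section-at i _ n)))

  psi-section-2 : section 2 psi ≋ zeroS
  psi-section-2 = pointwise λ n → trans (section-psi 2 (s≤s (s≤s (s≤s z≤n))) n)
    (at (≋-trans (section-cong 2 (proj₂ (proj₂ (forms (suc n))))) (section-2-dissection _ _ _ _ _)) n)

  psi-section-4 : section 4 psi ≋ zeroS
  psi-section-4 = pointwise λ n → trans (section-psi 4 (s≤s (s≤s (s≤s (s≤s (s≤s z≤n))))) n)
    (at (≋-trans (section-cong 4 (proj₂ (proj₂ (forms (suc n))))) (section-4-dissection _ _ _ _ _)) n)

  psi-section-3 : section 3 psi ≋ dilate 4 psi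
  psi-section-3 = pointwise λ n → trans (section-psi 3 (s≤s (s≤s (s≤s (s≤s z≤n)))) n) (trans
    (at (≋-trans (section-cong 3 (proj₂ (proj₂ (forms (suc n))))) (section-3-dissection _ _ _ _ _)) n)
    (dilate-local 4 n (λ i i≤n → partialPsi-at (suc n) i (ℕₚ.m≤n⇒m≤1+n i≤n))))

-- Substitution in expressions, composition of substitutions, and their effect on f_r

dilate-lookup : ∀ d {n} (i : Fin n) (ρ : Vec Series n) → dilate d (Vec.lookup ρ i) ≋ Vec.lookup (Vec.map (dilate d) ρ) i
dilate-lookup d zero    (x ∷ ρ) = ≋-refl
dilate-lookup d (suc i) (x ∷ ρ) = dilate-lookup d i ρ

dilate-eval : ∀ d n p ρ → dilate d (eval n p ρ) ≋ eval n p (Vec.map (dilate d) ρ)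
dilate-eval d zero    c        []      = dilate-const d c
dilate-eval d (suc n) []       (x ∷ ρ) = dilate-const d (+ 0)
dilate-eval d (suc n) (p ∷ ps) (x ∷ ρ) = ≋-trans (dilate-+S d _ _)
  (+-cong (dilate-eval d n p ρ) (≋-trans (dilate-* d x _) (*-congˡ (dilate-eval d (suc n) ps (x ∷ ρ)))))

dilate-⟦⟧ : ∀ d {n} (e : Expr n) ρ → dilate d (⟦ e ⟧ ρ) ≋ ⟦ e ⟧ (Vec.map (dilate d) ρ)
dilate-⟦⟧ d (con c)  ρ = dilate-const d c
dilate-⟦⟧ d (var i)  ρ = dilate-lookup d i ρ
dilate-⟦⟧ d (poly p) ρ = dilate-eval d _ p ρ
dilate-⟦⟧ d (e :+ g) ρ = ≋-trans (dilate-+S d _ _) (+-cong (dilate-⟦⟧ d e ρ) (dilate-⟦⟧ d g ρ))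
dilate-⟦⟧ d (e :* g) ρ = ≋-trans (dilate-* d _ _) (*-cong (dilate-⟦⟧ d e ρ) (dilate-⟦⟧ d g ρ))
dilate-⟦⟧ d (e :- g) ρ = ≋-trans (dilate-+S d _ _) (+-cong (dilate-⟦⟧ d e ρ) (≋-trans (dilate-neg d _) (-‿cong (dilate-⟦⟧ d g ρ))))
dilate-⟦⟧ d (:- e)   ρ = ≋-trans (dilate-neg d _) (-‿cong (dilate-⟦⟧ d e ρ))
dilate-⟦⟧ d (e :^ k) ρ = ≋-trans (dilate-^ d _ k) (^-cong (dilate-⟦⟧ d e ρ) k)

dilate-expr : ∀ d n (e : N-ary n (Expr n) (Expr n)) (ρ : Vec Series n) →
              dilate d (⟦ e $ⁿ vars n ⟧ ρ) ≋ ⟦ e $ⁿ vars n ⟧ (Vec.map (dilate d) ρ)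
dilate-expr d n e ρ = dilate-⟦⟧ d (e $ⁿ vars n) ρ

-- The functional equation of `dilate-head` determines an operator, by induction on the exponent.
-- Composites of substitutions are identified in this way.
expansion-unique : ∀ m (Y Z : Series → Series) →
  (∀ a → Y a ≋ const (a 0) + qS ^ suc m * Y (tail a)) →
  (∀ a → Z a ≋ const (a 0) + qS ^ suc m * Z (tail a)) → ∀ a → Y a ≋ Z a
expansion-unique m Y Z y z a = pointwise λ n → step-induction m (λ n → ∀ a → Y a n ≡ Z a n) low high n a
  where
  coefficient : ∀ W → (∀ a → W a ≋ const (a 0) + qS ^ suc m * W (tail a)) → ∀ a n →
                W a n ≡ const (a 0) n ℤ.+ (qS ^ suc m * W (tail a)) n
  coefficient W w a n = trans (at (w a) n) (+-at (const (a 0)) (qS ^ suc m * W (tail a)) n)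
  low : ∀ i → i < suc m → ∀ a → Y a i ≡ Z a i
  low i i<m a = trans (coefficient Y y a i) (trans (cong (λ t → const (a 0) i ℤ.+ t)
    (trans (q^*-low (suc m) (Y (tail a)) i i<m) (sym (q^*-low (suc m) (Z (tail a)) i i<m)))) (sym (coefficient Z z a i)))
  high : ∀ n → (∀ a → Y a n ≡ Z a n) → ∀ a → Y a (n ℕ.+ suc m) ≡ Z a (n ℕ.+ suc m)
  high n ih a = trans (coefficient Y y a (n ℕ.+ suc m)) (trans (cong (λ t → const (a 0) (n ℕ.+ suc m) ℤ.+ t)
    (trans (q^*-+ (suc m) (Y (tail a)) n) (trans (ih (tail a)) (sym (q^*-+ (suc m) (Z (tail a)) n))))) (sym (coefficient Z z a (n ℕ.+ suc m))))

dilate-dilate-head : ∀ d e a → dilate d (dilate e a) ≋ const (a 0) + qS ^ (suc d ℕ.* suc e) * dilate d (dilate e (tail a))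
dilate-dilate-head d e a = begin
  dilate d (dilate e a) ≈⟨ dilate-cong d (dilate-head e a) ⟩
  dilate d (const (a 0) + qS ^ suc e * dilate e (tail a))
    ≈⟨ ≋-trans (dilate-+S d _ _) (+-cong (dilate-const d (a 0)) (dilate-* d _ _)) ⟩
  const (a 0) + dilate d (qS ^ suc e) * dilate d (dilate e (tail a))
    ≈⟨ +-congˡ (*-congʳ (≋-trans (dilate-^ d qS (suc e)) (≋-trans (^-cong (dilate-q d) (suc e)) (^-* qS (suc d) (suc e))))) ⟩
  const (a 0) + qS ^ (suc d ℕ.* suc e) * dilate d (dilate e (tail a)) ∎
  where open ≋-Reasoning

dilate-comm : ∀ d e a → dilate d (dilate e a) ≋ dilate e (dilate d a)
dilate-comm d e = expansion-unique (e ℕ.+ d ℕ.* suc e) (dilate d ∘ dilate e) (dilate e ∘ dilate d) (dilate-dilate-head d e)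
  (λ a → ≋-trans (dilate-dilate-head e d a) (+-congˡ (*-congʳ (≋-reflexive (cong (qS ^_) (ℕₚ.*-comm (suc e) (suc d)))))))

dilate-partialProd : ∀ d r N → dilate d (partialProd r N) ≋ partialProd (suc d ℕ.* r) N
dilate-partialProd d r zero    = dilate-const d (+ 1)
dilate-partialProd d r (suc N) = begin
  dilate d (partialProd r (suc N)) ≈⟨ dilate-cong d (partialProd-suc r N) ⟩
  dilate d (partialProd r N * (oneS + - qS ^ (r ℕ.* suc N)))
    ≈⟨ dilate-expr d 2 (λ p m → p :* (con (+ 1) :- m)) (partialProd r N ∷ qS ^ (r ℕ.* suc N) ∷ []) ⟩
  dilate d (partialProd r N) * (oneS + - dilate d (qS ^ (r ℕ.* suc N)))
    ≈⟨ *-cong (dilate-partialProd d r N) (+-congˡ (-‿cong (≋-trans (dilate-^ d qS (r ℕ.* suc N))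
         (≋-trans (^-cong (dilate-q d) (r ℕ.* suc N)) (≋-trans (^-* qS (suc d) (r ℕ.* suc N))
           (≋-reflexive (cong (qS ^_) (sym (ℕₚ.*-assoc (suc d) r (suc N)))))))))) ⟩
  partialProd (suc d ℕ.* r) N * (oneS + - qS ^ (suc d ℕ.* r ℕ.* suc N)) ≈⟨ ≋-sym (partialProd-suc (suc d ℕ.* r) N) ⟩
  partialProd (suc d ℕ.* r) (suc N) ∎
  where open ≋-Reasoning

f-dilate : ∀ d r → dilate d (f (suc r)) ≋ f (suc d ℕ.* suc r)
f-dilate d r = pointwise λ n → trans
  (dilate-local d n (λ i i≤n → sym (partialProd-at r n i i≤n)))
  (at (dilate-partialProd d (suc r) n) n)

-- The Rogers–Ramanujan parametrisation.  With r = ratio(q⁵) and s = ratio(q¹⁰),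
-- q r is the continued fraction R(q⁵) and the theorems below are its classical 5-dissection and
-- its modular equation of degree 2.
ratio : Series
ratio = f 5 * inv (section 0 (f 1))

private
  G₀ = section 0 (f 1)
  G₂ = section 2 (f 1)
  H₀ = dilate 1 G₀
  H₄ = dilate 1 G₂
  C₀ = section 0 Triangular.psi
  C₁ = section 1 Triangular.psi
  P  = dilate 4 Triangular.psi
  s₁ = dilate 1 ratio

  f-dissection : f 1 ≋ dissection G₀ (- f 5) G₂ zeroS zeroS
  f-dissection = ≋-trans (dissect (f 1)) (dissection-cong ≋-refl
    (≋-trans PentagonalSections.f-section-1 (-‿cong (f-dilate 4 0))) ≋-refl
    PentagonalSections.f-section-3 PentagonalSections.f-section-4)

  f-expansion : f 1 ≋ dilate 4 G₀ + - (qS * f 25) + qS ^ 2 * dilate 4 G₂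
  f-expansion = ≋-trans f-dissection (≋-trans
    (+-congˡ (*-congˡ (+-cong (≋-trans (dilate-neg 4 (f 5)) (-‿cong (f-dilate 4 4)))
      (*-congˡ (+-congˡ (*-congˡ (+-cong dilate-zeroS (*-congˡ dilate-zeroS))))))))
    (solve 4 (λ g q F h → g :+ q :* ((:- F) :+ q :* (h :+ q :* (con (+ 0) :+ q :* con (+ 0)))) :≈ g :- q :* F :+ q :^ 2 :* h)
      (dilate 4 G₀ ∷ qS ∷ f 25 ∷ dilate 4 G₂ ∷ []) refl))

  f2-expansion : f 2 ≋ dilate 4 H₀ + - (qS ^ 2 * f 50) + qS ^ 4 * dilate 4 H₄
  f2-expansion = begin
    f 2            ≈⟨ ≋-sym (f-dilate 1 0) ⟩
    dilate 1 (f 1) ≈⟨ dilate-cong 1 f-expansion ⟩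
    dilate 1 (dilate 4 G₀ + - (qS * f 25) + qS ^ 2 * dilate 4 G₂)
      ≈⟨ dilate-expr 1 4 (λ g q F h → g :- q :* F :+ q :^ 2 :* h) (dilate 4 G₀ ∷ qS ∷ f 25 ∷ dilate 4 G₂ ∷ []) ⟩
    dilate 1 (dilate 4 G₀) + - (dilate 1 qS * dilate 1 (f 25)) + dilate 1 qS ^ 2 * dilate 1 (dilate 4 G₂)
      ≈⟨ +-cong (+-cong (dilate-comm 1 4 G₀) (-‿cong (*-cong (dilate-q 1) (f-dilate 1 24))))
           (*-cong (≋-trans (^-cong (dilate-q 1) 2) (^-* qS 2 2)) (dilate-comm 1 4 G₂)) ⟩
    dilate 4 H₀ + - (qS ^ 2 * f 50) + qS ^ 4 * dilate 4 H₄ ∎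
    where open ≋-Reasoning

  psi-expansion : Triangular.psi ≋ dilate 4 C₀ + qS * dilate 4 C₁ + qS ^ 3 * dilate 4 P
  psi-expansion = ≋-trans (dissect Triangular.psi) (≋-trans
    (dissection-cong ≋-refl ≋-refl Triangular.psi-section-2 Triangular.psi-section-3 Triangular.psi-section-4) (≋-trans
    (+-congˡ (*-congˡ (+-congˡ (*-congˡ (+-cong dilate-zeroS (*-congˡ (+-congˡ (*-congˡ dilate-zeroS))))))))
    (solve 4 (λ c q d p → c :+ q :* (d :+ q :* (con (+ 0) :+ q :* (p :+ q :* con (+ 0)))) :≈ c :+ q :* d :+ q :^ 3 :* p)
      (dilate 4 C₀ ∷ qS ∷ dilate 4 C₁ ∷ dilate 4 P ∷ []) refl)))

  lhs-dissection : f 1 * Triangular.psi ≋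
    dissection (G₀ * C₀ + qS * G₂ * P) (G₀ * C₁ + - (f 5 * C₀)) (- (f 5 * C₁) + G₂ * C₀) (G₀ * P + G₂ * C₁) (- (f 5 * P))
  lhs-dissection = ≋-trans (*-cong f-expansion psi-expansion) (≋-trans
    (solve 7 (λ q g F h c d p →
       (g :- q :* F :+ q :^ 2 :* h) :* (c :+ q :* d :+ q :^ 3 :* p) :≈
       (g :* c :+ q :^ 5 :* h :* p) :+ q :* ((g :* d :- F :* c) :+ q :* ((:- (F :* d) :+ h :* c) :+
         q :* ((g :* p :+ h :* d) :+ q :* (:- (F :* p))))))
       (qS ∷ dilate 4 G₀ ∷ f 25 ∷ dilate 4 G₂ ∷ dilate 4 C₀ ∷ dilate 4 C₁ ∷ dilate 4 P ∷ []) refl)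
    (≋-sym (+-cong
      (≋-trans (dilate-expr 4 5 (λ g c q h p → g :* c :+ q :* h :* p) (G₀ ∷ C₀ ∷ qS ∷ G₂ ∷ P ∷ [])) (+-congˡ (*-congʳ (*-congʳ (dilate-q 4)))))
      (*-congˡ (+-cong
      (≋-trans (dilate-expr 4 4 (λ g d F c → g :* d :- F :* c) (G₀ ∷ C₁ ∷ f 5 ∷ C₀ ∷ [])) (+-congˡ (-‿cong (*-congʳ (f-dilate 4 4)))))
      (*-congˡ (+-cong
      (≋-trans (dilate-expr 4 4 (λ F d h c → :- (F :* d) :+ h :* c) (f 5 ∷ C₁ ∷ G₂ ∷ C₀ ∷ [])) (+-congʳ (-‿cong (*-congʳ (f-dilate 4 4)))))
      (*-congˡ (+-cong
      (dilate-expr 4 4 (λ g p h d → g :* p :+ h :* d) (G₀ ∷ P ∷ G₂ ∷ C₁ ∷ []))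
      (*-congˡ (≋-trans (dilate-expr 4 2 (λ F p → :- (F :* p)) (f 5 ∷ P ∷ [])) (-‿cong (*-congʳ (f-dilate 4 4))))))))))))))

  rhs-dissection : f 2 * f 2 ≋
    dissection (H₀ * H₀) (const -[1+ 1 ] * qS * f 10 * H₄) (const -[1+ 1 ] * H₀ * f 10) (qS * H₄ * H₄) (f 10 * f 10 + const (+ 2) * H₀ * H₄)
  rhs-dissection = ≋-trans (*-cong f2-expansion f2-expansion) (≋-trans
    (solve 4 (λ q h F k →
       (h :- q :^ 2 :* F :+ q :^ 4 :* k) :* (h :- q :^ 2 :* F :+ q :^ 4 :* k) :≈
       (h :* h) :+ q :* ((con -[1+ 1 ] :* q :^ 5 :* F :* k) :+ q :* ((con -[1+ 1 ] :* h :* F) :+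
         q :* ((q :^ 5 :* k :* k) :+ q :* (F :* F :+ con (+ 2) :* h :* k)))))
       (qS ∷ dilate 4 H₀ ∷ f 50 ∷ dilate 4 H₄ ∷ []) refl)
    (≋-sym (+-cong
      (dilate-expr 4 1 (λ h → h :* h) (H₀ ∷ []))
      (*-congˡ (+-cong
      (≋-trans (dilate-expr 4 3 (λ q F k → con -[1+ 1 ] :* q :* F :* k) (qS ∷ f 10 ∷ H₄ ∷ [])) (*-congʳ (*-cong (*-congˡ (dilate-q 4)) (f-dilate 4 9))))
      (*-congˡ (+-cong
      (≋-trans (dilate-expr 4 2 (λ h F → con -[1+ 1 ] :* h :* F) (H₀ ∷ f 10 ∷ [])) (*-congˡ (f-dilate 4 9)))
      (*-congˡ (+-cong
      (≋-trans (dilate-expr 4 2 (λ q k → q :* k :* k) (qS ∷ H₄ ∷ [])) (*-congʳ (*-congʳ (dilate-q 4))))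
      (*-congˡ (≋-trans (dilate-expr 4 3 (λ F h k → F :* F :+ con (+ 2) :* h :* k) (f 10 ∷ H₀ ∷ H₄ ∷ []))
        (+-congʳ (*-cong (f-dilate 4 9) (f-dilate 4 9))))))))))))))

  both : ∀ {a₀ a₁ a₂ a₃ a₄ b₀ b₁ b₂ b₃ b₄} i {x y} →
    (section i (dissection a₀ a₁ a₂ a₃ a₄) ≋ x) → (section i (dissection b₀ b₁ b₂ b₃ b₄) ≋ y) →
    dissection a₀ a₁ a₂ a₃ a₄ ≋ dissection b₀ b₁ b₂ b₃ b₄ → x ≋ y
  both i p q h = ≋-trans (≋-sym p) (≋-trans (section-cong i h) q)

  comparison = ≋-trans (≋-sym lhs-dissection) (≋-trans Triangular.gauss rhs-dissection)

  class₀ : G₀ * C₀ + qS * G₂ * P ≋ H₀ * H₀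
  class₀ = both 0 (section-0-dissection _ _ _ _ _) (section-0-dissection _ _ _ _ _) comparison

  class₁ : G₀ * C₁ + - (f 5 * C₀) ≋ const -[1+ 1 ] * qS * f 10 * H₄
  class₁ = both 1 (section-1-dissection _ _ _ _ _) (section-1-dissection _ _ _ _ _) comparison

  class₂ : - (f 5 * C₁) + G₂ * C₀ ≋ const -[1+ 1 ] * H₀ * f 10
  class₂ = both 2 (section-2-dissection _ _ _ _ _) (section-2-dissection _ _ _ _ _) comparison

  class₄ : - (f 5 * P) ≋ f 10 * f 10 + const (+ 2) * H₀ * H₄
  class₄ = both 4 (section-4-dissection _ _ _ _ _) (section-4-dissection _ _ _ _ _) comparison

  f5*P : f 5 * P ≋ f 10 * f 10
  f5*P = begin
    f 5 * P                           ≈⟨ *-congʳ (≋-sym (f-dilate 4 0)) ⟩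
    dilate 4 (f 1) * P                ≈⟨ ≋-sym (dilate-* 4 (f 1) Triangular.psi) ⟩
    dilate 4 (f 1 * Triangular.psi)   ≈⟨ dilate-cong 4 Triangular.gauss ⟩
    dilate 4 (f 2 * f 2)              ≈⟨ dilate-* 4 (f 2) (f 2) ⟩
    dilate 4 (f 2) * dilate 4 (f 2)   ≈⟨ *-cong (f-dilate 4 1) (f-dilate 4 1) ⟩
    f 10 * f 10                       ∎
    where open ≋-Reasoning

  two≢0 : ¬ (const (+ 2) 0 ≡ + 0)
  two≢0 ()

  -- Class 4 of Gauss's identity says -f₅ P = f₁₀² + 2 H₀ H₄, while the same identity at q⁵ says f₅
  -- P = f₁₀². Hence 2 H₀ H₄ = -2 f₁₀².
  H₀*H₄ : H₀ * H₄ ≋ - (f 10 * f 10)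
  H₀*H₄ = regular-head two≢0 (H₀ * H₄) (- (f 10 * f 10))
    (solve-by 5 (λ h k X F P → con (+ 2) :* (h :* k) :≈ con (+ 2) :* (:- (X :* X))
        by (con -[1+ 0 ] , :- (F :* P) :≈ X :* X :+ con (+ 2) :* h :* k) ∷ (con -[1+ 0 ] , F :* P :≈ X :* X) ∷ [])
      (H₀ ∷ H₄ ∷ f 10 ∷ f 5 ∷ P ∷ []) refl (class₄ , f5*P , tt))

  -- The product is found at q² and pulled back. It makes a single series, `ratio`, sufficient to
  -- express both unknown sections of f₁.
  G₀*G₂ : G₀ * G₂ ≋ - (f 5 * f 5)
  G₀*G₂ = dilate-injective 1 (≋-trans (dilate-* 1 G₀ G₂) (≋-trans H₀*H₄
    (≋-sym (≋-trans (dilate-expr 1 1 (λ F → :- (F :* F)) (f 5 ∷ [])) (-‿cong (*-cong (f-dilate 1 4) (f-dilate 1 4)))))))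

  G₀-1 : G₀ 0 ≡ + 1
  G₀-1 = section-at 0 (f 1) 0

  G₀*ratio : G₀ * ratio ≋ f 5
  G₀*ratio = ≋-trans (solve 3 (λ g F i → g :* (F :* i) :≈ F :* (g :* i)) (G₀ ∷ f 5 ∷ inv G₀ ∷ []) refl)
    (≋-trans (*-congˡ (inverse G₀-1)) (*-identityʳ (f 5)))

  G₂≋ : G₂ ≋ - (f 5 * ratio)
  G₂≋ = regular-1 G₀-1 G₂ (- (f 5 * ratio)) (≋-trans G₀*G₂
    (≋-sym (≋-trans (solve 3 (λ g F r → g :* (:- (F :* r)) :≈ :- (F :* (g :* r))) (G₀ ∷ f 5 ∷ ratio ∷ []) refl)
      (-‿cong (*-congˡ G₀*ratio)))))

  H₀*s₁ : H₀ * s₁ ≋ f 10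
  H₀*s₁ = ≋-trans (≋-sym (dilate-* 1 G₀ ratio)) (≋-trans (dilate-cong 1 G₀*ratio) (f-dilate 1 4))

  H₄≋ : H₄ ≋ - (f 10 * s₁)
  H₄≋ = ≋-trans (dilate-cong 1 G₂≋) (≋-trans (dilate-expr 1 2 (λ F r → :- (F :* r)) (f 5 ∷ ratio ∷ [])) (-‿cong (*-congʳ (f-dilate 1 4))))

  H₀-1 : H₀ 0 ≡ + 1
  H₀-1 = trans (dilate-0 1 G₀) G₀-1

ratio-1 : ratio 0 ≡ + 1
ratio-1 = *-head-1 {f 5} {inv G₀} refl refl

-- Classes 0, 1 and 2 of Gauss's identity are three linear equations for the two sections C₀ and C₁
-- of the theta series. The combination with multipliers 2r², r and 1 eliminates both.
ratio-equation : dilate 1 ratio ≋ ratio ^ 2 + qS * ratio * dilate 1 ratio ^ 2 * (dilate 1 ratio + ratio ^ 2)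
ratio-equation = regular-2H² _ _ (solve-by 11 (λ q r s g h F X k c d p →
    con (+ 2) :* (h :* h) :* s :≈ con (+ 2) :* (h :* h) :* (r :^ 2 :+ q :* r :* s :^ 2 :* (s :+ r :^ 2))
    by (con (+ 2) :* r :^ 2 , g :* c :+ q :* (:- (F :* r)) :* p :≈ h :* h)
     ∷ (r , g :* d :- F :* c :≈ con -[1+ 1 ] :* q :* X :* k)
     ∷ (con (+ 1) , :- (F :* d) :+ (:- (F :* r)) :* c :≈ con -[1+ 1 ] :* h :* X)
     ∷ (con (+ 2) :* r :* c :+ d , F :≈ g :* r)
     ∷ (con (+ 2) :* r :^ 3 :* q , F :* p :≈ X :* X)
     ∷ (con -[1+ 1 ] :* r :* q :* X , k :≈ :- (X :* s))
     ∷ ((con (+ 2) :* r :* q :* s :+ con (+ 2) :* r :^ 3 :* q) :* (X :+ h :* s) :- con (+ 2) :* h , X :≈ h :* s)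
     ∷ [])
  (qS ∷ ratio ∷ s₁ ∷ G₀ ∷ H₀ ∷ f 5 ∷ f 10 ∷ H₄ ∷ C₀ ∷ C₁ ∷ P ∷ []) refl
  ( ≋-trans (+-congˡ (*-congʳ (*-congˡ (≋-sym G₂≋)))) class₀
  , class₁
  , ≋-trans (+-congˡ (*-congʳ (≋-sym G₂≋))) class₂
  , ≋-sym G₀*ratio , f5*P , H₄≋ , ≋-sym H₀*s₁ , tt))
  where
  regular-2H² : Regular (const (+ 2) * (H₀ * H₀))
  regular-2H² = regular-* (regular-head two≢0) (regular-* (regular-1 H₀-1) (regular-1 H₀-1))

R₅ S₅ : Series
R₅ = qS * dilate 4 ratio
S₅ = qS ^ 2 * dilate 4 (dilate 1 ratio)

f1*R₅ : f 1 * R₅ ≋ qS * f 25 * (oneS + - R₅ + - R₅ ^ 2)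
f1*R₅ = solve-by 6 (λ q f r g F h → let R = q :* r in
    f :* R :≈ q :* F :* (con (+ 1) :- R :- R :^ 2)
    by (R , f :≈ g :- q :* F :+ q :^ 2 :* h) ∷ (q , g :* r :≈ F) ∷ (q :^ 3 :* r , h :≈ :- (F :* r)) ∷ [])
  (qS ∷ f 1 ∷ dilate 4 ratio ∷ dilate 4 G₀ ∷ f 25 ∷ dilate 4 G₂ ∷ []) refl
  ( f-expansion
  , ≋-trans (≋-sym (dilate-* 4 G₀ ratio)) (≋-trans (dilate-cong 4 G₀*ratio) (f-dilate 4 4))
  , ≋-trans (dilate-cong 4 G₂≋) (≋-trans (dilate-expr 4 2 (λ F r → :- (F :* r)) (f 5 ∷ ratio ∷ [])) (-‿cong (*-congʳ (f-dilate 4 4))))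
  , tt)

S₅≋dilate-R₅ : S₅ ≋ dilate 1 R₅
S₅≋dilate-R₅ = ≋-sym (≋-trans (dilate-* 1 qS (dilate 4 ratio)) (*-cong (dilate-q 1) (dilate-comm 1 4 ratio)))

f2*S₅ : f 2 * S₅ ≋ qS ^ 2 * f 50 * (oneS + - S₅ + - S₅ ^ 2)
f2*S₅ = begin
  f 2 * S₅                 ≈⟨ *-cong (≋-sym (f-dilate 1 0)) S₅≋dilate-R₅ ⟩
  dilate 1 (f 1) * dilate 1 R₅ ≈⟨ ≋-sym (dilate-* 1 (f 1) R₅) ⟩
  dilate 1 (f 1 * R₅)      ≈⟨ dilate-cong 1 f1*R₅ ⟩
  dilate 1 (qS * f 25 * (oneS + - R₅ + - R₅ ^ 2))
    ≈⟨ dilate-expr 1 3 (λ q F R → q :* F :* (con (+ 1) :- R :- R :^ 2)) (qS ∷ f 25 ∷ R₅ ∷ []) ⟩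
  dilate 1 qS * dilate 1 (f 25) * (oneS + - dilate 1 R₅ + - dilate 1 R₅ ^ 2)
    ≈⟨ *-cong (*-cong (dilate-q 1) (f-dilate 1 24))
         (+-cong (+-congˡ (-‿cong (≋-sym S₅≋dilate-R₅))) (-‿cong (^-cong (≋-sym S₅≋dilate-R₅) 2))) ⟩
  qS ^ 2 * f 50 * (oneS + - S₅ + - S₅ ^ 2) ∎
  where open ≋-Reasoning

R₅-S₅ : S₅ + - R₅ ^ 2 ≋ R₅ * S₅ ^ 2 * (S₅ + R₅ ^ 2)
R₅-S₅ = solve-by 3 (λ q r s → let R = q :* r ; S = q :^ 2 :* s in
    S :- R :^ 2 :≈ R :* S :^ 2 :* (S :+ R :^ 2)
    by (q :^ 2 , s :≈ r :^ 2 :+ q :^ 5 :* r :* s :^ 2 :* (s :+ r :^ 2)) ∷ [])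
  (qS ∷ dilate 4 ratio ∷ dilate 4 s₁ ∷ []) refl
  (≋-trans (dilate-cong 4 ratio-equation) (≋-trans
    (dilate-expr 4 3 (λ q r s → r :^ 2 :+ q :* r :* s :^ 2 :* (s :+ r :^ 2)) (qS ∷ ratio ∷ s₁ ∷ []))
    (+-congˡ (*-congʳ (*-congʳ (*-congʳ (dilate-q 4)))))) , tt)

-- The derivation q d/dq

opaque
  θ : Series → Series
  θ a n = + n ℤ.* a n

  θ-at : ∀ a n → θ a n ≡ + n ℤ.* a n
  θ-at a n = refl

θ-cong : ∀ {a b} → a ≋ b → θ a ≋ θ b
θ-cong {a} {b} p = pointwise λ n → trans (θ-at a n) (trans (cong (+ n ℤ.*_) (at p n)) (sym (θ-at b n)))

θ-+ : ∀ a b → θ (a + b) ≋ θ a + θ b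
θ-+ a b = pointwise λ n → trans (θ-at (a + b) n) (trans (cong (+ n ℤ.*_) (+-at a b n))
  (trans (ℤₚ.*-distribˡ-+ (+ n) (a n) (b n)) (sym (trans (+-at (θ a) (θ b) n) (cong₂ ℤ._+_ (θ-at a n) (θ-at b n))))))

θ-neg : ∀ a → θ (- a) ≋ - θ a
θ-neg a = pointwise λ n → trans (θ-at (- a) n) (trans (cong (+ n ℤ.*_) (neg-at a n))
  (trans (sym (ℤₚ.neg-distribʳ-* (+ n) (a n))) (sym (trans (neg-at (θ a) n) (cong ℤ.-_ (θ-at a n))))))

θ-const : ∀ c → θ (const c) ≋ zeroS
θ-const c = pointwise λ { zero → trans (θ-at (const c) 0) (ℤₚ.*-zeroˡ c) ; (suc n) → trans (θ-at (const c) (suc n)) (ℤₚ.*-zeroʳ (+ suc n)) }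

θ-tail : ∀ a n → tail (θ a) n ≡ θ (tail a) n ℤ.+ tail a n
θ-tail a n = trans (θ-at a (suc n)) (trans (suc-* n (a (suc n))) (cong (ℤ._+ a (suc n)) (sym (θ-at (tail a) n))))
  where
  suc-* : ∀ n x → + suc n ℤ.* x ≡ + n ℤ.* x ℤ.+ x
  suc-* n x = trans (cong (ℤ._* x) (trans (cong +_ (ℕₚ.+-comm 1 n)) (ℤₚ.pos-+ n 1)))
    (trans (ℤₚ.*-distribʳ-+ x (+ n) (+ 1)) (cong (λ t → + n ℤ.* x ℤ.+ t) (ℤₚ.*-identityˡ x)))

θ-conv : ∀ a b n → + n ℤ.* conv a b n ≡ conv (θ a) b n ℤ.+ conv a (θ b) n
θ-conv a b zero    = trans (ℤₚ.*-zeroˡ (a 0 ℤ.* b 0)) (sym (cong₂ ℤ._+_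
  (trans (cong (ℤ._* b 0) (trans (θ-at a 0) (ℤₚ.*-zeroˡ (a 0)))) (ℤₚ.*-zeroˡ (b 0)))
  (trans (cong (a 0 ℤ.*_) (trans (θ-at b 0) (ℤₚ.*-zeroˡ (b 0)))) (ℤₚ.*-zeroʳ (a 0)))))
θ-conv a b (suc n) = begin
  N ℤ.* (x ℤ.+ y)                                 ≡⟨ ℤₚ.*-distribˡ-+ N x y ⟩
  N ℤ.* x ℤ.+ N ℤ.* y                             ≡⟨ cong₂ ℤ._+_ first second ⟩
  a 0 ℤ.* θ b (suc n) ℤ.+ ((conv (θ (tail a)) b n ℤ.+ conv (tail a) b n) ℤ.+ conv (tail a) (θ b) n)
    ≡⟨ cong (λ t → a 0 ℤ.* θ b (suc n) ℤ.+ (t ℤ.+ conv (tail a) (θ b) n)) (sym third) ⟩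
  a 0 ℤ.* θ b (suc n) ℤ.+ (conv (tail (θ a)) b n ℤ.+ conv (tail a) (θ b) n)
    ≡⟨ lemma (a 0 ℤ.* θ b (suc n)) (conv (tail (θ a)) b n) (conv (tail a) (θ b) n) ⟩
  conv (tail (θ a)) b n ℤ.+ (a 0 ℤ.* θ b (suc n) ℤ.+ conv (tail a) (θ b) n)
    ≡⟨ cong (ℤ._+ (a 0 ℤ.* θ b (suc n) ℤ.+ conv (tail a) (θ b) n)) (sym fourth) ⟩
  conv (θ a) b (suc n) ℤ.+ conv a (θ b) (suc n)   ∎
  where
  open ≡.≡-Reasoning
  N = + suc n
  x = a 0 ℤ.* b (suc n)
  y = conv (tail a) b n
  lemma : ∀ u v w → u ℤ.+ (v ℤ.+ w) ≡ v ℤ.+ (u ℤ.+ w)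
  lemma u v w = trans (sym (ℤₚ.+-assoc u v w)) (trans (cong (ℤ._+ w) (ℤₚ.+-comm u v)) (ℤₚ.+-assoc v u w))
  first : N ℤ.* x ≡ a 0 ℤ.* θ b (suc n)
  first = trans (trans (sym (ℤₚ.*-assoc N (a 0) (b (suc n)))) (trans (cong (ℤ._* b (suc n)) (ℤₚ.*-comm N (a 0)))
    (ℤₚ.*-assoc (a 0) N (b (suc n))))) (cong (a 0 ℤ.*_) (sym (θ-at b (suc n))))
  second : N ℤ.* y ≡ (conv (θ (tail a)) b n ℤ.+ conv (tail a) b n) ℤ.+ conv (tail a) (θ b) n
  second = trans (cong (ℤ._* y) (ℤₚ.pos-+ 1 n)) (trans (ℤₚ.*-distribʳ-+ y (+ 1) (+ n))
    (trans (cong₂ ℤ._+_ (ℤₚ.*-identityˡ y) (θ-conv (tail a) b n))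
    (trans (sym (ℤₚ.+-assoc y (conv (θ (tail a)) b n) (conv (tail a) (θ b) n))) (cong (ℤ._+ conv (tail a) (θ b) n) (ℤₚ.+-comm y (conv (θ (tail a)) b n))))))
  third : conv (tail (θ a)) b n ≡ conv (θ (tail a)) b n ℤ.+ conv (tail a) b n
  third = trans (conv-cong {b = b} (λ m → trans (θ-tail a m) (sym (+-at (θ (tail a)) (tail a) m))) (λ _ → refl) n)
    (trans (sym (*-at (θ (tail a) + tail a) b n)) (trans (at (solve 3 (λ a c b → (a :+ c) :* b :≈ a :* b :+ c :* b) (θ (tail a) ∷ tail a ∷ b ∷ []) refl) n)
    (trans (+-at _ _ n) (cong₂ ℤ._+_ (*-at _ _ n) (*-at _ _ n)))))
  fourth : conv (θ a) b (suc n) ≡ conv (tail (θ a)) b n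
  fourth = trans (cong (λ t → t ℤ.* b (suc n) ℤ.+ conv (tail (θ a)) b n) (trans (θ-at a 0) (ℤₚ.*-zeroˡ (a 0))))
    (trans (cong (ℤ._+ conv (tail (θ a)) b n) (ℤₚ.*-zeroˡ (b (suc n)))) (ℤₚ.+-identityˡ _))

θ-* : ∀ a b → θ (a * b) ≋ θ a * b + a * θ b
θ-* a b = pointwise λ n → trans (θ-at (a * b) n) (trans (cong (+ n ℤ.*_) (*-at a b n)) (trans (θ-conv a b n)
  (sym (trans (+-at _ _ n) (cong₂ ℤ._+_ (*-at (θ a) b n) (*-at a (θ b) n))))))

θ-dilate : ∀ d a → θ (dilate d a) ≋ const (+ suc d) * dilate d (θ a)
θ-dilate d a = pointwise λ n → trans (go n) (sym (const-* (+ suc d) (dilate d (θ a)) n))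
  where
  opaque
    unfolding dilate
    go : ∀ n → θ (dilate d a) n ≡ + suc d ℤ.* dilate d (θ a) n
    go n with n ℕ.% suc d in eq
    ... | suc _ rewrite θ-at (dilate d a) n | eq = trans (ℤₚ.*-zeroʳ (+ n)) (sym (ℤₚ.*-zeroʳ (+ suc d)))
    ... | zero  rewrite θ-at (dilate d a) n | eq = trans
      (cong (λ t → + t ℤ.* a (n ℕ./ suc d)) (trans (DivMod.m≡m%n+[m/n]*n n (suc d)) (trans (cong (ℕ._+ n ℕ./ suc d ℕ.* suc d) eq) (ℕₚ.*-comm (n ℕ./ suc d) (suc d)))))
      (trans (cong (ℤ._* a (n ℕ./ suc d)) (ℤₚ.pos-* (suc d) (n ℕ./ suc d)))
      (trans (ℤₚ.*-assoc (+ suc d) (+ (n ℕ./ suc d)) (a (n ℕ./ suc d))) (cong (+ suc d ℤ.*_) (sym (θ-at a (n ℕ./ suc d))))))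

θ-q : θ qS ≋ qS
θ-q = pointwise λ { zero → trans (θ-at qS 0) refl ; (suc zero) → trans (θ-at qS 1) refl ; (suc (suc n)) → trans (θ-at qS (suc (suc n))) (ℤₚ.*-zeroʳ (+ suc (suc n))) }

-- Stated as θ a = l a, so that products, powers and substitutions are treated without forming
-- quotients.
LogDerivative : Series → Series → Set
LogDerivative l a = θ a ≋ l * a

log-* : ∀ {l m a b} → LogDerivative l a → LogDerivative m b → LogDerivative (l + m) (a * b)
log-* {l} {m} {a} {b} p q = ≋-trans (θ-* a b) (≋-trans (+-cong (*-congʳ p) (*-congˡ q))
  (solve 4 (λ l m a b → l :* a :* b :+ a :* (m :* b) :≈ (l :+ m) :* (a :* b)) (l ∷ m ∷ a ∷ b ∷ []) refl))

log-one : LogDerivative zeroS oneS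
log-one = ≋-trans (θ-const (+ 1)) (≋-sym (zeroˡ oneS))

log-^ : ∀ {l a} → LogDerivative l a → ∀ k → LogDerivative (const (+ k) * l) (a ^ k)
log-^ {l} p zero    = ≋-trans log-one (*-congʳ (≋-sym (zeroˡ l)))
log-^ {l} {a} p (suc k) = ≋-trans (log-* p (log-^ p k)) (*-congʳ
  (≋-trans (solve 2 (λ l k → l :+ k :* l :≈ (con (+ 1) :+ k) :* l) (l ∷ const (+ k) ∷ []) refl)
    (*-congʳ (≋-sym (IntegerHom.ι-+ seriesHom (+ 1) (+ k))))))

log-dilate : ∀ d {l a} → LogDerivative l a → LogDerivative (const (+ suc d) * dilate d l) (dilate d a)
log-dilate d {l} {a} p = ≋-trans (θ-dilate d a) (≋-trans (*-congˡ (≋-trans (dilate-cong d p) (dilate-* d l a)))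
  (≋-sym (*-assoc (const (+ suc d)) (dilate d l) (dilate d a))))

θ-kernel : ∀ {u} → θ u ≋ zeroS → u 0 ≡ + 1 → u ≋ oneS
θ-kernel {u} θu u₀ = pointwise λ { zero → u₀ ; (suc n) → vanish n }
  where
  vanish : ∀ n → u (suc n) ≡ + 0
  vanish n with ℤₚ.i*j≡0⇒i≡0∨j≡0 (+ suc n) {u (suc n)} (trans (sym (θ-at u (suc n))) (at θu (suc n)))
  ... | inj₁ ()
  ... | inj₂ z = z

θ-quotient : ∀ {a b u} → b 0 ≡ + 1 → θ a * b ≋ a * θ b → a ≋ u * b → θ u ≋ zeroS
θ-quotient {a} {b} {u} b₀ h a≋ = regular-* (regular-1 b₀) (regular-1 b₀) (θ u) zeroS
  (solve-by 6 (λ a b u x y z → b :* b :* z :≈ b :* b :* con (+ 0)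
     by (:- b , x :≈ z :* b :+ u :* y) ∷ (con (+ 1) , x :* b :≈ a :* y) ∷ (y , a :≈ u :* b) ∷ [])
   (a ∷ b ∷ u ∷ θ a ∷ θ b ∷ θ u ∷ []) refl (≋-trans (θ-cong a≋) (θ-* u b) , h , a≋ , tt))

-- The hypothesis equates the logarithmic derivatives, cross-multiplied. So the quotient a/b is
-- killed by θ, hence constant in characteristic zero, and the constant terms show that it is 1.
log-unique : ∀ {a b} → a 0 ≡ + 1 → b 0 ≡ + 1 → θ a * b ≋ a * θ b → a ≋ b
log-unique {a} {b} a₀ b₀ h = ≋-trans a≋ (≋-trans (*-congʳ
    (θ-kernel (θ-quotient {u = a * inv b} b₀ h a≋) (*-head-1 {a} {inv b} a₀ (inv-head b)))) (*-identityˡ b))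
  where
  a≋ : a ≋ a * inv b * b
  a≋ = solve-by 3 (λ a b i → a :≈ a :* i :* b by (:- a , b :* i :≈ con (+ 1)) ∷ []) (a ∷ b ∷ inv b ∷ []) refl (inverse b₀ , tt)

-- The logarithmic derivative of f₁ is -Σ σ(n) qⁿ, written as a sum of Lambert series.

geometric : Series
geometric zero    = + 0
geometric (suc n) = + 1

lambert : ℕ → Series
lambert k = const (ℤ.- + suc k) * dilate k geometric

geometric-equation : (oneS + - qS) * geometric ≋ qS
geometric-equation = ≋-trans (solve 2 (λ q g → (con (+ 1) :- q) :* g :≈ g :- q :* g) (qS ∷ geometric ∷ []) refl)
  (pointwise λ n → trans (+-at geometric (- (qS * geometric)) n) (trans (cong (λ t → geometric n ℤ.+ t) (neg-at (qS * geometric) n)) (go n)))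
  where
  go : ∀ n → geometric n ℤ.+ ℤ.- (qS * geometric) n ≡ qS n
  go zero          = cong (λ t → + 0 ℤ.+ ℤ.- t) (q*-zero geometric)
  go (suc zero)    = cong (λ t → + 1 ℤ.+ ℤ.- t) (q*-suc geometric 0)
  go (suc (suc n)) = cong (λ t → + 1 ℤ.+ ℤ.- t) (q*-suc geometric (suc n))

log-oneMinus-q^ : ∀ k → LogDerivative (lambert k) (oneS + - qS ^ suc k)
log-oneMinus-q^ k = begin
  θ (oneS + - qS ^ suc k)          ≈⟨ ≋-trans (θ-+ oneS _) (+-cong (θ-const (+ 1)) (≋-trans (θ-neg _) (-‿cong (≋-trans (θ-cong (≋-sym (dilate-q k)))
                                        (≋-trans (θ-dilate k qS) (*-congˡ (dilate-cong k θ-q))))))) ⟩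
  zeroS + - (const (+ suc k) * dilate k qS)
    ≈⟨ solve-by 4 (λ c d g m → con (+ 0) :- c :* d :≈ (:- c) :* g :* m by (c , m :* g :≈ d) ∷ [])
         (const (+ suc k) ∷ dilate k qS ∷ dilate k geometric ∷ oneS + - qS ^ suc k ∷ []) refl (dilated , tt) ⟩
  - const (+ suc k) * dilate k geometric * (oneS + - qS ^ suc k)
    ≈⟨ *-congʳ (*-congʳ (≋-sym (IntegerHom.ι-neg seriesHom (+ suc k)))) ⟩
  lambert k * (oneS + - qS ^ suc k) ∎
  where
  open ≋-Reasoning
  dilated : (oneS + - qS ^ suc k) * dilate k geometric ≋ dilate k qS
  dilated = ≋-trans (*-congʳ (+-congˡ (-‿cong (≋-sym (dilate-q k))))) (≋-trans
    (≋-sym (dilate-expr k 2 (λ q g → (con (+ 1) :- q) :* g) (qS ∷ geometric ∷ []))) (dilate-cong k geometric-equation))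

lambertSum : ℕ → Series
lambertSum zero    = zeroS
lambertSum (suc N) = lambertSum N + lambert N

log-partialProd : ∀ N → LogDerivative (lambertSum N) (partialProd 1 N)
log-partialProd zero    = log-one
log-partialProd (suc N) = ≋-trans (θ-cong step) (≋-trans (log-* (log-partialProd N) (log-oneMinus-q^ N)) (*-congˡ (≋-sym step)))
  where
  step : partialProd 1 (suc N) ≋ partialProd 1 N * (oneS + - qS ^ suc N)
  step = ≋-trans (partialProd-suc 1 N) (*-congˡ (+-congˡ (-‿cong (≋-reflexive (cong (qS ^_) (ℕₚ.*-identityˡ (suc N)))))))

-- The coefficients are minus the usual divisor sums.
sigma : Series
sigma n = lambertSum n n

lambert-low : ∀ k n → n < suc k → lambert k n ≡ + 0
lambert-low k n n<k = trans (const-* (ℤ.- + suc k) (dilate k geometric) n)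
  (trans (cong (ℤ.- + suc k ℤ.*_) (low n n<k)) (ℤₚ.*-zeroʳ (ℤ.- + suc k)))
  where
  low : ∀ n → n < suc k → dilate k geometric n ≡ + 0
  low zero    _   = dilate-0 k geometric
  low (suc n) n<k = dilate-low k geometric n n<k

lambertSum-at : ∀ N n → n ≤ N → lambertSum N n ≡ sigma n
lambertSum-at zero    zero n≤N = refl
lambertSum-at (suc N) n    n≤N with ℕₚ.m≤n⇒m<n∨m≡n n≤N
... | inj₂ refl       = refl
... | inj₁ (s≤s n≤N′) = trans (+-at (lambertSum N) (lambert N) n)
  (trans (cong₂ ℤ._+_ (lambertSum-at N n n≤N′) (lambert-low N n (s≤s n≤N′))) (ℤₚ.+-identityʳ _))

log-f : LogDerivative sigma (f 1)
log-f = pointwise λ n → begin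
  θ (f 1) n                             ≡⟨ θ-at (f 1) n ⟩
  + n ℤ.* partialProd 1 n n             ≡⟨ sym (θ-at (partialProd 1 n) n) ⟩
  θ (partialProd 1 n) n                 ≡⟨ at (log-partialProd n) n ⟩
  (lambertSum n * partialProd 1 n) n    ≡⟨ *-local n (λ i i≤n → lambertSum-at n i i≤n) (λ i i≤n → partialProd-at 0 n i i≤n) ⟩
  (sigma * f 1) n                       ∎
  where open ≡.≡-Reasoning

opaque
  unfolding dilate
  -- A number prime to 5 divides 5n exactly when it divides n, so restricting to multiples of 5
  -- reproduces the same 0-1 coefficients.
  section-dilate-coprime : ∀ k → Coprime (suc k) 5 → section 0 (dilate k geometric) ≋ dilate k geometric
  section-dilate-coprime k coprime = pointwise λ n → trans (section-at 0 (dilate k geometric) n) (go n)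
    where
    value : ℕ → ℤ
    value n = if n ℕ.% suc k ℕ.≡ᵇ 0 then geometric (n ℕ./ suc k) else + 0
    divides : ∀ n → suc k ∣ suc n → value (suc n) ≡ + 1
    divides n d rewrite n∣m⇒m%n≡0 (suc n) (suc k) d with suc n ℕ./ suc k in eq
    ... | suc _ = refl
    ... | zero  = ⊥-elim (1+n≢0 (trans (sym (DivMod.m/n*n≡m d)) (cong (ℕ._* suc k) eq)))
      where
      1+n≢0 : ¬ (suc n ≡ 0)
      1+n≢0 ()
    avoids : ∀ n → ¬ (suc k ∣ suc n) → value (suc n) ≡ + 0
    avoids n ¬d with suc n ℕ.% suc k in eq
    ... | zero  = ⊥-elim (¬d (m%n≡0⇒n∣m (suc n) (suc k) eq))
    ... | suc _ = refl
    go : ∀ n → dilate k geometric (5 ℕ.* n) ≡ dilate k geometric n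
    go zero    = refl
    go (suc n) with suc k ∣? suc n
    ... | yes d = trans (divides (n ℕ.+ 4 ℕ.* suc n) (∣-trans d (n∣m*n 5))) (sym (divides n d))
    ... | no ¬d = trans (avoids (n ℕ.+ 4 ℕ.* suc n) (λ d → ¬d (coprime-divisor coprime d))) (sym (avoids n ¬d))

dilate-dilate : ∀ d e a → dilate d (dilate e a) ≋ dilate (e ℕ.+ d ℕ.* suc e) a
dilate-dilate d e = expansion-unique (e ℕ.+ d ℕ.* suc e) (dilate d ∘ dilate e) (dilate (e ℕ.+ d ℕ.* suc e))
  (dilate-dilate-head d e) (dilate-head (e ℕ.+ d ℕ.* suc e))

section-const* : ∀ c a → section 0 (const c * a) ≋ const c * section 0 a
section-const* c a = ≋-trans (section-cong 0 (*-congʳ (≋-sym (dilate-const 4 c)))) (section-dilate* 0 (s≤s z≤n) (const c) a)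

section-lambert : ∀ k → Coprime (suc k) 5 → section 0 (lambert k) ≋ lambert k
section-lambert k coprime = ≋-trans (section-const* _ _) (*-congˡ (section-dilate-coprime k coprime))

lambert-5 : ∀ j → lambert (5 ℕ.* j ℕ.+ 4) ≋ const (+ 5) * dilate 4 (lambert j)
lambert-5 j = begin
  const (ℤ.- + suc (5 ℕ.* j ℕ.+ 4)) * dilate (5 ℕ.* j ℕ.+ 4) geometric
    ≈⟨ *-cong (≋-trans (≋-reflexive (cong const coefficient)) (IntegerHom.ι-* seriesHom (+ 5) (ℤ.- + suc j)))
         (≋-trans (≋-reflexive (cong (λ t → dilate t geometric) (index j))) (≋-sym (dilate-dilate 4 j geometric))) ⟩
  const (+ 5) * const (ℤ.- + suc j) * dilate 4 (dilate j geometric)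
    ≈⟨ *-assoc _ _ _ ⟩
  const (+ 5) * (const (ℤ.- + suc j) * dilate 4 (dilate j geometric))
    ≈⟨ *-congˡ (≋-sym (≋-trans (dilate-* 4 _ _) (*-congʳ (dilate-const 4 _)))) ⟩
  const (+ 5) * dilate 4 (lambert j) ∎
  where
  open ≋-Reasoning
  index : ∀ j → 5 ℕ.* j ℕ.+ 4 ≡ j ℕ.+ 4 ℕ.* suc j
  index = solve-∀
  coefficient : ℤ.- + suc (5 ℕ.* j ℕ.+ 4) ≡ + 5 ℤ.* ℤ.- + suc j
  coefficient = trans (cong (λ t → ℤ.- + t) (lemma j)) (trans (cong ℤ.-_ (ℤₚ.pos-* 5 (suc j))) (ℤₚ.neg-distribʳ-* (+ 5) (+ suc j)))
    where
    lemma : ∀ j → suc (5 ℕ.* j ℕ.+ 4) ≡ 5 ℕ.* suc j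
    lemma = solve-∀

divisor-5 : ∀ d → d ∣ 5 → d ≡ 1 ⊎ d ≡ 5
divisor-5 0 p = ⊥-elim (toWitnessFalse {a? = 0 ∣? 5} _ p)
divisor-5 1 p = inj₁ refl
divisor-5 2 p = ⊥-elim (toWitnessFalse {a? = 2 ∣? 5} _ p)
divisor-5 3 p = ⊥-elim (toWitnessFalse {a? = 3 ∣? 5} _ p)
divisor-5 4 p = ⊥-elim (toWitnessFalse {a? = 4 ∣? 5} _ p)
divisor-5 5 p = inj₂ refl
divisor-5 (suc (suc (suc (suc (suc (suc d)))))) p with Divisibility.∣⇒≤ p
... | s≤s (s≤s (s≤s (s≤s (s≤s ()))))

coprime-5 : ∀ j i → suc i < 5 → Coprime (suc (5 ℕ.* j ℕ.+ i)) 5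
coprime-5 j i i<5 {d} (d∣m , d∣5) with divisor-5 d d∣5
... | inj₁ d≡1  = d≡1
... | inj₂ refl = ⊥-elim (ℕₚ.<⇒≱ i<5 (Divisibility.∣⇒≤
  (∣m+n∣m⇒∣n (subst (5 ∣_) (sym (ℕₚ.+-suc (5 ℕ.* j) i)) d∣m) (m∣m*n j))))

-- Terms with d prime to 5 are unchanged by the section. The term of d = 5d′ is 5 times that of d′
-- taken at q⁵, and the section replaces it by 5 times that of d′.
section-lambertSum : ∀ N → section 0 (lambertSum (5 ℕ.* N)) ≋
  lambertSum (5 ℕ.* N) + - (const (+ 5) * dilate 4 (lambertSum N)) + const (+ 5) * lambertSum N
section-lambertSum zero = ≋-trans section-zero (≋-sym (≋-trans (+-congʳ (+-congˡ (-‿cong (*-congˡ dilate-zeroS))))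
  (solve 0 (con (+ 0) :- con (+ 5) :* con (+ 0) :+ con (+ 5) :* con (+ 0) :≈ con (+ 0)) [] refl)))
section-lambertSum (suc N) = begin
  section 0 (lambertSum (5 ℕ.* suc N))  ≡⟨ cong (section 0 ∘ lambertSum) (index N) ⟩
  section 0 (Λ + l 0 + l 1 + l 2 + l 3 + l 4)
    ≈⟨ ≋-trans (section-+ 0 _ _) (+-congʳ (≋-trans (section-+ 0 _ _) (+-congʳ (≋-trans (section-+ 0 _ _) (+-congʳ
         (≋-trans (section-+ 0 _ _) (+-congʳ (section-+ 0 _ _)))))))) ⟩
  section 0 Λ + section 0 (l 0) + section 0 (l 1) + section 0 (l 2) + section 0 (l 3) + section 0 (l 4)
    ≈⟨ +-cong (+-cong (+-cong (+-cong (+-cong (section-lambertSum N) (c 0 2≤)) (c 1 3≤)) (c 2 4≤)) (c 3 5≤)) last ⟩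
  (Λ + - (const (+ 5) * dilate 4 (lambertSum N)) + const (+ 5) * lambertSum N) + l 0 + l 1 + l 2 + l 3 + const (+ 5) * lambert N
    ≈⟨ solve-by 10 (λ L D M a b c d e g h →
         (L :- con (+ 5) :* D :+ con (+ 5) :* M) :+ a :+ b :+ c :+ d :+ con (+ 5) :* g :≈
         (L :+ a :+ b :+ c :+ d :+ e) :- con (+ 5) :* (D :+ h) :+ con (+ 5) :* (M :+ g)
         by (con -[1+ 0 ] , e :≈ con (+ 5) :* h) ∷ [])
       (Λ ∷ dilate 4 (lambertSum N) ∷ lambertSum N ∷ l 0 ∷ l 1 ∷ l 2 ∷ l 3 ∷ l 4 ∷ lambert N ∷ dilate 4 (lambert N) ∷ []) refl
       (l₄ , tt) ⟩
  (Λ + l 0 + l 1 + l 2 + l 3 + l 4) + - (const (+ 5) * (dilate 4 (lambertSum N) + dilate 4 (lambert N))) + const (+ 5) * (lambertSum N + lambert N)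
    ≈⟨ +-congʳ (+-cong (≋-reflexive (cong lambertSum (sym (index N)))) (-‿cong (*-congˡ (≋-sym (dilate-+S 4 _ _))))) ⟩
  lambertSum (5 ℕ.* suc N) + - (const (+ 5) * dilate 4 (lambertSum (suc N))) + const (+ 5) * lambertSum (suc N) ∎
  where
  open ≋-Reasoning
  Λ = lambertSum (5 ℕ.* N)
  l : ℕ → Series
  l i = lambert (i ℕ.+ 5 ℕ.* N)
  index : ∀ N → 5 ℕ.* suc N ≡ 5 ℕ.+ 5 ℕ.* N
  index N = ℕₚ.*-suc 5 N
  2≤ : 1 < 5
  2≤ = s≤s (s≤s z≤n)
  3≤ : 2 < 5
  3≤ = s≤s (s≤s (s≤s z≤n))
  4≤ : 3 < 5
  4≤ = s≤s (s≤s (s≤s (s≤s z≤n)))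
  5≤ : 4 < 5
  5≤ = s≤s (s≤s (s≤s (s≤s (s≤s z≤n))))
  c : ∀ i → suc i < 5 → section 0 (l i) ≋ l i
  c i i<5 = section-lambert (i ℕ.+ 5 ℕ.* N) (subst (λ t → Coprime (suc t) 5) (ℕₚ.+-comm (5 ℕ.* N) i) (coprime-5 N i i<5))
  l₄ : l 4 ≋ const (+ 5) * dilate 4 (lambert N)
  l₄ = ≋-trans (≋-reflexive (cong lambert (ℕₚ.+-comm 4 (5 ℕ.* N)))) (lambert-5 N)
  last : section 0 (l 4) ≋ const (+ 5) * lambert N
  last = ≋-trans (section-cong 0 l₄) (≋-trans (section-const* (+ 5) _) (*-congˡ (section-0-dilate (lambert N))))

section-sigma : section 0 sigma ≋ const (+ 6) * sigma + - (const (+ 5) * dilate 4 sigma)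
section-sigma = pointwise λ n → begin
  section 0 sigma n                       ≡⟨ section-at 0 sigma n ⟩
  sigma (5 ℕ.* n)                         ≡⟨ sym (section-at 0 (lambertSum (5 ℕ.* n)) n) ⟩
  section 0 (lambertSum (5 ℕ.* n)) n      ≡⟨ at (section-lambertSum n) n ⟩
  (lambertSum (5 ℕ.* n) + - (const (+ 5) * dilate 4 (lambertSum n)) + const (+ 5) * lambertSum n) n
    ≡⟨ trans (expand (lambertSum (5 ℕ.* n)) (lambertSum n) n) (trans (cong₂ (λ s t → (s ℤ.+ ℤ.- (+ 5 ℤ.* t)) ℤ.+ + 5 ℤ.* sigma n)
         (lambertSum-at (5 ℕ.* n) n (ℕₚ.m≤n*m n 5)) (dilate-local 4 n (λ i i≤n → lambertSum-at n i i≤n))) (sym (expand sigma sigma n))) ⟩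
  (sigma + - (const (+ 5) * dilate 4 sigma) + const (+ 5) * sigma) n
    ≡⟨ at (solve 2 (λ s d → s :- con (+ 5) :* d :+ con (+ 5) :* s :≈ con (+ 6) :* s :- con (+ 5) :* d) (sigma ∷ dilate 4 sigma ∷ []) refl) n ⟩
  (const (+ 6) * sigma + - (const (+ 5) * dilate 4 sigma)) n ∎
  where
  open ≡.≡-Reasoning
  expand : ∀ a b n → (a + - (const (+ 5) * dilate 4 b) + const (+ 5) * b) n ≡ (a n ℤ.+ ℤ.- (+ 5 ℤ.* dilate 4 b n)) ℤ.+ + 5 ℤ.* b n
  expand a b n = trans (+-at _ _ n) (cong₂ ℤ._+_ (trans (+-at a _ n) (cong (λ t → a n ℤ.+ t) (trans (neg-at _ n) (cong ℤ.-_ (const-* (+ 5) (dilate 4 b) n)))))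
    (const-* (+ 5) b n))

-- The norm of the 5-dissection of f₁, f₅⁶/(q⁵ f₂₅⁶) = R⁻⁵ - 11 - R⁵: both sides have the same logarithmic derivative,
-- because Σ σ(5n) qⁿ = 6 Σ σ(n) qⁿ - 5 Σ σ(n) q⁵ⁿ.

ratio⁵ : Series
ratio⁵ = qS * ratio ^ 5

normForm : Series → Series
normForm x = oneS + - (const (+ 11) * x) + - x ^ 2

log-q : LogDerivative oneS qS
log-q = ≋-trans θ-q (≋-sym (*-identityˡ qS))

private
  ω Ω λ₅ : Series
  ω  = θ ratio * inv ratio
  Ω  = oneS + const (+ 5) * ω
  λ₅ = dilate 4 sigma

  log-ratio : LogDerivative ω ratio
  log-ratio = solve-by 3 (λ t r i → t :≈ t :* i :* r by (:- t , r :* i :≈ con (+ 1)) ∷ []) (θ ratio ∷ ratio ∷ inv ratio ∷ []) refl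
    (inverse ratio-1 , tt)

  log-ratio⁵ : LogDerivative Ω ratio⁵
  log-ratio⁵ = log-* log-q (log-^ log-ratio 5)

  log-R₅ : LogDerivative (dilate 4 Ω) R₅
  log-R₅ = ≋-trans (log-* log-q (log-dilate 4 log-ratio)) (*-congʳ (≋-sym
    (dilate-expr 4 1 (λ w → con (+ 1) :+ con (+ 5) :* w) (ω ∷ []))))

  log-f5 : LogDerivative (const (+ 5) * λ₅) (f 5)
  log-f5 = ≋-trans (θ-cong (≋-sym (f-dilate 4 0))) (≋-trans (log-dilate 4 log-f) (*-congˡ (f-dilate 4 0)))

  log-f25 : LogDerivative (const (+ 5) * dilate 4 (const (+ 5) * λ₅)) (f 25)
  log-f25 = ≋-trans (θ-cong (≋-sym (f-dilate 4 4))) (≋-trans (log-dilate 4 log-f5) (*-congˡ (f-dilate 4 4)))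

  L₂₅ : Series
  L₂₅ = const (+ 5) * dilate 4 (const (+ 5) * λ₅)

  θ-A : θ (oneS + - R₅ + - R₅ ^ 2) ≋ - (dilate 4 Ω * R₅) + - (const (+ 2) * dilate 4 Ω * R₅ ^ 2)
  θ-A = ≋-trans (θ-+ _ _) (≋-trans (+-cong (≋-trans (θ-+ _ _) (+-cong (θ-const (+ 1)) (≋-trans (θ-neg R₅) (-‿cong log-R₅))))
    (≋-trans (θ-neg (R₅ ^ 2)) (-‿cong (log-^ log-R₅ 2)))) (+-congʳ (+-identityˡ _)))

  differentiated : (sigma + dilate 4 Ω) * (f 1 * R₅) ≋ (oneS + L₂₅) * (qS * f 25) * (oneS + - R₅ + - R₅ ^ 2)
                   + qS * f 25 * (- (dilate 4 Ω * R₅) + - (const (+ 2) * dilate 4 Ω * R₅ ^ 2))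
  differentiated = ≋-trans (≋-sym (log-* log-f log-R₅)) (≋-trans (θ-cong f1*R₅) (≋-trans (θ-* _ _)
    (+-cong (*-congʳ (log-* log-q log-f25)) (*-congˡ θ-A))))

  -- (1 - 11R⁵ - R¹⁰)/(1 - R - R²)
  cofactor : ∀ {n} → Expr n → Expr n
  cofactor R = con (+ 1) :+ R :* (con (+ 1) :+ R :* (con (+ 2) :+ R :* (con (+ 3) :+ R :* (con (+ 5) :+
    R :* (con -[1+ 2 ] :+ R :* (con (+ 2) :+ R :* (con -[1+ 0 ] :+ R)))))))

  regular-qf25 : Regular (qS * f 25)
  regular-qf25 = regular-* regular-q (regular-1 refl)

  W : Series
  W = Ω + - oneS + - (const (+ 25) * λ₅)

  -- The logarithmic derivative of `f1*R₅` has denominator 1 - R - R². Multiplying by `cofactor`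
  -- replaces it by the norm form, a series in q⁵, so that section 0 becomes applicable; `W` gathers
  -- the summands which are series in q⁵ already.
  rational : normForm (R₅ ^ 5) * (sigma + dilate 4 W) ≋ - (dilate 4 Ω * ((R₅ + const (+ 2) * R₅ ^ 2) * ⟦ cofactor (var zero) ⟧ (R₅ ∷ [])))
  rational = regular-qf25 _ _ (solve-by 8 (λ q F f R s o L w → let A′ = cofactor R in
      (q :* F) :* ((con (+ 1) :- con (+ 11) :* R :^ 5 :- (R :^ 5) :^ 2) :* (s :+ w)) :≈
      (q :* F) :* (:- (o :* ((R :+ con (+ 2) :* R :^ 2) :* A′)))
      by (A′ , (s :+ o) :* (f :* R) :≈ (con (+ 1) :+ L) :* (q :* F) :* (con (+ 1) :- R :- R :^ 2) :+
                q :* F :* (:- (o :* R) :- con (+ 2) :* o :* R :^ 2))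
       ∷ (:- (A′ :* (s :+ o)) , f :* R :≈ q :* F :* (con (+ 1) :- R :- R :^ 2))
       ∷ ((q :* F) :* (con (+ 1) :- con (+ 11) :* R :^ 5 :- (R :^ 5) :^ 2) , w :≈ o :- con (+ 1) :- L) ∷ [])
    (qS ∷ f 25 ∷ f 1 ∷ R₅ ∷ sigma ∷ dilate 4 Ω ∷ L₂₅ ∷ dilate 4 W ∷ []) refl (differentiated , f1*R₅ , dilated , tt))
    where
    dilated : dilate 4 W ≋ dilate 4 Ω + - oneS + - L₂₅
    dilated = ≋-trans (dilate-expr 4 2 (λ o l → o :- con (+ 1) :- con (+ 25) :* l) (Ω ∷ λ₅ ∷ []))
      (+-congˡ (-‿cong (≋-trans (solve 1 (λ l → con (+ 25) :* l :≈ con (+ 5) :* (con (+ 5) :* l)) (dilate 4 λ₅ ∷ []) refl)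
        (*-congˡ (≋-sym (≋-trans (dilate-* 4 (const (+ 5)) λ₅) (*-congʳ (dilate-const 4 (+ 5)))))))))

  R₅⁵ : R₅ ^ 5 ≋ dilate 4 ratio⁵
  R₅⁵ = ≋-trans (solve 2 (λ q r → (q :* r) :^ 5 :≈ q :^ 5 :* r :^ 5) (qS ∷ dilate 4 ratio ∷ []) refl)
    (≋-sym (≋-trans (dilate-* 4 qS (ratio ^ 5)) (*-cong (dilate-q 4) (dilate-^ 4 ratio 5))))

  normForm-dilate : ∀ x → dilate 4 (normForm x) ≋ normForm (dilate 4 x)
  normForm-dilate x = dilate-expr 4 1 (λ x → con (+ 1) :- con (+ 11) :* x :- x :^ 2) (x ∷ [])

  normForm-cong : ∀ {x y} → x ≋ y → normForm x ≋ normForm y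
  normForm-cong p = +-cong (+-congˡ (-‿cong (*-congˡ p))) (-‿cong (^-cong p 2))

  numerator : (R₅ + const (+ 2) * R₅ ^ 2) * ⟦ cofactor (var zero) ⟧ (R₅ ∷ []) ≋
    dissection (const (+ 11) * ratio⁵ + const (+ 2) * ratio⁵ ^ 2) (ratio * (oneS + const (+ 7) * ratio⁵))
      (ratio ^ 2 * (const (+ 3) + - (const (+ 4) * ratio⁵))) (ratio ^ 3 * (const (+ 4) + const (+ 3) * ratio⁵))
      (ratio ^ 4 * (const (+ 7) + - ratio⁵))
  numerator = ≋-trans
    (solve-by 3 (λ q r z → let R = q :* r in
        (R :+ con (+ 2) :* R :^ 2) :* cofactor R :≈
        (con (+ 11) :* z :+ con (+ 2) :* z :^ 2) :+ q :* (r :* (con (+ 1) :+ con (+ 7) :* z) :+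
          q :* (r :^ 2 :* (con (+ 3) :- con (+ 4) :* z) :+ q :* (r :^ 3 :* (con (+ 4) :+ con (+ 3) :* z) :+ q :* (r :^ 4 :* (con (+ 7) :- z)))))
        by (con (+ 11) :+ con (+ 2) :* (R :^ 5 :+ z) :+ con (+ 7) :* R :- con (+ 4) :* R :^ 2 :+ con (+ 3) :* R :^ 3 :- R :^ 4
           , R :^ 5 :≈ z) ∷ [])
      (qS ∷ dilate 4 ratio ∷ dilate 4 ratio⁵ ∷ []) refl (R₅⁵ , tt))
    (≋-sym (+-cong
      (dilate-expr 4 1 (λ z → con (+ 11) :* z :+ con (+ 2) :* z :^ 2) (ratio⁵ ∷ []))
      (*-congˡ (+-cong (dilate-expr 4 2 (λ r z → r :* (con (+ 1) :+ con (+ 7) :* z)) (ratio ∷ ratio⁵ ∷ []))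
      (*-congˡ (+-cong (dilate-expr 4 2 (λ r z → r :^ 2 :* (con (+ 3) :- con (+ 4) :* z)) (ratio ∷ ratio⁵ ∷ []))
      (*-congˡ (+-cong (dilate-expr 4 2 (λ r z → r :^ 3 :* (con (+ 4) :+ con (+ 3) :* z)) (ratio ∷ ratio⁵ ∷ []))
      (*-congˡ (dilate-expr 4 2 (λ r z → r :^ 4 :* (con (+ 7) :- z)) (ratio ∷ ratio⁵ ∷ [])))))))))))

  sections : normForm ratio⁵ * ((const (+ 6) * sigma + - (const (+ 5) * λ₅)) + W) ≋
             - (Ω * (const (+ 11) * ratio⁵ + const (+ 2) * ratio⁵ ^ 2))
  sections = begin
    normForm ratio⁵ * ((const (+ 6) * sigma + - (const (+ 5) * λ₅)) + W)
      ≈⟨ *-congˡ (≋-sym (≋-trans (section-+ 0 sigma (dilate 4 W)) (+-cong section-sigma (section-0-dilate W)))) ⟩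
    normForm ratio⁵ * section 0 (sigma + dilate 4 W)
      ≈⟨ ≋-sym (section-dilate* 0 (s≤s z≤n) (normForm ratio⁵) (sigma + dilate 4 W)) ⟩
    section 0 (dilate 4 (normForm ratio⁵) * (sigma + dilate 4 W))
      ≈⟨ section-cong 0 (*-congʳ (≋-trans (normForm-dilate ratio⁵) (normForm-cong (≋-sym R₅⁵)))) ⟩
    section 0 (normForm (R₅ ^ 5) * (sigma + dilate 4 W)) ≈⟨ section-cong 0 rational ⟩
    section 0 (- (dilate 4 Ω * ((R₅ + const (+ 2) * R₅ ^ 2) * ⟦ cofactor (var zero) ⟧ (R₅ ∷ []))))
      ≈⟨ ≋-trans (section-neg 0 _) (-‿cong (≋-trans (section-dilate* 0 (s≤s z≤n) Ω _)
           (*-congˡ (≋-trans (section-cong 0 numerator) (section-0-dissection _ _ _ _ _))))) ⟩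
    - (Ω * (const (+ 11) * ratio⁵ + const (+ 2) * ratio⁵ ^ 2)) ∎
    where open ≋-Reasoning

  θ-normForm : θ (normForm ratio⁵) ≋ - (const (+ 11) * (Ω * ratio⁵)) + - (const (+ 2) * Ω * ratio⁵ ^ 2)
  θ-normForm = ≋-trans (θ-+ _ _) (≋-trans (+-cong (≋-trans (θ-+ _ _) (+-cong (θ-const (+ 1)) (≋-trans (θ-neg _) (-‿cong
      (≋-trans (θ-* _ _) (≋-trans (+-cong (≋-trans (*-congʳ (θ-const (+ 11))) (zeroˡ _)) (*-congˡ log-ratio⁵)) (+-identityˡ _)))))))
      (≋-trans (θ-neg (ratio⁵ ^ 2)) (-‿cong (log-^ log-ratio⁵ 2)))) (+-congʳ (+-identityˡ _)))

normForm-ϱ-1 : normForm ratio⁵ 0 ≡ + 1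
normForm-ϱ-1 = trans (at (solve 2 (λ q r → let z = q :* r :^ 5 in con (+ 1) :- con (+ 11) :* z :- z :^ 2 :≈
                 con (+ 1) :+ q :* (:- (con (+ 11) :* r :^ 5) :- q :* (r :^ 5) :^ 2)) (qS ∷ ratio ∷ []) refl) 0)
    (trans (+-at oneS _ 0) (cong (λ t → + 1 ℤ.+ t) (q*-zero _)))

norm : f 5 ^ 6 * normForm ratio⁵ ≋ ratio ^ 5 * f 1 ^ 6
norm = log-unique (*-head-1 {f 5 ^ 6} (^-head {f 5} refl 6) normForm-ϱ-1) (*-head-1 {ratio ^ 5} (^-head ratio-1 5) (^-head {f 1} refl 6)) equation
  where
  equation : θ (f 5 ^ 6 * normForm ratio⁵) * (ratio ^ 5 * f 1 ^ 6) ≋ (f 5 ^ 6 * normForm ratio⁵) * θ (ratio ^ 5 * f 1 ^ 6)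
  equation = ≋-trans
    (*-congʳ (≋-trans (θ-* _ _) (+-cong (*-congʳ (log-^ log-f5 6)) (*-congˡ θ-normForm))))
    -- The logarithmic derivatives agree because 30λ₅ + (6σ - 5λ₅ + W) = 6σ + 5ω, where W = Ω - 1 -
    -- 25λ₅ and Ω = 1 + 5ω.
    (≋-trans (solve-by 8 (λ F T D w s l z n →
        ((con (+ 6) :* (con (+ 5) :* l)) :* F :* n :+ F :* (:- (con (+ 11) :* ((con (+ 1) :+ con (+ 5) :* w) :* z)) :- con (+ 2) :* (con (+ 1) :+ con (+ 5) :* w) :* z :^ 2)) :* T :≈
        F :* n :* ((con (+ 5) :* w :+ con (+ 6) :* s) :* T)
        by (:- (F :* T) , n :* ((con (+ 6) :* s :- con (+ 5) :* l) :+ ((con (+ 1) :+ con (+ 5) :* w) :- con (+ 1) :- con (+ 25) :* l)) :≈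
             :- ((con (+ 1) :+ con (+ 5) :* w) :* (con (+ 11) :* z :+ con (+ 2) :* z :^ 2))) ∷ [])
      (f 5 ^ 6 ∷ ratio ^ 5 * f 1 ^ 6 ∷ oneS ∷ ω ∷ sigma ∷ λ₅ ∷ ratio⁵ ∷ normForm ratio⁵ ∷ []) refl (sections , tt))
    (*-congˡ (≋-sym (log-* (log-^ log-ratio 5) (log-^ log-f 6)))))

-- The eta quotients of level 10 in terms of k = q r s²

private
  r₁ k₁ k : Series
  r₁ = ratio
  k₁ = r₁ * s₁ ^ 2
  k  = qS * k₁

  s₁-1 : s₁ 0 ≡ + 1
  s₁-1 = trans (dilate-0 1 ratio) ratio-1

  k₁-1 : k₁ 0 ≡ + 1
  k₁-1 = *-head-1 {r₁} {s₁ ^ 2} ratio-1 (^-head s₁-1 2)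

p₁ p₂ : Series → Series
p₁ x = oneS + - (const (+ 4) * x) + - x ^ 2
p₂ x = oneS + x + - x ^ 2

private
  head-oneMinus : ∀ {x y} → x ≋ oneS + qS * y → x 0 ≡ + 1
  head-oneMinus {x} {y} p = trans (at p 0) (trans (+-at oneS (qS * y) 0) (cong (λ t → + 1 ℤ.+ t) (q*-zero y)))

  p₁-1 : ∀ y → p₁ (qS * y) 0 ≡ + 1
  p₁-1 y = head-oneMinus (solve 2 (λ q y → con (+ 1) :- con (+ 4) :* (q :* y) :- (q :* y) :^ 2 :≈ con (+ 1) :+ q :* (:- (con (+ 4) :* y) :- q :* y :^ 2)) (qS ∷ y ∷ []) refl)

  p₂-1 : ∀ y → p₂ (qS * y) 0 ≡ + 1
  p₂-1 y = head-oneMinus (solve 2 (λ q y → con (+ 1) :+ (q :* y) :- (q :* y) :^ 2 :≈ con (+ 1) :+ q :* (y :- q :* y :^ 2)) (qS ∷ y ∷ []) refl)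

  1+k-1 : (oneS + k) 0 ≡ + 1
  1+k-1 = head-oneMinus {y = k₁} ≋-refl

  1-k-1 : (oneS + - k) 0 ≡ + 1
  1-k-1 = head-oneMinus (solve 2 (λ q k → con (+ 1) :- q :* k :≈ con (+ 1) :+ q :* (:- k)) (qS ∷ k₁ ∷ []) refl)

  s₁-r₁ : s₁ * (oneS + - k) ≋ r₁ ^ 2 * (oneS + k)
  s₁-r₁ = solve-by 3 (λ q r s → let k = q :* (r :* s :^ 2) in s :* (con (+ 1) :- k) :≈ r :^ 2 :* (con (+ 1) :+ k)
    by (con (+ 1) , s :≈ r :^ 2 :+ q :* r :* s :^ 2 :* (s :+ r :^ 2)) ∷ []) (qS ∷ r₁ ∷ s₁ ∷ []) refl (ratio-equation , tt)

  ϱ ς : Series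
  ϱ = ratio⁵
  ς = qS ^ 2 * s₁ ^ 5

  -- Ramanujan's R(q)⁵ = k((1 - k)/(1 + k))²; its companion `ς-k` is R(q²)⁵ = k²(1 + k)/(1 - k).
  -- Both follow from `s₁-r₁` and k = q r s².
  ϱ-k : ϱ * (oneS + k) ^ 2 ≋ k * (oneS + - k) ^ 2
  ϱ-k = solve-by 4 (λ q r s k → q :* r :^ 5 :* (con (+ 1) :+ k) :^ 2 :≈ k :* (con (+ 1) :- k) :^ 2
    by (:- (q :* r) :* (s :* (con (+ 1) :- k) :+ r :^ 2 :* (con (+ 1) :+ k)) , s :* (con (+ 1) :- k) :≈ r :^ 2 :* (con (+ 1) :+ k))
     ∷ (:- ((con (+ 1) :- k) :^ 2) , k :≈ q :* (r :* s :^ 2)) ∷ [])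
    (qS ∷ r₁ ∷ s₁ ∷ k ∷ []) refl (s₁-r₁ , ≋-refl , tt)

  ς-k : ς * (oneS + - k) ≋ k ^ 2 * (oneS + k)
  ς-k = solve-by 4 (λ q r s k → q :^ 2 :* s :^ 5 :* (con (+ 1) :- k) :≈ k :^ 2 :* (con (+ 1) :+ k)
    by (q :^ 2 :* s :^ 4 , s :* (con (+ 1) :- k) :≈ r :^ 2 :* (con (+ 1) :+ k))
     ∷ (:- ((k :+ q :* (r :* s :^ 2)) :* (con (+ 1) :+ k)) , k :≈ q :* (r :* s :^ 2)) ∷ [])
    (qS ∷ r₁ ∷ s₁ ∷ k ∷ []) refl (s₁-r₁ , ≋-refl , tt)

  normForm-ϱ : normForm ϱ * (oneS + k) ^ 4 ≋ p₁ k ^ 2 * p₂ k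
  normForm-ϱ = solve-by 2 (λ x k → (con (+ 1) :- con (+ 11) :* x :- x :^ 2) :* (con (+ 1) :+ k) :^ 4 :≈
      (con (+ 1) :- con (+ 4) :* k :- k :^ 2) :^ 2 :* (con (+ 1) :+ k :- k :^ 2)
    by (:- (con (+ 11) :* (con (+ 1) :+ k) :^ 2) :- x :* (con (+ 1) :+ k) :^ 2 :- k :* (con (+ 1) :- k) :^ 2
       , x :* (con (+ 1) :+ k) :^ 2 :≈ k :* (con (+ 1) :- k) :^ 2) ∷ [])
    (ϱ ∷ k ∷ []) refl (ϱ-k , tt)

  normForm-ς : normForm ς * (oneS + - k) ^ 2 ≋ p₁ k * p₂ k ^ 2
  normForm-ς = solve-by 2 (λ x k → (con (+ 1) :- con (+ 11) :* x :- x :^ 2) :* (con (+ 1) :- k) :^ 2 :≈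
      (con (+ 1) :- con (+ 4) :* k :- k :^ 2) :* (con (+ 1) :+ k :- k :^ 2) :^ 2
    by (:- (con (+ 11) :* (con (+ 1) :- k)) :- x :* (con (+ 1) :- k) :- k :^ 2 :* (con (+ 1) :+ k)
       , x :* (con (+ 1) :- k) :≈ k :^ 2 :* (con (+ 1) :+ k)) ∷ [])
    (ς ∷ k ∷ []) refl (ς-k , tt)

  norm₂ : f 10 ^ 6 * normForm ς ≋ s₁ ^ 5 * f 2 ^ 6
  norm₂ = ≋-trans (≋-sym (≋-trans (dilate-expr 1 3 (λ F q r → let z = q :* r :^ 5 in F :^ 6 :* (con (+ 1) :- con (+ 11) :* z :- z :^ 2)) (f 5 ∷ qS ∷ ratio ∷ []))
      (*-cong (^-cong (f-dilate 1 4) 6) (+-cong (+-congˡ (-‿cong (*-congˡ ς≋))) (-‿cong (^-cong ς≋ 2))))))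
    (≋-trans (dilate-cong 1 norm) (≋-trans (dilate-expr 1 2 (λ r F → r :^ 5 :* F :^ 6) (ratio ∷ f 1 ∷ [])) (*-congˡ (^-cong (f-dilate 1 0) 6))))
    where
    ς≋ : dilate 1 qS * s₁ ^ 5 ≋ ς
    ς≋ = *-congʳ (dilate-q 1)

private
  normForm-ς-1 : normForm ς 0 ≡ + 1
  normForm-ς-1 = head-oneMinus (solve 2 (λ q r → let z = q :^ 2 :* r :^ 5 in con (+ 1) :- con (+ 11) :* z :- z :^ 2 :≈
    con (+ 1) :+ q :* (:- (con (+ 11) :* q :* r :^ 5) :- q :* (q :* r :^ 5) :^ 2)) (qS ∷ s₁ ∷ []) refl)

three≢0 : ¬ (const (+ 3) 0 ≡ + 0)
three≢0 ()

-- The cofactor a² + ab + b² of a - b in a³ - b³ has constant term 3, hence is regular. Cubes are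
-- taken because the norm formulas contain the f_r only to the sixth power.
cube-root : ∀ {a b} → a 0 ≡ + 1 → b 0 ≡ + 1 → a ^ 3 ≋ b ^ 3 → a ≋ b
cube-root {a} {b} a₀ b₀ h = regular-head nonzero a b
  (solve-by 2 (λ a b → (a :^ 2 :+ a :* b :+ b :^ 2) :* a :≈ (a :^ 2 :+ a :* b :+ b :^ 2) :* b by (con (+ 1) , a :^ 3 :≈ b :^ 3) ∷ [])
    (a ∷ b ∷ []) refl (h , tt))
  where
  value : (a ^ 2 + a * b + b ^ 2) 0 ≡ + 3
  value = trans (+-at (a ^ 2 + a * b) (b ^ 2) 0) (cong₂ ℤ._+_
    (trans (+-at (a ^ 2) (a * b) 0) (cong₂ ℤ._+_ (^-head a₀ 2) (*-head-1 {a} {b} a₀ b₀))) (^-head b₀ 2))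
  nonzero : ¬ ((a ^ 2 + a * b + b ^ 2) 0 ≡ + 0)
  nonzero z = three≢0 (trans (sym value) z)

-- f₁² f₁₀⁴ / (f₂⁴ f₅²) = k/(q (1 + k - k²)); both sides are determined by their cubes.
eta-u : f 1 ^ 2 * f 10 ^ 4 * p₂ k ≋ k₁ * (f 2 ^ 4 * f 5 ^ 2)
eta-u = cube-root
  (*-head-1 {f 1 ^ 2 * f 10 ^ 4} (*-head-1 {f 1 ^ 2} (^-head {f 1} refl 2) (^-head {f 10} refl 4)) (p₂-1 k₁))
  (*-head-1 {k₁} k₁-1 (*-head-1 {f 2 ^ 4} (^-head {f 2} refl 4) (^-head {f 5} refl 2)))
  (regular-* (regular-^ (regular-1 ratio-1) 5) (regular-* (regular-^ (regular-1 1+k-1) 4) (regular-^ (regular-1 normForm-ς-1) 2)) _ _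
    (solve-by 12 (λ a b c d r s g h P X Y e →
      (r :^ 5 :* (g :^ 4 :* Y :^ 2)) :* (a :^ 2 :* d :^ 4 :* P) :^ 3 :≈
      (r :^ 5 :* (g :^ 4 :* Y :^ 2)) :* ((r :* s :^ 2) :* (b :^ 4 :* c :^ 2)) :^ 3
      by (:- (g :^ 4 :* Y :^ 2 :* d :^ 12 :* P :^ 3) , c :^ 6 :* X :≈ r :^ 5 :* a :^ 6)
       ∷ (c :^ 6 :* X :* P :^ 3 :* g :^ 4 :* (d :^ 6 :* Y :+ s :^ 5 :* b :^ 6) , d :^ 6 :* Y :≈ s :^ 5 :* b :^ 6)
       ∷ (c :^ 6 :* s :^ 10 :* b :^ 12 :* P :^ 3 , X :* g :^ 4 :≈ e :^ 2 :* P)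
       ∷ (c :^ 6 :* s :^ 6 :* b :^ 12 :* Y :^ 2 :* (s :* h :+ r :^ 2 :* g) :* ((s :* h) :^ 2 :+ (r :^ 2 :* g) :^ 2) , s :* h :≈ r :^ 2 :* g)
       ∷ (:- (c :^ 6 :* s :^ 10 :* b :^ 12 :* (Y :* h :^ 2 :+ e :* P :^ 2)) , Y :* h :^ 2 :≈ e :* P :^ 2) ∷ [])
    (f 1 ∷ f 2 ∷ f 5 ∷ f 10 ∷ r₁ ∷ s₁ ∷ oneS + k ∷ oneS + - k ∷ p₂ k ∷ normForm ϱ ∷ normForm ς ∷ p₁ k ∷ []) refl
    (norm , norm₂ , normForm-ϱ , s₁-r₁ , normForm-ς , tt)))

-- f₅² f₁₀² / (f₁² f₂²) = k (1 - k²)/(q (1 - 4k - k²)(1 + k - k²)), by the same argument.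
eta-w : f 5 ^ 2 * f 10 ^ 2 * (p₁ k * p₂ k) ≋ k₁ * ((oneS + k) * (oneS + - k)) * (f 1 ^ 2 * f 2 ^ 2)
eta-w = cube-root
  (*-head-1 {f 5 ^ 2 * f 10 ^ 2} (*-head-1 {f 5 ^ 2} (^-head {f 5} refl 2) (^-head {f 10} refl 2)) (*-head-1 {p₁ k} (p₁-1 k₁) (p₂-1 k₁)))
  (*-head-1 {k₁ * ((oneS + k) * (oneS + - k))} (*-head-1 {k₁} k₁-1 (*-head-1 {oneS + k} 1+k-1 1-k-1))
    (*-head-1 {f 1 ^ 2} (^-head {f 1} refl 2) (^-head {f 2} refl 2)))
  (regular-* (regular-* (regular-1 normForm-ϱ-1) (regular-1 normForm-ς-1))
    (regular-* (regular-^ (regular-1 1+k-1) 4) (regular-^ (regular-1 1-k-1) 2)) _ _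
    (solve-by 12 (λ a b c d r s g h P X Y e →
      (X :* Y :* (g :^ 4 :* h :^ 2)) :* (c :^ 2 :* d :^ 2 :* (e :* P)) :^ 3 :≈
      (X :* Y :* (g :^ 4 :* h :^ 2)) :* ((r :* s :^ 2) :* (g :* h) :* (a :^ 2 :* b :^ 2)) :^ 3
      by (d :^ 6 :* Y :* g :^ 4 :* h :^ 2 :* e :^ 3 :* P :^ 3 , c :^ 6 :* X :≈ r :^ 5 :* a :^ 6)
       ∷ (r :^ 5 :* a :^ 6 :* g :^ 4 :* h :^ 2 :* e :^ 3 :* P :^ 3 , d :^ 6 :* Y :≈ s :^ 5 :* b :^ 6)
       ∷ (:- (r :^ 3 :* s :^ 6 :* g :^ 3 :* h :^ 3 :* a :^ 6 :* b :^ 6 :* Y :* h :^ 2) , X :* g :^ 4 :≈ e :^ 2 :* P)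
       ∷ (:- (r :^ 3 :* s :^ 5 :* a :^ 6 :* b :^ 6 :* g :^ 3 :* h :^ 2 :* e :^ 3 :* P :^ 3) , s :* h :≈ r :^ 2 :* g)
       ∷ (:- (r :^ 3 :* s :^ 6 :* g :^ 3 :* h :^ 3 :* a :^ 6 :* b :^ 6 :* e :^ 2 :* P) , Y :* h :^ 2 :≈ e :* P :^ 2) ∷ [])
    (f 1 ∷ f 2 ∷ f 5 ∷ f 10 ∷ r₁ ∷ s₁ ∷ oneS + k ∷ oneS + - k ∷ p₂ k ∷ normForm ϱ ∷ normForm ς ∷ p₁ k ∷ []) refl
    (norm , norm₂ , normForm-ϱ , s₁-r₁ , normForm-ς , tt)))

-- The Hauptmodul x, first defined through k; that it is the given eta quotient is shown by descent along q ↦ q⁵.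

private
  x₁ : Series
  x₁ = k₁ * inv (p₁ k)

  x₁-1 : x₁ 0 ≡ + 1
  x₁-1 = *-head-1 {k₁} {inv (p₁ k)} k₁-1 refl

hauptmodul : Series
hauptmodul = qS * x₁

hauptmodul-p₁ : hauptmodul * p₁ k ≋ k
hauptmodul-p₁ = solve-by 4 (λ q k P i → q :* (k :* i) :* P :≈ q :* k by (q :* k , P :* i :≈ con (+ 1)) ∷ [])
  (qS ∷ k₁ ∷ p₁ k ∷ inv (p₁ k) ∷ []) refl (inverse (p₁-1 k₁) , tt)

A₅ B₅ K X Z : Series
A₅ = oneS + - R₅ + - R₅ ^ 2
B₅ = oneS + - S₅ + - S₅ ^ 2
K  = R₅ * S₅ ^ 2
X  = dilate 4 hauptmodul
Z  = oneS + const (+ 5) * X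

private
  K≋ : K ≋ dilate 4 k
  K≋ = ≋-trans (solve 3 (λ q r s → (q :* r) :* (q :^ 2 :* s) :^ 2 :≈ q :^ 5 :* (r :* s :^ 2)) (qS ∷ dilate 4 ratio ∷ dilate 4 s₁ ∷ []) refl)
    (≋-sym (≋-trans (dilate-expr 4 3 (λ q r s → q :* (r :* s :^ 2)) (qS ∷ r₁ ∷ s₁ ∷ [])) (*-congʳ (dilate-q 4))))

  X-p₁ : X * p₁ K ≋ K
  X-p₁ = ≋-trans (*-congˡ (+-cong (+-congˡ (-‿cong (*-congˡ K≋))) (-‿cong (^-cong K≋ 2)))) (≋-trans
    (≋-sym (dilate-expr 4 2 (λ x k → x :* (con (+ 1) :- con (+ 4) :* k :- k :^ 2)) (hauptmodul ∷ k ∷ [])))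
    (≋-trans (dilate-cong 4 hauptmodul-p₁) (≋-sym K≋)))

  regular-p₁K : Regular (p₁ K)
  regular-p₁K = regular-1 (head-oneMinus (solve 3 (λ q r s → let k = (q :* r) :* (q :^ 2 :* s) :^ 2 ; l = q :^ 4 :* (r :* s :^ 2) in
    con (+ 1) :- con (+ 4) :* k :- k :^ 2 :≈ con (+ 1) :+ q :* (:- (con (+ 4) :* l) :- q :* l :^ 2)) (qS ∷ dilate 4 ratio ∷ dilate 4 s₁ ∷ []) refl))

  regular-S₅ : Regular S₅
  regular-S₅ = regular-* (regular-^ regular-q 2) (regular-1 (trans (dilate-0 4 s₁) s₁-1))

  regular-R₅ : Regular R₅
  regular-R₅ = regular-* regular-q (regular-1 (trans (dilate-0 4 ratio) ratio-1))

  A₅-1 : A₅ 0 ≡ + 1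
  A₅-1 = head-oneMinus (solve 2 (λ q r → con (+ 1) :- q :* r :- (q :* r) :^ 2 :≈ con (+ 1) :+ q :* (:- r :- q :* r :^ 2)) (qS ∷ dilate 4 ratio ∷ []) refl)

  -- The two quartic relations between a = A₅/R₅ = f₁/(q f₂₅) and b = B₅/S₅ = f₂/(q² f₅₀):
  -- (1 + 4X) a⁴ = b (b - 4 Z a) and X b⁴ = a (Z a + b).
  quartic₁ : (oneS + const (+ 4) * X) * A₅ ^ 4 * S₅ ^ 2 ≋ R₅ ^ 3 * B₅ * (B₅ * R₅ + - (const (+ 4) * Z * A₅ * S₅))
  quartic₁ = regular-p₁K _ _ (solve-by 3 (λ R S X → let K = R :* S :^ 2 ; P = con (+ 1) :- con (+ 4) :* K :- K :^ 2 ; A = con (+ 1) :- R :- R :^ 2 ; B = con (+ 1) :- S :- S :^ 2 in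
      P :* ((con (+ 1) :+ con (+ 4) :* X) :* A :^ 4 :* S :^ 2) :≈
      P :* (R :^ 3 :* B :* (B :* R :- con (+ 4) :* (con (+ 1) :+ con (+ 5) :* X) :* A :* S))
      by (con (+ 4) :* A :^ 4 :* S :^ 2 :+ con (+ 20) :* R :^ 3 :* B :* A :* S , X :* P :≈ K)
       ∷ (con (+ 1) :* S :^ 1 :+ con -[1+ 3 ] :* R :^ 1 :* S :^ 1 :+ con (+ 1) :* R :^ 1 :* S :^ 3 :+
      con (+ 1) :* R :^ 2 :+ con (+ 2) :* R :^ 2 :* S :^ 1 :+ con -[1+ 3 ] :* R :^ 2 :* S :^ 3 :+
      con (+ 4) :* R :^ 3 :* S :^ 1 :+ con -[1+ 0 ] :* R :^ 3 :* S :^ 2 :+ con (+ 2) :* R :^ 3 :* S :^ 3 :+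
      con -[1+ 1 ] :* R :^ 4 :* S :^ 2 :+ con -[1+ 0 ] :* R :^ 4 :* S :^ 3 :+ con -[1+ 3 ] :* R :^ 4 :* S :^ 4 :+
      con -[1+ 3 ] :* R :^ 5 :* S :^ 2 :+ con (+ 2) :* R :^ 5 :* S :^ 4 :+ con -[1+ 0 ] :* R :^ 5 :* S :^ 5 :+
      con -[1+ 0 ] :* R :^ 6 :* S :^ 2 :+ con (+ 4) :* R :^ 6 :* S :^ 4 :+ con (+ 1) :* R :^ 7 :* S :^ 4 , S :- R :^ 2 :≈ R :* S :^ 2 :* (S :+ R :^ 2)) ∷ [])
    (R₅ ∷ S₅ ∷ X ∷ []) refl (X-p₁ , R₅-S₅ , tt))

  quartic₂ : X * B₅ ^ 4 * R₅ ^ 2 ≋ A₅ * S₅ ^ 3 * (Z * A₅ * S₅ + B₅ * R₅)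
  quartic₂ = regular-p₁K _ _ (solve-by 3 (λ R S X → let K = R :* S :^ 2 ; P = con (+ 1) :- con (+ 4) :* K :- K :^ 2 ; A = con (+ 1) :- R :- R :^ 2 ; B = con (+ 1) :- S :- S :^ 2 in
      P :* (X :* B :^ 4 :* R :^ 2) :≈ P :* (A :* S :^ 3 :* ((con (+ 1) :+ con (+ 5) :* X) :* A :* S :+ B :* R))
      by (B :^ 4 :* R :^ 2 :- con (+ 5) :* A :^ 2 :* S :^ 4 , X :* P :≈ K)
       ∷ (con -[1+ 0 ] :* S :^ 3 :+ con -[1+ 0 ] :* R :^ 1 :* S :^ 2 :+ con (+ 3) :* R :^ 1 :* S :^ 3 :+
      con (+ 1) :* R :^ 1 :* S :^ 4 :+ con -[1+ 1 ] :* R :^ 1 :* S :^ 5 :+ con (+ 2) :* R :^ 2 :* S :^ 4 :+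
      con (+ 1) :* R :^ 2 :* S :^ 5 :+ con -[1+ 2 ] :* R :^ 2 :* S :^ 6 :+ con -[1+ 0 ] :* R :^ 2 :* S :^ 7 :+
      con -[1+ 0 ] :* R :^ 3 :* S :^ 6 , S :- R :^ 2 :≈ R :* S :^ 2 :* (S :+ R :^ 2)) ∷ [])
    (R₅ ∷ S₅ ∷ X ∷ []) refl (X-p₁ , R₅-S₅ , tt))

  z : Series
  z = oneS + const (+ 5) * hauptmodul

  z-p₁ : z * p₁ k ≋ p₂ k
  z-p₁ = solve-by 2 (λ x k → let P = con (+ 1) :- con (+ 4) :* k :- k :^ 2 in (con (+ 1) :+ con (+ 5) :* x) :* P :≈ con (+ 1) :+ k :- k :^ 2
    by (con (+ 5) , x :* P :≈ k) ∷ []) (hauptmodul ∷ k ∷ []) refl (hauptmodul-p₁ , tt)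

  regular-f : ∀ r → Regular (f r)
  regular-f r = regular-1 (f-head r)

  -- With u = x/z this is u f₂⁴ f₅² = q f₁² f₁₀⁴.
  u-eta : hauptmodul * (f 2 ^ 4 * f 5 ^ 2) ≋ z * (qS * (f 1 ^ 2 * f 10 ^ 4))
  u-eta = regular-* (regular-1 (p₁-1 k₁)) (regular-1 (p₂-1 k₁)) _ _ (solve-by 8 (λ q e E k P T x z →
      P :* T :* (x :* E) :≈ P :* T :* (z :* (q :* e))
      by (T :* E , x :* P :≈ q :* k) ∷ (:- (T :* q :* e) , z :* P :≈ T) ∷ (:- (T :* q) , e :* T :≈ k :* E) ∷ [])
    (qS ∷ f 1 ^ 2 * f 10 ^ 4 ∷ f 2 ^ 4 * f 5 ^ 2 ∷ k₁ ∷ p₁ k ∷ p₂ k ∷ hauptmodul ∷ z ∷ []) refl (hauptmodul-p₁ , z-p₁ , eta-u , tt))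

  U-eta : X * (f 10 ^ 4 * f 25 ^ 2) ≋ Z * (qS ^ 5 * (f 5 ^ 2 * f 50 ^ 4))
  U-eta = begin
    X * (f 10 ^ 4 * f 25 ^ 2) ≈⟨ *-congˡ (≋-sym (*-cong (^-cong (f-dilate 4 1) 4) (^-cong (f-dilate 4 4) 2))) ⟩
    X * (dilate 4 (f 2) ^ 4 * dilate 4 (f 5) ^ 2)
      ≈⟨ ≋-sym (dilate-expr 4 3 (λ x b c → x :* (b :^ 4 :* c :^ 2)) (hauptmodul ∷ f 2 ∷ f 5 ∷ [])) ⟩
    dilate 4 (hauptmodul * (f 2 ^ 4 * f 5 ^ 2)) ≈⟨ dilate-cong 4 u-eta ⟩
    dilate 4 (z * (qS * (f 1 ^ 2 * f 10 ^ 4)))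
      ≈⟨ dilate-expr 4 4 (λ x q a d → (con (+ 1) :+ con (+ 5) :* x) :* (q :* (a :^ 2 :* d :^ 4))) (hauptmodul ∷ qS ∷ f 1 ∷ f 10 ∷ []) ⟩
    Z * (dilate 4 qS * (dilate 4 (f 1) ^ 2 * dilate 4 (f 10) ^ 4))
      ≈⟨ *-congˡ (*-cong (dilate-q 4) (*-cong (^-cong (f-dilate 4 0) 2) (^-cong (f-dilate 4 9) 4))) ⟩
    Z * (qS ^ 5 * (f 5 ^ 2 * f 50 ^ 4)) ∎
    where open ≋-Reasoning

  -- u(q) u(q⁵) = a²/b⁴
  u-U : hauptmodul * X * (B₅ ^ 4 * R₅ ^ 2) ≋ z * Z * (A₅ ^ 2 * S₅ ^ 4)
  u-U = regular-* (regular-* (regular-^ regular-q 8) (regular-* (regular-^ (regular-f 50) 4) (regular-^ (regular-f 25) 2)))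
                  (regular-* (regular-^ (regular-f 10) 4) (regular-* (regular-^ (regular-f 2) 4) (regular-^ (regular-f 5) 2))) _ _
    (solve-by 15 (λ q f₁ f₂ f₅ f₁₀ f₂₅ f₅₀ x z X Z A B R S →
      let N = q :^ 8 :* (f₅₀ :^ 4 :* f₂₅ :^ 2) :* (f₁₀ :^ 4 :* (f₂ :^ 4 :* f₅ :^ 2)) ; b = q :^ 2 :* f₅₀ :* B ; s = f₂ :* S ; a = q :* f₂₅ :* A ; r = f₁ :* R in
      N :* (x :* X :* (B :^ 4 :* R :^ 2)) :≈ N :* (z :* Z :* (A :^ 2 :* S :^ 4))
      by (:- (x :* X :* R :^ 2 :* f₂₅ :^ 2 :* f₁₀ :^ 4 :* f₂ :^ 4 :* f₅ :^ 2) :* (s :+ b) :* (s :^ 2 :+ b :^ 2) , s :≈ b)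
       ∷ (R :^ 2 :* s :^ 4 :* (X :* (f₁₀ :^ 4 :* f₂₅ :^ 2)) , x :* (f₂ :^ 4 :* f₅ :^ 2) :≈ z :* (q :* (f₁ :^ 2 :* f₁₀ :^ 4)))
       ∷ (R :^ 2 :* s :^ 4 :* (z :* (q :* (f₁ :^ 2 :* f₁₀ :^ 4))) , X :* (f₁₀ :^ 4 :* f₂₅ :^ 2) :≈ Z :* (q :^ 5 :* (f₅ :^ 2 :* f₅₀ :^ 4)))
       ∷ (s :^ 4 :* z :* Z :* q :^ 6 :* f₁₀ :^ 4 :* f₅ :^ 2 :* f₅₀ :^ 4 :* (r :+ a) , r :≈ a) ∷ [])
      (qS ∷ f 1 ∷ f 2 ∷ f 5 ∷ f 10 ∷ f 25 ∷ f 50 ∷ hauptmodul ∷ z ∷ X ∷ Z ∷ A₅ ∷ B₅ ∷ R₅ ∷ S₅ ∷ []) refl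
      (f2*S₅ , u-eta , U-eta , f1*R₅ , tt))

private
  x : Series
  x = hauptmodul

  -- This is b/a = Z(1 + 4x)/x. By `u-U`, x X b⁴ = z Z a², and by `quartic₂`, X b⁴ = a(Z a + b);
  -- hence x(Z a + b) = z Z a, and z - x = 1 + 4x.
  ratio-relation : x * (B₅ * R₅) ≋ Z * (A₅ * S₅) * (oneS + const (+ 4) * x)
  ratio-relation = regular-* (regular-1 A₅-1) (regular-^ regular-S₅ 3) _ _
    (solve-by 6 (λ A B R S x X → let Z = con (+ 1) :+ con (+ 5) :* X in
      A :* S :^ 3 :* (x :* (B :* R)) :≈ A :* S :^ 3 :* (Z :* (A :* S) :* (con (+ 1) :+ con (+ 4) :* x))
      by (con (+ 1) , x :* X :* (B :^ 4 :* R :^ 2) :≈ (con (+ 1) :+ con (+ 5) :* x) :* Z :* (A :^ 2 :* S :^ 4))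
       ∷ (:- x , X :* B :^ 4 :* R :^ 2 :≈ A :* S :^ 3 :* (Z :* A :* S :+ B :* R)) ∷ [])
    (A₅ ∷ B₅ ∷ R₅ ∷ S₅ ∷ x ∷ X ∷ []) refl (u-U , quartic₂ , tt))

  -- `eta-w` rewritten through x p₁ = k, z p₁ = p₂ and (1 + 4x) p₁ = 1 - k². Its image `W-eta` will
  -- remove the factors 1 + 4X and Z.
  w-eta : qS * (f 5 ^ 2 * f 10 ^ 2) * z ≋ x * (oneS + const (+ 4) * x) * (f 1 ^ 2 * f 2 ^ 2)
  w-eta = regular-^ (regular-1 (p₁-1 k₁)) 2 _ _ (solve-by 7 (λ q e F k₁ P z x → let k = q :* k₁ in
      P :^ 2 :* (q :* e :* z) :≈ P :^ 2 :* (x :* (con (+ 1) :+ con (+ 4) :* x) :* F)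
      by (:- F :* (P :+ con (+ 4) :* (x :* P :+ k)) , x :* P :≈ k)
       ∷ (q :* e :* P , z :* P :≈ con (+ 1) :+ k :- k :^ 2)
       ∷ (q , e :* (P :* (con (+ 1) :+ k :- k :^ 2)) :≈ k₁ :* ((con (+ 1) :+ k) :* (con (+ 1) :- k)) :* F)
       ∷ (:- (k :* F) , P :≈ con (+ 1) :- con (+ 4) :* k :- k :^ 2) ∷ [])
    (qS ∷ f 5 ^ 2 * f 10 ^ 2 ∷ f 1 ^ 2 * f 2 ^ 2 ∷ k₁ ∷ p₁ k ∷ z ∷ x ∷ []) refl (hauptmodul-p₁ , z-p₁ , eta-w , ≋-refl , tt))

  W-eta : qS ^ 5 * (f 25 ^ 2 * f 50 ^ 2) * Z ≋ X * (oneS + const (+ 4) * X) * (f 5 ^ 2 * f 10 ^ 2)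
  W-eta = begin
    qS ^ 5 * (f 25 ^ 2 * f 50 ^ 2) * Z
      ≈⟨ *-congʳ (≋-sym (*-cong (dilate-q 4) (*-cong (^-cong (f-dilate 4 4) 2) (^-cong (f-dilate 4 9) 2)))) ⟩
    dilate 4 qS * (dilate 4 (f 5) ^ 2 * dilate 4 (f 10) ^ 2) * Z
      ≈⟨ ≋-sym (dilate-expr 4 4 (λ q c d x → q :* (c :^ 2 :* d :^ 2) :* (con (+ 1) :+ con (+ 5) :* x)) (qS ∷ f 5 ∷ f 10 ∷ x ∷ [])) ⟩
    dilate 4 (qS * (f 5 ^ 2 * f 10 ^ 2) * z) ≈⟨ dilate-cong 4 w-eta ⟩
    dilate 4 (x * (oneS + const (+ 4) * x) * (f 1 ^ 2 * f 2 ^ 2))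
      ≈⟨ dilate-expr 4 3 (λ a b x → x :* (con (+ 1) :+ con (+ 4) :* x) :* (a :^ 2 :* b :^ 2)) (f 1 ∷ f 2 ∷ x ∷ []) ⟩
    X * (oneS + const (+ 4) * X) * (dilate 4 (f 1) ^ 2 * dilate 4 (f 2) ^ 2)
      ≈⟨ *-congˡ (*-cong (^-cong (f-dilate 4 0) 2) (^-cong (f-dilate 4 1) 2)) ⟩
    X * (oneS + const (+ 4) * X) * (f 5 ^ 2 * f 10 ^ 2) ∎
    where open ≋-Reasoning

  Z-1 : Z 0 ≡ + 1
  Z-1 = trans (+-at oneS (const (+ 5) * X) 0) (cong (λ t → + 1 ℤ.+ t) (trans (const-* (+ 5) X 0)
    (cong (+ 5 ℤ.*_) (trans (dilate-0 4 x) (q*-zero x₁)))))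

  -- The eta quotient X/x. Inserting b/a into `quartic₁` gives (1 + 4X) x a³ = Z b, the local lemma
  -- `cubic`; there a and b are eta quotients, and so is Z/(X(1 + 4X)) by `W-eta`.
  quotient-X : X * (f 25 * f 2 * (f 5 ^ 2 * f 10 ^ 2)) ≋ x * (qS ^ 4 * (f 1 ^ 3 * f 50 ^ 3))
  quotient-X = regular-* (regular-* (regular-^ regular-q 3) (regular-^ (regular-1 A₅-1) 3))
                         (regular-* regular-S₅ (regular-* (regular-^ (regular-f 25) 2) (regular-1 Z-1))) _ _
    (solve-by 12 (λ q f₁ f₂ e f₂₅ f₅₀ x X A B R S → let Z = con (+ 1) :+ con (+ 5) :* X ; r = f₁ :* R ; a = q :* f₂₅ :* A ; s = f₂ :* S ; b = q :^ 2 :* f₅₀ :* B ; N = q :^ 3 :* A :^ 3 :* (S :* (f₂₅ :^ 2 :* Z)) in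
      N :* (X :* (f₂₅ :* f₂ :* e)) :≈ N :* (x :* (q :^ 4 :* (f₁ :^ 3 :* f₅₀ :^ 3)))
      by (:- (S :* Z :* X :* f₂ :* e) :* (r :^ 2 :+ r :* a :+ a :^ 2) , r :≈ a)
       ∷ (f₁ :^ 3 :* R :^ 3 :* Z :* X :* e , s :≈ b)
       ∷ (:- (f₁ :^ 3 :* q :^ 2 :* f₅₀ :* X :* e) , (con (+ 1) :+ con (+ 4) :* X) :* x :* (A :^ 3 :* S) :≈ R :^ 3 :* B :* Z)
       ∷ (:- (f₁ :^ 3 :* q :^ 2 :* f₅₀ :* x :* A :^ 3 :* S) , q :^ 5 :* (f₂₅ :^ 2 :* f₅₀ :^ 2) :* Z :≈ X :* (con (+ 1) :+ con (+ 4) :* X) :* e) ∷ [])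
      (qS ∷ f 1 ∷ f 2 ∷ f 5 ^ 2 * f 10 ^ 2 ∷ f 25 ∷ f 50 ∷ x ∷ X ∷ A₅ ∷ B₅ ∷ R₅ ∷ S₅ ∷ []) refl
      (f1*R₅ , f2*S₅ , cubic , W-eta , tt))
    where
    cubic : (oneS + const (+ 4) * X) * x * (A₅ ^ 3 * S₅) ≋ R₅ ^ 3 * B₅ * Z
    cubic = regular-* (regular-1 A₅-1) regular-S₅ _ _ (solve-by 6 (λ A B R S x X → let Z = con (+ 1) :+ con (+ 5) :* X in
        A :* S :* ((con (+ 1) :+ con (+ 4) :* X) :* x :* (A :^ 3 :* S)) :≈ A :* S :* (R :^ 3 :* B :* Z)
        by (x , (con (+ 1) :+ con (+ 4) :* X) :* A :^ 4 :* S :^ 2 :≈ R :^ 3 :* B :* (B :* R :- con (+ 4) :* Z :* A :* S))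
         ∷ (R :^ 3 :* B , x :* (B :* R) :≈ Z :* (A :* S) :* (con (+ 1) :+ con (+ 4) :* x)) ∷ [])
      (A₅ ∷ B₅ ∷ R₅ ∷ S₅ ∷ x ∷ X ∷ []) refl (quartic₁ , ratio-relation , tt))

  -- Identification of the Hauptmodul with the given eta quotient

  y₁ : Series
  y₁ = f 2 * f 10 ^ 3 * inv (f 1 ^ 3 * f 5)

  y₁-1 : y₁ 0 ≡ + 1
  y₁-1 = *-head-1 {f 2 * f 10 ^ 3} (*-head-1 {f 2} refl (^-head {f 10} refl 3)) refl

  xS≋ : xS ≋ qS * y₁
  xS≋ = ≋-trans (≋-reflexive unfold) (solve 4 (λ q a b c → q :* a :* b :* c :≈ q :* (a :* b :* c)) (qS ∷ f 2 ∷ f 10 ^ 3 ∷ inv (f 1 ^ 3 * f 5) ∷ []) refl)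
    where
    unfold : xS ≡ qS * f 2 * f 10 ^ 3 * inv (f 1 ^ 3 * f 5)
    unfold = trans (⊗≡* (qS ⊗ f 2 ⊗ pow (f 10) 3) (inv (pow (f 1) 3 ⊗ f 5))) (cong₂ _*_
      (trans (⊗≡* (qS ⊗ f 2) (pow (f 10) 3)) (cong₂ _*_ (⊗≡* qS (f 2)) (pow≡^ (f 10) 3)))
      (cong inv (trans (⊗≡* (pow (f 1) 3) (f 5)) (cong (_* f 5) (pow≡^ (f 1) 3)))))

  y₁-eta : y₁ * (f 1 ^ 3 * f 5) ≋ f 2 * f 10 ^ 3
  y₁-eta = solve-by 3 (λ a e i → a :* i :* e :≈ a by (a , e :* i :≈ con (+ 1)) ∷ []) (f 2 * f 10 ^ 3 ∷ f 1 ^ 3 * f 5 ∷ inv (f 1 ^ 3 * f 5) ∷ []) refl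
    (inverse (*-head-1 {f 1 ^ 3} (^-head {f 1} refl 3) refl) , tt)

  Y₁-eta : dilate 4 y₁ * (f 5 ^ 3 * f 25) ≋ f 10 * f 50 ^ 3
  Y₁-eta = ≋-trans (*-congˡ (≋-sym (*-cong (^-cong (f-dilate 4 0) 3) (f-dilate 4 4)))) (≋-trans
    (≋-sym (dilate-expr 4 3 (λ y a c → y :* (a :^ 3 :* c)) (y₁ ∷ f 1 ∷ f 5 ∷ []))) (≋-trans (dilate-cong 4 y₁-eta)
    (≋-trans (dilate-expr 4 2 (λ b d → b :* d :^ 3) (f 2 ∷ f 10 ∷ [])) (*-cong (f-dilate 4 1) (^-cong (f-dilate 4 9) 3)))))

  quotient-Y : dilate 4 y₁ * (f 25 * f 2 * (f 5 ^ 2 * f 10 ^ 2)) ≋ y₁ * (f 1 ^ 3 * f 50 ^ 3)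
  quotient-Y = regular-* (regular-f 5) (regular-f 10) _ _ (solve-by 8 (λ a b c d e g y Y →
      c :* d :* (Y :* (e :* b :* (c :^ 2 :* d :^ 2))) :≈ c :* d :* (y :* (a :^ 3 :* g :^ 3))
      by (b :* d :^ 3 , Y :* (c :^ 3 :* e) :≈ d :* g :^ 3) ∷ (:- (d :* g :^ 3) , y :* (a :^ 3 :* c) :≈ b :* d :^ 3) ∷ [])
    (f 1 ∷ f 2 ∷ f 5 ∷ f 10 ∷ f 25 ∷ f 50 ∷ y₁ ∷ dilate 4 y₁ ∷ []) refl (Y₁-eta , y₁-eta , tt))

  X≋ : X ≋ qS ^ 5 * dilate 4 x₁
  X≋ = ≋-trans (dilate-* 4 qS x₁) (*-congʳ (dilate-q 4))

  cross : dilate 4 x₁ * y₁ ≋ dilate 4 y₁ * x₁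
  cross = regular-* (regular-* (regular-^ regular-q 5) (regular-* (regular-f 25) (regular-f 2)))
                    (regular-* (regular-^ (regular-f 5) 2) (regular-^ (regular-f 10) 2)) _ _
    (solve-by 9 (λ q m n e x y X Y Xq →
      q :^ 5 :* m :* n :* (X :* y) :≈ q :^ 5 :* m :* n :* (Y :* x)
      by (:- (m :* n :* y) , Xq :≈ q :^ 5 :* X) ∷ (y , Xq :* (m :* n) :≈ q :* x :* (q :^ 4 :* e)) ∷ (:- (q :^ 5 :* x) , Y :* (m :* n) :≈ y :* e) ∷ [])
    (qS ∷ f 25 * f 2 ∷ f 5 ^ 2 * f 10 ^ 2 ∷ f 1 ^ 3 * f 50 ^ 3 ∷ x₁ ∷ y₁ ∷ dilate 4 x₁ ∷ dilate 4 y₁ ∷ X ∷ []) refl (X≋ , quotient-X , quotient-Y , tt))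

dilate-fixed : ∀ {e} → dilate 4 e ≋ e → e ≋ const (e 0)
dilate-fixed {e} h = pointwise (<-rec (λ n → e n ≡ const (e 0) n) step)
  where
  step : ∀ n → (∀ {m} → m < n → e m ≡ const (e 0) m) → e n ≡ const (e 0) n
  step n ih = trans (sym (at h n)) (trans (by-quotient n ih) (at (dilate-const 4 (e 0)) n))
    where
    by-quotient : ∀ n → (∀ {m} → m < n → e m ≡ const (e 0) m) → dilate 4 e n ≡ dilate 4 (const (e 0)) n
    by-quotient zero    ih = trans (dilate-0 4 e) (sym (dilate-0 4 (const (e 0))))
    by-quotient (suc n) ih = dilate-local′ n ih
      where
      opaque
        unfolding dilate
        dilate-local′ : ∀ n → (∀ {m} → m < suc n → e m ≡ const (e 0) m) → dilate 4 e (suc n) ≡ dilate 4 (const (e 0)) (suc n)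
        dilate-local′ n ih with suc n ℕ.% 5 ℕ.≡ᵇ 0
        ... | false = refl
        ... | true  = ih (DivMod.m/n<m (suc n) 5 (s≤s (s≤s z≤n)))

-- The hypothesis makes a/b invariant under q ↦ q⁵. The n-th coefficient of an invariant series is 0
-- or the coefficient at n/5 < n, so such a series is constant.
descent : ∀ {a b} → a 0 ≡ + 1 → b 0 ≡ + 1 → dilate 4 a * b ≋ dilate 4 b * a → a ≋ b
descent {a} {b} a₀ b₀ h = ≋-trans (a≋ a b b₀) (≋-trans (*-congʳ (≋-trans (dilate-fixed fixed) (≋-reflexive (cong const (*-head-1 {a} {inv b} a₀ refl)))))
    (*-identityˡ b))
  where
  a≋ : ∀ a b → b 0 ≡ + 1 → a ≋ a * inv b * b
  a≋ a b b₀ = solve-by 3 (λ a b i → a :≈ a :* i :* b by (:- a , b :* i :≈ con (+ 1)) ∷ []) (a ∷ b ∷ inv b ∷ []) refl (inverse b₀ , tt)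
  fixed : dilate 4 (a * inv b) ≋ a * inv b
  fixed = regular-* (regular-1 (trans (dilate-0 4 b) b₀)) (regular-1 b₀) _ _
    (solve-by 6 (λ a b e A B E → B :* b :* E :≈ B :* b :* e
        by (:- b , A :≈ E :* B) ∷ (con (+ 1) , A :* b :≈ B :* a) ∷ (B , a :≈ e :* b) ∷ [])
      (a ∷ b ∷ a * inv b ∷ dilate 4 a ∷ dilate 4 b ∷ dilate 4 (a * inv b) ∷ []) refl
      (≋-trans (dilate-cong 4 (a≋ a b b₀)) (dilate-* 4 (a * inv b) b) , h , a≋ a b b₀ , tt))

xS≋hauptmodul : xS ≋ hauptmodul
xS≋hauptmodul = ≋-trans xS≋ (*-congˡ (≋-sym (descent x₁-1 y₁-1 cross)))

-- The modular equation of degree 5, and Φ in terms of x and X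

private
  -- That is, a² = Z²(1 + 4x)/(x²(1 + 4X)): in `quartic₁` the factor b - 4Z a equals Z a((1 + 4x) -
  -- 4x)/x, which is just Z a/x.
  a-relation : (oneS + const (+ 4) * X) * (x ^ 2 * A₅ ^ 2) ≋ Z ^ 2 * (oneS + const (+ 4) * x) * R₅ ^ 2
  a-relation = regular-* (regular-^ (regular-1 A₅-1) 2) (regular-^ regular-S₅ 2) _ _
    (solve-by 6 (λ A B R S x X → let Z = con (+ 1) :+ con (+ 5) :* X ; t = Z :* (A :* S) ; y = con (+ 1) :+ con (+ 4) :* x in
      A :^ 2 :* S :^ 2 :* ((con (+ 1) :+ con (+ 4) :* X) :* (x :^ 2 :* A :^ 2)) :≈ A :^ 2 :* S :^ 2 :* (Z :^ 2 :* y :* R :^ 2)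
      by (x :^ 2 , (con (+ 1) :+ con (+ 4) :* X) :* A :^ 4 :* S :^ 2 :≈ R :^ 3 :* B :* (B :* R :- con (+ 4) :* Z :* A :* S))
       ∷ (R :^ 2 :* (x :* (B :* R) :+ t :* y :- con (+ 4) :* x :* t) , x :* (B :* R) :≈ t :* y) ∷ [])
    (A₅ ∷ B₅ ∷ R₅ ∷ S₅ ∷ x ∷ X ∷ []) refl (quartic₁ , ratio-relation , tt))

  -- Divided by a², `quartic₂` reads X (b/a)⁴ a² = Z + b/a. With the values of b/a and a² inserted,
  -- R₅ and S₅ are gone, and x + (1 + 4x) = 1 + 5x accounts for the factor on the right.
  sextic : X * Z ^ 5 * (oneS + const (+ 4) * x) ^ 5 ≋ x ^ 5 * (oneS + const (+ 5) * x) * (oneS + const (+ 4) * X)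
  sextic = regular-* (regular-* (regular-^ regular-R₅ 2) (regular-* (regular-^ (regular-1 A₅-1) 2) (regular-^ regular-S₅ 4))) (regular-1 Z-1) _ _
    (solve-by 6 (λ A B R S x X → let Z = con (+ 1) :+ con (+ 5) :* X ; t = Z :* (A :* S) ; y = con (+ 1) :+ con (+ 4) :* x ; v = x :* (B :* R) ; w = t :* y ; Y = con (+ 1) :+ con (+ 4) :* X in
      R :^ 2 :* (A :^ 2 :* S :^ 4) :* Z :* (X :* Z :^ 5 :* y :^ 5) :≈
      R :^ 2 :* (A :^ 2 :* S :^ 4) :* Z :* (x :^ 5 :* (con (+ 1) :+ con (+ 5) :* x) :* Y)
      by (:- (X :* S :^ 4 :* Z :^ 4 :* A :^ 2 :* y :^ 4) , Y :* (x :^ 2 :* A :^ 2) :≈ Z :^ 2 :* y :* R :^ 2)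
       ∷ (:- (Y :* x :^ 2 :* X) :* (v :+ w) :* (v :^ 2 :+ w :^ 2) , v :≈ w)
       ∷ (Y :* x :^ 6 :* R :^ 2 , X :* B :^ 4 :* R :^ 2 :≈ A :* S :^ 3 :* (Z :* A :* S :+ B :* R))
       ∷ (Y :* x :^ 5 :* R :^ 2 :* A :* S :^ 3 , v :≈ w) ∷ [])
    (A₅ ∷ B₅ ∷ R₅ ∷ S₅ ∷ x ∷ X ∷ []) refl (a-relation , ratio-relation , quartic₂ , ratio-relation , tt))

a₀ₚ a₁ₚ a₂ₚ a₃ₚ a₄ₚ : Poly 1
a₀ₚ = + 0 ∷ + 1 ∷ + 20 ∷ + 150 ∷ + 500 ∷ + 625 ∷ []
a₁ₚ = + 0 ∷ + 15 ∷ + 305 ∷ + 2325 ∷ + 7875 ∷ + 10000 ∷ []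
a₂ₚ = + 0 ∷ + 85 ∷ + 1750 ∷ + 13525 ∷ + 46500 ∷ + 60000 ∷ []
a₃ₚ = + 0 ∷ + 215 ∷ + 4475 ∷ + 35000 ∷ + 122000 ∷ + 160000 ∷ []
a₄ₚ = + 0 ∷ + 205 ∷ + 4300 ∷ + 34000 ∷ + 120000 ∷ + 160000 ∷ []

-- The difference of the two sides of the sextic is divisible by Z + 5 (1 + 4X) x; the quotient is x⁵ - quinticₚ.
quinticₚ : Poly 2
quinticₚ = a₀ₚ ∷ a₁ₚ ∷ a₂ₚ ∷ a₃ₚ ∷ a₄ₚ ∷ []

quintic : x ^ 5 ≋ eval 2 quinticₚ (x ∷ X ∷ [])
quintic = regular-1 unit _ _ (solve-by 2 (λ x X → let Z = con (+ 1) :+ con (+ 5) :* X ; Y = con (+ 1) :+ con (+ 4) :* X in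
    (Z :+ con (+ 5) :* Y :* x) :* x :^ 5 :≈ (Z :+ con (+ 5) :* Y :* x) :* poly quinticₚ
    by (con -[1+ 0 ] , X :* Z :^ 5 :* (con (+ 1) :+ con (+ 4) :* x) :^ 5 :≈ x :^ 5 :* (con (+ 1) :+ con (+ 5) :* x) :* Y) ∷ [])
  (x ∷ X ∷ []) refl (sextic , tt))
  where
  unit : (Z + const (+ 5) * (oneS + const (+ 4) * X) * x) 0 ≡ + 1
  unit = trans (+-at Z _ 0) (cong₂ ℤ._+_ Z-1 (trans (*-head (const (+ 5) * (oneS + const (+ 4) * X)) x)
    (trans (cong ((const (+ 5) * (oneS + const (+ 4) * X)) 0 ℤ.*_) (q*-zero x₁)) (ℤₚ.*-zeroʳ ((const (+ 5) * (oneS + const (+ 4) * X)) 0)))))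

private
  Φ-eta : Φ * (f 1 * f 2 ^ 2) ≋ qS ^ 5 * (f 25 * f 50 ^ 2)
  Φ-eta = ≋-trans (*-congʳ (≋-reflexive unfold)) (≋-trans (*-congʳ (*-congʳ (shift≋ 5 (f 25 * f 50 ^ 2))))
    (solve-by 3 (λ a e i → a :* i :* e :≈ a by (a , e :* i :≈ con (+ 1)) ∷ []) (qS ^ 5 * (f 25 * f 50 ^ 2) ∷ f 1 * f 2 ^ 2 ∷ inv (f 1 * f 2 ^ 2) ∷ []) refl
      (inverse (*-head-1 {f 1} refl (^-head {f 2} refl 2)) , tt)))
    where
    unfold : Φ ≡ shift 5 (f 25 * f 50 ^ 2) * inv (f 1 * f 2 ^ 2)
    unfold = trans (⊗≡* (shift 5 (f 25 ⊗ pow (f 50) 2)) (inv (f 1 ⊗ pow (f 2) 2))) (cong₂ _*_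
      (cong (shift 5) (trans (⊗≡* (f 25) (pow (f 50) 2)) (cong (f 25 *_) (pow≡^ (f 50) 2))))
      (cong inv (trans (⊗≡* (f 1) (pow (f 2) 2)) (cong (f 1 *_) (pow≡^ (f 2) 2)))))

  Φ-AB : Φ * (A₅ * B₅ ^ 2) ≋ R₅ * S₅ ^ 2
  Φ-AB = regular-* (regular-^ regular-q 5) (regular-* (regular-f 25) (regular-^ (regular-f 50) 2)) _ _
    (solve-by 10 (λ q f₁ f₂ f₂₅ f₅₀ A B R S Φ → let b = q :^ 2 :* f₅₀ :* B ; s = f₂ :* S in
      q :^ 5 :* (f₂₅ :* f₅₀ :^ 2) :* (Φ :* (A :* B :^ 2)) :≈ q :^ 5 :* (f₂₅ :* f₅₀ :^ 2) :* (R :* S :^ 2)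
      by (:- (Φ :* b :^ 2) , f₁ :* R :≈ q :* f₂₅ :* A) ∷ (:- (Φ :* f₁ :* R) :* (s :+ b) , s :≈ b)
       ∷ (R :* S :^ 2 , Φ :* (f₁ :* f₂ :^ 2) :≈ q :^ 5 :* (f₂₅ :* f₅₀ :^ 2)) ∷ [])
    (qS ∷ f 1 ∷ f 2 ∷ f 25 ∷ f 50 ∷ A₅ ∷ B₅ ∷ R₅ ∷ S₅ ∷ Φ ∷ []) refl (f1*R₅ , f2*S₅ , Φ-eta , tt))

-- From Φ = 1/(a b²), an odd power of a once b/a is known. As a² is rational in x and X, one factor
-- a survives: Φ = a x⁶(1 + 4X)²/((1 + 4x)⁴ Z⁶).
Φ-relation : (oneS + const (+ 4) * x) ^ 4 * Z ^ 6 * Φ * R₅ ≋ A₅ * x ^ 6 * (oneS + const (+ 4) * X) ^ 2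
Φ-relation = regular-* (regular-^ (regular-1 A₅-1) 3) (regular-* (regular-^ regular-R₅ 3) (regular-^ regular-S₅ 2)) _ _
  (solve-by 7 (λ A B R S x X Φ → let Z = con (+ 1) :+ con (+ 5) :* X ; y = con (+ 1) :+ con (+ 4) :* x ; Y = con (+ 1) :+ con (+ 4) :* X ; v = x :* (B :* R) ; w = Z :* (A :* S) :* y ; m = Y :* (x :^ 2 :* A :^ 2) ; n = Z :^ 2 :* y :* R :^ 2 in
    A :^ 3 :* (R :^ 3 :* S :^ 2) :* (y :^ 4 :* Z :^ 6 :* Φ :* R) :≈ A :^ 3 :* (R :^ 3 :* S :^ 2) :* (A :* x :^ 6 :* Y :^ 2)
    by (:- (A :^ 3 :* S :^ 2 :* y :^ 2 :* Z :^ 2 :* Φ) :* (m :+ n) , m :≈ n)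
     ∷ (:- (A :* Φ :* m :^ 2) :* (v :+ w) , v :≈ w)
     ∷ (m :^ 2 :* x :^ 2 :* R :^ 2 , Φ :* (A :* B :^ 2) :≈ R :* S :^ 2) ∷ [])
  (A₅ ∷ B₅ ∷ R₅ ∷ S₅ ∷ x ∷ X ∷ Φ ∷ []) refl (a-relation , ratio-relation , Φ-AB , tt))

-- The zeroth section of a polynomial in R₅ and S₅, computed from its coefficients: R₅ⁱ S₅ʲ lies in the class i + 2j.

extractMonomial : ℕ → Expr 3 → Expr 3
extractMonomial 0 e = e
extractMonomial 1 e = con (+ 0)
extractMonomial 2 e = con (+ 0)
extractMonomial 3 e = con (+ 0)
extractMonomial 4 e = con (+ 0)
-- Five factors q form q⁵, which the section turns into a single q, the variable `zero`.
extractMonomial (suc (suc (suc (suc (suc n))))) e = extractMonomial n (var zero :* e)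

extractInner : ℕ → ℕ → Poly 1 → Expr 3
extractInner i j []       = con (+ 0)
extractInner i j (c ∷ cs) = extractMonomial (i ℕ.+ 2 ℕ.* j) (con c :* (var (# 1) :^ i :* var (# 2) :^ j)) :+ extractInner i (suc j) cs

extract : ℕ → Poly 2 → Expr 3
extract i []       = con (+ 0)
extract i (p ∷ ps) = extractInner i 0 p :+ extract (suc i) ps

private
  ρ₃ : Vec Series 3
  ρ₃ = qS ∷ r₁ ∷ s₁ ∷ []

  section-q-zero : ∀ {a} → section 4 a ≋ zeroS → section 0 (qS * a) ≋ zeroS
  section-q-zero {a} h = ≋-trans (section-0-q a) (≋-trans (*-congˡ h) (zeroʳ qS))

  reassociate : ∀ n a → qS ^ suc n * a ≋ qS * (qS ^ n * a)
  reassociate n a = *-assoc qS (qS ^ n) a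

  <5 : ∀ n → (n ℕ.≤ᵇ 4) ≡ true → n < 5
  <5 n h = s≤s (ℕₚ.≤ᵇ⇒≤ n 4 (subst Bool.T (sym h) tt))

  section-low : ∀ i j → suc (i ℕ.+ j) ≡ 5 → ∀ a → section 4 (qS ^ i * dilate 4 a) ≋ section j (dilate 4 a)
  section-low 0 4 refl a = section-cong 4 (*-identityˡ _)
  section-low 1 3 refl a = ≋-trans (section-cong 4 (*-congʳ (*-identityʳ qS))) (section-suc-q 3 _)
  section-low 2 2 refl a = ≋-trans (section-cong 4 (≋-trans (reassociate 1 _) (*-congˡ (*-congʳ (*-identityʳ qS)))))
    (≋-trans (section-suc-q 3 _) (section-suc-q 2 _))
  section-low 3 1 refl a = ≋-trans (section-cong 4 (≋-trans (reassociate 2 _) (*-congˡ (≋-trans (reassociate 1 _) (*-congˡ (*-congʳ (*-identityʳ qS)))))))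
    (≋-trans (section-suc-q 3 _) (≋-trans (section-suc-q 2 _) (section-suc-q 1 _)))
  section-low 4 0 refl a = ≋-trans (section-cong 4 (≋-trans (reassociate 3 _) (*-congˡ (≋-trans (reassociate 2 _) (*-congˡ (≋-trans (reassociate 1 _) (*-congˡ (*-congʳ (*-identityʳ qS)))))))))
    (≋-trans (section-suc-q 3 _) (≋-trans (section-suc-q 2 _) (≋-trans (section-suc-q 1 _) (section-suc-q 0 _))))

  extractMonomial-sound : ∀ n e → section 0 (qS ^ n * dilate 4 (⟦ e ⟧ ρ₃)) ≋ ⟦ extractMonomial n e ⟧ ρ₃
  extractMonomial-sound 0 e = ≋-trans (section-cong 0 (*-identityˡ _)) (section-0-dilate (⟦ e ⟧ ρ₃))
  extractMonomial-sound 1 e = ≋-trans (section-cong 0 (reassociate 0 _)) (section-q-zero (≋-trans (section-low 0 4 refl _) (section-suc-dilate 3 (<5 4 refl) _)))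
  extractMonomial-sound 2 e = ≋-trans (section-cong 0 (reassociate 1 _)) (section-q-zero (≋-trans (section-low 1 3 refl _) (section-suc-dilate 2 (<5 3 refl) _)))
  extractMonomial-sound 3 e = ≋-trans (section-cong 0 (reassociate 2 _)) (section-q-zero (≋-trans (section-low 2 2 refl _) (section-suc-dilate 1 (<5 2 refl) _)))
  extractMonomial-sound 4 e = ≋-trans (section-cong 0 (reassociate 3 _)) (section-q-zero (≋-trans (section-low 3 1 refl _) (section-suc-dilate 0 (<5 1 refl) _)))
  extractMonomial-sound (suc (suc (suc (suc (suc n))))) e = ≋-trans (section-cong 0 (≋-trans
      (solve 3 (λ q m d → q :* (q :* (q :* (q :* (q :* m)))) :* d :≈ m :* (q :^ 5 :* d)) (qS ∷ qS ^ n ∷ dilate 4 (⟦ e ⟧ ρ₃) ∷ []) refl)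
      (*-congˡ (≋-sym (≋-trans (dilate-* 4 qS (⟦ e ⟧ ρ₃)) (*-congʳ (dilate-q 4)))))))
    (extractMonomial-sound n (var zero :* e))

  monomial-RS : ∀ c i j → R₅ ^ i * (S₅ ^ j * const c) ≋ qS ^ (i ℕ.+ 2 ℕ.* j) * dilate 4 (const c * (r₁ ^ i * s₁ ^ j))
  monomial-RS c i j = begin
    R₅ ^ i * (S₅ ^ j * const c)
      ≈⟨ *-cong (^-distrib qS (dilate 4 r₁) i) (*-congʳ (≋-trans (^-distrib (qS ^ 2) (dilate 4 s₁) j) (*-congʳ (^-* qS 2 j)))) ⟩
    (qS ^ i * dilate 4 r₁ ^ i) * ((qS ^ (2 ℕ.* j) * dilate 4 s₁ ^ j) * const c)
      ≈⟨ solve 5 (λ a b d e f → (a :* b) :* ((d :* e) :* f) :≈ (a :* d) :* (f :* (b :* e)))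
           (qS ^ i ∷ dilate 4 r₁ ^ i ∷ qS ^ (2 ℕ.* j) ∷ dilate 4 s₁ ^ j ∷ const c ∷ []) refl ⟩
    (qS ^ i * qS ^ (2 ℕ.* j)) * (const c * (dilate 4 r₁ ^ i * dilate 4 s₁ ^ j))
      ≈⟨ *-cong (≋-sym (^-+ qS i (2 ℕ.* j))) (≋-sym (≋-trans (dilate-* 4 _ _) (*-cong (dilate-const 4 c)
           (≋-trans (dilate-* 4 _ _) (*-cong (dilate-^ 4 r₁ i) (dilate-^ 4 s₁ j)))))) ⟩
    qS ^ (i ℕ.+ 2 ℕ.* j) * dilate 4 (const c * (r₁ ^ i * s₁ ^ j)) ∎
    where
    open ≋-Reasoning
    ^-distrib : ∀ a b k → (a * b) ^ k ≋ a ^ k * b ^ k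
    ^-distrib a b zero    = ≋-sym (*-identityˡ oneS)
    ^-distrib a b (suc k) = ≋-trans (*-congˡ (^-distrib a b k)) (solve 4 (λ a b c d → a :* b :* (c :* d) :≈ a :* c :* (b :* d)) (a ∷ b ∷ a ^ k ∷ b ^ k ∷ []) refl)

  extractInner-sound : ∀ i j cs → section 0 (R₅ ^ i * (S₅ ^ j * eval 1 cs (S₅ ∷ []))) ≋ ⟦ extractInner i j cs ⟧ ρ₃
  extractInner-sound i j []       = ≋-trans (section-cong 0 (solve 2 (λ a b → a :* (b :* con (+ 0)) :≈ con (+ 0)) (R₅ ^ i ∷ S₅ ^ j ∷ []) refl)) section-zero
  extractInner-sound i j (c ∷ cs) = ≋-trans (section-cong 0
      (solve 5 (λ a b c s v → a :* (b :* (c :+ s :* v)) :≈ a :* (b :* c) :+ a :* ((s :* b) :* v)) (R₅ ^ i ∷ S₅ ^ j ∷ const c ∷ S₅ ∷ eval 1 cs (S₅ ∷ []) ∷ []) refl))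
    (≋-trans (section-+ 0 _ _) (+-cong
      (≋-trans (section-cong 0 (monomial-RS c i j)) (extractMonomial-sound (i ℕ.+ 2 ℕ.* j) (con c :* (var (# 1) :^ i :* var (# 2) :^ j))))
      (extractInner-sound i (suc j) cs)))

  extract-sound : ∀ i p → section 0 (R₅ ^ i * eval 2 p (R₅ ∷ S₅ ∷ [])) ≋ ⟦ extract i p ⟧ ρ₃
  extract-sound i []       = ≋-trans (section-cong 0 (zeroʳ (R₅ ^ i))) section-zero
  extract-sound i (p ∷ ps) = ≋-trans (section-cong 0
      (solve 4 (λ a p r v → a :* (p :+ r :* v) :≈ a :* (con (+ 1) :* p) :+ (r :* a) :* v) (R₅ ^ i ∷ eval 1 p (S₅ ∷ []) ∷ R₅ ∷ eval 2 ps (R₅ ∷ S₅ ∷ []) ∷ []) refl))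
    (≋-trans (section-+ 0 _ _) (+-cong (extractInner-sound i 0 p) (extract-sound (suc i) ps)))

  -- The extraction takes place in the free polynomial ring in R and S, so its value is a polynomial
  -- in q, r, s that is not reduced by `ratio-equation`. Where the desired form depends on that
  -- relation, it is applied afterwards, as in `section-A²B`.
  section-RS : ∀ (e : N-ary 2 (Expr 2) (Expr 2)) (t : N-ary 3 (Expr 3) (Expr 3)) →
               isZero 3 (normalise 3 (extract 0 (normalise 2 (e $ⁿ vars 2)) :- (t $ⁿ vars 3))) ≡ true →
               section 0 (⟦ e $ⁿ vars 2 ⟧ (R₅ ∷ S₅ ∷ [])) ≋ ⟦ t $ⁿ vars 3 ⟧ ρ₃
  section-RS e t h = begin
    section 0 (⟦ e $ⁿ vars 2 ⟧ (R₅ ∷ S₅ ∷ [])) ≈⟨ section-cong 0 (≋-sym (≋-trans (*-identityˡ _) (normalise-sound (e $ⁿ vars 2) (R₅ ∷ S₅ ∷ [])))) ⟩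
    section 0 (R₅ ^ 0 * eval 2 p (R₅ ∷ S₅ ∷ [])) ≈⟨ extract-sound 0 p ⟩
    ⟦ extract 0 p ⟧ ρ₃                          ≈⟨ difference-zero (≋-trans (≋-sym (normalise-sound (extract 0 p :- (t $ⁿ vars 3)) ρ₃)) (isZero-sound 3 (normalise 3 (extract 0 p :- (t $ⁿ vars 3))) ρ₃ h)) ⟩
    ⟦ t $ⁿ vars 3 ⟧ ρ₃                          ∎
    where
    open ≋-Reasoning
    p = normalise 2 (e $ⁿ vars 2)

  -- Values of U₅ on Laurent monomials in a = A₅/R₅ and b = B₅/S₅

  Aₑ Bₑ A′ₑ : ∀ {n} → Expr n → Expr n
  Aₑ R  = con (+ 1) :- R :- R :^ 2
  Bₑ S  = con (+ 1) :- S :- S :^ 2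
  A′ₑ R = cofactor R

  A′₅ : Series
  A′₅ = ⟦ A′ₑ (var zero) ⟧ (R₅ ∷ [])

  -- R₅⁵, S₅⁵ and K = R₅S₅² are series in q⁵, and multiplication by them turns a^i b^j into a
  -- polynomial in R₅ and S₅. Read in this way, the sections up to `section-A³` say that U₅ sends a,
  -- b, a², ab, b², a³ to -1, -1, -1, 1, -1, 5; `section-AB²` gives U₅(ab²) = z/x.
  section-A : section 0 (R₅ ^ 4 * A₅) ≋ - ϱ
  section-A = section-RS (λ R S → R :^ 4 :* Aₑ R) (λ q r s → :- (q :* r :^ 5)) refl

  section-B : section 0 (S₅ ^ 4 * B₅) ≋ - ς
  section-B = section-RS (λ R S → S :^ 4 :* Bₑ S) (λ q r s → :- (q :^ 2 :* s :^ 5)) refl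

  section-A² : section 0 (R₅ ^ 3 * A₅ ^ 2) ≋ - ϱ
  section-A² = section-RS (λ R S → R :^ 3 :* Aₑ R :^ 2) (λ q r s → :- (q :* r :^ 5)) refl

  section-AB : section 0 (A₅ * B₅ * S₅) ≋ k
  section-AB = section-RS (λ R S → Aₑ R :* Bₑ S :* S) (λ q r s → q :* (r :* s :^ 2)) refl

  section-B² : section 0 (S₅ ^ 3 * B₅ ^ 2) ≋ - ς
  section-B² = section-RS (λ R S → S :^ 3 :* Bₑ S :^ 2) (λ q r s → :- (q :^ 2 :* s :^ 5)) refl

  section-A³ : section 0 (R₅ ^ 2 * A₅ ^ 3) ≋ const (+ 5) * ϱ
  section-A³ = section-RS (λ R S → R :^ 2 :* Aₑ R :^ 3) (λ q r s → con (+ 5) :* (q :* r :^ 5)) refl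

  section-AB² : section 0 (A₅ * B₅ ^ 2) ≋ p₂ k
  section-AB² = section-RS (λ R S → Aₑ R :* Bₑ S :^ 2) (λ q r s → let k = q :* (r :* s :^ 2) in con (+ 1) :+ k :- k :^ 2) refl

  y : Series
  y = oneS + const (+ 4) * x

  -- Since the argument is K² a² b, this says U₅(a²b) = 1/(1 + 4x).
  section-A²B : y * section 0 (A₅ ^ 2 * B₅ * S₅ ^ 3) ≋ k ^ 2
  section-A²B = ≋-trans (*-congˡ (section-RS (λ R S → Aₑ R :^ 2 :* Bₑ S :* S :^ 3) (λ q r s → con -[1+ 0 ] :* q :^ 2 :* s :^ 5 :+ con (+ 1) :* q :^ 2 :* r :^ 2 :* s :^ 4 :+ con (+ 1) :* q :^ 2 :* r :^ 4 :* s :^ 3) refl))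
    (regular-1 (p₁-1 k₁) _ _ (solve-by 4 (λ q r s x → let k = q :* (r :* s :^ 2) ; P = con (+ 1) :- con (+ 4) :* k :- k :^ 2 ; t = con -[1+ 0 ] :* q :^ 2 :* s :^ 5 :+ con (+ 1) :* q :^ 2 :* r :^ 2 :* s :^ 4 :+ con (+ 1) :* q :^ 2 :* r :^ 4 :* s :^ 3 in
       P :* ((con (+ 1) :+ con (+ 4) :* x) :* t) :≈ P :* k :^ 2
       by (con (+ 4) :* t , x :* P :≈ k)
        ∷ (con -[1+ 0 ] :* q :^ 2 :* s :^ 4 :+ con -[1+ 0 ] :* q :^ 3 :* r :^ 1 :* s :^ 6 :+ con -[1+ 0 ] :* q :^ 2 :* r :^ 2 :* s :^ 3 :+ con (+ 1) :* q :^ 3 :* r :^ 3 :* s :^ 5 , s :≈ r :^ 2 :+ q :* r :* s :^ 2 :* (s :+ r :^ 2)) ∷ [])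
     (qS ∷ r₁ ∷ s₁ ∷ x ∷ []) refl (hauptmodul-p₁ , ratio-equation , tt)))

  -- `A′₅` complements `A₅` to the norm form at R₅⁵, so the argument is b/a times K and the norm
  -- form, both series in q⁵. The result says U₅(b/a) = 1 + 4x.
  section-BA′ : section 0 (B₅ * R₅ ^ 2 * S₅ * A′₅) ≋ y * (k * normForm ϱ)
  section-BA′ = ≋-trans (section-RS (λ R S → Bₑ S :* R :^ 2 :* S :* A′ₑ R)
      (λ q r s → con (+ 1) :* q :^ 1 :* r :^ 3 :* s :^ 1 :+ con -[1+ 1 ] :* q :^ 2 :* r :^ 4 :* s :^ 3 :+ con -[1+ 4 ] :* q :^ 2 :* r :^ 6 :* s :^ 2 :+ con (+ 2) :* q :^ 2 :* r :^ 8 :* s :^ 1 :+ con (+ 1) :* q :^ 3 :* r :^ 9 :* s :^ 3) refl)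
    (regular-1 (p₁-1 k₁) _ _ (solve-by 4 (λ q r s x → let k = q :* (r :* s :^ 2) ; P = con (+ 1) :- con (+ 4) :* k :- k :^ 2 ; z = q :* r :^ 5 ; n = con (+ 1) :- con (+ 11) :* z :- z :^ 2 in
       P :* (con (+ 1) :* q :^ 1 :* r :^ 3 :* s :^ 1 :+ con -[1+ 1 ] :* q :^ 2 :* r :^ 4 :* s :^ 3 :+ con -[1+ 4 ] :* q :^ 2 :* r :^ 6 :* s :^ 2 :+ con (+ 2) :* q :^ 2 :* r :^ 8 :* s :^ 1 :+ con (+ 1) :* q :^ 3 :* r :^ 9 :* s :^ 3) :≈ P :* ((con (+ 1) :+ con (+ 4) :* x) :* (k :* n))
       by (:- (con (+ 4) :* k :* n) , x :* P :≈ k)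
        ∷ (con -[1+ 0 ] :* q :^ 1 :* r :^ 1 :* s :^ 1 :+ con -[1+ 0 ] :* q :^ 2 :* r :^ 2 :* s :^ 3 :+ con -[1+ 7 ] :* q :^ 2 :* r :^ 4 :* s :^ 2 :+ con -[1+ 1 ] :* q :^ 3 :* r :^ 5 :* s :^ 4 :+ con -[1+ 1 ] :* q :^ 2 :* r :^ 6 :* s :^ 1 :+ con (+ 8) :* q :^ 3 :* r :^ 7 :* s :^ 3 :+ con -[1+ 0 ] :* q :^ 3 :* r :^ 9 :* s :^ 2 :+ con (+ 1) :* q :^ 4 :* r :^ 10 :* s :^ 4
          , s :≈ r :^ 2 :+ q :* r :* s :^ 2 :* (s :+ r :^ 2)) ∷ [])
     (qS ∷ r₁ ∷ s₁ ∷ x ∷ []) refl (hauptmodul-p₁ , ratio-equation , tt)))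

  S₅⁵ : S₅ ^ 5 ≋ dilate 4 ς
  S₅⁵ = ≋-trans (solve 2 (λ q s → (q :^ 2 :* s) :^ 5 :≈ (q :^ 5) :^ 2 :* s :^ 5) (qS ∷ dilate 4 s₁ ∷ []) refl)
    (≋-sym (≋-trans (dilate-expr 4 2 (λ q s → q :^ 2 :* s :^ 5) (qS ∷ s₁ ∷ [])) (*-congʳ (^-cong (dilate-q 4) 2))))

  -- X/x and X A₅/R₅
  e o : Series
  e = qS ^ 4 * (dilate 4 x₁ * inv x₁)
  o = qS ^ 4 * (dilate 4 x₁ * (A₅ * inv (dilate 4 r₁)))

  e-x : e * x ≋ X
  e-x = ≋-trans (solve-by 4 (λ q a b i → q :^ 4 :* (a :* i) :* (q :* b) :≈ q :^ 5 :* a by (q :^ 5 :* a , b :* i :≈ con (+ 1)) ∷ [])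
    (qS ∷ dilate 4 x₁ ∷ x₁ ∷ inv x₁ ∷ []) refl (inverse x₁-1 , tt)) (≋-sym X≋)

  o-R : o * R₅ ≋ X * A₅
  o-R = solve-by 6 (λ q a A r i X → q :^ 4 :* (a :* (A :* i)) :* (q :* r) :≈ X :* A
      by (q :^ 5 :* a :* A , r :* i :≈ con (+ 1)) ∷ (:- A , X :≈ q :^ 5 :* a) ∷ [])
    (qS ∷ dilate 4 x₁ ∷ A₅ ∷ dilate 4 r₁ ∷ inv (dilate 4 r₁) ∷ X ∷ []) refl (inverse (trans (dilate-0 4 ratio) ratio-1) , X≋ , tt)

  Y : Series
  Y = oneS + const (+ 4) * X

  -- The relations of the previous section, multiplied by powers of e = X/x.
  e-B : X * (B₅ * R₅) ≋ Z * (A₅ * S₅) * (e + const (+ 4) * X)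
  e-B = solve-by 6 (λ e b t x X Z → X :* b :≈ Z :* t :* (e :+ con (+ 4) :* X)
      by (e , x :* b :≈ Z :* t :* (con (+ 1) :+ con (+ 4) :* x)) ∷ (con (+ 4) :* Z :* t :- b , e :* x :≈ X) ∷ [])
    (e ∷ B₅ * R₅ ∷ A₅ * S₅ ∷ x ∷ X ∷ Z ∷ []) refl (ratio-relation , e-x , tt)

  e-A² : Y * (X ^ 2 * A₅ ^ 2) ≋ Z ^ 2 * (e * (e + const (+ 4) * X)) * R₅ ^ 2
  e-A² = solve-by 6 (λ e A R x X Z → let Y = con (+ 1) :+ con (+ 4) :* X in
      Y :* (X :^ 2 :* A :^ 2) :≈ Z :^ 2 :* (e :* (e :+ con (+ 4) :* X)) :* R :^ 2
      by (e :^ 2 , Y :* (x :^ 2 :* A :^ 2) :≈ Z :^ 2 :* (con (+ 1) :+ con (+ 4) :* x) :* R :^ 2)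
       ∷ (con (+ 4) :* e :* Z :^ 2 :* R :^ 2 :- Y :* A :^ 2 :* (e :* x :+ X) , e :* x :≈ X) ∷ [])
    (e ∷ A₅ ∷ R₅ ∷ x ∷ X ∷ Z ∷ []) refl (a-relation , e-x , tt)

  e-AB : Y * (X ^ 3 * (A₅ * B₅)) ≋ Z ^ 3 * (e * (e + const (+ 4) * X) ^ 2) * (R₅ * S₅)
  e-AB = regular-* (regular-1 A₅-1) regular-R₅ _ _ (solve-by 7 (λ e A B R S X Z → let Y = con (+ 1) :+ con (+ 4) :* X ; w = e :+ con (+ 4) :* X in
      A :* R :* (Y :* (X :^ 3 :* (A :* B))) :≈ A :* R :* (Z :^ 3 :* (e :* w :^ 2) :* (R :* S))
      by (X :* B :* R , Y :* (X :^ 2 :* A :^ 2) :≈ Z :^ 2 :* (e :* w) :* R :^ 2)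
       ∷ (Z :^ 2 :* (e :* w) :* R :^ 2 , X :* (B :* R) :≈ Z :* (A :* S) :* w) ∷ [])
    (e ∷ A₅ ∷ B₅ ∷ R₅ ∷ S₅ ∷ X ∷ Z ∷ []) refl (e-A² , e-B , tt))

  e-B² : Y * (X ^ 4 * B₅ ^ 2) ≋ Z ^ 4 * (e * (e + const (+ 4) * X) ^ 3) * S₅ ^ 2
  e-B² = regular-* (regular-1 A₅-1) regular-R₅ _ _ (solve-by 7 (λ e A B R S X Z → let Y = con (+ 1) :+ con (+ 4) :* X ; w = e :+ con (+ 4) :* X in
      A :* R :* (Y :* (X :^ 4 :* B :^ 2)) :≈ A :* R :* (Z :^ 4 :* (e :* w :^ 3) :* S :^ 2)
      by (X :* B :* R , Y :* (X :^ 3 :* (A :* B)) :≈ Z :^ 3 :* (e :* w :^ 2) :* (R :* S))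
       ∷ (Z :^ 3 :* (e :* w :^ 2) :* (R :* S) , X :* (B :* R) :≈ Z :* (A :* S) :* w) ∷ [])
    (e ∷ A₅ ∷ B₅ ∷ R₅ ∷ S₅ ∷ X ∷ Z ∷ []) refl (e-AB , e-B , tt))

  -- This is X⁴ x^(-j). Negative powers of x are the natural ones: over the series in q⁵, b/a is
  -- linear in 1/x, and a², ab, b² are polynomials in 1/x of degrees 2, 3, 4. The factor X⁴ avoids
  -- negative exponents of q.
  E : ℕ → Series
  E j = X ^ (4 ℕ.∸ j) * e ^ j

  section-equation : ∀ {a b c d C D} → dilate 4 c ≋ C → dilate 4 d ≋ D → C * a ≋ D * b → c * section 0 a ≋ d * section 0 b
  section-equation {a} {b} {c} {d} p q h = ≋-trans (≋-sym (section-dilate* 0 (s≤s z≤n) c a))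
    (≋-trans (section-cong 0 (≋-trans (*-congʳ p) (≋-trans h (*-congʳ (≋-sym q))))) (section-dilate* 0 (s≤s z≤n) d b))

  section-combination₂ : ∀ a b m → section 0 (a + const m * b) ≋ section 0 a + const m * section 0 b
  section-combination₂ a b m = ≋-trans (section-+ 0 _ _) (+-congˡ (section-const* m b))

  section-combination₃ : ∀ a b c m n → section 0 (a + const m * b + const n * c) ≋ section 0 a + const m * section 0 b + const n * section 0 c
  section-combination₃ a b c m n = ≋-trans (section-+ 0 _ _) (+-cong (section-combination₂ a b m) (section-const* n c))

  section-combination₄ : ∀ a b c d m n l → section 0 (a + const m * b + const n * c + const l * d) ≋
    section 0 a + const m * section 0 b + const n * section 0 c + const l * section 0 d
  section-combination₄ a b c d m n l = ≋-trans (section-+ 0 _ _) (+-cong (section-combination₃ a b c m n) (section-const* l d))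

  dilate-yx : ∀ k → dilate 4 (y * x ^ k) ≋ Y * X ^ k
  dilate-yx k = ≋-trans (dilate-* 4 y (x ^ k)) (*-cong (dilate-expr 4 1 (λ x → con (+ 1) :+ con (+ 4) :* x) (x ∷ [])) (dilate-^ 4 x k))

  dilate-z : ∀ {m M} k → dilate 4 m ≋ M → dilate 4 (z ^ k * m) ≋ Z ^ k * M
  dilate-z {m} k p = ≋-trans (dilate-* 4 (z ^ k) m) (*-cong (≋-trans (dilate-^ 4 z k)
    (^-cong (dilate-expr 4 1 (λ x → con (+ 1) :+ con (+ 5) :* x) (x ∷ [])) k)) p)

  z-1 : z 0 ≡ + 1
  z-1 = head-oneMinus (solve 2 (λ q x → con (+ 1) :+ con (+ 5) :* (q :* x) :≈ con (+ 1) :+ q :* (con (+ 5) :* x)) (qS ∷ x₁ ∷ []) refl)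

  regular-ϱ : Regular ϱ
  regular-ϱ = regular-* regular-q (regular-^ (regular-1 ratio-1) 5)

  regular-ς : Regular ς
  regular-ς = regular-* (regular-^ regular-q 2) (regular-^ (regular-1 s₁-1) 5)

  regular-k : Regular k
  regular-k = regular-* regular-q (regular-1 k₁-1)

  M : ℕ → Series
  M j = section 0 (E j)

  trace-0 : M 0 ≋ x ^ 4
  trace-0 = ≋-trans (section-cong 0 (≋-trans (*-identityʳ (X ^ 4)) (≋-sym (dilate-^ 4 x 4)))) (section-0-dilate (x ^ 4))

  -- `M j` is x⁴ U₅(x^(-j)). Apply U₅ to b/a = Z(1/x + 4). The next three relations arise in the
  -- same way from a², ab and b², each bringing in one further power of 1/x.
  trace-1 : z * (M 1 + const (+ 4) * M 0) ≋ y * x ^ 4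
  trace-1 = regular-* regular-k (regular-1 normForm-ϱ-1) _ _ (≋-trans
    (solve 4 (λ k n z m → k :* n :* (z :* m) :≈ (z :^ 1 :* (k :* n)) :* m) (k ∷ normForm ϱ ∷ z ∷ M 1 + const (+ 4) * M 0 ∷ []) refl)
    (≋-trans (*-congˡ (≋-sym (section-combination₂ (E 1) (E 0) (+ 4)))) (≋-trans
    (section-equation {c = z ^ 1 * (k * normForm ϱ)} {d = x ^ 4} {C = Z ^ 1 * (K * normForm (R₅ ^ 5))} {D = X ^ 4}
      (dilate-z 1 (≋-trans (dilate-* 4 k (normForm ϱ)) (*-cong (≋-sym K≋) (≋-trans (normForm-dilate ϱ) (normForm-cong (≋-sym R₅⁵))))))
      (dilate-^ 4 x 4)
      (solve-by 6 (λ e B R S X Z → let A = Aₑ R ; n = R :^ 5 in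
          Z :^ 1 :* (R :* S :^ 2 :* (con (+ 1) :- con (+ 11) :* n :- n :^ 2)) :* (X :^ 3 :* (e :* con (+ 1)) :+ con (+ 4) :* (X :^ 4 :* con (+ 1))) :≈
          X :^ 4 :* (B :* R :^ 2 :* S :* A′ₑ R)
          by (:- (X :^ 3 :* R :* S :* A′ₑ R) , X :* (B :* R) :≈ Z :* (A :* S) :* (e :+ con (+ 4) :* X)) ∷ [])
        (e ∷ B₅ ∷ R₅ ∷ S₅ ∷ X ∷ Z ∷ []) refl (e-B , tt)))
    (≋-trans (*-congˡ section-BA′) (solve 4 (λ k n y x → x :^ 4 :* (y :* (k :* n)) :≈ k :* n :* (y :* x :^ 4)) (k ∷ normForm ϱ ∷ y ∷ x ∷ []) refl)))))

  trace-2 : z ^ 2 * (M 2 + const (+ 4) * M 1) ≋ - (y * x ^ 4)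
  trace-2 = regular-ϱ _ _ (≋-trans
    (solve 3 (λ n z m → n :* (z :^ 2 :* m) :≈ (z :^ 2 :* n) :* m) (ϱ ∷ z ∷ M 2 + const (+ 4) * M 1 ∷ []) refl)
    (≋-trans (*-congˡ (≋-sym (section-combination₂ (E 2) (E 1) (+ 4)))) (≋-trans (≋-sym
    (section-equation {c = y * x ^ 4} {d = z ^ 2 * ϱ} {C = Y * X ^ 4} {D = Z ^ 2 * R₅ ^ 5} (dilate-yx 4) (dilate-z 2 (≋-sym R₅⁵))
      (solve-by 5 (λ e A R X Z → let Y = con (+ 1) :+ con (+ 4) :* X in
          Y :* X :^ 4 :* (R :^ 3 :* A :^ 2) :≈ Z :^ 2 :* R :^ 5 :* (X :^ 2 :* (e :* (e :* con (+ 1))) :+ con (+ 4) :* (X :^ 3 :* (e :* con (+ 1))))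
          by (X :^ 2 :* R :^ 3 , Y :* (X :^ 2 :* A :^ 2) :≈ Z :^ 2 :* (e :* (e :+ con (+ 4) :* X)) :* R :^ 2) ∷ [])
        (e ∷ A₅ ∷ R₅ ∷ X ∷ Z ∷ []) refl (e-A² , tt))))
    (≋-trans (*-congˡ section-A²) (solve 3 (λ n y x → y :* x :^ 4 :* (:- n) :≈ n :* (:- (y :* x :^ 4))) (ϱ ∷ y ∷ x ∷ []) refl)))))

  trace-3 : z ^ 3 * (M 3 + const (+ 8) * M 2 + const (+ 16) * M 1) ≋ y * x ^ 4
  trace-3 = regular-k _ _ (≋-trans
    (solve 3 (λ n z m → n :* (z :^ 3 :* m) :≈ (z :^ 3 :* n) :* m) (k ∷ z ∷ M 3 + const (+ 8) * M 2 + const (+ 16) * M 1 ∷ []) refl)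
    (≋-trans (*-congˡ (≋-sym (section-combination₃ (E 3) (E 2) (E 1) (+ 8) (+ 16)))) (≋-trans (≋-sym
    (section-equation {c = y * x ^ 4} {d = z ^ 3 * k} {C = Y * X ^ 4} {D = Z ^ 3 * K} (dilate-yx 4) (dilate-z 3 (≋-sym K≋))
      (solve-by 7 (λ e A B R S X Z → let Y = con (+ 1) :+ con (+ 4) :* X in
          Y :* X :^ 4 :* (A :* B :* S) :≈ Z :^ 3 :* (R :* S :^ 2) :* (X :^ 1 :* e :^ 3 :+ con (+ 8) :* (X :^ 2 :* e :^ 2) :+ con (+ 16) :* (X :^ 3 :* e :^ 1))
          by (X :* S , Y :* (X :^ 3 :* (A :* B)) :≈ Z :^ 3 :* (e :* (e :+ con (+ 4) :* X) :^ 2) :* (R :* S)) ∷ [])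
        (e ∷ A₅ ∷ B₅ ∷ R₅ ∷ S₅ ∷ X ∷ Z ∷ []) refl (e-AB , tt))))
    (≋-trans (*-congˡ section-AB) (*-comm _ k)))))

  trace-4 : z ^ 4 * (M 4 + const (+ 12) * M 3 + const (+ 48) * M 2 + const (+ 64) * M 1) ≋ - (y * x ^ 4)
  trace-4 = regular-ς _ _ (≋-trans
    (solve 3 (λ n z m → n :* (z :^ 4 :* m) :≈ (z :^ 4 :* n) :* m) (ς ∷ z ∷ M 4 + const (+ 12) * M 3 + const (+ 48) * M 2 + const (+ 64) * M 1 ∷ []) refl)
    (≋-trans (*-congˡ (≋-sym (section-combination₄ (E 4) (E 3) (E 2) (E 1) (+ 12) (+ 48) (+ 64)))) (≋-trans (≋-sym
    (section-equation {c = y * x ^ 4} {d = z ^ 4 * ς} {C = Y * X ^ 4} {D = Z ^ 4 * S₅ ^ 5} (dilate-yx 4) (dilate-z 4 (≋-sym S₅⁵))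
      (solve-by 5 (λ e B S X Z → let Y = con (+ 1) :+ con (+ 4) :* X in
          Y :* X :^ 4 :* (S :^ 3 :* B :^ 2) :≈ Z :^ 4 :* S :^ 5 :* (X :^ 0 :* e :^ 4 :+ con (+ 12) :* (X :^ 1 :* e :^ 3) :+ con (+ 48) :* (X :^ 2 :* e :^ 2) :+ con (+ 64) :* (X :^ 3 :* e :^ 1))
          by (S :^ 3 , Y :* (X :^ 4 :* B :^ 2) :≈ Z :^ 4 :* (e :* (e :+ con (+ 4) :* X) :^ 3) :* S :^ 2) ∷ [])
        (e ∷ B₅ ∷ S₅ ∷ X ∷ Z ∷ []) refl (e-B² , tt))))
    (≋-trans (*-congˡ section-B²) (solve 3 (λ n y x → y :* x :^ 4 :* (:- n) :≈ n :* (:- (y :* x :^ 4))) (ς ∷ y ∷ x ∷ []) refl)))))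

  -- This is X⁵ a x^(-j). The factor a is the one that Φ carries beyond a rational function of x and
  -- X.
  O : ℕ → Series
  O j = o * E j

  N : ℕ → Series
  N j = section 0 (O j)

  twisted-0 : N 0 ≋ - x ^ 5
  twisted-0 = regular-ϱ _ _ (≋-trans (≋-sym
    (section-equation {c = x ^ 5} {d = ϱ} {C = X ^ 5} {D = R₅ ^ 5} (dilate-^ 4 x 5) (≋-sym R₅⁵)
      (solve-by 4 (λ o A R X → X :^ 5 :* (R :^ 4 :* A) :≈ R :^ 5 :* (o :* (X :^ 4 :* con (+ 1)))
          by (:- (X :^ 4 :* R :^ 4) , o :* R :≈ X :* A) ∷ [])
        (o ∷ A₅ ∷ R₅ ∷ X ∷ []) refl (o-R , tt))))
    (≋-trans (*-congˡ section-A) (solve 2 (λ n x → x :^ 5 :* (:- n) :≈ n :* (:- x :^ 5)) (ϱ ∷ x ∷ []) refl)))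

  o-B : X ^ 2 * B₅ ≋ Z * (o * (e + const (+ 4) * X)) * S₅
  o-B = regular-R₅ _ _ (solve-by 8 (λ e o A B R S X Z → let w = e :+ con (+ 4) :* X in
      R :* (X :^ 2 :* B) :≈ R :* (Z :* (o :* w) :* S)
      by (X , X :* (B :* R) :≈ Z :* (A :* S) :* w) ∷ (:- (Z :* w :* S) , o :* R :≈ X :* A) ∷ [])
    (e ∷ o ∷ A₅ ∷ B₅ ∷ R₅ ∷ S₅ ∷ X ∷ Z ∷ []) refl (e-B , o-R , tt))

  -- `N j` is x⁵ U₅(a x^(-j)). Multiplying the expressions for b/a, a², ab, b² by a gives b, a³,
  -- a²b, ab², whose images under U₅ are known; this case comes from b = Z a(1/x + 4).
  twisted-1 : z * (N 1 + const (+ 4) * N 0) ≋ - x ^ 5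
  twisted-1 = regular-ς _ _ (≋-trans
    (solve 3 (λ n z m → n :* (z :* m) :≈ (z :^ 1 :* n) :* m) (ς ∷ z ∷ N 1 + const (+ 4) * N 0 ∷ []) refl)
    (≋-trans (*-congˡ (≋-sym (section-combination₂ (O 1) (O 0) (+ 4)))) (≋-trans (≋-sym
    (section-equation {c = x ^ 5} {d = z ^ 1 * ς} {C = X ^ 5} {D = Z ^ 1 * S₅ ^ 5} (dilate-^ 4 x 5) (dilate-z 1 (≋-sym S₅⁵))
      (solve-by 6 (λ e o B S X Z → let w = e :+ con (+ 4) :* X in
          X :^ 5 :* (S :^ 4 :* B) :≈ Z :^ 1 :* S :^ 5 :* (o :* (X :^ 3 :* e :^ 1) :+ con (+ 4) :* (o :* (X :^ 4 :* e :^ 0)))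
          by (X :^ 3 :* S :^ 4 , X :^ 2 :* B :≈ Z :* (o :* w) :* S) ∷ [])
        (e ∷ o ∷ B₅ ∷ S₅ ∷ X ∷ Z ∷ []) refl (o-B , tt))))
    (≋-trans (*-congˡ section-B) (solve 2 (λ n x → x :^ 5 :* (:- n) :≈ n :* (:- x :^ 5)) (ς ∷ x ∷ []) refl)))))

  twisted-2 : z ^ 2 * (N 2 + const (+ 4) * N 1) ≋ const (+ 5) * (y * x ^ 5)
  twisted-2 = regular-ϱ _ _ (≋-trans
    (solve 3 (λ n z m → n :* (z :^ 2 :* m) :≈ (z :^ 2 :* n) :* m) (ϱ ∷ z ∷ N 2 + const (+ 4) * N 1 ∷ []) refl)
    (≋-trans (*-congˡ (≋-sym (section-combination₂ (O 2) (O 1) (+ 4)))) (≋-trans (≋-sym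
    (section-equation {c = y * x ^ 5} {d = z ^ 2 * ϱ} {C = Y * X ^ 5} {D = Z ^ 2 * R₅ ^ 5} (dilate-yx 5) (dilate-z 2 (≋-sym R₅⁵))
      (solve-by 6 (λ e o A R X Z → let Y = con (+ 1) :+ con (+ 4) :* X ; w = e :+ con (+ 4) :* X in
          Y :* X :^ 5 :* (R :^ 2 :* A :^ 3) :≈ Z :^ 2 :* R :^ 5 :* (o :* (X :^ 2 :* e :^ 2) :+ con (+ 4) :* (o :* (X :^ 3 :* e :^ 1)))
          by (X :^ 3 :* R :^ 2 :* A , Y :* (X :^ 2 :* A :^ 2) :≈ Z :^ 2 :* (e :* w) :* R :^ 2)
           ∷ (:- (X :^ 2 :* R :^ 4 :* Z :^ 2 :* e :* w) , o :* R :≈ X :* A) ∷ [])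
        (e ∷ o ∷ A₅ ∷ R₅ ∷ X ∷ Z ∷ []) refl (e-A² , o-R , tt))))
    (≋-trans (*-congˡ section-A³) (solve 3 (λ n y x → y :* x :^ 5 :* (con (+ 5) :* n) :≈ n :* (con (+ 5) :* (y :* x :^ 5))) (ϱ ∷ y ∷ x ∷ []) refl)))))

  twisted-3 : z ^ 3 * (N 3 + const (+ 8) * N 2 + const (+ 16) * N 1) ≋ x ^ 5
  twisted-3 = regular-^ regular-k 2 _ _ (≋-trans
    (solve 3 (λ k z m → k :^ 2 :* (z :^ 3 :* m) :≈ (z :^ 3 :* k :^ 2) :* m) (k ∷ z ∷ N 3 + const (+ 8) * N 2 + const (+ 16) * N 1 ∷ []) refl)
    (≋-trans (*-congˡ (≋-sym (section-combination₃ (O 3) (O 2) (O 1) (+ 8) (+ 16)))) (≋-trans (≋-sym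
    (section-equation {c = y * x ^ 5} {d = z ^ 3 * k ^ 2} {C = Y * X ^ 5} {D = Z ^ 3 * K ^ 2} (dilate-yx 5)
      (dilate-z 3 (≋-trans (dilate-^ 4 k 2) (^-cong (≋-sym K≋) 2)))
      (solve-by 8 (λ e o A B R S X Z → let Y = con (+ 1) :+ con (+ 4) :* X ; w = e :+ con (+ 4) :* X in
          Y :* X :^ 5 :* (A :^ 2 :* B :* S :^ 3) :≈ Z :^ 3 :* (R :* S :^ 2) :^ 2 :*
            (o :* (X :^ 1 :* e :^ 3) :+ con (+ 8) :* (o :* (X :^ 2 :* e :^ 2)) :+ con (+ 16) :* (o :* (X :^ 3 :* e :^ 1)))
          by (X :^ 2 :* A :* S :^ 3 , Y :* (X :^ 3 :* (A :* B)) :≈ Z :^ 3 :* (e :* w :^ 2) :* (R :* S))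
           ∷ (:- (X :* S :^ 4 :* R :* Z :^ 3 :* e :* w :^ 2) , o :* R :≈ X :* A) ∷ [])
        (e ∷ o ∷ A₅ ∷ B₅ ∷ R₅ ∷ S₅ ∷ X ∷ Z ∷ []) refl (e-AB , o-R , tt))))
    (solve-by 4 (λ k y x t → y :* x :^ 5 :* t :≈ k :^ 2 :* x :^ 5 by (x :^ 5 , y :* t :≈ k :^ 2) ∷ [])
      (k ∷ y ∷ x ∷ section 0 (A₅ ^ 2 * B₅ * S₅ ^ 3) ∷ []) refl (section-A²B , tt)))))

  twisted-4 : z ^ 3 * (N 4 + const (+ 12) * N 3 + const (+ 48) * N 2 + const (+ 64) * N 1) ≋ y * x ^ 4
  twisted-4 = regular-* regular-k (regular-1 z-1) _ _ (≋-trans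
    (solve 3 (λ n z m → n :* z :* (z :^ 3 :* m) :≈ (z :^ 4 :* n) :* m) (k ∷ z ∷ N 4 + const (+ 12) * N 3 + const (+ 48) * N 2 + const (+ 64) * N 1 ∷ []) refl)
    (≋-trans (*-congˡ (≋-sym (section-combination₄ (O 4) (O 3) (O 2) (O 1) (+ 12) (+ 48) (+ 64)))) (≋-trans (≋-sym
    (section-equation {c = y * x ^ 5} {d = z ^ 4 * k} {C = Y * X ^ 5} {D = Z ^ 4 * K} (dilate-yx 5) (dilate-z 4 (≋-sym K≋))
      (solve-by 8 (λ e o A B R S X Z → let Y = con (+ 1) :+ con (+ 4) :* X ; w = e :+ con (+ 4) :* X in
          Y :* X :^ 5 :* (A :* B :^ 2) :≈ Z :^ 4 :* (R :* S :^ 2) :* (o :* (X :^ 0 :* e :^ 4) :+ con (+ 12) :* (o :* (X :^ 1 :* e :^ 3)) :+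
            con (+ 48) :* (o :* (X :^ 2 :* e :^ 2)) :+ con (+ 64) :* (o :* (X :^ 3 :* e :^ 1)))
          by (X :* A , Y :* (X :^ 4 :* B :^ 2) :≈ Z :^ 4 :* (e :* w :^ 3) :* S :^ 2)
           ∷ (:- (Z :^ 4 :* e :* w :^ 3 :* S :^ 2) , o :* R :≈ X :* A) ∷ [])
        (e ∷ o ∷ A₅ ∷ B₅ ∷ R₅ ∷ S₅ ∷ X ∷ Z ∷ []) refl (e-B² , o-R , tt))))
    (≋-trans (*-congˡ section-AB²) (regular-1 (p₁-1 k₁) _ _ (solve-by 6 (λ k y x z P T →
        P :* (y :* x :^ 5 :* T) :≈ P :* (k :* z :* (y :* x :^ 4))
        by (y :* x :^ 4 :* T , x :* P :≈ k) ∷ (:- (k :* y :* x :^ 4) , z :* P :≈ T) ∷ [])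
      (k ∷ y ∷ x ∷ z ∷ p₁ k ∷ p₂ k ∷ []) refl (hauptmodul-p₁ , z-p₁ , tt)))))))

-- Coordinates over ℤ[X] with respect to a basis b₀, …, b₄ such that x bⱼ₊₁ = bⱼ.

Coordinates : Set
Coordinates = Vec (Poly 1) 5

-- Multiplication by x shifts coordinates, as x bⱼ₊₁ = bⱼ. The coordinate leaving at index 0 returns
-- through x b₀ = a₄b₀ + a₃b₁ + a₂b₂ + a₁b₃ + a₀b₄, the quintic divided by x⁴. In these coordinates
-- all normal forms are univariate.
timesX : Coordinates → Coordinates
timesX (c₀ ∷ c₁ ∷ c₂ ∷ c₃ ∷ c₄ ∷ []) =
  addₚ 1 c₁ (mulₚ 1 c₀ a₄ₚ) ∷ addₚ 1 c₂ (mulₚ 1 c₀ a₃ₚ) ∷ addₚ 1 c₃ (mulₚ 1 c₀ a₂ₚ) ∷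
  addₚ 1 c₄ (mulₚ 1 c₀ a₁ₚ) ∷ mulₚ 1 c₀ a₀ₚ ∷ []

scale : Poly 1 → Coordinates → Coordinates
scale p = Vec.map (mulₚ 1 p)

infixl 6 _⊹_
_⊹_ : Coordinates → Coordinates → Coordinates
_⊹_ = Vec.zipWith (addₚ 1)

zeroC unitC : Coordinates
zeroC = [] ∷ [] ∷ [] ∷ [] ∷ [] ∷ []
unitC = (+ 1 ∷ []) ∷ [] ∷ [] ∷ [] ∷ [] ∷ []

timesPoly : Poly 2 → Coordinates → Coordinates
timesPoly []       c = zeroC
timesPoly (h ∷ hs) c = scale h c ⊹ timesX (timesPoly hs c)

iterate : (Coordinates → Coordinates) → ℕ → Coordinates → Coordinates
iterate φ zero    c = c
iterate φ (suc n) c = φ (iterate φ n c)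

opaque
  combine : Coordinates → Series → Vec Series 5 → Series
  combine (c₀ ∷ c₁ ∷ c₂ ∷ c₃ ∷ c₄ ∷ []) t (b₀ ∷ b₁ ∷ b₂ ∷ b₃ ∷ b₄ ∷ []) =
    ev c₀ * b₀ + ev c₁ * b₁ + ev c₂ * b₂ + ev c₃ * b₃ + ev c₄ * b₄
    where
    ev : Poly 1 → Series
    ev c = eval 1 c (t ∷ [])

record Basis (b : Vec Series 5) : Set where
  field
    step₁ : x * Vec.lookup b (# 1) ≋ Vec.lookup b (# 0)
    step₂ : x * Vec.lookup b (# 2) ≋ Vec.lookup b (# 1)
    step₃ : x * Vec.lookup b (# 3) ≋ Vec.lookup b (# 2)
    step₄ : x * Vec.lookup b (# 4) ≋ Vec.lookup b (# 3)
    step₀ : x * Vec.lookup b (# 0) ≋ combine (a₄ₚ ∷ a₃ₚ ∷ a₂ₚ ∷ a₁ₚ ∷ a₀ₚ ∷ []) X b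

private
  X₁ : Vec Series 1
  X₁ = X ∷ []

opaque
  unfolding combine

  timesX-sound : ∀ {b} → Basis b → ∀ c → combine (timesX c) X b ≋ x * combine c X b
  timesX-sound {b₀ ∷ b₁ ∷ b₂ ∷ b₃ ∷ b₄ ∷ []} basis (c₀ ∷ c₁ ∷ c₂ ∷ c₃ ∷ c₄ ∷ []) = ≋-trans
    (+-cong (+-cong (+-cong (+-cong (entry c₁ a₄ₚ b₀) (entry c₂ a₃ₚ b₁)) (entry c₃ a₂ₚ b₂)) (entry c₄ a₁ₚ b₃)) (*-congʳ (mulₚ-sound 1 c₀ a₀ₚ X₁)))
    (solve-by 16 (λ x b₀ b₁ b₂ b₃ b₄ c₀ c₁ c₂ c₃ c₄ a₀ a₁ a₂ a₃ a₄ →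
        (c₁ :+ c₀ :* a₄) :* b₀ :+ (c₂ :+ c₀ :* a₃) :* b₁ :+ (c₃ :+ c₀ :* a₂) :* b₂ :+ (c₄ :+ c₀ :* a₁) :* b₃ :+ c₀ :* a₀ :* b₄ :≈
        x :* (c₀ :* b₀ :+ c₁ :* b₁ :+ c₂ :* b₂ :+ c₃ :* b₃ :+ c₄ :* b₄)
        by (:- c₁ , x :* b₁ :≈ b₀) ∷ (:- c₂ , x :* b₂ :≈ b₁) ∷ (:- c₃ , x :* b₃ :≈ b₂) ∷ (:- c₄ , x :* b₄ :≈ b₃)
         ∷ (:- c₀ , x :* b₀ :≈ a₄ :* b₀ :+ a₃ :* b₁ :+ a₂ :* b₂ :+ a₁ :* b₃ :+ a₀ :* b₄) ∷ [])
      (x ∷ b₀ ∷ b₁ ∷ b₂ ∷ b₃ ∷ b₄ ∷ ev c₀ ∷ ev c₁ ∷ ev c₂ ∷ ev c₃ ∷ ev c₄ ∷ ev a₀ₚ ∷ ev a₁ₚ ∷ ev a₂ₚ ∷ ev a₃ₚ ∷ ev a₄ₚ ∷ []) refl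
      (step₁ , step₂ , step₃ , step₄ , step₀ , tt))
    where
    open Basis basis
    ev : Poly 1 → Series
    ev c = eval 1 c X₁
    entry : ∀ c a b → ev (addₚ 1 c (mulₚ 1 c₀ a)) * b ≋ (ev c + ev c₀ * ev a) * b
    entry c a b = *-congʳ (≋-trans (addₚ-sound 1 c (mulₚ 1 c₀ a) X₁) (+-congˡ (mulₚ-sound 1 c₀ a X₁)))

  combine-⊹ : ∀ c d t b → combine (c ⊹ d) t b ≋ combine c t b + combine d t b
  combine-⊹ (c₀ ∷ c₁ ∷ c₂ ∷ c₃ ∷ c₄ ∷ []) (d₀ ∷ d₁ ∷ d₂ ∷ d₃ ∷ d₄ ∷ []) t (b₀ ∷ b₁ ∷ b₂ ∷ b₃ ∷ b₄ ∷ []) = ≋-trans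
    (+-cong (+-cong (+-cong (+-cong (entry c₀ d₀ b₀) (entry c₁ d₁ b₁)) (entry c₂ d₂ b₂)) (entry c₃ d₃ b₃)) (entry c₄ d₄ b₄))
    (solve 10 (λ a b c d e f g h i j → (a :+ b) :+ (c :+ d) :+ (e :+ f) :+ (g :+ h) :+ (i :+ j) :≈ (a :+ c :+ e :+ g :+ i) :+ (b :+ d :+ f :+ h :+ j))
      (ev c₀ * b₀ ∷ ev d₀ * b₀ ∷ ev c₁ * b₁ ∷ ev d₁ * b₁ ∷ ev c₂ * b₂ ∷ ev d₂ * b₂ ∷ ev c₃ * b₃ ∷ ev d₃ * b₃ ∷ ev c₄ * b₄ ∷ ev d₄ * b₄ ∷ []) refl)
    where
    ev : Poly 1 → Series
    ev c = eval 1 c (t ∷ [])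
    entry : ∀ c d b → ev (addₚ 1 c d) * b ≋ ev c * b + ev d * b
    entry c d b = ≋-trans (*-congʳ (addₚ-sound 1 c d (t ∷ []))) (CommutativeRing.distribʳ seriesRing b (ev c) (ev d))

  combine-scale : ∀ p c t b → combine (scale p c) t b ≋ eval 1 p (t ∷ []) * combine c t b
  combine-scale p (c₀ ∷ c₁ ∷ c₂ ∷ c₃ ∷ c₄ ∷ []) t (b₀ ∷ b₁ ∷ b₂ ∷ b₃ ∷ b₄ ∷ []) = ≋-trans
    (+-cong (+-cong (+-cong (+-cong (entry c₀ b₀) (entry c₁ b₁)) (entry c₂ b₂)) (entry c₃ b₃)) (entry c₄ b₄))
    (solve 6 (λ p a b c d e → p :* a :+ p :* b :+ p :* c :+ p :* d :+ p :* e :≈ p :* (a :+ b :+ c :+ d :+ e))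
      (ev p ∷ ev c₀ * b₀ ∷ ev c₁ * b₁ ∷ ev c₂ * b₂ ∷ ev c₃ * b₃ ∷ ev c₄ * b₄ ∷ []) refl)
    where
    ev : Poly 1 → Series
    ev c = eval 1 c (t ∷ [])
    entry : ∀ c b → ev (mulₚ 1 p c) * b ≋ ev p * (ev c * b)
    entry c b = ≋-trans (*-congʳ (mulₚ-sound 1 p c (t ∷ []))) (*-assoc (ev p) (ev c) b)

  timesPoly-sound : ∀ {b} → Basis b → ∀ hs c → combine (timesPoly hs c) X b ≋ eval 2 hs (x ∷ X ∷ []) * combine c X b
  timesPoly-sound {b₀ ∷ b₁ ∷ b₂ ∷ b₃ ∷ b₄ ∷ []} basis [] c = ≋-trans
    (solve 5 (λ a b c d e → con (+ 0) :* a :+ con (+ 0) :* b :+ con (+ 0) :* c :+ con (+ 0) :* d :+ con (+ 0) :* e :≈ con (+ 0))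
      (b₀ ∷ b₁ ∷ b₂ ∷ b₃ ∷ b₄ ∷ []) refl)
    (≋-sym (zeroˡ _))
  timesPoly-sound {b} basis (h ∷ hs) c = ≋-trans (combine-⊹ (scale h c) (timesX (timesPoly hs c)) X b) (≋-trans
    (+-cong (combine-scale h c X b) (≋-trans (timesX-sound basis (timesPoly hs c)) (*-congˡ (timesPoly-sound basis hs c))))
    (solve 4 (λ h c x s → h :* c :+ x :* (s :* c) :≈ (h :+ x :* s) :* c) (eval 1 h X₁ ∷ combine c X b ∷ x ∷ eval 2 hs (x ∷ X ∷ []) ∷ []) refl))

iterate-sound : ∀ {b} φ t → (∀ c → combine (φ c) X b ≋ t * combine c X b) → ∀ n c → combine (iterate φ n c) X b ≋ t ^ n * combine c X b
iterate-sound φ t h zero    c = ≋-sym (*-identityˡ _)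
iterate-sound φ t h (suc n) c = ≋-trans (h (iterate φ n c)) (≋-trans (*-congˡ (iterate-sound φ t h n c)) (≋-sym (*-assoc t (t ^ n) _)))

opaque
  unfolding combine

  combine-unit : ∀ b t → combine unitC t b ≋ Vec.lookup b zero
  combine-unit (b₀ ∷ b₁ ∷ b₂ ∷ b₃ ∷ b₄ ∷ []) t =
    solve 6 (λ a b c d e t → (con (+ 1) :+ t :* con (+ 0)) :* a :+ con (+ 0) :* b :+ con (+ 0) :* c :+ con (+ 0) :* d :+ con (+ 0) :* e :≈ a)
      (b₀ ∷ b₁ ∷ b₂ ∷ b₃ ∷ b₄ ∷ t ∷ []) refl

  section-combine : ∀ c b → section 0 (combine c X b) ≋ combine c x (Vec.map (section 0) b)
  section-combine (c₀ ∷ c₁ ∷ c₂ ∷ c₃ ∷ c₄ ∷ []) (b₀ ∷ b₁ ∷ b₂ ∷ b₃ ∷ b₄ ∷ []) =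
    ≋-trans (section-+ 0 _ _) (+-cong (≋-trans (section-+ 0 _ _) (+-cong (≋-trans (section-+ 0 _ _) (+-cong
      (≋-trans (section-+ 0 _ _) (+-cong (entry c₀ b₀) (entry c₁ b₁))) (entry c₂ b₂))) (entry c₃ b₃))) (entry c₄ b₄))
    where
    entry : ∀ c b → section 0 (eval 1 c X₁ * b) ≋ eval 1 c (x ∷ []) * section 0 b
    entry c b = ≋-trans (section-cong 0 (*-congʳ (≋-sym (dilate-eval 4 1 c (x ∷ []))))) (section-dilate* 0 (s≤s z≤n) (eval 1 c (x ∷ [])) b)

pairing : Coordinates → Vec (Poly 1) 5 → Poly 1
pairing (c₀ ∷ c₁ ∷ c₂ ∷ c₃ ∷ c₄ ∷ []) (d₀ ∷ d₁ ∷ d₂ ∷ d₃ ∷ d₄ ∷ []) =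
  addₚ 1 (addₚ 1 (addₚ 1 (addₚ 1 (mulₚ 1 c₀ d₀) (mulₚ 1 c₁ d₁)) (mulₚ 1 c₂ d₂)) (mulₚ 1 c₃ d₃)) (mulₚ 1 c₄ d₄)

opaque
  unfolding combine

  combine-pairing : ∀ c d t w b → (∀ i → w * Vec.lookup b i ≋ eval 1 (Vec.lookup d i) (t ∷ [])) →
                    w * combine c t b ≋ eval 1 (pairing c d) (t ∷ [])
  combine-pairing (c₀ ∷ c₁ ∷ c₂ ∷ c₃ ∷ c₄ ∷ []) (d₀ ∷ d₁ ∷ d₂ ∷ d₃ ∷ d₄ ∷ []) t w (b₀ ∷ b₁ ∷ b₂ ∷ b₃ ∷ b₄ ∷ []) h = ≋-trans
    (solve 11 (λ w a b c d e f g h i j → w :* (a :* f :+ b :* g :+ c :* h :+ d :* i :+ e :* j) :≈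
        a :* (w :* f) :+ b :* (w :* g) :+ c :* (w :* h) :+ d :* (w :* i) :+ e :* (w :* j))
      (w ∷ ev c₀ ∷ ev c₁ ∷ ev c₂ ∷ ev c₃ ∷ ev c₄ ∷ b₀ ∷ b₁ ∷ b₂ ∷ b₃ ∷ b₄ ∷ []) refl)
    (≋-sym (≋-trans (sum s₃ (mulₚ 1 c₄ d₄)) (+-cong (≋-trans (sum s₂ (mulₚ 1 c₃ d₃)) (+-cong (≋-trans (sum s₁′ (mulₚ 1 c₂ d₂)) (+-cong
      (≋-trans (sum (mulₚ 1 c₀ d₀) (mulₚ 1 c₁ d₁)) (+-cong (product c₀ d₀ (h (# 0))) (product c₁ d₁ (h (# 1))))) (product c₂ d₂ (h (# 2))))) (product c₃ d₃ (h (# 3))))) (product c₄ d₄ (h (# 4))))))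
    where
    ev : Poly 1 → Series
    ev c = eval 1 c (t ∷ [])
    product : ∀ c d {u} → u ≋ ev d → ev (mulₚ 1 c d) ≋ ev c * u
    product c d p = ≋-trans (mulₚ-sound 1 c d (t ∷ [])) (*-congˡ (≋-sym p))
    sum : ∀ c d → ev (addₚ 1 c d) ≋ ev c + ev d
    sum c d = addₚ-sound 1 c d (t ∷ [])
    s₁′ s₂ s₃ : Poly 1
    s₁′ = addₚ 1 (mulₚ 1 c₀ d₀) (mulₚ 1 c₁ d₁)
    s₂ = addₚ 1 s₁′ (mulₚ 1 c₂ d₂)
    s₃ = addₚ 1 s₂ (mulₚ 1 c₃ d₃)

polynomial-≋ : ∀ (e : N-ary 1 (Expr 1) (Expr 1)) (p : Poly 1) t →
  isZero 1 (addₚ 1 (normalise 1 (e $ⁿ vars 1)) (negₚ 1 p)) ≡ true → ⟦ e $ⁿ vars 1 ⟧ (t ∷ []) ≋ eval 1 p (t ∷ [])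
polynomial-≋ e p t h = difference-zero (≋-trans (≋-sym (normalise-sound ((e $ⁿ vars 1) :- poly p) (t ∷ []))) (isZero-sound 1 (addₚ 1 (normalise 1 (e $ⁿ vars 1)) (negₚ 1 p)) (t ∷ []) h))

-- The two bases over ℤ[X] and the values of U₅ on them

private
  monomialBasis : Vec Series 5
  monomialBasis = E 0 ∷ E 1 ∷ E 2 ∷ E 3 ∷ E 4 ∷ []

  twistedBasis : Vec Series 5
  twistedBasis = O 0 ∷ O 1 ∷ O 2 ∷ O 3 ∷ O 4 ∷ []

  opaque
    unfolding combine

    E-step₀ : x * E 0 ≋ combine (a₄ₚ ∷ a₃ₚ ∷ a₂ₚ ∷ a₁ₚ ∷ a₀ₚ ∷ []) X monomialBasis
    E-step₀ = solve-by 8 (λ x X e a₀ a₁ a₂ a₃ a₄ →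
        x :* (X :^ 4 :* e :^ 0) :≈ a₄ :* (X :^ 4 :* e :^ 0) :+ a₃ :* (X :^ 3 :* e :^ 1) :+ a₂ :* (X :^ 2 :* e :^ 2) :+ a₁ :* (X :^ 1 :* e :^ 3) :+ a₀ :* (X :^ 0 :* e :^ 4)
        by (e :^ 4 , x :^ 5 :≈ a₀ :+ x :* (a₁ :+ x :* (a₂ :+ x :* (a₃ :+ x :* (a₄ :+ x :* con (+ 0))))))
         ∷ (:- (x :* ((e :* x) :+ X) :* ((e :* x) :^ 2 :+ X :^ 2)) :+ a₁ :* e :^ 3 :+ a₂ :* e :^ 2 :* (e :* x :+ X)
              :+ a₃ :* e :* ((e :* x) :^ 2 :+ e :* x :* X :+ X :^ 2) :+ a₄ :* (e :* x :+ X) :* ((e :* x) :^ 2 :+ X :^ 2) , e :* x :≈ X) ∷ [])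
      (x ∷ X ∷ e ∷ ev a₀ₚ ∷ ev a₁ₚ ∷ ev a₂ₚ ∷ ev a₃ₚ ∷ ev a₄ₚ ∷ []) refl (quintic , e-x , tt)
      where
      ev : Poly 1 → Series
      ev c = eval 1 c X₁

  E-basis : Basis monomialBasis
  E-basis = record
    { step₁ = solve-by 3 (λ x X e → x :* (X :^ 3 :* e :^ 1) :≈ X :^ 4 :* e :^ 0 by (X :^ 3 , e :* x :≈ X) ∷ []) (x ∷ X ∷ e ∷ []) refl (e-x , tt)
    ; step₂ = solve-by 3 (λ x X e → x :* (X :^ 2 :* e :^ 2) :≈ X :^ 3 :* e :^ 1 by (X :^ 2 :* e , e :* x :≈ X) ∷ []) (x ∷ X ∷ e ∷ []) refl (e-x , tt)
    ; step₃ = solve-by 3 (λ x X e → x :* (X :^ 1 :* e :^ 3) :≈ X :^ 2 :* e :^ 2 by (X :* e :^ 2 , e :* x :≈ X) ∷ []) (x ∷ X ∷ e ∷ []) refl (e-x , tt)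
    ; step₄ = solve-by 3 (λ x X e → x :* (X :^ 0 :* e :^ 4) :≈ X :^ 1 :* e :^ 3 by (e :^ 3 , e :* x :≈ X) ∷ []) (x ∷ X ∷ e ∷ []) refl (e-x , tt)
    ; step₀ = E-step₀ }

  opaque
    unfolding combine

    combine-*ˡ : ∀ o c t b → o * combine c t b ≋ combine c t (Vec.map (o *_) b)
    combine-*ˡ o (c₀ ∷ c₁ ∷ c₂ ∷ c₃ ∷ c₄ ∷ []) t (b₀ ∷ b₁ ∷ b₂ ∷ b₃ ∷ b₄ ∷ []) =
      solve 11 (λ o a b c d e f g h i j → o :* (a :* f :+ b :* g :+ c :* h :+ d :* i :+ e :* j) :≈
          a :* (o :* f) :+ b :* (o :* g) :+ c :* (o :* h) :+ d :* (o :* i) :+ e :* (o :* j))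
        (o ∷ ev c₀ ∷ ev c₁ ∷ ev c₂ ∷ ev c₃ ∷ ev c₄ ∷ b₀ ∷ b₁ ∷ b₂ ∷ b₃ ∷ b₄ ∷ []) refl
      where
      ev : Poly 1 → Series
      ev c = eval 1 c (t ∷ [])

  O-basis : Basis twistedBasis
  O-basis = record { step₁ = lift step₁ ; step₂ = lift step₂ ; step₃ = lift step₃ ; step₄ = lift step₄
    ; step₀ = ≋-trans (*-swap x o (E 0)) (≋-trans (*-congˡ step₀) (combine-*ˡ o _ X monomialBasis)) }
    where
    open Basis E-basis
    lift : ∀ {a b} → x * a ≋ b → x * (o * a) ≋ o * b
    lift {a} p = ≋-trans (*-swap x o a) (*-congˡ p)

  -- The polynomials `z ^ 4 * M j` and `z ^ 4 * N j`, obtained by solving the trace and twisted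
  -- relations one after the other; z⁴ is a common denominator for all of them.
  N₀ N₁ N₂ N₃ N₄ P₀ P₁ P₂ P₃ P₄ : ∀ {n} → Expr n → Expr n
  zₑ yₑ : ∀ {n} → Expr n → Expr n
  zₑ x = con (+ 1) :+ con (+ 5) :* x
  yₑ x = con (+ 1) :+ con (+ 4) :* x
  N₀ x = zₑ x :^ 4 :* x :^ 4
  N₁ x = zₑ x :^ 3 :* (yₑ x :* x :^ 4) :- con (+ 4) :* N₀ x
  N₂ x = :- (zₑ x :^ 2 :* (yₑ x :* x :^ 4)) :- con (+ 4) :* N₁ x
  N₃ x = zₑ x :* (yₑ x :* x :^ 4) :- con (+ 8) :* N₂ x :- con (+ 16) :* N₁ x
  N₄ x = :- (yₑ x :* x :^ 4) :- con (+ 12) :* N₃ x :- con (+ 48) :* N₂ x :- con (+ 64) :* N₁ x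
  P₀ x = :- (zₑ x :^ 4 :* x :^ 5)
  P₁ x = :- (zₑ x :^ 3 :* x :^ 5) :- con (+ 4) :* P₀ x
  P₂ x = con (+ 5) :* (zₑ x :^ 2 :* (yₑ x :* x :^ 5)) :- con (+ 4) :* P₁ x
  P₃ x = zₑ x :* x :^ 5 :- con (+ 8) :* P₂ x :- con (+ 16) :* P₁ x
  P₄ x = zₑ x :* (yₑ x :* x :^ 4) :- con (+ 12) :* P₃ x :- con (+ 48) :* P₂ x :- con (+ 64) :* P₁ x

  traceₚ twistedₚ : Vec (Poly 1) 5
  traceₚ   = Vec.map (λ g → normalise 1 (g (var zero))) (N₀ ∷ N₁ ∷ N₂ ∷ N₃ ∷ N₄ ∷ [])
  twistedₚ = Vec.map (λ g → normalise 1 (g (var zero))) (P₀ ∷ P₁ ∷ P₂ ∷ P₃ ∷ P₄ ∷ [])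

  ⟦_⟧ₓ : (∀ {n} → Expr n → Expr n) → Series
  ⟦ g ⟧ₓ = ⟦ g (var zero) ⟧ (x ∷ [])

  normal : (g : Expr 1 → Expr 1) → ⟦ g (var zero) ⟧ (x ∷ []) ≋ eval 1 (normalise 1 (g (var zero))) (x ∷ [])
  normal g = ≋-sym (normalise-sound (g (var zero)) (x ∷ []))

  trace₀ : z ^ 4 * M 0 ≋ ⟦ N₀ ⟧ₓ
  trace₀ = *-congˡ trace-0

  trace₁ : z ^ 4 * M 1 ≋ ⟦ N₁ ⟧ₓ
  trace₁ = solve-by 4 (λ x M₀ M₁ n → let z = zₑ x in z :^ 4 :* M₁ :≈ z :^ 3 :* (yₑ x :* x :^ 4) :- con (+ 4) :* n
      by (z :^ 3 , z :* (M₁ :+ con (+ 4) :* M₀) :≈ yₑ x :* x :^ 4) ∷ (con -[1+ 3 ] , z :^ 4 :* M₀ :≈ n) ∷ [])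
    (x ∷ M 0 ∷ M 1 ∷ ⟦ N₀ ⟧ₓ ∷ []) refl (trace-1 , trace₀ , tt)

  trace₂ : z ^ 4 * M 2 ≋ ⟦ N₂ ⟧ₓ
  trace₂ = solve-by 4 (λ x M₀ M₁ n → let z = zₑ x in z :^ 4 :* M₁ :≈ :- (z :^ 2 :* (yₑ x :* x :^ 4)) :- con (+ 4) :* n
      by (z :^ 2 , z :^ 2 :* (M₁ :+ con (+ 4) :* M₀) :≈ :- (yₑ x :* x :^ 4)) ∷ (con -[1+ 3 ] , z :^ 4 :* M₀ :≈ n) ∷ [])
    (x ∷ M 1 ∷ M 2 ∷ ⟦ N₁ ⟧ₓ ∷ []) refl (trace-2 , trace₁ , tt)

  trace₃ : z ^ 4 * M 3 ≋ ⟦ N₃ ⟧ₓ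
  trace₃ = solve-by 6 (λ x M₁ M₂ M₃ n₁ n₂ → let z = zₑ x in z :^ 4 :* M₃ :≈ z :* (yₑ x :* x :^ 4) :- con (+ 8) :* n₂ :- con (+ 16) :* n₁
      by (z , z :^ 3 :* (M₃ :+ con (+ 8) :* M₂ :+ con (+ 16) :* M₁) :≈ yₑ x :* x :^ 4) ∷ (con -[1+ 7 ] , z :^ 4 :* M₂ :≈ n₂) ∷ (con -[1+ 15 ] , z :^ 4 :* M₁ :≈ n₁) ∷ [])
    (x ∷ M 1 ∷ M 2 ∷ M 3 ∷ ⟦ N₁ ⟧ₓ ∷ ⟦ N₂ ⟧ₓ ∷ []) refl (trace-3 , trace₂ , trace₁ , tt)

  trace₄ : z ^ 4 * M 4 ≋ ⟦ N₄ ⟧ₓ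
  trace₄ = solve-by 8 (λ x M₁ M₂ M₃ M₄ n₁ n₂ n₃ → let z = zₑ x in
      z :^ 4 :* M₄ :≈ :- (yₑ x :* x :^ 4) :- con (+ 12) :* n₃ :- con (+ 48) :* n₂ :- con (+ 64) :* n₁
      by (con (+ 1) , z :^ 4 :* (M₄ :+ con (+ 12) :* M₃ :+ con (+ 48) :* M₂ :+ con (+ 64) :* M₁) :≈ :- (yₑ x :* x :^ 4))
       ∷ (con -[1+ 11 ] , z :^ 4 :* M₃ :≈ n₃) ∷ (con -[1+ 47 ] , z :^ 4 :* M₂ :≈ n₂) ∷ (con -[1+ 63 ] , z :^ 4 :* M₁ :≈ n₁) ∷ [])
    (x ∷ M 1 ∷ M 2 ∷ M 3 ∷ M 4 ∷ ⟦ N₁ ⟧ₓ ∷ ⟦ N₂ ⟧ₓ ∷ ⟦ N₃ ⟧ₓ ∷ []) refl (trace-4 , trace₃ , trace₂ , trace₁ , tt)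

  twisted₀ : z ^ 4 * N 0 ≋ ⟦ P₀ ⟧ₓ
  twisted₀ = ≋-trans (*-congˡ twisted-0) (solve 2 (λ z x → z :* (:- x) :≈ :- (z :* x)) (z ^ 4 ∷ x ^ 5 ∷ []) refl)

  twisted₁ : z ^ 4 * N 1 ≋ ⟦ P₁ ⟧ₓ
  twisted₁ = solve-by 4 (λ x M₀ M₁ n → let z = zₑ x in z :^ 4 :* M₁ :≈ :- (z :^ 3 :* x :^ 5) :- con (+ 4) :* n
      by (z :^ 3 , z :* (M₁ :+ con (+ 4) :* M₀) :≈ :- x :^ 5) ∷ (con -[1+ 3 ] , z :^ 4 :* M₀ :≈ n) ∷ [])
    (x ∷ N 0 ∷ N 1 ∷ ⟦ P₀ ⟧ₓ ∷ []) refl (twisted-1 , twisted₀ , tt)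

  twisted₂ : z ^ 4 * N 2 ≋ ⟦ P₂ ⟧ₓ
  twisted₂ = solve-by 4 (λ x M₀ M₁ n → let z = zₑ x in z :^ 4 :* M₁ :≈ con (+ 5) :* (z :^ 2 :* (yₑ x :* x :^ 5)) :- con (+ 4) :* n
      by (z :^ 2 , z :^ 2 :* (M₁ :+ con (+ 4) :* M₀) :≈ con (+ 5) :* (yₑ x :* x :^ 5)) ∷ (con -[1+ 3 ] , z :^ 4 :* M₀ :≈ n) ∷ [])
    (x ∷ N 1 ∷ N 2 ∷ ⟦ P₁ ⟧ₓ ∷ []) refl (twisted-2 , twisted₁ , tt)

  twisted₃ : z ^ 4 * N 3 ≋ ⟦ P₃ ⟧ₓ
  twisted₃ = solve-by 6 (λ x M₁ M₂ M₃ n₁ n₂ → let z = zₑ x in z :^ 4 :* M₃ :≈ z :* x :^ 5 :- con (+ 8) :* n₂ :- con (+ 16) :* n₁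
      by (z , z :^ 3 :* (M₃ :+ con (+ 8) :* M₂ :+ con (+ 16) :* M₁) :≈ x :^ 5) ∷ (con -[1+ 7 ] , z :^ 4 :* M₂ :≈ n₂) ∷ (con -[1+ 15 ] , z :^ 4 :* M₁ :≈ n₁) ∷ [])
    (x ∷ N 1 ∷ N 2 ∷ N 3 ∷ ⟦ P₁ ⟧ₓ ∷ ⟦ P₂ ⟧ₓ ∷ []) refl (twisted-3 , twisted₂ , twisted₁ , tt)

  twisted₄ : z ^ 4 * N 4 ≋ ⟦ P₄ ⟧ₓ
  twisted₄ = solve-by 8 (λ x M₁ M₂ M₃ M₄ n₁ n₂ n₃ → let z = zₑ x in
      z :^ 4 :* M₄ :≈ z :* (yₑ x :* x :^ 4) :- con (+ 12) :* n₃ :- con (+ 48) :* n₂ :- con (+ 64) :* n₁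
      by (z , z :^ 3 :* (M₄ :+ con (+ 12) :* M₃ :+ con (+ 48) :* M₂ :+ con (+ 64) :* M₁) :≈ yₑ x :* x :^ 4)
       ∷ (con -[1+ 11 ] , z :^ 4 :* M₃ :≈ n₃) ∷ (con -[1+ 47 ] , z :^ 4 :* M₂ :≈ n₂) ∷ (con -[1+ 63 ] , z :^ 4 :* M₁ :≈ n₁) ∷ [])
    (x ∷ N 1 ∷ N 2 ∷ N 3 ∷ N 4 ∷ ⟦ P₁ ⟧ₓ ∷ ⟦ P₂ ⟧ₓ ∷ ⟦ P₃ ⟧ₓ ∷ []) refl (twisted-4 , twisted₃ , twisted₂ , twisted₁ , tt)

  trace-values : ∀ i → z ^ 4 * Vec.lookup (Vec.map (section 0) monomialBasis) i ≋ eval 1 (Vec.lookup traceₚ i) (x ∷ [])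
  trace-values zero                         = ≋-trans trace₀ (normal N₀)
  trace-values (suc zero)                   = ≋-trans trace₁ (normal N₁)
  trace-values (suc (suc zero))             = ≋-trans trace₂ (normal N₂)
  trace-values (suc (suc (suc zero)))       = ≋-trans trace₃ (normal N₃)
  trace-values (suc (suc (suc (suc zero)))) = ≋-trans trace₄ (normal N₄)

  twisted-values : ∀ i → z ^ 4 * Vec.lookup (Vec.map (section 0) twistedBasis) i ≋ eval 1 (Vec.lookup twistedₚ i) (x ∷ [])
  twisted-values zero                         = ≋-trans twisted₀ (normal P₀)
  twisted-values (suc zero)                   = ≋-trans twisted₁ (normal P₁)
  twisted-values (suc (suc zero))             = ≋-trans twisted₂ (normal P₂)
  twisted-values (suc (suc (suc zero)))       = ≋-trans twisted₃ (normal P₃)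
  twisted-values (suc (suc (suc (suc zero)))) = ≋-trans twisted₄ (normal P₄)

-- The polynomials with U₅(xⁱ) = τᵢ(x) and U₅(Z⁵Φxⁱ) = δᵢ(x), obtained by carrying out the divisions in τ-check and δ-check.
τ δ : ℕ → Poly 1
τ 0 = + 1 ∷ []
τ 1 = + 0 ∷ + 41 ∷ + 860 ∷ + 6800 ∷ + 24000 ∷ + 32000 ∷ []
τ 2 = + 0 ∷ + 86 ∷ + 10195 ∷ + 366600 ∷ + 6534800 ∷ + 68384000 ∷ + 450720000 ∷ + 1907200000 ∷ + 5056000000 ∷ + 7680000000 ∷ + 5120000000 ∷
  []
τ 3 = + 0 ∷ + 51 ∷ + 27495 ∷ + 2836265 ∷ + 128688900 ∷ + 3343692000 ∷ + 56283680000 ∷ + 656205600000 ∷ + 5502096000000 ∷ + 33821312000000 ∷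
  + 153192960000000 ∷ + 506956800000000 ∷ + 1195008000000000 ∷ + 1904640000000000 ∷ + 1843200000000000 ∷ + 819200000000000 ∷ []
τ 4 = + 0 ∷ + 12 ∷ + 32674 ∷ + 8579260 ∷ + 831492275 ∷ + 42958434000 ∷ + 1396773180000 ∷ + 31314949600000 ∷ + 511802288800000 ∷
  + 6319880448000000 ∷ + 60349364480000000 ∷ + 452174745600000000 ∷ + 2679038592000000000 ∷ + 12574269440000000000 ∷
  + 46561935360000000000 ∷ + 134544588800000000000 ∷ + 297365504000000000000 ∷ + 485949440000000000000 ∷ + 553779200000000000000 ∷
  + 393216000000000000000 ∷ + 131072000000000000000 ∷ []
τ (suc (suc (suc (suc (suc _))))) = []
δ 0 = + 0 ∷ + 1 ∷ + 40 ∷ + 794 ∷ + 9125 ∷ + 64475 ∷ + 286000 ∷ + 780000 ∷ + 1200000 ∷ + 800000 ∷ []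
δ 1 = + 0 ∷ + 0 ∷ + 121 ∷ + 9484 ∷ + 321025 ∷ + 6327850 ∷ + 81874125 ∷ + 738217500 ∷ + 4780850000 ∷ + 22488800000 ∷ + 76460000000 ∷
  + 183600000000 ∷ + 296000000000 ∷ + 288000000000 ∷ + 128000000000 ∷ []
δ 2 = + 0 ∷ + 0 ∷ + 140 ∷ + 35245 ∷ + 2808365 ∷ + 117376000 ∷ + 3100037500 ∷ + 56831205625 ∷ + 763507050000 ∷ + 7771895500000 ∷
  + 61182640000000 ∷ + 376797500000000 ∷ + 1823151200000000 ∷ + 6913681600000000 ∷ + 20347776000000000 ∷ + 45594240000000000 ∷
  + 75238400000000000 ∷ + 86272000000000000 ∷ + 61440000000000000 ∷ + 20480000000000000 ∷ []
δ 3 = + 0 ∷ + 0 ∷ + 64 ∷ + 59136 ∷ + 10547620 ∷ + 850378650 ∷ + 40530512250 ∷ + 1298590915000 ∷ + 30103152240625 ∷ + 528858099450000 ∷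
  + 7262462532500000 ∷ + 79624221710000000 ∷ + 707157357820000000 ∷ + 5136043622800000000 ∷ + 30674128864000000000 ∷
  + 150938497280000000000 ∷ + 611049315200000000000 ∷ + 2024736448000000000000 ∷ + 5439398912000000000000 ∷ + 11668643840000000000000 ∷
  + 19525324800000000000000 ∷ + 24567808000000000000000 ∷ + 21872640000000000000000 ∷ + 12288000000000000000000 ∷
  + 3276800000000000000000 ∷ []
δ 4 = + 0 ∷ + 0 ∷ + 13 ∷ + 54342 ∷ + 21645560 ∷ + 3231134475 ∷ + 261994052875 ∷ + 13648364390000 ∷ + 501535624578125 ∷
  + 13781722427603125 ∷ + 294509461032250000 ∷ + 5030953041631500000 ∷ + 70082663702580000000 ∷ + 807847198383100000000 ∷
  + 7788550590672000000000 ∷ + 63288334721120000000000 ∷ + 435690966505600000000000 ∷ + 2548759030153600000000000 ∷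
  + 12682694057728000000000000 ∷ + 53629451281920000000000000 ∷ + 192118376960000000000000000 ∷ + 579878492672000000000000000 ∷
  + 1462436904960000000000000000 ∷ + 3044539924480000000000000000 ∷ + 5141902131200000000000000000 ∷ + 6869368832000000000000000000 ∷
  + 6987448320000000000000000000 ∷ + 5085593600000000000000000000 ∷ + 2359296000000000000000000000 ∷ + 524288000000000000000000000 ∷ []
δ (suc (suc (suc (suc (suc _))))) = []

private
  regular-x : Regular x
  regular-x = regular-* regular-q (regular-1 x₁-1)

  y-1 : y 0 ≡ + 1
  y-1 = head-oneMinus (solve 2 (λ q x → con (+ 1) :+ con (+ 4) :* (q :* x) :≈ con (+ 1) :+ q :* (con (+ 4) :* x)) (qS ∷ x₁ ∷ []) refl)

  -- x⁴ U₅(xⁱ) = U₅(X⁴ xⁱ), and X⁴ is the basis element `E 0`, so i applications of `timesX` give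
  -- the coordinates of the argument. After pairing with the known values the claim is an equality
  -- of integer polynomials, from which z⁴ x⁴ is cancelled.
  τ-check : ∀ i → isZero 1 (addₚ 1 (normalise 1 (N₀ (var zero) :* poly (τ i))) (negₚ 1 (pairing (iterate timesX i unitC) traceₚ))) ≡ true →
            section 0 (x ^ i) ≋ eval 1 (τ i) (x ∷ [])
  τ-check i h = regular-* (regular-^ (regular-1 z-1) 4) (regular-^ regular-x 4) _ _ (begin
    z ^ 4 * x ^ 4 * section 0 (x ^ i) ≈⟨ *-assoc (z ^ 4) (x ^ 4) _ ⟩
    z ^ 4 * (x ^ 4 * section 0 (x ^ i))
      ≈⟨ *-congˡ (≋-trans (≋-sym (section-dilate* 0 (s≤s z≤n) (x ^ 4) (x ^ i))) (section-cong 0 expansion)) ⟩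
    z ^ 4 * section 0 (combine (iterate timesX i unitC) X monomialBasis)
      ≈⟨ *-congˡ (section-combine (iterate timesX i unitC) monomialBasis) ⟩
    z ^ 4 * combine (iterate timesX i unitC) x (Vec.map (section 0) monomialBasis)
      ≈⟨ combine-pairing (iterate timesX i unitC) traceₚ x (z ^ 4) _ trace-values ⟩
    eval 1 (pairing (iterate timesX i unitC) traceₚ) (x ∷ [])
      ≈⟨ ≋-sym (polynomial-≋ (λ x → N₀ x :* poly (τ i)) (pairing (iterate timesX i unitC) traceₚ) x h) ⟩
    z ^ 4 * x ^ 4 * eval 1 (τ i) (x ∷ []) ∎)
    where
    open ≋-Reasoning
    expansion : dilate 4 (x ^ 4) * x ^ i ≋ combine (iterate timesX i unitC) X monomialBasis
    expansion = ≋-trans (*-congʳ (dilate-^ 4 x 4)) (≋-trans (*-comm (X ^ 4) (x ^ i)) (≋-sym (≋-trans (iterate-sound timesX x (timesX-sound E-basis) i unitC)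
      (*-congˡ (≋-trans (combine-unit monomialBasis X) (*-identityʳ (X ^ 4)))))))

section-x^ : ∀ i → i < 5 → section 0 (x ^ i) ≋ eval 1 (τ i) (x ∷ [])
section-x^ 0 _ = τ-check 0 refl
section-x^ 1 _ = τ-check 1 refl
section-x^ 2 _ = τ-check 2 refl
section-x^ 3 _ = τ-check 3 refl
section-x^ 4 _ = τ-check 4 refl
section-x^ (suc (suc (suc (suc (suc _))))) (s≤s (s≤s (s≤s (s≤s (s≤s ())))))

private
  -- (1 + 4x) h(x, X) = 1 + 4X
  hₚ : Poly 2
  hₚ = (+ 1 ∷ -[1+ 1019 ] ∷ -[1+ 20479 ] ∷ -[1+ 153599 ] ∷ -[1+ 511999 ] ∷ -[1+ 639999 ] ∷ [])
       ∷ (-[1+ 3 ] ∷ -[1+ 11279 ] ∷ -[1+ 230399 ] ∷ -[1+ 1766399 ] ∷ -[1+ 6015999 ] ∷ -[1+ 7679999 ] ∷ [])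
       ∷ (+ 16 ∷ -[1+ 41919 ] ∷ -[1+ 870399 ] ∷ -[1+ 6783999 ] ∷ -[1+ 23551999 ] ∷ -[1+ 30719999 ] ∷ [])
       ∷ (-[1+ 63 ] ∷ -[1+ 52479 ] ∷ -[1+ 1100799 ] ∷ -[1+ 8703999 ] ∷ -[1+ 30719999 ] ∷ -[1+ 40959999 ] ∷ [])
       ∷ (+ 256 ∷ [])
       ∷ []

  h-inverse : y * eval 2 hₚ (x ∷ X ∷ []) ≋ Y
  h-inverse = solve-by 2 (λ x X → yₑ x :* poly hₚ :≈ yₑ X by (con (+ 1024) , x :^ 5 :≈ poly quinticₚ) ∷ []) (x ∷ X ∷ []) refl (quintic , tt)

  -- Z⁵ Φ xⁱ (1 + 4X)² Z X⁵ = o h⁴ x⁶⁺ⁱ X⁴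
  twistedCoordinates : ℕ → Coordinates
  twistedCoordinates i = iterate timesX i (iterate timesX 6 (iterate (timesPoly hₚ) 4 unitC))

  coordinates-sound : ∀ {b} → Basis b → ∀ i n m hs → combine (iterate timesX i (iterate timesX n (iterate (timesPoly hs) m unitC))) X b ≋
    x ^ i * (x ^ n * (eval 2 hs (x ∷ X ∷ []) ^ m * Vec.lookup b zero))
  coordinates-sound {b} basis i n m hs = ≋-trans (iterate-sound timesX x (timesX-sound basis) i _) (*-congˡ
    (≋-trans (iterate-sound timesX x (timesX-sound basis) n _) (*-congˡ
    (≋-trans (iterate-sound (timesPoly hs) (eval 2 hs (x ∷ X ∷ [])) (timesPoly-sound basis hs) m unitC) (*-congˡ (combine-unit b X))))))

  -- In `Φ-relation` the factor (1 + 4x)⁴ is inverted by h⁴ at the price of (1 + 4X)⁴. Both h and w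
  -- are arbitrary series here, so the solver does not expand the fourth power of a large
  -- polynomial.
  Φ-equation : ∀ h w → y * h ≋ Y → w * (x ^ 6 * (h ^ 4 * O 0)) ≋ Y ^ 2 * Z * X ^ 5 * (Z ^ 5 * Φ * w)
  Φ-equation h w h-inverse = regular-* (regular-^ (regular-1 y-1) 4) regular-R₅ _ _ (solve-by 9 (λ o x X R y h w F A → let Z = zₑ X ; Y = yₑ X in
      y :^ 4 :* R :* (w :* (x :^ 6 :* (h :^ 4 :* (o :* (X :^ 4 :* con (+ 1)))))) :≈
      y :^ 4 :* R :* (Y :^ 2 :* Z :* X :^ 5 :* (Z :^ 5 :* F :* w))
      by (R :* w :* x :^ 6 :* o :* X :^ 4 :* (y :* h :+ Y) :* ((y :* h) :^ 2 :+ Y :^ 2) , y :* h :≈ Y)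
       ∷ (w :* x :^ 6 :* X :^ 4 :* Y :^ 4 , o :* R :≈ X :* A)
       ∷ (:- (w :* X :^ 5 :* Y :^ 2) , y :^ 4 :* Z :^ 6 :* F :* R :≈ A :* x :^ 6 :* Y :^ 2) ∷ [])
    (o ∷ x ∷ X ∷ R₅ ∷ y ∷ h ∷ w ∷ Φ ∷ A₅ ∷ []) refl (h-inverse , o-R , Φ-relation , tt))

  Φ-coordinates : ∀ i → Y ^ 2 * Z * X ^ 5 * (Z ^ 5 * Φ * x ^ i) ≋ combine (twistedCoordinates i) X twistedBasis
  Φ-coordinates i = ≋-sym (≋-trans (coordinates-sound O-basis i 6 4 hₚ) (Φ-equation (eval 2 hₚ (x ∷ X ∷ [])) (x ^ i) h-inverse))

  scaleδ : ∀ {n} → Expr n → Expr n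
  scaleδ x = zₑ x :^ 4 :* (yₑ x :^ 2 :* zₑ x :* x :^ 5)

  δ-check : ∀ i → isZero 1 (addₚ 1 (normalise 1 (scaleδ (var zero) :* poly (δ i))) (negₚ 1 (pairing (twistedCoordinates i) twistedₚ))) ≡ true →
            section 0 (Z ^ 5 * Φ * x ^ i) ≋ eval 1 (δ i) (x ∷ [])
  δ-check i h = regular-* (regular-^ (regular-1 z-1) 4) (regular-* (regular-* (regular-^ (regular-1 y-1) 2) (regular-1 z-1)) (regular-^ regular-x 5)) _ _ (begin
    z ^ 4 * (y ^ 2 * z * x ^ 5) * section 0 (Z ^ 5 * Φ * x ^ i) ≈⟨ *-assoc (z ^ 4) _ _ ⟩
    z ^ 4 * (y ^ 2 * z * x ^ 5 * section 0 (Z ^ 5 * Φ * x ^ i))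
      ≈⟨ *-congˡ (≋-trans (≋-sym (section-dilate* 0 (s≤s z≤n) (y ^ 2 * z * x ^ 5) _)) (section-cong 0 (≋-trans (*-congʳ factor) (Φ-coordinates i)))) ⟩
    z ^ 4 * section 0 (combine (twistedCoordinates i) X twistedBasis)
      ≈⟨ *-congˡ (section-combine (twistedCoordinates i) twistedBasis) ⟩
    z ^ 4 * combine (twistedCoordinates i) x (Vec.map (section 0) twistedBasis)
      ≈⟨ combine-pairing (twistedCoordinates i) twistedₚ x (z ^ 4) _ twisted-values ⟩
    eval 1 (pairing (twistedCoordinates i) twistedₚ) (x ∷ [])
      ≈⟨ ≋-sym (polynomial-≋ (λ x → scaleδ x :* poly (δ i)) (pairing (twistedCoordinates i) twistedₚ) x h) ⟩
    z ^ 4 * (y ^ 2 * z * x ^ 5) * eval 1 (δ i) (x ∷ []) ∎)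
    where
    open ≋-Reasoning
    factor : dilate 4 (y ^ 2 * z * x ^ 5) ≋ Y ^ 2 * Z * X ^ 5
    factor = dilate-expr 4 1 (λ x → yₑ x :^ 2 :* zₑ x :* x :^ 5) (x ∷ [])

section-Φx^ : ∀ i → i < 5 → section 0 (Z ^ 5 * Φ * x ^ i) ≋ eval 1 (δ i) (x ∷ [])
section-Φx^ 0 _ = δ-check 0 refl
section-Φx^ 1 _ = δ-check 1 refl
section-Φx^ 2 _ = δ-check 2 refl
section-Φx^ 3 _ = δ-check 3 refl
section-Φx^ 4 _ = δ-check 4 refl
section-Φx^ (suc (suc (suc (suc (suc _))))) (s≤s (s≤s (s≤s (s≤s (s≤s ())))))

-- Lattices of polynomials in x

five : Series
five = const (+ 5)

-- ⌊r/5⌋ and ⌈l/2⌉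
e₀ : ℕ → ℕ
e₀ (suc (suc (suc (suc (suc r))))) = suc (e₀ r)
e₀ r                               = 0

half : ℕ → ℕ
half 0             = 0
half 1             = 1
half (suc (suc l)) = suc (half l)

-- A module over ℤ[5t, 5t²], that is, over the polynomials in t whose coefficient at t^l is
-- divisible by 5^⌈l/2⌉.
record Lattice (t : Series) (Q : Series → Set) : Set where
  field
    l-resp  : ∀ {a b} → a ≋ b → Q a → Q b
    l-zero  : Q zeroS
    l-plus  : ∀ {a b} → Q a → Q b → Q (a + b)
    l-scale : ∀ c {a} → Q a → Q (const c * a)
    l-mul₁  : ∀ {a} → Q a → Q (five * t * a)
    l-mul₂  : ∀ {a} → Q a → Q (five * t ^ 2 * a)

Weighted : (ℕ → ℕ) → ℕ → Poly 1 → Set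
Weighted w i []       = ⊤
Weighted w i (c ∷ cs) = (+ (5 ℕ.^ w i) ∣ᶻ c) × Weighted w (suc i) cs

weighted? : (ℕ → ℕ) → ℕ → Poly 1 → Bool
weighted? w i []       = true
weighted? w i (c ∷ cs) = isYes (+ (5 ℕ.^ w i) ∣ᶻ? c) ∧ weighted? w (suc i) cs

weighted-sound : ∀ w i p → weighted? w i p ≡ true → Weighted w i p
weighted-sound w i []       h = tt
weighted-sound w i (c ∷ cs) h with ∧-true {isYes (+ (5 ℕ.^ w i) ∣ᶻ? c)} h
... | hc , hcs = toWitness {a? = + (5 ℕ.^ w i) ∣ᶻ? c} (subst Bool.T (sym hc) tt) , weighted-sound w (suc i) cs hcs

five^ : ∀ k → const (+ (5 ℕ.^ k)) ≋ five ^ k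
five^ zero    = ≋-refl
five^ (suc k) = ≋-trans (≋-reflexive (cong const (ℤₚ.pos-* 5 (5 ℕ.^ k)))) (≋-trans (IntegerHom.ι-* seriesHom (+ 5) (+ (5 ℕ.^ k))) (*-congˡ (five^ k)))

divisible : ∀ {k c} → + (5 ℕ.^ k) ∣ᶻ c → ∃ λ d → const c ≋ const d * five ^ k
divisible {k} (dividesᶻ d refl) = d , ≋-trans (IntegerHom.ι-* seriesHom d (+ (5 ℕ.^ k))) (*-congˡ (five^ k))

module _ {t Q} (lattice : Lattice t Q) where
  open Lattice lattice

  -- Serves two purposes: with the weight `half` it yields the action of ℤ[5t, 5t²] on an element,
  -- and with `e₀` and a = 1 it yields membership in Λ₀.
  weighted-sum : ∀ w a → (∀ l → Q (five ^ w l * t ^ l * a)) → ∀ i p → Weighted w i p → Q (t ^ i * eval 1 p (t ∷ []) * a)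
  weighted-sum w a h i []       _        = l-resp (solve 2 (λ u a → con (+ 0) :≈ u :* con (+ 0) :* a) (t ^ i ∷ a ∷ []) refl) l-zero
  weighted-sum w a h i (c ∷ cs) (d , ds) with divisible {w i} {c} d
  ... | c′ , c≋ = l-resp
    (solve-by 7 (λ c′ p u a t v c → c′ :* (p :* u :* a) :+ t :* u :* v :* a :≈ u :* (c :+ t :* v) :* a by (:- (u :* a) , c :≈ c′ :* p) ∷ [])
      (const c′ ∷ five ^ w i ∷ t ^ i ∷ a ∷ t ∷ eval 1 cs (t ∷ []) ∷ const c ∷ []) refl (c≋ , tt))
    (l-plus (l-scale c′ (h i)) (weighted-sum w a h (suc i) cs ds))

  -- 5^⌈l/2⌉ t^l is a power of 5t², times one factor 5t when l is odd.
  half-action : ∀ {a} → Q a → ∀ l → Q (five ^ half l * t ^ l * a)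
  half-action {a} q 0 = l-resp (solve 1 (λ a → a :≈ con (+ 1) :* con (+ 1) :* a) (a ∷ []) refl) q
  half-action {a} q 1 = l-resp (solve 2 (λ t a → con (+ 5) :* t :* a :≈ con (+ 5) :* con (+ 1) :* (t :* con (+ 1)) :* a) (t ∷ a ∷ []) refl) (l-mul₁ q)
  half-action {a} q (suc (suc l)) = l-resp (solve 4 (λ t a p u → con (+ 5) :* t :^ 2 :* (p :* u :* a) :≈ con (+ 5) :* p :* (t :* (t :* u)) :* a)
    (t ∷ a ∷ five ^ half l ∷ t ^ l ∷ []) refl) (l-mul₂ (half-action q l))

  action : ∀ p → weighted? half 0 p ≡ true → ∀ {a} → Q a → Q (eval 1 p (t ∷ []) * a)
  action p h {a} q = l-resp (*-congʳ (*-identityˡ _)) (weighted-sum half a (half-action q) 0 p (weighted-sound half 0 p h))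

  five-action : ∀ n {a} → Q a → Q (five ^ n * a)
  five-action zero    q = l-resp (≋-sym (*-identityˡ _)) q
  five-action (suc n) q = l-resp (≋-sym (*-assoc five (five ^ n) _)) (l-scale (+ 5) (five-action n q))

  five≤ : ∀ {m n} → m ≤ n → ∀ {a} → Q (five ^ m * a) → Q (five ^ n * a)
  five≤ {m} {n} m≤n {a} q = l-resp (≋-trans (≋-sym (*-assoc (five ^ (n ℕ.∸ m)) (five ^ m) a)) (*-congʳ (≋-trans (≋-sym (^-+ five (n ℕ.∸ m) m)) (≋-reflexive (cong (five ^_) (ℕₚ.m∸n+n≡m m≤n))))))
    (five-action (n ℕ.∸ m) q)

-- Presented by generators and closed under `≋`, so that a linear statement about the lattice is
-- proved by recursion on the derivation, with real content only at the generators.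
data Λ₀ : Series → Set where
  resp  : ∀ {a b} → a ≋ b → Λ₀ a → Λ₀ b
  zero  : Λ₀ zeroS
  plus  : ∀ {a b} → Λ₀ a → Λ₀ b → Λ₀ (a + b)
  scaled : ∀ c {a} → Λ₀ a → Λ₀ (const c * a)
  gen   : ∀ r → Λ₀ (five ^ e₀ r * x ^ r)

data Λ₁ : Series → Set where
  resp  : ∀ {a b} → a ≋ b → Λ₁ a → Λ₁ b
  zero  : Λ₁ zeroS
  plus  : ∀ {a b} → Λ₁ a → Λ₁ b → Λ₁ (a + b)
  scaled : ∀ c {a} → Λ₁ a → Λ₁ (const c * a)
  gen₁  : Λ₁ (x + - x ^ 3)
  gen₂  : Λ₁ (x ^ 2 + - x ^ 3)
  low   : ∀ {a} → Λ₀ a → Λ₁ (five * x * a)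

e₀-suc : ∀ r → e₀ r ≤ e₀ (suc r)
e₀-suc 0 = z≤n
e₀-suc 1 = z≤n
e₀-suc 2 = z≤n
e₀-suc 3 = z≤n
e₀-suc 4 = z≤n
e₀-suc (suc (suc (suc (suc (suc r))))) = s≤s (e₀-suc r)

e₀-1 : ∀ r → e₀ (suc r) ≤ suc (e₀ r)
e₀-1 0 = z≤n
e₀-1 1 = z≤n
e₀-1 2 = z≤n
e₀-1 3 = z≤n
e₀-1 4 = s≤s z≤n
e₀-1 (suc (suc (suc (suc (suc r))))) = s≤s (e₀-1 r)

e₀-2 : ∀ r → e₀ (suc (suc r)) ≤ suc (e₀ r)
e₀-2 0 = z≤n
e₀-2 1 = z≤n
e₀-2 2 = z≤n
e₀-2 3 = s≤s z≤n
e₀-2 4 = s≤s z≤n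
e₀-2 (suc (suc (suc (suc (suc r))))) = s≤s (e₀-2 r)

private
  Λ₀-five-action : ∀ n {a} → Λ₀ a → Λ₀ (five ^ n * a)
  Λ₀-five-action zero    q = resp (≋-sym (*-identityˡ _)) q
  Λ₀-five-action (suc n) q = resp (≋-sym (*-assoc five (five ^ n) _)) (scaled (+ 5) (Λ₀-five-action n q))

Λ₀-monomial : ∀ n r → e₀ r ≤ n → Λ₀ (five ^ n * x ^ r)
Λ₀-monomial n r h = resp (≋-trans (≋-sym (*-assoc (five ^ (n ℕ.∸ e₀ r)) (five ^ e₀ r) (x ^ r)))
    (*-congʳ (≋-trans (≋-sym (^-+ five (n ℕ.∸ e₀ r) (e₀ r))) (≋-reflexive (cong (five ^_) (ℕₚ.m∸n+n≡m h))))))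
  (Λ₀-five-action (n ℕ.∸ e₀ r) (gen r))

Λ₀-mul₁ : ∀ {a} → Λ₀ a → Λ₀ (five * x * a)
Λ₀-mul₁ (resp p q)   = resp (*-congˡ p) (Λ₀-mul₁ q)
Λ₀-mul₁ zero         = resp (≋-sym (zeroʳ _)) zero
Λ₀-mul₁ (plus p q)   = resp (≋-sym (CommutativeRing.distribˡ seriesRing _ _ _)) (plus (Λ₀-mul₁ p) (Λ₀-mul₁ q))
Λ₀-mul₁ (scaled c q) = resp (≋-sym (*-swap _ _ _)) (scaled c (Λ₀-mul₁ q))
Λ₀-mul₁ (gen r)      = resp (solve 4 (λ f x p u → f :* p :* (x :* u) :≈ f :* x :* (p :* u)) (five ∷ x ∷ five ^ e₀ r ∷ x ^ r ∷ []) refl)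
  (Λ₀-monomial (suc (e₀ r)) (suc r) (e₀-1 r))

Λ₀-mul₂ : ∀ {a} → Λ₀ a → Λ₀ (five * x ^ 2 * a)
Λ₀-mul₂ (resp p q)   = resp (*-congˡ p) (Λ₀-mul₂ q)
Λ₀-mul₂ zero         = resp (≋-sym (zeroʳ _)) zero
Λ₀-mul₂ (plus p q)   = resp (≋-sym (CommutativeRing.distribˡ seriesRing _ _ _)) (plus (Λ₀-mul₂ p) (Λ₀-mul₂ q))
Λ₀-mul₂ (scaled c q) = resp (≋-sym (*-swap _ _ _)) (scaled c (Λ₀-mul₂ q))
Λ₀-mul₂ (gen r)      = resp (solve 4 (λ f x p u → f :* p :* (x :* (x :* u)) :≈ f :* x :^ 2 :* (p :* u)) (five ∷ x ∷ five ^ e₀ r ∷ x ^ r ∷ []) refl)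
  (Λ₀-monomial (suc (e₀ r)) (suc (suc r)) (e₀-2 r))

Λ₀-lattice : Lattice x Λ₀
Λ₀-lattice = record { l-resp = resp ; l-zero = zero ; l-plus = plus ; l-scale = scaled ; l-mul₁ = Λ₀-mul₁ ; l-mul₂ = Λ₀-mul₂ }

Λ₀-x^ : ∀ r → e₀ r ≡ 0 → Λ₀ (x ^ r)
Λ₀-x^ r h = resp (*-identityˡ (x ^ r)) (Λ₀-monomial 0 r (ℕₚ.≤-reflexive h))

Λ₀-neg : ∀ {a} → Λ₀ a → Λ₀ (- a)
Λ₀-neg {a} q = resp (solve 1 (λ a → con -[1+ 0 ] :* a :≈ :- a) (a ∷ []) refl) (scaled -[1+ 0 ] q)

Λ₁⊆Λ₀ : ∀ {a} → Λ₁ a → Λ₀ a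
Λ₁⊆Λ₀ (resp p q)   = resp p (Λ₁⊆Λ₀ q)
Λ₁⊆Λ₀ zero         = zero
Λ₁⊆Λ₀ (plus p q)   = plus (Λ₁⊆Λ₀ p) (Λ₁⊆Λ₀ q)
Λ₁⊆Λ₀ (scaled c q) = scaled c (Λ₁⊆Λ₀ q)
Λ₁⊆Λ₀ gen₁         = plus (resp (*-identityʳ x) (Λ₀-x^ 1 refl)) (Λ₀-neg (Λ₀-x^ 3 refl))
Λ₁⊆Λ₀ gen₂         = plus (Λ₀-x^ 2 refl) (Λ₀-neg (Λ₀-x^ 3 refl))
Λ₁⊆Λ₀ (low q)      = Λ₀-mul₁ q

-- Multiplied by x, the two special generators have degree 4, where the weight ⌊r/5⌋ is still 0. The
-- purpose is 5x² Λ₁ = 5x (x Λ₁) ⊆ 5x Λ₀, hence stability of Λ₁ under 5x².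
xΛ₁⊆Λ₀ : ∀ {a} → Λ₁ a → Λ₀ (x * a)
xΛ₁⊆Λ₀ (resp p q)   = resp (*-congˡ p) (xΛ₁⊆Λ₀ q)
xΛ₁⊆Λ₀ zero         = resp (≋-sym (zeroʳ x)) zero
xΛ₁⊆Λ₀ (plus p q)   = resp (≋-sym (CommutativeRing.distribˡ seriesRing _ _ _)) (plus (xΛ₁⊆Λ₀ p) (xΛ₁⊆Λ₀ q))
xΛ₁⊆Λ₀ (scaled c q) = resp (≋-sym (*-swap _ _ _)) (scaled c (xΛ₁⊆Λ₀ q))
xΛ₁⊆Λ₀ gen₁         = resp (solve 1 (λ x → x :^ 2 :- x :^ 4 :≈ x :* (x :- x :^ 3)) (x ∷ []) refl) (plus (Λ₀-x^ 2 refl) (Λ₀-neg (Λ₀-x^ 4 refl)))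
xΛ₁⊆Λ₀ gen₂         = resp (solve 1 (λ x → x :^ 3 :- x :^ 4 :≈ x :* (x :^ 2 :- x :^ 3)) (x ∷ []) refl) (plus (Λ₀-x^ 3 refl) (Λ₀-neg (Λ₀-x^ 4 refl)))
xΛ₁⊆Λ₀ (low {a} q)  = resp (solve 2 (λ x a → con (+ 5) :* x :^ 2 :* a :≈ x :* (con (+ 5) :* x :* a)) (x ∷ a ∷ []) refl) (Λ₀-mul₂ q)

Λ₁-lattice : Lattice x Λ₁
Λ₁-lattice = record { l-resp = resp ; l-zero = zero ; l-plus = plus ; l-scale = scaled ; l-mul₁ = λ q → low (Λ₁⊆Λ₀ q)
  ; l-mul₂ = λ {a} q → resp (solve 2 (λ x a → con (+ 5) :* x :* (x :* a) :≈ con (+ 5) :* x :^ 2 :* a) (x ∷ a ∷ []) refl) (low (xΛ₁⊆Λ₀ q)) }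

data Five (Q : Series → Set) (a : Series) : Set where
  times-five : ∀ {b} → Q b → a ≋ five * b → Five Q a

Five-lattice : ∀ {t Q} → Lattice t Q → Lattice t (Five Q)
Five-lattice {t} lattice = record
  { l-resp  = λ { p (times-five q h) → times-five q (≋-trans (≋-sym p) h) }
  ; l-zero  = times-five l-zero (≋-sym (zeroʳ five))
  ; l-plus  = λ { (times-five p h) (times-five q k) → times-five (l-plus p q) (≋-trans (+-cong h k) (≋-sym (CommutativeRing.distribˡ seriesRing _ _ _))) }
  ; l-scale = λ { c (times-five q h) → times-five (l-scale c q) (≋-trans (*-congˡ h) (*-swap _ _ _)) }
  ; l-mul₁  = λ { (times-five q h) → times-five (l-mul₁ q) (≋-trans (*-congˡ h) (*-swap _ _ _)) }
  ; l-mul₂  = λ { (times-five q h) → times-five (l-mul₂ q) (≋-trans (*-congˡ h) (*-swap _ _ _)) } }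
  where open Lattice lattice

-- The module over ℤ[5X, 5X²] generated by P
data Extended (P : Series → Set) : Series → Set where
  resp   : ∀ {a b} → a ≋ b → Extended P a → Extended P b
  zero   : Extended P zeroS
  plus   : ∀ {a b} → Extended P a → Extended P b → Extended P (a + b)
  scaled : ∀ c {a} → Extended P a → Extended P (const c * a)
  mul₁   : ∀ {a} → Extended P a → Extended P (five * X * a)
  mul₂   : ∀ {a} → Extended P a → Extended P (five * X ^ 2 * a)
  base   : ∀ {a} → P a → Extended P a

-- The quintic lets a statement about section 0 (m x^r) propagate from r < 5 to all r.
module _ {Q : Series → Set} (lattice : Lattice x Q) (m : Series) where
  open Lattice lattice

  private
    T : Series → Series
    T a = section 0 (m * a)

    T-cong : ∀ {a b} → a ≋ b → T a ≋ T b
    T-cong p = section-cong 0 (*-congˡ p)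

    T-+ : ∀ a b → T (a + b) ≋ T a + T b
    T-+ a b = ≋-trans (section-cong 0 (CommutativeRing.distribˡ seriesRing m a b)) (section-+ 0 _ _)

    T-linear : ∀ c a → T (dilate 4 c * a) ≋ c * T a
    T-linear c a = ≋-trans (section-cong 0 (*-swap m (dilate 4 c) a)) (section-dilate* 0 (s≤s z≤n) c (m * a))

    T-const : ∀ c a → T (const c * a) ≋ const c * T a
    T-const c a = ≋-trans (T-cong (*-congʳ (≋-sym (dilate-const 4 c)))) (T-linear (const c) a)

    T-zero : T zeroS ≋ zeroS
    T-zero = ≋-trans (section-cong 0 (zeroʳ m)) section-zero

    T-eval : ∀ p a → T (eval 1 p (X ∷ []) * a) ≋ eval 1 p (x ∷ []) * T a
    T-eval p a = ≋-trans (T-cong (*-congʳ (≋-sym (dilate-eval 4 1 p (x ∷ []))))) (T-linear (eval 1 p (x ∷ [])) a)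

    T-eval-plus : ∀ p a b → T (eval 1 p (X ∷ []) * a + b) ≋ eval 1 p (x ∷ []) * T a + T b
    T-eval-plus p a b = ≋-trans (T-+ _ b) (+-congʳ (T-eval p a))

    -- a₀ begins with X, which is outside ℤ[5X, 5X²]. The additional factor 5 in the weight of
    -- x^(5+r), compared with that of x^r, is spent on a₀; the polynomials a₁, ..., a₄ act as they
    -- stand, and there that factor covers the weights of x^(r+1), ..., x^(r+4).
    5a₀ₚ : Poly 1
    5a₀ₚ = mulₚ 1 (conₚ 1 (+ 5)) a₀ₚ

    G : ℕ → Series
    G r = five ^ e₀ r * x ^ r

    G₊ : ℕ → ℕ → Series
    G₊ r j = five ^ suc (e₀ r) * x ^ (r ℕ.+ j)

    reduce : ∀ r → G (5 ℕ.+ r) ≋ eval 1 5a₀ₚ (X ∷ []) * G r + (eval 1 a₁ₚ (X ∷ []) * G₊ r 1 +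
             (eval 1 a₂ₚ (X ∷ []) * G₊ r 2 + (eval 1 a₃ₚ (X ∷ []) * G₊ r 3 + eval 1 a₄ₚ (X ∷ []) * G₊ r 4)))
    reduce r = ≋-trans (solve-by 8 (λ x p u a₀ a₁ a₂ a₃ a₄ →
        con (+ 5) :* p :* (x :* (x :* (x :* (x :* (x :* u))))) :≈
        (con (+ 5) :* a₀) :* (p :* u) :+ (a₁ :* (con (+ 5) :* p :* (u :* x :^ 1)) :+ (a₂ :* (con (+ 5) :* p :* (u :* x :^ 2)) :+
          (a₃ :* (con (+ 5) :* p :* (u :* x :^ 3)) :+ a₄ :* (con (+ 5) :* p :* (u :* x :^ 4)))))
        by (con (+ 5) :* p :* u , x :^ 5 :≈ a₀ :+ x :* (a₁ :+ x :* (a₂ :+ x :* (a₃ :+ x :* (a₄ :+ x :* con (+ 0)))))) ∷ [])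
      (x ∷ five ^ e₀ r ∷ x ^ r ∷ ev a₀ₚ ∷ ev a₁ₚ ∷ ev a₂ₚ ∷ ev a₃ₚ ∷ ev a₄ₚ ∷ []) refl (quintic , tt))
      (+-cong (*-congʳ (≋-sym (≋-trans (mulₚ-sound 1 (conₚ 1 (+ 5)) a₀ₚ (X ∷ [])) (*-congʳ (conₚ-sound 1 (+ 5) (X ∷ []))))))
        (+-cong (power 1) (+-cong (power 2) (+-cong (power 3) (power 4)))))
      where
      ev : Poly 1 → Series
      ev c = eval 1 c (X ∷ [])
      power : ∀ {c} j → c * (five * five ^ e₀ r * (x ^ r * x ^ j)) ≋ c * G₊ r j
      power j = *-congˡ (*-congˡ (≋-sym (^-+ x r j)))

  quintic-recursion : (∀ r → r < 5 → Q (section 0 (m * x ^ r))) → ∀ r → Q (section 0 (m * (five ^ e₀ r * x ^ r)))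
  quintic-recursion initial = <-rec (λ r → Q (T (G r))) step
    where
    start : ∀ r → e₀ r ≡ 0 → r < 5 → Q (T (G r))
    start r h r<5 = l-resp (T-cong (≋-sym (≋-trans (*-congʳ (≋-reflexive (cong (five ^_) h))) (*-identityˡ (x ^ r))))) (initial r r<5)
    step : ∀ r → (∀ {s} → s < r → Q (T (G s))) → Q (T (G r))
    step 0 _ = start 0 refl (<5 0 refl)
    step 1 _ = start 1 refl (<5 1 refl)
    step 2 _ = start 2 refl (<5 2 refl)
    step 3 _ = start 3 refl (<5 3 refl)
    step 4 _ = start 4 refl (<5 4 refl)
    step (suc (suc (suc (suc (suc r))))) ih = l-resp (≋-sym total)
      (l-plus (action lattice 5a₀ₚ refl (ih (s≤s (ℕₚ.m≤n+m r 4))))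
      (l-plus (action lattice a₁ₚ refl (raised 1 (e₀-1 r) (<5 1 refl)))
      (l-plus (action lattice a₂ₚ refl (raised 2 (e₀-2 r) (<5 2 refl)))
      (l-plus (action lattice a₃ₚ refl (raised 3 e₀-3 (<5 3 refl)))
              (action lattice a₄ₚ refl (raised 4 e₀-4 (<5 4 refl)))))))
      where
      e₀-4 : e₀ (4 ℕ.+ r) ≤ suc (e₀ r)
      e₀-4 = e₀-suc (4 ℕ.+ r)
      e₀-3 : e₀ (3 ℕ.+ r) ≤ suc (e₀ r)
      e₀-3 = ℕₚ.≤-trans (e₀-suc (3 ℕ.+ r)) e₀-4
      raised : ∀ j → e₀ (j ℕ.+ r) ≤ suc (e₀ r) → j < 5 → Q (T (G₊ r j))
      raised j h j<5 = subst (λ s → Q (T (five ^ suc (e₀ r) * x ^ s))) (ℕₚ.+-comm j r)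
        (l-resp (≋-sym (T-five (suc (e₀ r)) (x ^ (j ℕ.+ r)))) (five≤ lattice h (l-resp (T-five (e₀ (j ℕ.+ r)) (x ^ (j ℕ.+ r))) (ih (ℕₚ.+-monoˡ-< r j<5)))))
        where
        T-five : ∀ n a → T (five ^ n * a) ≋ five ^ n * T a
        T-five n a = ≋-trans (T-cong (*-congʳ (≋-sym (five^ n)))) (≋-trans (T-const (+ (5 ℕ.^ n)) a) (*-congʳ (five^ n)))
      total : T (G (5 ℕ.+ r)) ≋ eval 1 5a₀ₚ (x ∷ []) * T (G r) + (eval 1 a₁ₚ (x ∷ []) * T (G₊ r 1) + (eval 1 a₂ₚ (x ∷ []) * T (G₊ r 2) +
                (eval 1 a₃ₚ (x ∷ []) * T (G₊ r 3) + eval 1 a₄ₚ (x ∷ []) * T (G₊ r 4))))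
      total = ≋-trans (T-cong (reduce r)) (≋-trans (T-eval-plus 5a₀ₚ _ _) (+-congˡ (≋-trans (T-eval-plus a₁ₚ _ _) (+-congˡ
        (≋-trans (T-eval-plus a₂ₚ _ _) (+-congˡ (≋-trans (T-eval-plus a₃ₚ _ _) (+-congˡ (T-eval a₄ₚ _)))))))))

  Λ₀-image : (∀ r → r < 5 → Q (section 0 (m * x ^ r))) → ∀ {a} → Λ₀ a → Q (section 0 (m * a))
  Λ₀-image initial (resp p q)   = l-resp (T-cong p) (Λ₀-image initial q)
  Λ₀-image initial zero         = l-resp (≋-sym T-zero) l-zero
  Λ₀-image initial (plus p q)   = l-resp (≋-sym (T-+ _ _)) (l-plus (Λ₀-image initial p) (Λ₀-image initial q))
  Λ₀-image initial (scaled c q) = l-resp (≋-sym (T-const c _)) (l-scale c (Λ₀-image initial q))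
  Λ₀-image initial (gen r)      = quintic-recursion initial r

  -- U₅ turns the multipliers 5X and 5X² into 5x and 5x², under which `Q` is stable. So adjoining
  -- them to `P` costs nothing.
  Extended-image : ∀ {P} → (∀ {a} → P a → Q (section 0 (m * a))) → ∀ {a} → Extended P a → Q (section 0 (m * a))
  Extended-image h (resp p q)   = l-resp (T-cong p) (Extended-image h q)
  Extended-image h zero         = l-resp (≋-sym T-zero) l-zero
  Extended-image h (plus p q)   = l-resp (≋-sym (T-+ _ _)) (l-plus (Extended-image h p) (Extended-image h q))
  Extended-image h (scaled c q) = l-resp (≋-sym (T-const c _)) (l-scale c (Extended-image h q))
  Extended-image h (mul₁ q)     = l-resp (≋-sym (≋-trans (T-cong (*-congʳ (≋-sym (≋-trans (dilate-* 4 five x) (*-congʳ (dilate-const 4 (+ 5))))))) (T-linear _ _))) (l-mul₁ (Extended-image h q))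
  Extended-image h (mul₂ q)     = l-resp (≋-sym (≋-trans (T-cong (*-congʳ (≋-sym (≋-trans (dilate-* 4 five (x ^ 2)) (*-cong (dilate-const 4 (+ 5)) (dilate-^ 4 x 2)))))) (T-linear _ _))) (l-mul₂ (Extended-image h q))
  Extended-image h (base p)     = h p

-- g = Z⁵/z as a polynomial in 5x and X: multiplication by g replaces division by z.
gₚ : Poly 2
gₚ = (+ 1 ∷ -[1+ 3099 ] ∷ -[1+ 62249 ] ∷ -[1+ 467499 ] ∷ -[1+ 1559374 ] ∷ -[1+ 1949999 ] ∷ [])
     ∷ (-[1+ 0 ] ∷ -[1+ 6274 ] ∷ -[1+ 128374 ] ∷ -[1+ 985624 ] ∷ -[1+ 3362499 ] ∷ -[1+ 4299999 ] ∷ [])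
     ∷ (+ 1 ∷ -[1+ 4349 ] ∷ -[1+ 90374 ] ∷ -[1+ 704999 ] ∷ -[1+ 2449999 ] ∷ -[1+ 3199999 ] ∷ [])
     ∷ (-[1+ 0 ] ∷ -[1+ 1024 ] ∷ -[1+ 21499 ] ∷ -[1+ 169999 ] ∷ -[1+ 599999 ] ∷ -[1+ 799999 ] ∷ [])
     ∷ (+ 1 ∷ [])
     ∷ []

g : Series
g = eval 2 gₚ (five * x ∷ X ∷ [])

-- gₚ is monic of degree 4 in 5x, so z g has leading term (5x)⁵ = 3125 x⁵, and 3125 times the
-- quintic accounts for the difference from Z⁵. `rescale` rewrites a polynomial in 5x as one in x
-- before the solver compares.
g-equation : z * g ≋ Z ^ 5
g-equation = ≋-trans (*-congˡ (normal-form gₚ)) (solve-by 2 (λ x X → zₑ x :* poly g₅ₚ :≈ zₑ X :^ 5 by (con (+ 3125) , x :^ 5 :≈ poly quinticₚ) ∷ []) (x ∷ X ∷ []) refl (quintic , tt))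
  where
  rescale : ℤ → Poly 2 → Poly 2
  rescale c []       = []
  rescale c (p ∷ ps) = mulₚ 1 (conₚ 1 c) p ∷ rescale (+ 5 ℤ.* c) ps
  g₅ₚ : Poly 2
  g₅ₚ = rescale (+ 1) gₚ
  rescale-sound : ∀ c ps → const c * eval 2 ps (five * x ∷ X ∷ []) ≋ eval 2 (rescale c ps) (x ∷ X ∷ [])
  rescale-sound c []       = zeroʳ (const c)
  rescale-sound c (p ∷ ps) = ≋-trans
    (solve 4 (λ c p x v → c :* (p :+ con (+ 5) :* x :* v) :≈ c :* p :+ x :* (con (+ 5) :* c :* v)) (const c ∷ eval 1 p (X ∷ []) ∷ x ∷ eval 2 ps (five * x ∷ X ∷ []) ∷ []) refl)
    (+-cong (≋-sym (≋-trans (mulₚ-sound 1 (conₚ 1 c) p (X ∷ [])) (*-congʳ (conₚ-sound 1 c (X ∷ [])))))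
      (*-congˡ (≋-trans (*-congʳ (≋-sym (IntegerHom.ι-* seriesHom (+ 5) c))) (rescale-sound (+ 5 ℤ.* c) ps))))
  normal-form : ∀ ps → eval 2 ps (five * x ∷ X ∷ []) ≋ eval 2 (rescale (+ 1) ps) (x ∷ X ∷ [])
  normal-form ps = ≋-trans (≋-sym (*-identityˡ _)) (rescale-sound (+ 1) ps)

Extended-lattice : ∀ P → Lattice X (Extended P)
Extended-lattice P = record { l-resp = resp ; l-zero = zero ; l-plus = plus ; l-scale = scaled ; l-mul₁ = mul₁ ; l-mul₂ = mul₂ }

module _ {P : Series → Set} (P-mul : ∀ {a} → P a → P (five * x * a)) where
  Extended-mul : ∀ {a} → Extended P a → Extended P (five * x * a)
  Extended-mul (resp p q)   = resp (*-congˡ p) (Extended-mul q)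
  Extended-mul zero         = resp (≋-sym (zeroʳ _)) zero
  Extended-mul (plus p q)   = resp (≋-sym (CommutativeRing.distribˡ seriesRing _ _ _)) (plus (Extended-mul p) (Extended-mul q))
  Extended-mul (scaled c q) = resp (≋-sym (*-swap _ _ _)) (scaled c (Extended-mul q))
  Extended-mul (mul₁ q)     = resp (≋-sym (*-swap _ _ _)) (mul₁ (Extended-mul q))
  Extended-mul (mul₂ q)     = resp (≋-sym (*-swap _ _ _)) (mul₂ (Extended-mul q))
  Extended-mul (base p)     = base (P-mul p)

  all-weighted? : Poly 2 → Bool
  all-weighted? []       = true
  all-weighted? (p ∷ ps) = weighted? half 0 p ∧ all-weighted? ps

  Extended-eval : ∀ ps → all-weighted? ps ≡ true → ∀ {a} → Extended P a → Extended P (eval 2 ps (five * x ∷ X ∷ []) * a)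
  Extended-eval []       h {a} q = resp (≋-sym (zeroˡ a)) zero
  Extended-eval (p ∷ ps) h {a} q with ∧-true {weighted? half 0 p} h
  ... | hp , hps = resp (solve 4 (λ p y v a → p :* a :+ y :* (v :* a) :≈ (p :+ y :* v) :* a) (eval 1 p (X ∷ []) ∷ five * x ∷ eval 2 ps (five * x ∷ X ∷ []) ∷ a ∷ []) refl)
    (plus (action (Extended-lattice P) p hp q) (Extended-mul (Extended-eval ps hps q)))

  Extended-g^ : ∀ n {a} → P a → Extended P (g ^ n * a)
  Extended-g^ zero    p = resp (≋-sym (*-identityˡ _)) (base p)
  Extended-g^ (suc n) p = resp (≋-sym (*-assoc g (g ^ n) _)) (Extended-eval gₚ refl (Extended-g^ n p))

-- Images of the lattice generators under U₅

private
  weighted-member : ∀ p → weighted? e₀ 0 p ≡ true → Λ₀ (eval 1 p (x ∷ []))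
  weighted-member p h = resp (≋-trans (*-identityʳ _) (*-identityˡ _))
    (weighted-sum Λ₀-lattice e₀ oneS (λ r → resp (≋-sym (*-identityʳ _)) (gen r)) 0 p (weighted-sound e₀ 0 p h))

  τ₅ : Poly 1
  τ₅ = addₚ 1 a₀ₚ (addₚ 1 (mulₚ 1 a₁ₚ (τ 1)) (addₚ 1 (mulₚ 1 a₂ₚ (τ 2)) (addₚ 1 (mulₚ 1 a₃ₚ (τ 3)) (mulₚ 1 a₄ₚ (τ 4)))))

  eval-sum : ∀ p₀ p₁ p₂ p₃ p₄ ρ → eval 1 (addₚ 1 p₀ (addₚ 1 p₁ (addₚ 1 p₂ (addₚ 1 p₃ p₄)))) ρ ≋
             eval 1 p₀ ρ + (eval 1 p₁ ρ + (eval 1 p₂ ρ + (eval 1 p₃ ρ + eval 1 p₄ ρ)))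
  eval-sum p₀ p₁ p₂ p₃ p₄ ρ = ≋-trans (addₚ-sound 1 p₀ (addₚ 1 p₁ (addₚ 1 p₂ (addₚ 1 p₃ p₄))) ρ) (+-congˡ
    (≋-trans (addₚ-sound 1 p₁ (addₚ 1 p₂ (addₚ 1 p₃ p₄)) ρ) (+-congˡ
    (≋-trans (addₚ-sound 1 p₂ (addₚ 1 p₃ p₄) ρ) (+-congˡ (addₚ-sound 1 p₃ p₄ ρ))))))

  section-x⁵ : section 0 (x ^ 5) ≋ eval 1 τ₅ (x ∷ [])
  section-x⁵ = ≋-trans (section-cong 0 (≋-trans quintic (solve 6 (λ x a b c d e →
      a :+ x :* (b :+ x :* (c :+ x :* (d :+ x :* (e :+ x :* con (+ 0))))) :≈ a :* x :^ 0 :+ (b :* x :^ 1 :+ (c :* x :^ 2 :+ (d :* x :^ 3 :+ e :* x :^ 4))))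
      (x ∷ ev a₀ₚ ∷ ev a₁ₚ ∷ ev a₂ₚ ∷ ev a₃ₚ ∷ ev a₄ₚ ∷ []) refl)))
    (≋-trans (section-+ 0 _ _) (≋-trans (+-cong (≋-trans (term a₀ₚ 0 (<5 0 refl)) (≋-trans (*-congˡ (conₚ-sound 1 (+ 1) (x ∷ []))) (*-identityʳ _)))
      (≋-trans (section-+ 0 _ _) (+-cong (term a₁ₚ 1 (<5 1 refl))
      (≋-trans (section-+ 0 _ _) (+-cong (term a₂ₚ 2 (<5 2 refl))
      (≋-trans (section-+ 0 _ _) (+-cong (term a₃ₚ 3 (<5 3 refl)) (term a₄ₚ 4 (<5 4 refl)))))))))
    (≋-sym (≋-trans (eval-sum a₀ₚ (mulₚ 1 a₁ₚ (τ 1)) (mulₚ 1 a₂ₚ (τ 2)) (mulₚ 1 a₃ₚ (τ 3)) (mulₚ 1 a₄ₚ (τ 4)) (x ∷ [])) (+-congˡ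
      (+-cong (mulₚ-sound 1 a₁ₚ (τ 1) (x ∷ [])) (+-cong (mulₚ-sound 1 a₂ₚ (τ 2) (x ∷ [])) (+-cong (mulₚ-sound 1 a₃ₚ (τ 3) (x ∷ [])) (mulₚ-sound 1 a₄ₚ (τ 4) (x ∷ []))))))))))
    where
    ev : Poly 1 → Series
    ev c = eval 1 c (X ∷ [])
    term : ∀ p i → i < 5 → section 0 (ev p * x ^ i) ≋ eval 1 p (x ∷ []) * eval 1 (τ i) (x ∷ [])
    term p i i<5 = ≋-trans (section-cong 0 (*-congʳ (≋-sym (dilate-eval 4 1 p (x ∷ []))))) (≋-trans (section-dilate* 0 (s≤s z≤n) _ _) (*-congˡ (section-x^ i i<5)))

  -- The part 5x Λ₀ of Λ₁ brings its own factor 5, so U₅(x Λ₀) ⊆ Λ₀ is what it requires. These are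
  -- the five starting cases; the last one involves x⁵ and is reduced by the quintic.
  base-odd : ∀ r → r < 5 → Λ₀ (section 0 (x * x ^ r))
  base-odd 0 _ = resp (≋-sym (section-x^ 1 (<5 1 refl))) (weighted-member (τ 1) refl)
  base-odd 1 _ = resp (≋-sym (section-x^ 2 (<5 2 refl))) (weighted-member (τ 2) refl)
  base-odd 2 _ = resp (≋-sym (section-x^ 3 (<5 3 refl))) (weighted-member (τ 3) refl)
  base-odd 3 _ = resp (≋-sym (section-x^ 4 (<5 4 refl))) (weighted-member (τ 4) refl)
  base-odd 4 _ = resp (≋-sym section-x⁵) (weighted-member τ₅ refl)
  base-odd (suc (suc (suc (suc (suc _))))) (s≤s (s≤s (s≤s (s≤s (s≤s ())))))

  -- Only proposes a quotient; that the division is exact is checked by normalisation wherever the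
  -- result is used.
  divide-by-5 : Poly 1 → Poly 1
  divide-by-5 = List.map (λ c → sign-of c (ℤ.∣ c ∣ ℕ./ 5))
    where
    sign-of : ℤ → ℕ → ℤ
    sign-of (+ _)    n = + n
    sign-of -[1+ _ ] n = ℤ.- + n

  differenceₚ : Poly 1 → Poly 1 → Poly 1
  differenceₚ p q = addₚ 1 p (negₚ 1 q)

  -- Here the power of 5 is gained: τ₁, τ₂ and τ₃ are congruent modulo 5 Λ₀, as the two Boolean
  -- tests confirm for i = 1 and i = 2.
  section-difference : ∀ i → i < 5 → (h : isZero 1 (normalise 1 (poly (differenceₚ (τ i) (τ 3)) :- con (+ 5) :* poly (divide-by-5 (differenceₚ (τ i) (τ 3))))) ≡ true) →
    weighted? e₀ 0 (divide-by-5 (differenceₚ (τ i) (τ 3))) ≡ true → Five Λ₀ (section 0 (x ^ i + - x ^ 3))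
  section-difference i i<5 h w = times-five (weighted-member d w) (≋-trans (section-+ 0 _ _) (≋-trans (+-cong (section-x^ i i<5)
      (≋-trans (section-neg 0 (x ^ 3)) (-‿cong (section-x^ 3 (<5 3 refl))))) (≋-trans
    (≋-sym (≋-trans (addₚ-sound 1 (τ i) (negₚ 1 (τ 3)) (x ∷ [])) (+-congˡ (negₚ-sound 1 (τ 3) (x ∷ [])))))
    (difference-zero (≋-trans (≋-sym (normalise-sound ex (x ∷ []))) (isZero-sound 1 (normalise 1 ex) (x ∷ []) h))))))
    where
    d = divide-by-5 (differenceₚ (τ i) (τ 3))
    ex : Expr 1
    ex = poly (differenceₚ (τ i) (τ 3)) :- con (+ 5) :* poly d

  -- δ is a combination of x - x³, x² - x³ and an element of 5 x Λ₀.
  remainderₚ : ℤ → ℤ → Poly 1 → Poly 1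
  remainderₚ c d p = divide-by-5 (List.drop 1 (normalise 1 (poly p :- con c :* (X′ :- X′ :^ 3) :- con d :* (X′ :^ 2 :- X′ :^ 3))))
    where
    X′ : Expr 1
    X′ = var zero

  Λ₁-member : ∀ c d p → isZero 1 (normalise 1 ((con c :* (var zero :- var zero :^ 3) :+ con d :* (var zero :^ 2 :- var zero :^ 3) :+
      con (+ 5) :* var zero :* poly (remainderₚ c d p)) :- poly p)) ≡ true → weighted? e₀ 0 (remainderₚ c d p) ≡ true → Λ₁ (eval 1 p (x ∷ []))
  Λ₁-member c d p h w = resp (difference-zero (≋-trans (≋-sym (normalise-sound ex (x ∷ []))) (isZero-sound 1 (normalise 1 ex) (x ∷ []) h)))
    (plus (plus (scaled c gen₁) (scaled d gen₂)) (low (weighted-member (remainderₚ c d p) w)))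
    where
    ex : Expr 1
    ex = (con c :* (var zero :- var zero :^ 3) :+ con d :* (var zero :^ 2 :- var zero :^ 3) :+ con (+ 5) :* var zero :* poly (remainderₚ c d p)) :- poly p

  base-even : ∀ r → r < 5 → Λ₁ (section 0 (Z ^ 5 * Φ * x ^ r))
  -- The two integers are the coefficients of x and x² in `δ r`. Subtracting these multiples of x -
  -- x³ and x² - x³ removes both terms, and what is left, starting at x³, lies in 5x Λ₀.
  base-even 0 r<5 = resp (≋-sym (section-Φx^ 0 r<5)) (Λ₁-member (+ 1) (+ 40) (δ 0) refl refl)
  base-even 1 r<5 = resp (≋-sym (section-Φx^ 1 r<5)) (Λ₁-member (+ 0) (+ 121) (δ 1) refl refl)
  base-even 2 r<5 = resp (≋-sym (section-Φx^ 2 r<5)) (Λ₁-member (+ 0) (+ 140) (δ 2) refl refl)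
  base-even 3 r<5 = resp (≋-sym (section-Φx^ 3 r<5)) (Λ₁-member (+ 0) (+ 64) (δ 3) refl refl)
  base-even 4 r<5 = resp (≋-sym (section-Φx^ 4 r<5)) (Λ₁-member (+ 0) (+ 13) (δ 4) refl refl)
  base-even (suc (suc (suc (suc (suc _))))) (s≤s (s≤s (s≤s (s≤s (s≤s ())))))

-- The factor `oneS` gives U₅ the shape section 0 (m * a) that `Extended-image` expects, with m = 1.
U5-Λ₁ : ∀ {a} → Λ₁ a → Five Λ₀ (section 0 (oneS * a))
U5-Λ₁ q = Lattice.l-resp lattice (section-cong 0 (≋-sym (*-identityˡ _))) (go q)
  where
  lattice = Five-lattice Λ₀-lattice
  open Lattice lattice
  go : ∀ {a} → Λ₁ a → Five Λ₀ (section 0 a)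
  go (resp p q)   = l-resp (section-cong 0 p) (go q)
  go zero         = l-resp (≋-sym section-zero) l-zero
  go (plus p q)   = l-resp (≋-sym (section-+ 0 _ _)) (l-plus (go p) (go q))
  go (scaled c q) = l-resp (≋-sym (section-const* c _)) (l-scale c (go q))
  go gen₁         = l-resp (section-cong 0 (+-congʳ (*-identityʳ x))) (section-difference 1 (<5 1 refl) refl refl)
  go gen₂         = section-difference 2 (<5 2 refl) refl refl
  go (low {a} q)  = times-five (Λ₀-image Λ₀-lattice x base-odd q) (≋-trans (section-cong 0 (*-assoc five x a)) (section-const* (+ 5) (x * a)))

odd-step : ∀ n {a} → Λ₁ a → Five Λ₀ (section 0 (oneS * (g ^ n * a)))
odd-step n q = Extended-image (Five-lattice Λ₀-lattice) oneS U5-Λ₁ (Extended-g^ (Lattice.l-mul₁ Λ₁-lattice) n q)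

even-step : ∀ n {a} → Λ₀ a → Λ₁ (section 0 (Z ^ 5 * Φ * (g ^ n * a)))
even-step n q = Extended-image Λ₁-lattice (Z ^ 5 * Φ) (Λ₀-image Λ₁-lattice (Z ^ 5 * Φ) base-even) (Extended-g^ Λ₀-mul₁ n q)

-- The induction

-- Exponents with ψ (2k+1) = odd-exponent k and ψ (2k+2) = 5 * odd-exponent k; even-exponent 0 = 0.
even-exponent odd-exponent : ℕ → ℕ
even-exponent zero    = 0
even-exponent (suc k) = 5 ℕ.* odd-exponent k
odd-exponent k        = 5 ℕ.* even-exponent k ℕ.+ 5

private
  U5≋ : ∀ a → U5 a ≋ section 0 a
  U5≋ a = ≋-reflexive (U5≡section a)

  dilate-z^ : ∀ n → dilate 4 (z ^ n) ≋ Z ^ n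
  dilate-z^ n = ≋-trans (dilate-^ 4 z n) (^-cong (dilate-expr 4 1 (λ x → con (+ 1) :+ con (+ 5) :* x) (x ∷ [])) n)

  Z^ : ∀ n → Z ^ (5 ℕ.* n) ≋ g ^ n * z ^ n
  Z^ n = ≋-trans (≋-sym (^-* Z 5 n)) (≋-trans (^-cong (≋-sym g-equation) n) (distribute n))
    where
    distribute : ∀ n → (z * g) ^ n ≋ g ^ n * z ^ n
    distribute zero    = ≋-sym (*-identityˡ oneS)
    distribute (suc n) = ≋-trans (*-congˡ (distribute n))
      (solve 4 (λ z g a b → z :* g :* (a :* b) :≈ g :* a :* (z :* b)) (z ∷ g ∷ g ^ n ∷ z ^ n ∷ []) refl)

  U5-odd : ∀ n L → z ^ (5 ℕ.* n) * U5 L ≋ section 0 (oneS * (g ^ n * (z ^ n * L)))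
  U5-odd n L = begin
    z ^ (5 ℕ.* n) * U5 L                       ≈⟨ *-congˡ (U5≋ L) ⟩
    z ^ (5 ℕ.* n) * section 0 L                ≈⟨ ≋-sym (section-dilate* 0 (s≤s z≤n) (z ^ (5 ℕ.* n)) L) ⟩
    section 0 (dilate 4 (z ^ (5 ℕ.* n)) * L)   ≈⟨ section-cong 0 (*-congʳ (≋-trans (dilate-z^ (5 ℕ.* n)) (Z^ n))) ⟩
    section 0 (g ^ n * z ^ n * L)
      ≈⟨ section-cong 0 (solve 3 (λ a b l → a :* b :* l :≈ con (+ 1) :* (a :* (b :* l))) (g ^ n ∷ z ^ n ∷ L ∷ []) refl) ⟩
    section 0 (oneS * (g ^ n * (z ^ n * L)))   ∎
    where open ≋-Reasoning

  -- The additional exponent 5 supplies the factor Z⁵ in front of Φ, with which the images of the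
  -- powers of x become polynomials.
  U5-even : ∀ n L → z ^ (5 ℕ.* n ℕ.+ 5) * U5 (Φ * L) ≋ section 0 (Z ^ 5 * Φ * (g ^ n * (z ^ n * L)))
  U5-even n L = begin
    z ^ (5 ℕ.* n ℕ.+ 5) * U5 (Φ * L)                       ≈⟨ *-congˡ (U5≋ (Φ * L)) ⟩
    z ^ (5 ℕ.* n ℕ.+ 5) * section 0 (Φ * L)                ≈⟨ ≋-sym (section-dilate* 0 (s≤s z≤n) (z ^ (5 ℕ.* n ℕ.+ 5)) (Φ * L)) ⟩
    section 0 (dilate 4 (z ^ (5 ℕ.* n ℕ.+ 5)) * (Φ * L))
      ≈⟨ section-cong 0 (*-congʳ (≋-trans (dilate-z^ (5 ℕ.* n ℕ.+ 5)) (≋-trans (^-+ Z (5 ℕ.* n) 5) (*-congʳ (Z^ n))))) ⟩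
    section 0 (g ^ n * z ^ n * Z ^ 5 * (Φ * L))
      ≈⟨ section-cong 0 (solve 5 (λ a b w f l → a :* b :* w :* (f :* l) :≈ w :* f :* (a :* (b :* l))) (g ^ n ∷ z ^ n ∷ Z ^ 5 ∷ Φ ∷ L ∷ []) refl) ⟩
    section 0 (Z ^ 5 * Φ * (g ^ n * (z ^ n * L)))          ∎
    where open ≋-Reasoning

  section-five^ : ∀ m n k a b → b ≋ five ^ k * a → section 0 (m * (g ^ n * b)) ≋ five ^ k * section 0 (m * (g ^ n * a))
  section-five^ m n k a b h = ≋-trans (section-cong 0 (≋-trans (*-congˡ (*-congˡ h))
      (≋-trans (solve 4 (λ m g f a → m :* (g :* (f :* a)) :≈ f :* (m :* (g :* a))) (m ∷ g ^ n ∷ five ^ k ∷ a ∷ []) refl) (*-congʳ (≋-sym (five^ k))))))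
    (≋-trans (section-const* (+ (5 ℕ.^ k)) _) (*-congʳ (five^ k)))

open Triangular using (double)

parity : ∀ k → double k ℕ.% 2 ≡ 0 × suc (double k) ℕ.% 2 ≡ 1
parity zero    = refl , refl
parity (suc k) = trans (shift-2 (double k)) (proj₁ (parity k)) , trans (shift-2 (suc (double k))) (proj₂ (parity k))
  where
  shift-2 : ∀ n → suc (suc n) ℕ.% 2 ≡ n ℕ.% 2
  shift-2 n = trans (cong (ℕ._% 2) (ℕₚ.+-comm 2 n)) (DivMod.[m+n]%n≡m%n n 2)

halving : ∀ k → double k ℕ./ 2 ≡ k × suc (double k) ℕ./ 2 ≡ k
halving zero    = refl , refl
halving (suc k) = trans (shift-2 (double k)) (cong suc (proj₁ (halving k))) , trans (shift-2 (suc (double k))) (cong suc (proj₂ (halving k)))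
  where
  shift-2 : ∀ n → suc (suc n) ℕ./ 2 ≡ suc (n ℕ./ 2)
  shift-2 n = DivMod.m/n≡1+[m∸n]/n {suc (suc n)} {2} (s≤s (s≤s z≤n))

L-odd : ∀ k → L (suc (double k)) ≡ U5 (Φ * L (double k))
L-odd k rewrite proj₁ (parity k) = cong U5 (⊗≡* Φ (L (double k)))

L-even : ∀ k → L (double (suc k)) ≡ U5 (L (suc (double k)))
L-even k rewrite proj₂ (parity k) = refl

record Multiple (k : ℕ) (Q : Series → Set) (a : Series) : Set where
  constructor multiple
  field
    {factor} : Series
    member   : Q factor
    equality : a ≋ five ^ k * factor

after-odd : ∀ k → Multiple k Λ₁ (z ^ odd-exponent k * L (suc (double k))) →
            Multiple (suc k) Λ₀ (z ^ even-exponent (suc k) * L (double (suc k)))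
after-odd k (multiple {a} q h) = conclude (odd-step (odd-exponent k) q)
  where
  conclude : Five Λ₀ (section 0 (oneS * (g ^ odd-exponent k * a))) → Multiple (suc k) Λ₀ (z ^ even-exponent (suc k) * L (double (suc k)))
  conclude (times-five {b} r e) = multiple r (begin
    z ^ even-exponent (suc k) * L (double (suc k))                  ≈⟨ *-congˡ (≋-reflexive (L-even k)) ⟩
    z ^ (5 ℕ.* odd-exponent k) * U5 (L (suc (double k)))            ≈⟨ U5-odd (odd-exponent k) (L (suc (double k))) ⟩
    section 0 (oneS * (g ^ odd-exponent k * (z ^ odd-exponent k * L (suc (double k)))))
      ≈⟨ section-five^ oneS (odd-exponent k) k a (z ^ odd-exponent k * L (suc (double k))) h ⟩
    five ^ k * section 0 (oneS * (g ^ odd-exponent k * a))          ≈⟨ *-congˡ e ⟩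
    five ^ k * (five * b)                                           ≈⟨ *-swap (five ^ k) five b ⟩
    five * (five ^ k * b)                                           ≈⟨ ≋-sym (*-assoc five (five ^ k) b) ⟩
    five ^ suc k * b                                                ∎)
    where open ≋-Reasoning

after-even : ∀ k → Multiple k Λ₀ (z ^ even-exponent k * L (double k)) → Multiple k Λ₁ (z ^ odd-exponent k * L (suc (double k)))
after-even k (multiple {a} q h) = multiple (even-step (even-exponent k) q) (begin
  z ^ odd-exponent k * L (suc (double k))                           ≈⟨ *-congˡ (≋-reflexive (L-odd k)) ⟩
  z ^ (5 ℕ.* even-exponent k ℕ.+ 5) * U5 (Φ * L (double k))         ≈⟨ U5-even (even-exponent k) (L (double k)) ⟩
  section 0 (Z ^ 5 * Φ * (g ^ even-exponent k * (z ^ even-exponent k * L (double k))))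
    ≈⟨ section-five^ (Z ^ 5 * Φ) (even-exponent k) k a (z ^ even-exponent k * L (double k)) h ⟩
  five ^ k * section 0 (Z ^ 5 * Φ * (g ^ even-exponent k * a))      ∎)
  where open ≋-Reasoning

L-even-lattice : ∀ k → Multiple k Λ₀ (z ^ even-exponent k * L (double k))
L-odd-lattice  : ∀ k → Multiple k Λ₁ (z ^ odd-exponent k * L (suc (double k)))

L-even-lattice zero    = multiple (gen 0) (≋-sym (*-identityˡ (oneS * oneS)))
L-even-lattice (suc k) = after-odd k (L-odd-lattice k)
L-odd-lattice k        = after-even k (L-even-lattice k)

-- Values of ψ

private
  -- s = (25^k - 1)/24. Then 5^(2k+3) = 125(24s + 1) leaves 5 modulo 24 and 5^(2k+4) = 625(24s + 1)
  -- leaves 1, which gives the two quotients occurring in ψ.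
  geometric-25 : ℕ → ℕ
  geometric-25 zero    = 0
  geometric-25 (suc k) = 25 ℕ.* geometric-25 k ℕ.+ 1

  25^ : ∀ k → 25 ℕ.^ k ≡ 24 ℕ.* geometric-25 k ℕ.+ 1
  25^ zero    = refl
  25^ (suc k) = trans (cong (25 ℕ.*_) (25^ k)) (lemma (geometric-25 k))
    where
    lemma : ∀ s → 25 ℕ.* (24 ℕ.* s ℕ.+ 1) ≡ 24 ℕ.* (25 ℕ.* s ℕ.+ 1) ℕ.+ 1
    lemma = solve-∀

  5^double : ∀ k → 5 ℕ.^ double k ≡ 25 ℕ.^ k
  5^double zero    = refl
  5^double (suc k) = trans (cong (λ t → 5 ℕ.* (5 ℕ.* t)) (5^double k)) (sym (ℕₚ.*-assoc 5 5 (25 ℕ.^ k)))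

  odd-exponent≡ : ∀ k → odd-exponent k ≡ 125 ℕ.* geometric-25 k ℕ.+ 5
  odd-exponent≡ zero    = refl
  odd-exponent≡ (suc k) = trans (cong (λ t → 5 ℕ.* (5 ℕ.* t) ℕ.+ 5) (odd-exponent≡ k)) (lemma (geometric-25 k))
    where
    lemma : ∀ s → 5 ℕ.* (5 ℕ.* (125 ℕ.* s ℕ.+ 5)) ℕ.+ 5 ≡ 125 ℕ.* (25 ℕ.* s ℕ.+ 1) ℕ.+ 5
    lemma = solve-∀

  quotient-24 : ∀ q r → r < 24 → (r ℕ.+ q ℕ.* 24) ℕ./ 24 ≡ q
  quotient-24 q r r<24 = trans (DivMod.+-distrib-/-∣ʳ r {q ℕ.* 24} {24} (Divisibility.divides q refl))
    (cong₂ ℕ._+_ (DivMod.m<n⇒m/n≡0 r<24) (DivMod.m*n/n≡m q 24))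

  2∣double : ∀ k → 2 ∣ double k
  2∣double k = m%n≡0⇒n∣m (double k) 2 (proj₁ (parity k))

  gcd-odd : ∀ k → gcd (suc (double k)) 2 ≡ 1
  gcd-odd k with gcd (suc (double k)) 2 | gcd[m,n]∣m (suc (double k)) 2 | gcd[m,n]∣n (suc (double k)) 2
  ... | 0 | _ | d = ⊥-elim (toWitnessFalse {a? = 0 ∣? 2} _ d)
  ... | 1 | _ | _ = refl
  ... | 2 | d | _ = ⊥-elim (contradiction-1 (trans (sym (n∣m⇒m%n≡0 (suc (double k)) 2 d)) (proj₂ (parity k))))
    where
    contradiction-1 : ¬ (0 ≡ 1)
    contradiction-1 ()
  ... | suc (suc (suc _)) | _ | d with Divisibility.∣⇒≤ d
  ...   | s≤s (s≤s ())

  gcd-even : ∀ k → gcd (double k) 2 ≡ 2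
  gcd-even k = Divisibility.∣-antisym (gcd[m,n]∣n (double k) 2) (gcd-greatest (2∣double k) (Divisibility.∣-refl {2}))

ψ-odd : ∀ k → ψ (suc (double k)) ≡ odd-exponent k
ψ-odd k = trans (cong₂ (λ q d → q ℕ.+ 1 ℕ.∸ d) quotient (gcd-odd k)) (trans (ℕₚ.m+n∸n≡m (125 ℕ.* geometric-25 k ℕ.+ 5) 1) (sym (odd-exponent≡ k)))
  where
  lemma : ∀ s → 5 ℕ.* ((24 ℕ.* s ℕ.+ 1) ℕ.* 25) ≡ 5 ℕ.+ (125 ℕ.* s ℕ.+ 5) ℕ.* 24
  lemma = solve-∀
  power : 5 ℕ.^ (suc (double k) ℕ.+ 2) ≡ 5 ℕ.+ (125 ℕ.* geometric-25 k ℕ.+ 5) ℕ.* 24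
  power = trans (cong (5 ℕ.*_) (trans (ℕₚ.^-distribˡ-+-* 5 (double k) 2) (cong (ℕ._* 25) (trans (5^double k) (25^ k))))) (lemma (geometric-25 k))
  quotient : 5 ℕ.^ (suc (double k) ℕ.+ 2) ℕ./ 24 ≡ 125 ℕ.* geometric-25 k ℕ.+ 5
  quotient = trans (cong (ℕ._/ 24) power) (quotient-24 (125 ℕ.* geometric-25 k ℕ.+ 5) 5 (s≤s (s≤s (s≤s (s≤s (s≤s (s≤s z≤n)))))))

ψ-even : ∀ k → ψ (double (suc k)) ≡ even-exponent (suc k)
ψ-even k = trans (cong₂ (λ q d → q ℕ.+ 1 ℕ.∸ d) quotient (gcd-even (suc k))) (trans (cong (ℕ._∸ 2) (split (geometric-25 k)))
    (trans (ℕₚ.m+n∸n≡m (5 ℕ.* (125 ℕ.* geometric-25 k ℕ.+ 5)) 2) (cong (5 ℕ.*_) (sym (odd-exponent≡ k)))))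
  where
  split : ∀ s → 625 ℕ.* s ℕ.+ 26 ℕ.+ 1 ≡ 5 ℕ.* (125 ℕ.* s ℕ.+ 5) ℕ.+ 2
  split = solve-∀
  lemma : ∀ s → 5 ℕ.* (5 ℕ.* ((24 ℕ.* s ℕ.+ 1) ℕ.* 25)) ≡ 1 ℕ.+ (625 ℕ.* s ℕ.+ 26) ℕ.* 24
  lemma = solve-∀
  power : 5 ℕ.^ (double (suc k) ℕ.+ 2) ≡ 1 ℕ.+ (625 ℕ.* geometric-25 k ℕ.+ 26) ℕ.* 24
  power = trans (cong (λ t → 5 ℕ.* (5 ℕ.* t)) (trans (ℕₚ.^-distribˡ-+-* 5 (double k) 2) (cong (ℕ._* 25) (trans (5^double k) (25^ k))))) (lemma (geometric-25 k))
  quotient : 5 ℕ.^ (double (suc k) ℕ.+ 2) ℕ./ 24 ≡ 625 ℕ.* geometric-25 k ℕ.+ 26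
  quotient = trans (cong (ℕ._/ 24) power) (quotient-24 (625 ℕ.* geometric-25 k ℕ.+ 26) 1 (s≤s (s≤s z≤n)))

-- From lattice membership to integer polynomials in `xS`

Polynomial : Series → Set
Polynomial a = ∃ λ p → a ≋ eval 1 p (x ∷ [])

polynomial-+ : ∀ {a b} → Polynomial a → Polynomial b → Polynomial (a + b)
polynomial-+ (p , h) (q , k) = addₚ 1 p q , ≋-trans (+-cong h k) (≋-sym (addₚ-sound 1 p q (x ∷ [])))

polynomial-* : ∀ {a b} → Polynomial a → Polynomial b → Polynomial (a * b)
polynomial-* (p , h) (q , k) = mulₚ 1 p q , ≋-trans (*-cong h k) (≋-sym (mulₚ-sound 1 p q (x ∷ [])))

polynomial-expr : ∀ (e : Expr 1) → Polynomial (⟦ e ⟧ (x ∷ []))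
polynomial-expr e = normalise 1 e , ≋-sym (normalise-sound e (x ∷ []))

Λ₀-polynomial : ∀ {a} → Λ₀ a → Polynomial a
Λ₀-polynomial (resp p q) with Λ₀-polynomial q
... | r , h = r , ≋-trans (≋-sym p) h
Λ₀-polynomial zero         = polynomial-expr (con (+ 0))
Λ₀-polynomial (plus p q)   = polynomial-+ (Λ₀-polynomial p) (Λ₀-polynomial q)
Λ₀-polynomial (scaled c q) = polynomial-* (polynomial-expr (con c)) (Λ₀-polynomial q)
Λ₀-polynomial (gen r)      = polynomial-expr (con (+ 5) :^ e₀ r :* var zero :^ r)

evalPoly≋ : ∀ p → evalPoly p xS ≋ eval 1 p (x ∷ [])
evalPoly≋ []       = ≋-refl
evalPoly≋ (c ∷ cs) = ≋-trans (≋-reflexive (trans (⊕≡+ (const c) (xS ⊗ evalPoly cs xS)) (cong (λ t → const c + t) (⊗≡* xS (evalPoly cs xS)))))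
  (+-congˡ (*-cong xS≋hauptmodul (evalPoly≋ cs)))

F≋ : ∀ α → F α ≋ z ^ ψ α * L α
F≋ α = ≋-trans (≋-reflexive (trans (⊗≡* (pow u (ψ α)) (L α)) (cong (_* L α) (pow≡^ u (ψ α))))) (*-congʳ (^-cong u≋z (ψ α)))
  where
  u = oneS ⊕ (+ 5) · xS
  u≋z : u ≋ z
  u≋z = pointwise λ n → trans (cong (λ t → oneS n ℤ.+ + 5 ℤ.* t) (at xS≋hauptmodul n))
    (sym (trans (+-at oneS (const (+ 5) * x) n) (cong (λ t → oneS n ℤ.+ t) (const-* (+ 5) x n))))

conclude : ∀ α k → Multiple k Λ₀ (z ^ ψ α * L α) → ∃ λ (p : List ℤ) → ∀ n → F α n ≡ + (5 ℕ.^ k) ℤ.* evalPoly p xS n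
conclude α k (multiple q h) = read-off (Λ₀-polynomial q)
  where
  read-off : Polynomial _ → ∃ λ (p : List ℤ) → ∀ n → F α n ≡ + (5 ℕ.^ k) ℤ.* evalPoly p xS n
  read-off (p , e) = p , λ n → trans (at (≋-trans (F≋ α) (≋-trans h (*-cong (≋-sym (five^ k)) (≋-trans e (≋-sym (evalPoly≋ p)))))) n)
    (const-* (+ (5 ℕ.^ k)) (evalPoly p xS) n)

by-parity : ∀ α → (∃ λ k → α ≡ double k) ⊎ (∃ λ k → α ≡ suc (double k))
by-parity zero    = inj₁ (0 , refl)
by-parity (suc α) with by-parity α
... | inj₁ (k , refl) = inj₂ (k , refl)
... | inj₂ (k , refl) = inj₁ (suc k , refl)

private
  Claim : ℕ → ℕ → Set
  Claim α h = ∃ λ (p : List ℤ) → ∀ n → F α n ≡ + (5 ℕ.^ h) ℤ.* evalPoly p xS n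

  even-claim : ∀ k → Claim (double (suc k)) (double (suc k) ℕ./ 2)
  even-claim k = subst (Claim (double (suc k))) (sym (proj₁ (halving (suc k)))) (conclude (double (suc k)) (suc k)
    (subst (λ e → Multiple (suc k) Λ₀ (z ^ e * L (double (suc k)))) (sym (ψ-even k)) (L-even-lattice (suc k))))

  odd-claim : ∀ k → Claim (suc (double k)) (suc (double k) ℕ./ 2)
  odd-claim k = subst (Claim (suc (double k))) (sym (proj₂ (halving k))) (conclude (suc (double k)) k
    (subst (λ e → Multiple k Λ₀ (z ^ e * L (suc (double k)))) (sym (ψ-odd k)) (enlarge (L-odd-lattice k))))
    where
    -- Membership in Λ₁ was required to gain the next factor 5; polynomiality is read off in Λ₀.
    enlarge : ∀ {a} → Multiple k Λ₁ a → Multiple k Λ₀ a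
    enlarge (multiple q h) = multiple (Λ₁⊆Λ₀ q) h

  claim : ∀ α → 1 ≤ α → (∃ λ k → α ≡ double k) ⊎ (∃ λ k → α ≡ suc (double k)) → Claim α (α ℕ./ 2)
  claim _ ()  (inj₁ (zero  , refl))
  claim _ 1≤α (inj₁ (suc k , refl)) = even-claim k
  claim _ 1≤α (inj₂ (k     , refl)) = odd-claim k

theorem4p3 : (α : ℕ) → 1 ≤ α →
    ∃ λ (p : List ℤ) → ∀ (n : ℕ) →
      F α n ≡ + (5 ℕ.^ (α ℕ./ 2)) ℤ.* evalPoly p xS n
theorem4p3 α 1≤α = claim α 1≤α (by-parity α)
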